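{- For every $\alpha, \beta, \epsilon, \eta > 0$ and $k \in \mathbb{N}$, there exist $\delta > 0$ and $D \in \mathbb{N}$ such that if $Q \in \mathbb{N}$ and $A, B \subseteq \mathbb{Z}/Q\mathbb{Z}$ satisfy $|A| \geq \alpha Q$, $|B| \geq \beta Q$, and $B$ has non-empty intersection with every coset of every subgroup of $\mathbb{Z}/Q\mathbb{Z}$ of index at most $D$, then at least one of the following holds: (i) $|A+B| \geq (\alpha+\beta+\delta)Q$. (ii) $|A+B| \geq (1-\epsilon)Q$. (iii) There exist a subgroup $H \leq \mathbb{Z}/Q\mathbb{Z}$ of index at most $D$, elements $a_0 \in A$ and $b_0 \in B$, and a decomposition $A = A_0 + a_0$ and $B = (B_0 \cup B_1) + b_0$ such that (a) $A_0, B_0 \subseteq H$; (b) $B_1 \subseteq (\mathbb{Z}/Q\mathbb{Z}) \setminus H$ and $|B_1| > Q - |H| - \epsilon |H|$; and (c) there exist a surjective homomorphism $\phi : H \to \mathbb{Z}/N\mathbb{Z}$ for some $N > k$ and intervals $I,J \subseteq \mathbb{Z}/N\mathbb{Z}$ such that $A_0\subseteq \phi^{ -1}(I)$, $B_0\subseteq \phi^{ -1}(J)$, and $|\phi^{ -1}(I)\setminus A_0| < \epsilon Q$, $|\phi^{ -1}(J)\setminus B_0| < \epsilon Q$. (iv) There exist a subgroup $H \leq \mathbb{Z}/Q\mathbb{Z}$ of index at most $D$, elements $a_0 \in A$ and $b_0 \in B$, and a decomposition $A = A_0 + a_0$ and $B = (B_0 \cup B_1) + b_0$ such that (a) $A_0,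 B_0 \subseteq H$; (b) $B_1 \subseteq (\mathbb{Z}/Q\mathbb{Z}) \setminus H$ and $|B_1| > Q - |H| - \eta |H|$; and (c) $|B_0| < \eta |H|$.
   Context: An interval in $\mathbb{Z}/N\mathbb{Z}$ is the image under reduction mod $N$ of a set of consecutive integers. $C+x=\{c+x:c\in C\}$.
   Formalization: The parameters α, β, ε, η are taken to be positive rational numbers instead of positive real numbers (δ is likewise produced as a positive rational, which loses nothing). -}

module Defs where

open import Data.Bool using (Bool; _∧_; not)
open import Data.Nat as ℕ using (ℕ; NonZero; _∸_; _<_)
open import Data.Nat.DivMod using (_mod_)
open import Data.Integer using (+_)
open import Data.Rational using (ℚ; _/_)
open import Data.Fin using (Fin; toℕ)
open import Data.Fin.Properties using (any?; _≟_)
open import Data.Fin.Subset using (Subset; _∈_; ∣_∣)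
open import Data.Fin.Subset.Properties using (_∈?_)
open import Data.Vec using (tabulate)
open import Data.Product using (Σ; ∃; ∃-syntax; _×_; _,_)
open import Function.Bundles using (_⇔_)
open import Relation.Binary.PropositionalEquality using (_≡_)
open import Relation.Nullary.Decidable using (⌊_⌋; _×-dec_)

ℕ→ℚ : ℕ → ℚ
ℕ→ℚ n = (+ n) / 1

-- ℤ/Qℤ is modelled as Fin Q (Q ≥ 1), with arithmetic mod Q.
module _ {Q : ℕ} .{{_ : NonZero Q}} where

  0ₘ : Fin Q
  0ₘ = 0 mod Q

  _+ₘ_ : Fin Q → Fin Q → Fin Q
  x +ₘ y = (toℕ x ℕ.+ toℕ y) mod Q

  -ₘ_ : Fin Q → Fin Q
  -ₘ x = (Q ∸ toℕ x) mod Q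

  IsSubgroup : Subset Q → Set
  IsSubgroup H = (0ₘ ∈ H)
               × (∀ x y → x ∈ H → y ∈ H → (x +ₘ y) ∈ H)
               × (∀ x → x ∈ H → (-ₘ x) ∈ H)

  -- index [ℤ/Qℤ : H] = Q / |H| is at most D  (Lagrange: |H| divides Q)
  IndexAtMost : Subset Q → ℕ → Set
  IndexAtMost H D = Q ℕ.≤ D ℕ.* ∣ H ∣

  _⊕_ : Subset Q → Subset Q → Subset Q
  A ⊕ B = tabulate λ z →
    ⌊ any? (λ a → any? (λ b → (a ∈? A) ×-dec ((b ∈? B) ×-dec ((a +ₘ b) ≟ z)))) ⌋

  IsTranslate : Subset Q → Subset Q → Fin Q → Set
  IsTranslate C C' x = ∀ y → (y ∈ C) ⇔ (∃[ c ] (c ∈ C' × (c +ₘ x) ≡ y))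

  IsTranslate₂ : Subset Q → Subset Q → Subset Q → Fin Q → Set
  IsTranslate₂ B B₀ B₁ x = ∀ y → (y ∈ B) ⇔ (∃[ c ] ((c ∈ B₀ Data.Sum.⊎ c ∈ B₁) × (c +ₘ x) ≡ y))
    where import Data.Sum

IsInterval : {N : ℕ} .{{_ : NonZero N}} → Subset N → Set
IsInterval {N} I = ∃[ s ] ∃[ L ] (∀ y → (y ∈ I) ⇔ (∃[ i ] (i < L × ((s ℕ.+ i) mod N) ≡ y)))

IsSurjHomOn : {Q N : ℕ} .{{_ : NonZero Q}} .{{_ : NonZero N}} →
              Subset Q → (Fin Q → Fin N) → Set
IsSurjHomOn H φ = (∀ x y → x ∈ H → y ∈ H → φ (x +ₘ y) ≡ (φ x +ₘ φ y))
                × (∀ z → ∃[ x ] (x ∈ H × φ x ≡ z))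

preimageMinus : {Q N : ℕ} → Subset Q → (Fin Q → Fin N) → Subset N → Subset Q → Subset Q
preimageMinus H φ I A₀ = tabulate λ x → ⌊ x ∈? H ⌋ ∧ ⌊ φ x ∈? I ⌋ ∧ not ⌊ x ∈? A₀ ⌋

preimage : {Q N : ℕ} → Subset Q → (Fin Q → Fin N) → Subset N → Subset Q
preimage H φ I = tabulate λ x → ⌊ x ∈? H ⌋ ∧ ⌊ φ x ∈? I ⌋

{-# OPTIONS --safe #-}

-- Write ∂Z = |Z + B| − |Z|.  This is submodular in Z, so among the sets Z with |Z| and
-- |G ∖ (Z + B)| not too small, starting at A and passing from Z to Z ∩ (Z + g), to Z ∪ (Z + g), or
-- to the negative of G ∖ (Z + B) ends in a tiny set Y with ∂Y ≤ ∂A (an approximate atom): otherwise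
-- the stabiliser of Y would be a subgroup of small index, all of whose cosets meet B.  The same
-- argument yields |Z + B| ≥ |Z| + |B| − θ with a small error θ.  Let H be the subgroup generated by Y − Y.  Applying this
-- Cauchy–Davenport bound to the pieces of B in the cosets of H, B is nearly full outside a single
-- coset of H and A lies in one coset; if B is sparse in the exceptional coset, this is case (iv).
--
-- Otherwise work in H, where |B₀ ∖ (B₀ + u)| is tiny for u in the generating set Y − Y.  Hence
-- correlations take all intermediate values, and repeatedly replacing X by X ∩ (X + z), starting
-- from B₀, yields a small X such that A + X is still critical.  Choosing g with X ∩ (X + g)
-- nearly empty, criticality forces the translates X + jg to tile H up to small errors, returning
-- after n steps.  The index j of a translate containing p is a quasi-homomorphism to ℤ/n;
-- averaging its defect over H turns it into an exact homomorphism onto some ℤ/N.  A union of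
-- consecutive translates of X is nearly the preimage of an interval, and criticality passes this
-- structure from the union to A₀, and from A₀ to B₀.
module Submission where

-- The coset hypothesis speaks of `B` and says nothing about the sets later cut out of `B₀`. For
-- those it is replaced by a Lipschitz condition: a set of which each generator moves only few
-- points cannot pass abruptly from a missed coset to a full one, so it meets every coset of every
-- large subgroup, and the growth bound holds for it. Intersections and unions of translates stay
-- Lipschitz, but each shrinking step doubles the constants. Up to `2 * E ^ 16` steps are made, so
-- the atom has to be smaller than the group by a factor exceeding `2 ^ (2 * E ^ 16)`; this is the
-- origin of the huge constants. One integer `E` dominates 1000, `k` and the reciprocals of `α`,
-- `ε`, `η`. Inside `H` all sizes are compared with the scales `E ^ i * β`, neighbouring ones being
-- a factor of at least 1000 apart; most estimates then are linear inequalities, settled by explicit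
-- multipliers. The setting is an arbitrary finite abelian group because the growth bound is needed
-- both in the whole group and inside `H`.

module RationalBounds where

  open import Defs using (ℕ→ℚ)
  open import Data.Nat as ℕ using (ℕ; suc; zero; s≤s; z≤n)
  import Data.Nat.Properties as ℕₚ
  open import Data.Integer as ℤ using (+_; +[1+_])
  import Data.Integer.Properties as ℤₚ
  open import Data.Rational as ℚ using (ℚ; mkℚ; Positive; NonNegative; 1ℚ; 0ℚ; 1/_; toℚᵘ; ↧ₙ_)
  import Data.Rational.Properties as ℚₚ
  open import Data.Rational.Unnormalised as ℚᵘ using (mkℚᵘ; *≡*; *≤*)
  import Data.Rational.Unnormalised.Properties as ℚᵘₚ
  open import Data.Empty using (⊥-elim)
  open import Relation.Binary.PropositionalEquality using (_≡_; refl; sym; trans; cong; cong₂; subst; subst₂)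
  open import Data.Integer.Tactic.RingSolver using (solve-∀)

  -- Rational hypotheses as inequalities between natural numbers

  toℚᵘ-ι : ∀ n → toℚᵘ (ℕ→ℚ n) ℚᵘ.≃ mkℚᵘ (+ n) 0
  toℚᵘ-ι n = ℚₚ.toℚᵘ-fromℚᵘ (mkℚᵘ (+ n) 0)

  ι-+ : ∀ m n → ℕ→ℚ (m ℕ.+ n) ≡ ℕ→ℚ m ℚ.+ ℕ→ℚ n
  ι-+ m n = ℚₚ.toℚᵘ-injective (ℚᵘₚ.≃-trans (toℚᵘ-ι (m ℕ.+ n)) (ℚᵘₚ.≃-trans (*≡* at)
      (ℚᵘₚ.≃-sym (ℚᵘₚ.≃-trans (ℚₚ.toℚᵘ-homo-+ (ℕ→ℚ m) (ℕ→ℚ n)) (ℚᵘₚ.+-cong (toℚᵘ-ι m) (toℚᵘ-ι n))))))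
    where
    ring : ∀ a b → (a ℤ.+ b) ℤ.* (+ 1) ≡ (a ℤ.* + 1 ℤ.+ b ℤ.* + 1) ℤ.* + 1
    ring = solve-∀
    at : + (m ℕ.+ n) ℤ.* (+ 1) ≡ (+ m ℤ.* + 1 ℤ.+ + n ℤ.* + 1) ℤ.* + 1
    at = trans (cong (ℤ._* (+ 1)) (ℤₚ.pos-+ m n)) (ring (+ m) (+ n))

  ι-* : ∀ m n → ℕ→ℚ (m ℕ.* n) ≡ ℕ→ℚ m ℚ.* ℕ→ℚ n
  ι-* m n = ℚₚ.toℚᵘ-injective (ℚᵘₚ.≃-trans (toℚᵘ-ι (m ℕ.* n)) (ℚᵘₚ.≃-trans (*≡* (cong (ℤ._* (+ 1)) (ℤₚ.pos-* m n)))
      (ℚᵘₚ.≃-sym (ℚᵘₚ.≃-trans (ℚₚ.toℚᵘ-homo-* (ℕ→ℚ m) (ℕ→ℚ n)) (ℚᵘₚ.*-cong (toℚᵘ-ι m) (toℚᵘ-ι n))))))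

  ι-mono-≤ : ∀ {m n} → m ℕ.≤ n → ℕ→ℚ m ℚ.≤ ℕ→ℚ n
  ι-mono-≤ {m} {n} p = ℚₚ.toℚᵘ-cancel-≤ (ℚᵘₚ.≤-respˡ-≃ (ℚᵘₚ.≃-sym (toℚᵘ-ι m))
      (ℚᵘₚ.≤-respʳ-≃ (ℚᵘₚ.≃-sym (toℚᵘ-ι n)) (*≤* (ℤₚ.*-monoʳ-≤-nonNeg (+ 1) (ℤ.+≤+ p)))))

  ι-cancel-≤ : ∀ {m n} → ℕ→ℚ m ℚ.≤ ℕ→ℚ n → m ℕ.≤ n
  ι-cancel-≤ {m} {n} p with ℚᵘₚ.≤-respˡ-≃ (toℚᵘ-ι m) (ℚᵘₚ.≤-respʳ-≃ (toℚᵘ-ι n) (ℚₚ.toℚᵘ-mono-≤ p))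
  ... | *≤* q = ℤₚ.drop‿+≤+ (subst₂ ℤ._≤_ (ℤₚ.*-identityʳ (+ m)) (ℤₚ.*-identityʳ (+ n)) q)

  ι-nonNeg : ∀ n → NonNegative (ℕ→ℚ n)
  ι-nonNeg n = ℚₚ.normalize-nonNeg n 1

  ι-pos : ∀ n → 1 ℕ.≤ n → Positive (ℕ→ℚ n)
  ι-pos (suc n) _ = ℚₚ.normalize-pos (suc n) 1

  -- The product is the numerator of `q`, a positive integer.
  1≤denominator* : ∀ q → Positive q → 1ℚ ℚ.≤ ℕ→ℚ (↧ₙ q) ℚ.* q
  1≤denominator* q@(mkℚ +[1+ n ] d _) _ = ℚₚ.toℚᵘ-cancel-≤ (ℚᵘₚ.≤-respʳ-≃
    (ℚᵘₚ.≃-sym (ℚᵘₚ.≃-trans (ℚₚ.toℚᵘ-homo-* (ℕ→ℚ (suc d)) q) (ℚᵘₚ.*-congʳ {toℚᵘ q} (toℚᵘ-ι (suc d)))))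
    (*≤* (ℤ.+≤+ at)))
    where
    at : 1 ℕ.* (1 ℕ.* suc d) ℕ.≤ (suc d ℕ.* suc n) ℕ.* 1
    at = ℕₚ.≤-trans (ℕₚ.≤-reflexive (trans (ℕₚ.*-identityˡ _) (ℕₚ.*-identityˡ _)))
        (ℕₚ.≤-trans (ℕₚ.m≤m*n (suc d) (suc n)) (ℕₚ.≤-reflexive (sym (ℕₚ.*-identityʳ _))))

  1≤multiple : ∀ q E → Positive q → ↧ₙ q ℕ.≤ E → 1ℚ ℚ.≤ ℕ→ℚ E ℚ.* q
  1≤multiple q E pos le = ℚₚ.≤-trans (1≤denominator* q pos) (ℚₚ.*-monoʳ-≤-nonNeg q {{ℚₚ.pos⇒nonNeg q {{pos}}}} (ι-mono-≤ le))

  -- Under `1 ≤ E * q` a bound with the rational factor `q` becomes one with the integer factor `E`;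
  -- strict bounds in the other direction follow by contraposition.
  module _ {q : ℚ} {E : ℕ} (1≤Eq : 1ℚ ℚ.≤ ℕ→ℚ E ℚ.* q) where

    at-least : ∀ {m n} → q ℚ.* ℕ→ℚ m ℚ.≤ ℕ→ℚ n → m ℕ.≤ E ℕ.* n
    at-least {m} {n} p = ι-cancel-≤ (begin
      ℕ→ℚ m ≡⟨ ℚₚ.*-identityˡ (ℕ→ℚ m) ⟨
      1ℚ ℚ.* ℕ→ℚ m ≤⟨ ℚₚ.*-monoʳ-≤-nonNeg (ℕ→ℚ m) {{ι-nonNeg m}} 1≤Eq ⟩
      ℕ→ℚ E ℚ.* q ℚ.* ℕ→ℚ m ≡⟨ ℚₚ.*-assoc (ℕ→ℚ E) q (ℕ→ℚ m) ⟩
      ℕ→ℚ E ℚ.* (q ℚ.* ℕ→ℚ m) ≤⟨ ℚₚ.*-monoˡ-≤-nonNeg (ℕ→ℚ E) {{ι-nonNeg E}} p ⟩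
      ℕ→ℚ E ℚ.* ℕ→ℚ n ≡⟨ ι-* E n ⟨
      ℕ→ℚ (E ℕ.* n) ∎)
      where open ℚₚ.≤-Reasoning

    below : ∀ {m n} → E ℕ.* n ℕ.< m → ℕ→ℚ n ℚ.< q ℚ.* ℕ→ℚ m
    below p = ℚₚ.≰⇒> λ le → ℕₚ.<⇒≱ p (at-least le)

    co-large : ∀ {Q s} → s ℕ.≤ Q → ℕ→ℚ s ℚ.≤ (ℕ→ℚ 1 ℚ.- q) ℚ.* ℕ→ℚ Q → Q ℕ.+ E ℕ.* s ℕ.≤ E ℕ.* Q
    co-large {Q} {s} s≤ p = ℕₚ.≤-trans (ℕₚ.+-monoˡ-≤ (E ℕ.* s) (at-least {Q} {Q ℕ.∸ s} bound))
      (ℕₚ.≤-reflexive (trans (sym (ℕₚ.*-distribˡ-+ E (Q ℕ.∸ s) s)) (cong (E ℕ.*_) (ℕₚ.m∸n+n≡m s≤))))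
      where
      r : ℚ
      r = ℕ→ℚ (Q ℕ.∸ s)
      total : ℕ→ℚ s ℚ.+ r ≡ ℕ→ℚ Q
      total = trans (sym (ι-+ s (Q ℕ.∸ s))) (cong ℕ→ℚ (ℕₚ.m+[n∸m]≡n s≤))
      bound : q ℚ.* ℕ→ℚ Q ℚ.≤ r
      bound = begin
        q ℚ.* ℕ→ℚ Q ≡⟨ move (q ℚ.* ℕ→ℚ Q) (ℕ→ℚ s) ⟩
        (ℕ→ℚ s ℚ.+ q ℚ.* ℕ→ℚ Q) ℚ.- ℕ→ℚ s ≤⟨ ℚₚ.+-monoˡ-≤ (ℚ.- ℕ→ℚ s) (ℚₚ.+-monoˡ-≤ (q ℚ.* ℕ→ℚ Q) p) ⟩
        ((ℕ→ℚ 1 ℚ.- q) ℚ.* ℕ→ℚ Q ℚ.+ q ℚ.* ℕ→ℚ Q) ℚ.- ℕ→ℚ s ≡⟨ cong (ℚ._- ℕ→ℚ s) (trans (sym (ℚₚ.*-distribʳ-+ (ℕ→ℚ Q) (ℕ→ℚ 1 ℚ.- q) q))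
            (trans (cong (ℚ._* ℕ→ℚ Q) (trans (ℚₚ.+-assoc (ℕ→ℚ 1) (ℚ.- q) q)
                (trans (cong (ℕ→ℚ 1 ℚ.+_) (ℚₚ.+-inverseˡ q)) (ℚₚ.+-identityʳ (ℕ→ℚ 1))))) (ℚₚ.*-identityˡ (ℕ→ℚ Q)))) ⟩
        ℕ→ℚ Q ℚ.- ℕ→ℚ s ≡⟨ cong (ℚ._- ℕ→ℚ s) total ⟨
        (ℕ→ℚ s ℚ.+ r) ℚ.- ℕ→ℚ s ≡⟨ move r (ℕ→ℚ s) ⟨
        r ∎
        where
        open ℚₚ.≤-Reasoning
        move : ∀ a b → a ≡ (b ℚ.+ a) ℚ.- b
        move a b = sym (trans (cong (ℚ._- b) (ℚₚ.+-comm b a)) (trans (ℚₚ.+-assoc a b (ℚ.- b))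
            (trans (cong (a ℚ.+_) (ℚₚ.+-inverseʳ b)) (ℚₚ.+-identityʳ a))))

    nearly : ∀ {Q H B} → E ℕ.* Q ℕ.< E ℕ.* H ℕ.+ E ℕ.* B ℕ.+ H → ℕ→ℚ Q ℚ.- ℕ→ℚ H ℚ.- q ℚ.* ℕ→ℚ H ℚ.< ℕ→ℚ B
    nearly {Q} {H} {B} p = ℚₚ.≰⇒> λ le → ℕₚ.<⇒≱ p (contra le)
      where
      open ℚₚ.≤-Reasoning
      cancel : ∀ a b → (a ℚ.- b) ℚ.+ b ≡ a
      cancel a b = trans (ℚₚ.+-assoc a (ℚ.- b) b) (trans (cong (a ℚ.+_) (ℚₚ.+-inverseˡ b)) (ℚₚ.+-identityʳ a))
      contra : ℕ→ℚ B ℚ.≤ ℕ→ℚ Q ℚ.- ℕ→ℚ H ℚ.- q ℚ.* ℕ→ℚ H → E ℕ.* H ℕ.+ E ℕ.* B ℕ.+ H ℕ.≤ E ℕ.* Q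
      contra le = ℕₚ.≤-trans (ℕₚ.+-monoʳ-≤ (E ℕ.* H ℕ.+ E ℕ.* B) (at-least {H} {Q ℕ.∸ (H ℕ.+ B)} gap))
        (ℕₚ.≤-reflexive (trans (cong (ℕ._+ E ℕ.* (Q ℕ.∸ (H ℕ.+ B))) (sym (ℕₚ.*-distribˡ-+ E H B)))
          (trans (sym (ℕₚ.*-distribˡ-+ E (H ℕ.+ B) _)) (cong (E ℕ.*_) (ℕₚ.m+[n∸m]≡n HB≤Q)))))
        where
        sum : ℕ→ℚ B ℚ.+ q ℚ.* ℕ→ℚ H ℚ.+ ℕ→ℚ H ℚ.≤ ℕ→ℚ Q
        sum = begin
          ℕ→ℚ B ℚ.+ q ℚ.* ℕ→ℚ H ℚ.+ ℕ→ℚ H ≤⟨ ℚₚ.+-monoˡ-≤ (ℕ→ℚ H) (ℚₚ.+-monoˡ-≤ (q ℚ.* ℕ→ℚ H) le) ⟩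
          ℕ→ℚ Q ℚ.- ℕ→ℚ H ℚ.- q ℚ.* ℕ→ℚ H ℚ.+ q ℚ.* ℕ→ℚ H ℚ.+ ℕ→ℚ H ≡⟨ cong (ℚ._+ ℕ→ℚ H) (cancel (ℕ→ℚ Q ℚ.- ℕ→ℚ H) (q ℚ.* ℕ→ℚ H)) ⟩
          ℕ→ℚ Q ℚ.- ℕ→ℚ H ℚ.+ ℕ→ℚ H ≡⟨ cancel (ℕ→ℚ Q) (ℕ→ℚ H) ⟩
          ℕ→ℚ Q ∎
        rearranged : q ℚ.* ℕ→ℚ H ℚ.+ ℕ→ℚ (H ℕ.+ B) ℚ.≤ ℕ→ℚ Q
        rearranged = begin
          q ℚ.* ℕ→ℚ H ℚ.+ ℕ→ℚ (H ℕ.+ B) ≡⟨ cong (q ℚ.* ℕ→ℚ H ℚ.+_) (trans (ι-+ H B) (ℚₚ.+-comm (ℕ→ℚ H) (ℕ→ℚ B))) ⟩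
          q ℚ.* ℕ→ℚ H ℚ.+ (ℕ→ℚ B ℚ.+ ℕ→ℚ H) ≡⟨ trans (sym (ℚₚ.+-assoc (q ℚ.* ℕ→ℚ H) (ℕ→ℚ B) (ℕ→ℚ H)))
              (cong (ℚ._+ ℕ→ℚ H) (ℚₚ.+-comm (q ℚ.* ℕ→ℚ H) (ℕ→ℚ B))) ⟩
          ℕ→ℚ B ℚ.+ q ℚ.* ℕ→ℚ H ℚ.+ ℕ→ℚ H ≤⟨ sum ⟩
          ℕ→ℚ Q ∎
        qH≥0 : 0ℚ ℚ.≤ q ℚ.* ℕ→ℚ H
        qH≥0 = ℚₚ.≮⇒≥ λ lt → ℚₚ.<-irrefl refl (begin-strict
          0ℚ ≤⟨ ℚₚ.nonNegative⁻¹ (ℕ→ℚ H) {{ι-nonNeg H}} ⟩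
          ℕ→ℚ H ≡⟨ ℚₚ.*-identityˡ (ℕ→ℚ H) ⟨
          1ℚ ℚ.* ℕ→ℚ H ≤⟨ ℚₚ.*-monoʳ-≤-nonNeg (ℕ→ℚ H) {{ι-nonNeg H}} 1≤Eq ⟩
          ℕ→ℚ E ℚ.* q ℚ.* ℕ→ℚ H ≡⟨ ℚₚ.*-assoc (ℕ→ℚ E) q (ℕ→ℚ H) ⟩
          ℕ→ℚ E ℚ.* (q ℚ.* ℕ→ℚ H) <⟨ ℚₚ.*-monoʳ-<-pos (ℕ→ℚ E) {{ι-pos E E≥1}} lt ⟩
          ℕ→ℚ E ℚ.* 0ℚ ≡⟨ ℚₚ.*-zeroʳ (ℕ→ℚ E) ⟩
          0ℚ ∎)
          where
          E≥1 : 1 ℕ.≤ E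
          E≥1 = positive E 1≤Eq
            where
            positive : ∀ k → 1ℚ ℚ.≤ ℕ→ℚ k ℚ.* q → 1 ℕ.≤ k
            positive zero le = ⊥-elim (ℚₚ.<-irrefl refl (ℚₚ.<-≤-trans (ℚₚ.positive⁻¹ 1ℚ) (subst (1ℚ ℚ.≤_) (ℚₚ.*-zeroˡ q) le)))
            positive (suc k) _ = s≤s z≤n
        -- Makes the truncated difference `Q ∸ (H + B)` the true one, so that `at-least` may be
        -- applied to it.
        HB≤Q : H ℕ.+ B ℕ.≤ Q
        HB≤Q = ι-cancel-≤ (begin
          ℕ→ℚ (H ℕ.+ B) ≡⟨ ℚₚ.+-identityˡ _ ⟨
          0ℚ ℚ.+ ℕ→ℚ (H ℕ.+ B) ≤⟨ ℚₚ.+-monoˡ-≤ (ℕ→ℚ (H ℕ.+ B)) qH≥0 ⟩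
          q ℚ.* ℕ→ℚ H ℚ.+ ℕ→ℚ (H ℕ.+ B) ≤⟨ rearranged ⟩
          ℕ→ℚ Q ∎)
        gap : q ℚ.* ℕ→ℚ H ℚ.≤ ℕ→ℚ (Q ℕ.∸ (H ℕ.+ B))
        gap = begin
          q ℚ.* ℕ→ℚ H ≡⟨ undo (q ℚ.* ℕ→ℚ H) (ℕ→ℚ (H ℕ.+ B)) ⟨
          q ℚ.* ℕ→ℚ H ℚ.+ ℕ→ℚ (H ℕ.+ B) ℚ.- ℕ→ℚ (H ℕ.+ B) ≤⟨ ℚₚ.+-monoˡ-≤ (ℚ.- ℕ→ℚ (H ℕ.+ B)) rearranged ⟩
          ℕ→ℚ Q ℚ.- ℕ→ℚ (H ℕ.+ B) ≡⟨ cong (ℚ._- ℕ→ℚ (H ℕ.+ B)) (trans (cong ℕ→ℚ (sym (ℕₚ.m∸n+n≡m HB≤Q))) (ι-+ (Q ℕ.∸ (H ℕ.+ B)) (H ℕ.+ B))) ⟩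
          ℕ→ℚ (Q ℕ.∸ (H ℕ.+ B)) ℚ.+ ℕ→ℚ (H ℕ.+ B) ℚ.- ℕ→ℚ (H ℕ.+ B) ≡⟨ undo (ℕ→ℚ (Q ℕ.∸ (H ℕ.+ B))) (ℕ→ℚ (H ℕ.+ B)) ⟩
          ℕ→ℚ (Q ℕ.∸ (H ℕ.+ B)) ∎
          where
          undo : ∀ a b → (a ℚ.+ b) ℚ.- b ≡ a
          undo a b = trans (ℚₚ.+-assoc a b (ℚ.- b)) (trans (cong (a ℚ.+_) (ℚₚ.+-inverseʳ b)) (ℚₚ.+-identityʳ a))

  opaque
    reciprocal : ∀ Δ → 1 ℕ.≤ Δ → ℚ
    reciprocal Δ p = (1/ ℕ→ℚ Δ) {{ℚₚ.pos⇒nonZero (ℕ→ℚ Δ) {{ι-pos Δ p}}}}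

    reciprocal-pos : ∀ Δ p → Positive (reciprocal Δ p)
    reciprocal-pos Δ p = ℚₚ.1/pos⇒pos (ℕ→ℚ Δ) {{ι-pos Δ p}}

    -- The negation of the first alternative with `δ = 1/Δ`, multiplied by `Δ`: the densities are
    -- absorbed into the actual sizes and the excess becomes `Q` itself.
    critical : ∀ {α β Δ} (p : 1 ℕ.≤ Δ) {Q a b s} → α ℚ.* ℕ→ℚ Q ℚ.≤ ℕ→ℚ a → β ℚ.* ℕ→ℚ Q ℚ.≤ ℕ→ℚ b →
      ℕ→ℚ s ℚ.≤ (α ℚ.+ β ℚ.+ reciprocal Δ p) ℚ.* ℕ→ℚ Q → Δ ℕ.* s ℕ.≤ Δ ℕ.* (a ℕ.+ b) ℕ.+ Q
    critical {α} {β} {Δ} p {Q} {a} {b} {s} αQ βQ le = ι-cancel-≤ (begin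
      ℕ→ℚ (Δ ℕ.* s) ≡⟨ ι-* Δ s ⟩
      ℕ→ℚ Δ ℚ.* ℕ→ℚ s ≤⟨ ℚₚ.*-monoˡ-≤-nonNeg (ℕ→ℚ Δ) {{ι-nonNeg Δ}} le ⟩
      ℕ→ℚ Δ ℚ.* ((α ℚ.+ β ℚ.+ δ) ℚ.* ℕ→ℚ Q) ≡⟨ cong (ℕ→ℚ Δ ℚ.*_) (trans (ℚₚ.*-distribʳ-+ (ℕ→ℚ Q) (α ℚ.+ β) δ)
          (cong (ℚ._+ δ ℚ.* ℕ→ℚ Q) (ℚₚ.*-distribʳ-+ (ℕ→ℚ Q) α β))) ⟩
      ℕ→ℚ Δ ℚ.* (α ℚ.* ℕ→ℚ Q ℚ.+ β ℚ.* ℕ→ℚ Q ℚ.+ δ ℚ.* ℕ→ℚ Q) ≤⟨ ℚₚ.*-monoˡ-≤-nonNeg (ℕ→ℚ Δ) {{ι-nonNeg Δ}}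
          (ℚₚ.+-monoˡ-≤ (δ ℚ.* ℕ→ℚ Q) (ℚₚ.+-mono-≤ αQ βQ)) ⟩
      ℕ→ℚ Δ ℚ.* (ℕ→ℚ a ℚ.+ ℕ→ℚ b ℚ.+ δ ℚ.* ℕ→ℚ Q) ≡⟨ ℚₚ.*-distribˡ-+ (ℕ→ℚ Δ) (ℕ→ℚ a ℚ.+ ℕ→ℚ b) (δ ℚ.* ℕ→ℚ Q) ⟩
      ℕ→ℚ Δ ℚ.* (ℕ→ℚ a ℚ.+ ℕ→ℚ b) ℚ.+ ℕ→ℚ Δ ℚ.* (δ ℚ.* ℕ→ℚ Q) ≡⟨ cong₂ ℚ._+_ (trans (cong (ℕ→ℚ Δ ℚ.*_) (sym (ι-+ a b))) (sym (ι-* Δ (a ℕ.+ b))))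
          (trans (sym (ℚₚ.*-assoc (ℕ→ℚ Δ) δ (ℕ→ℚ Q))) (trans (cong (ℚ._* ℕ→ℚ Q)
              (ℚₚ.*-inverseʳ (ℕ→ℚ Δ) {{ℚₚ.pos⇒nonZero (ℕ→ℚ Δ) {{ι-pos Δ p}}}})) (ℚₚ.*-identityˡ (ℕ→ℚ Q)))) ⟩
      ℕ→ℚ (Δ ℕ.* (a ℕ.+ b)) ℚ.+ ℕ→ℚ Q ≡⟨ ι-+ (Δ ℕ.* (a ℕ.+ b)) Q ⟨
      ℕ→ℚ (Δ ℕ.* (a ℕ.+ b) ℕ.+ Q) ∎)
      where
      open ℚₚ.≤-Reasoning
      δ : ℚ
      δ = reciprocal Δ p

module Development where

  open import Algebra.Structures using (IsAbelianGroup)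
  open import Data.Bool using (Bool; T; _∧_; _∨_; false; not; true)
  open import Data.Bool.Properties using (T-irrelevant; T?)
  open import Data.Empty using (⊥; ⊥-elim)
  open import Data.Fin using (Fin; suc; toℕ; zero)
  open import Data.Fin.Properties as Finₚ using (toℕ-fromℕ<; toℕ-injective; toℕ<n)
  import Data.Fin.Subset
  open import Data.Fin.Subset using (Subset; ⁅_⁆; ∣_∣) renaming (_∈_ to _∈ˢ_; _⊆_ to _⊆ˢ_; ∁ to ∁ˢ)
  import Data.Fin.Subset.Properties
  open import Data.Fin.Subset.Properties using (x∈⁅x⁆; x∈⁅y⁆⇒x≡y; x∉p⇒x∈∁p; ∣⁅x⁆∣≡1) renaming (_∈?_ to _∈ˢ?_)
  open import Data.List as List using (List; []; _∷_)
  open import Data.Nat using (>-nonZero; NonZero; _*_; _+_; _<_; _<ᵇ_; _^_; _∸_; _≡ᵇ_; _≤_; _≤ᵇ_; suc; s≤s; zero; z≤n; ℕ)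
  open import Data.Nat.DivMod using ([m+kn]%n≡m%n; _%_; _/_; _mod_; m%n<n; m/n*n≤m; m<n*o⇒m/o<n; m<n⇒m%n≡m; m≡m%n+[m/n]*n)
  open import Data.Nat.Properties hiding (_≟_)
  open import Data.Nat.Tactic.RingSolver using (solve-∀)
  open import Data.Product using (_,_; _×_; proj₁; proj₂; Σ; ∃)
  open import Data.Rational as ℚ using (1ℚ; ℚ)
  import Data.Rational.Properties as ℚₚ
  open import Data.Sum using (_⊎_; inj₁; inj₂)
  open import Data.Unit using (tt; ⊤)
  open import Data.Vec using (Vec; []; _∷_; lookup; map; replicate; tabulate; zipWith)
  open import Data.Vec.N-ary using (N-ary; _$ⁿ_; curryⁿ; ∀ⁿ)
  open import Data.Vec.Properties using ([]=⇒lookup; lookup⇒[]=; lookup∘tabulate)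
  import Defs
  open import Defs using (-ₘ_; 0ₘ; IndexAtMost; IsInterval; IsSubgroup; IsSurjHomOn; IsTranslate; IsTranslate₂; _+ₘ_; preimage; preimageMinus; ℕ→ℚ)
  open import Function.Bundles using (mk⇔)
  open import Relation.Binary.Definitions using (DecidableEquality; tri<; tri>; tri≈)
  open import Relation.Binary.PropositionalEquality using (_≡_; cong; cong₂; isEquivalence; module ≡-Reasoning; refl; subst; sym; trans)
  open import Relation.Nullary using (Dec; no; yes; ¬_)
  open import Relation.Nullary.Decidable using (_×-dec_; decidable-stable; fromWitness; map′; toWitness; ¬?; ⌊_⌋)

  -- Certificates for linear inequalities over ℕ

  infixl 6 _⊞_
  infixl 7 _⊠_
  infix 5 _≼_ _≐_ _≑_
  infixr 3 _⟨_⟩⇒_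
  infix 4 _⊢_

  data Lin (n : ℕ) : Set where
    var : Fin n → Lin n
    con : ℕ → Lin n
    _⊞_ : Lin n → Lin n → Lin n
    _⊠_ : ℕ → Lin n → Lin n

  ⟦_⟧ : ∀ {n} → Lin n → Vec ℕ n → ℕ
  ⟦ var i ⟧ ρ = lookup ρ i
  ⟦ con k ⟧ ρ = k
  ⟦ e ⊞ f ⟧ ρ = ⟦ e ⟧ ρ + ⟦ f ⟧ ρ
  ⟦ k ⊠ e ⟧ ρ = k * ⟦ e ⟧ ρ

  Coeffs : ℕ → Set
  Coeffs n = ℕ × Vec ℕ n

  _·_ : ∀ {n} → Vec ℕ n → Vec ℕ n → ℕ
  [] · [] = 0
  (a ∷ as) · (x ∷ xs) = a * x + as · xs

  valueᶜ : ∀ {n} → Coeffs n → Vec ℕ n → ℕ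
  valueᶜ (k , as) ρ = k + as · ρ

  unit : ∀ {n} → Fin n → Vec ℕ n
  unit zero = 1 ∷ replicate _ 0
  unit (suc i) = 0 ∷ unit i

  _⊹_ : ∀ {n} → Coeffs n → Coeffs n → Coeffs n
  (k , as) ⊹ (l , bs) = k + l , zipWith _+_ as bs

  _⊛_ : ∀ {n} → ℕ → Coeffs n → Coeffs n
  c ⊛ (k , as) = c * k , map (c *_) as

  coeffs : ∀ {n} → Lin n → Coeffs n
  coeffs (var i) = 0 , unit i
  coeffs (con k) = k , replicate _ 0
  coeffs (e ⊞ f) = coeffs e ⊹ coeffs f
  coeffs (k ⊠ e) = k ⊛ coeffs e

  zeros-· : ∀ {n} (ρ : Vec ℕ n) → replicate n 0 · ρ ≡ 0
  zeros-· [] = refl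
  zeros-· (x ∷ ρ) = zeros-· ρ

  unit-· : ∀ {n} (i : Fin n) (ρ : Vec ℕ n) → unit i · ρ ≡ lookup ρ i
  unit-· zero (x ∷ ρ) = trans (cong (x + 0 +_) (zeros-· ρ)) (trans (+-identityʳ (x + 0)) (+-identityʳ x))
  unit-· (suc i) (x ∷ ρ) = unit-· i ρ

  +-interchange : ∀ a b c d → (a + b) + (c + d) ≡ (a + c) + (b + d)
  +-interchange a b c d = begin
    (a + b) + (c + d) ≡⟨ +-assoc a b (c + d) ⟩
    a + (b + (c + d)) ≡⟨ cong (a +_) (trans (sym (+-assoc b c d)) (trans (cong (_+ d) (+-comm b c)) (+-assoc c b d))) ⟩
    a + (c + (b + d)) ≡⟨ +-assoc a c (b + d) ⟨
    (a + c) + (b + d) ∎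
    where open ≡-Reasoning

  sum-· : ∀ {n} (as bs ρ : Vec ℕ n) → zipWith _+_ as bs · ρ ≡ as · ρ + bs · ρ
  sum-· [] [] [] = refl
  sum-· (a ∷ as) (b ∷ bs) (x ∷ ρ) =
    trans (cong₂ _+_ (*-distribʳ-+ x a b) (sum-· as bs ρ)) (+-interchange (a * x) (b * x) _ _)

  scale-· : ∀ {n} c (as ρ : Vec ℕ n) → map (c *_) as · ρ ≡ c * (as · ρ)
  scale-· c [] [] = sym (*-zeroʳ c)
  scale-· c (a ∷ as) (x ∷ ρ) =
    trans (cong₂ _+_ (*-assoc c a x) (scale-· c as ρ)) (sym (*-distribˡ-+ c (a * x) _))

  ⊹-value : ∀ {n} (p q : Coeffs n) ρ → valueᶜ (p ⊹ q) ρ ≡ valueᶜ p ρ + valueᶜ q ρ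
  ⊹-value (k , as) (l , bs) ρ = trans (cong (k + l +_) (sum-· as bs ρ)) (+-interchange k l _ _)

  ⊛-value : ∀ {n} c (p : Coeffs n) ρ → valueᶜ (c ⊛ p) ρ ≡ c * valueᶜ p ρ
  ⊛-value c (k , as) ρ = trans (cong (c * k +_) (scale-· c as ρ)) (sym (*-distribˡ-+ c k _))

  coeffs-sound : ∀ {n} (e : Lin n) ρ → valueᶜ (coeffs e) ρ ≡ ⟦ e ⟧ ρ
  coeffs-sound (var i) ρ = unit-· i ρ
  coeffs-sound (con k) ρ = trans (cong (k +_) (zeros-· ρ)) (+-identityʳ k)
  coeffs-sound (e ⊞ f) ρ = trans (⊹-value (coeffs e) (coeffs f) ρ) (cong₂ _+_ (coeffs-sound e ρ) (coeffs-sound f ρ))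
  coeffs-sound (k ⊠ e) ρ = trans (⊛-value k (coeffs e) ρ) (cong (k *_) (coeffs-sound e ρ))

  allLeq : ∀ {n} → Vec ℕ n → Vec ℕ n → Bool
  allLeq [] [] = true
  allLeq (a ∷ as) (b ∷ bs) = (a ≤ᵇ b) ∧ allLeq as bs

  T-∧ˡ : ∀ {a b} → T (a ∧ b) → T a
  T-∧ˡ {true} _ = tt

  T-∧ʳ : ∀ {a b} → T (a ∧ b) → T b
  T-∧ʳ {true} p = p

  allLeq-sound : ∀ {n} (as bs ρ : Vec ℕ n) → T (allLeq as bs) → as · ρ ≤ bs · ρ
  allLeq-sound [] [] [] _ = z≤n
  allLeq-sound (a ∷ as) (b ∷ bs) (x ∷ ρ) p =
    +-mono-≤ (*-monoˡ-≤ x (≤ᵇ⇒≤ a b (T-∧ˡ p))) (allLeq-sound as bs ρ (T-∧ʳ {a ≤ᵇ b} p))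

  leq : ∀ {n} → Coeffs n → Coeffs n → Bool
  leq (k , as) (l , bs) = (k ≤ᵇ l) ∧ allLeq as bs

  leq-sound : ∀ {n} (p q : Coeffs n) ρ → T (leq p q) → valueᶜ p ρ ≤ valueᶜ q ρ
  leq-sound (k , as) (l , bs) ρ t =
    +-mono-≤ (≤ᵇ⇒≤ k l (T-∧ˡ t)) (allLeq-sound as bs ρ (T-∧ʳ {k ≤ᵇ l} t))

  -- A hypothesis l ≐ r is used as l ≤ r, a hypothesis l ≑ r as r ≤ l.
  data Hyp (n : ℕ) : Set where
    _≼_ _≐_ _≑_ : Lin n → Lin n → Hyp n

  smallerSide largerSide : ∀ {n} → Hyp n → Lin n
  smallerSide (l ≼ r) = l
  smallerSide (l ≐ r) = l
  smallerSide (l ≑ r) = r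
  largerSide (l ≼ r) = r
  largerSide (l ≐ r) = r
  largerSide (l ≑ r) = l

  Holds : ∀ {n} → Hyp n → Vec ℕ n → Set
  Holds (l ≼ r) ρ = ⟦ l ⟧ ρ ≤ ⟦ r ⟧ ρ
  Holds (l ≐ r) ρ = ⟦ l ⟧ ρ ≡ ⟦ r ⟧ ρ
  Holds (l ≑ r) ρ = ⟦ l ⟧ ρ ≡ ⟦ r ⟧ ρ

  holds-≤ : ∀ {n} (h : Hyp n) ρ → Holds h ρ → ⟦ smallerSide h ⟧ ρ ≤ ⟦ largerSide h ⟧ ρ
  holds-≤ (l ≼ r) ρ p = p
  holds-≤ (l ≐ r) ρ p = ≤-reflexive p
  holds-≤ (l ≑ r) ρ p = ≤-reflexive (sym p)

  -- Hypotheses carry the multipliers of a Farkas certificate; so does the conclusion.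
  data Entailment (n : ℕ) : Set where
    _⟨_⟩⇒_ : Hyp n → ℕ → Entailment n → Entailment n
    _⊢_    : ℕ → Hyp n → Entailment n

  Sound : ∀ {n} → Entailment n → Vec ℕ n → Set
  Sound (h ⟨ c ⟩⇒ e) ρ = Holds h ρ → Sound e ρ
  Sound (c ⊢ g) ρ = ⟦ smallerSide g ⟧ ρ ≤ ⟦ largerSide g ⟧ ρ

  -- The pair `p`, `q` accumulates the weighted sum of the hypotheses, so `p ≤ q` is known. The
  -- scaled goal follows once its left side plus `q` is bounded, coefficient by coefficient, by its
  -- right side plus `p`; crossing `p` and `q` avoids subtraction. A goal of weight zero would
  -- certify nothing and is rejected.
  certified : ∀ {n} → Entailment n → Coeffs n → Coeffs n → Bool
  certified (h ⟨ c ⟩⇒ e) p q = certified e (p ⊹ (c ⊛ coeffs (smallerSide h))) (q ⊹ (c ⊛ coeffs (largerSide h)))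
  certified (zero ⊢ g) p q = false
  certified (suc c ⊢ g) p q = leq ((suc c ⊛ coeffs (smallerSide g)) ⊹ q) ((suc c ⊛ coeffs (largerSide g)) ⊹ p)

  scaled-value : ∀ {n} c (e : Lin n) ρ → valueᶜ (c ⊛ coeffs e) ρ ≡ c * ⟦ e ⟧ ρ
  scaled-value c e ρ = trans (⊛-value c (coeffs e) ρ) (cong (c *_) (coeffs-sound e ρ))

  certified-sound : ∀ {n} (e : Entailment n) p q ρ → valueᶜ p ρ ≤ valueᶜ q ρ → T (certified e p q) → Sound e ρ
  certified-sound (h ⟨ c ⟩⇒ e) p q ρ p≤q t hyp =
    certified-sound e _ _ ρ
      (subst₂-≤ (sym (⊹-value p _ ρ)) (sym (⊹-value q _ ρ))
        (+-mono-≤ p≤q (subst₂-≤ (sym (scaled-value c (smallerSide h) ρ)) (sym (scaled-value c (largerSide h) ρ))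
          (*-monoʳ-≤ c (holds-≤ h ρ hyp))))) t
    where
    subst₂-≤ : ∀ {a b c d} → a ≡ b → c ≡ d → a ≤ c → b ≤ d
    subst₂-≤ refl refl r = r
  certified-sound (suc c ⊢ g) p q ρ p≤q t =
    *-cancelˡ-≤ (suc c) (+-cancelʳ-≤ (valueᶜ q ρ) _ _ (begin
      suc c * ⟦ smallerSide g ⟧ ρ + valueᶜ q ρ            ≡⟨ cong (_+ valueᶜ q ρ) (scaled-value (suc c) (smallerSide g) ρ) ⟨
      valueᶜ (suc c ⊛ coeffs (smallerSide g)) ρ + valueᶜ q ρ ≡⟨ ⊹-value (suc c ⊛ coeffs (smallerSide g)) q ρ ⟨
      valueᶜ ((suc c ⊛ coeffs (smallerSide g)) ⊹ q) ρ       ≤⟨ leq-sound ((suc c ⊛ coeffs (smallerSide g)) ⊹ q)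
          ((suc c ⊛ coeffs (largerSide g)) ⊹ p) ρ t ⟩
      valueᶜ ((suc c ⊛ coeffs (largerSide g)) ⊹ p) ρ       ≡⟨ ⊹-value (suc c ⊛ coeffs (largerSide g)) p ρ ⟩
      valueᶜ (suc c ⊛ coeffs (largerSide g)) ρ + valueᶜ p ρ ≤⟨ +-monoʳ-≤ (valueᶜ (suc c ⊛ coeffs (largerSide g)) ρ) p≤q ⟩
      valueᶜ (suc c ⊛ coeffs (largerSide g)) ρ + valueᶜ q ρ ≡⟨ cong (_+ valueᶜ q ρ) (scaled-value (suc c) (largerSide g) ρ) ⟩
      suc c * ⟦ largerSide g ⟧ ρ + valueᶜ q ρ            ∎))
    where open ≤-Reasoning

  vars : ∀ n → Vec (Lin n) n
  vars n = tabulate var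

  gather : ∀ n {P : Vec ℕ n → Set} → (∀ ρ → P ρ) → ∀ⁿ n (curryⁿ P)
  gather zero f = f []
  gather (suc n) f = λ x → gather n λ ρ → f (x ∷ ρ)

  -- The certificate is checked by evaluation: the implicit argument is the unit type exactly when
  -- the multipliers work. Variables may be instantiated by arbitrary terms, so products enter as
  -- atoms.
  lin : ∀ n (e : N-ary n (Lin n) (Entailment n)) → {T (certified (e $ⁿ vars n) (coeffs (con 0)) (coeffs (con 0)))} →
        ∀ⁿ n (curryⁿ (Sound (e $ⁿ vars n)))
  lin n e {t} = gather n λ ρ → certified-sound (e $ⁿ vars n) _ _ ρ ≤-refl t

  -- Finite abelian groups and counting

  𝟙 : Bool → ℕ
  𝟙 true = 1
  𝟙 false = 0

  𝟙≤1 : ∀ b → 𝟙 b ≤ 1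
  𝟙≤1 true = ≤-refl
  𝟙≤1 false = z≤n

  𝟙-true : ∀ {b} → T b → 𝟙 b ≡ 1
  𝟙-true {true} _ = refl

  𝟙-false : ∀ {b} → ¬ T b → 𝟙 b ≡ 0
  𝟙-false {true} p = ⊥-elim (p tt)
  𝟙-false {false} _ = refl

  ∑ : ∀ {A : Set} → List A → (A → ℕ) → ℕ
  ∑ [] f = 0
  ∑ (x ∷ xs) f = f x + ∑ xs f

  module _ {A : Set} where

    ∑-cong : ∀ (xs : List A) {f g : A → ℕ} → (∀ x → f x ≡ g x) → ∑ xs f ≡ ∑ xs g
    ∑-cong [] p = refl
    ∑-cong (x ∷ xs) p = cong₂ _+_ (p x) (∑-cong xs p)

    ∑-mono : ∀ (xs : List A) {f g : A → ℕ} → (∀ x → f x ≤ g x) → ∑ xs f ≤ ∑ xs g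
    ∑-mono [] p = z≤n
    ∑-mono (x ∷ xs) p = +-mono-≤ (p x) (∑-mono xs p)

    ∑-+ : ∀ (xs : List A) (f g : A → ℕ) → ∑ xs (λ x → f x + g x) ≡ ∑ xs f + ∑ xs g
    ∑-+ [] f g = refl
    ∑-+ (x ∷ xs) f g = trans (cong (f x + g x +_) (∑-+ xs f g)) (+-interchange (f x) (g x) _ _)

    ∑-* : ∀ (xs : List A) c (f : A → ℕ) → ∑ xs (λ x → c * f x) ≡ c * ∑ xs f
    ∑-* [] c f = sym (*-zeroʳ c)
    ∑-* (x ∷ xs) c f = trans (cong (c * f x +_) (∑-* xs c f)) (sym (*-distribˡ-+ c (f x) _))

    ∑-swap : ∀ {B : Set} (xs : List A) (ys : List B) (f : A → B → ℕ) →
             ∑ xs (λ x → ∑ ys (f x)) ≡ ∑ ys (λ y → ∑ xs (λ x → f x y))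
    ∑-swap [] ys f = sym (zero-∑ ys)
      where
      zero-∑ : ∀ {B : Set} (ys : List B) → ∑ ys (λ _ → 0) ≡ 0
      zero-∑ [] = refl
      zero-∑ (_ ∷ ys) = zero-∑ ys
    ∑-swap (x ∷ xs) ys f = trans (cong (∑ ys (f x) +_) (∑-swap xs ys f)) (sym (∑-+′ ys (f x) _))
      where
      ∑-+′ : ∀ {B : Set} (ys : List B) (f g : B → ℕ) → ∑ ys (λ x → f x + g x) ≡ ∑ ys f + ∑ ys g
      ∑-+′ [] f g = refl
      ∑-+′ (x ∷ xs) f g = trans (cong (f x + g x +_) (∑-+′ xs f g)) (+-interchange (f x) (g x) _ _)

    ∑-positive : ∀ (xs : List A) (f : A → ℕ) → 1 ≤ ∑ xs f → ∃ λ x → 1 ≤ f x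
    ∑-positive (x ∷ xs) f p with f x in eq
    ... | suc k = x , subst (1 ≤_) (sym eq) (s≤s z≤n)
    ... | zero = ∑-positive xs f p

  -- `once` says that the enumeration lists every element exactly once, as a sum, so that it feeds
  -- directly into counting.
  record FinAb : Set₁ where
    field
      Carrier        : Set
      _∙_            : Carrier → Carrier → Carrier
      ε              : Carrier
      _⁻¹            : Carrier → Carrier
      isAbelianGroup : IsAbelianGroup _≡_ _∙_ ε _⁻¹
      _≟_            : DecidableEquality Carrier
      elems          : List Carrier
      once           : ∀ a → ∑ elems (λ x → 𝟙 ⌊ x ≟ a ⌋) ≡ 1

    infixl 7 _∙_
    infixl 7 _//_
    infix 8 _⁻¹

    _//_ : Carrier → Carrier → Carrier
    x // y = x ∙ y ⁻¹

  -- Equations between group words are decided by comparing exponents.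
  module AbelianSolver (𝔾 : FinAb) where
    open FinAb 𝔾
    open IsAbelianGroup isAbelianGroup using (assoc; comm; identityˡ; identityʳ; inverseˡ; inverseʳ)

    infixr 8 _·ₘ_
    _·ₘ_ : ℕ → Carrier → Carrier
    zero ·ₘ x = ε
    suc n ·ₘ x = x ∙ n ·ₘ x

    swap-middle : ∀ a b c d → (a ∙ b) ∙ (c ∙ d) ≡ (a ∙ c) ∙ (b ∙ d)
    swap-middle a b c d = trans (assoc a b (c ∙ d))
      (trans (cong (a ∙_) (trans (sym (assoc b c d)) (trans (cong (_∙ d) (comm b c)) (assoc c b d))))
        (sym (assoc a c (b ∙ d))))

    ·ₘ-+ : ∀ m n x → (m + n) ·ₘ x ≡ m ·ₘ x ∙ n ·ₘ x
    ·ₘ-+ zero n x = sym (identityˡ _)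
    ·ₘ-+ (suc m) n x = trans (cong (x ∙_) (·ₘ-+ m n x)) (sym (assoc x _ _))

    cancelʳ : ∀ {x y} z → x ∙ z ≡ y ∙ z → x ≡ y
    cancelʳ {x} {y} z p = trans (undo x) (trans (cong (_∙ z ⁻¹) p) (sym (undo y)))
      where
      undo : ∀ x → x ≡ (x ∙ z) ∙ z ⁻¹
      undo x = sym (trans (assoc x z (z ⁻¹)) (trans (cong (x ∙_) (inverseʳ z)) (identityʳ x)))

    infixl 7 _⊙_ _⊘_
    infix 4 _≗_
    data Word (n : ℕ) : Set where
      gen : Fin n → Word n
      one : Word n
      _⊙_ : Word n → Word n → Word n
      inv : Word n → Word n

    _⊘_ : ∀ {n} → Word n → Word n → Word n
    v ⊘ w = v ⊙ inv w

    ⟦_⟧ʷ : ∀ {n} → Word n → Vec Carrier n → Carrier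
    ⟦ gen i ⟧ʷ ρ = lookup ρ i
    ⟦ one ⟧ʷ ρ = ε
    ⟦ v ⊙ w ⟧ʷ ρ = ⟦ v ⟧ʷ ρ ∙ ⟦ w ⟧ʷ ρ
    ⟦ inv w ⟧ʷ ρ = ⟦ w ⟧ʷ ρ ⁻¹

    pos neg : ∀ {n} → Word n → Vec ℕ n
    pos (gen i) = unit i
    pos one = replicate _ 0
    pos (v ⊙ w) = zipWith _+_ (pos v) (pos w)
    pos (inv w) = neg w
    neg (gen i) = replicate _ 0
    neg one = replicate _ 0
    neg (v ⊙ w) = zipWith _+_ (neg v) (neg w)
    neg (inv w) = pos w

    product : ∀ {n} → Vec ℕ n → Vec Carrier n → Carrier
    product [] [] = ε
    product (k ∷ ks) (x ∷ xs) = k ·ₘ x ∙ product ks xs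

    product-zeros : ∀ {n} (ρ : Vec Carrier n) → product (replicate n 0) ρ ≡ ε
    product-zeros [] = refl
    product-zeros (x ∷ ρ) = trans (identityˡ _) (product-zeros ρ)

    product-unit : ∀ {n} (i : Fin n) (ρ : Vec Carrier n) → product (unit i) ρ ≡ lookup ρ i
    product-unit zero (x ∷ ρ) = trans (cong₂ _∙_ (identityʳ x) (product-zeros ρ)) (identityʳ x)
    product-unit (suc i) (x ∷ ρ) = trans (identityˡ _) (product-unit i ρ)

    product-+ : ∀ {n} (ks ls : Vec ℕ n) ρ → product (zipWith _+_ ks ls) ρ ≡ product ks ρ ∙ product ls ρ
    product-+ [] [] [] = sym (identityˡ ε)
    product-+ (k ∷ ks) (l ∷ ls) (x ∷ ρ) =
      trans (cong₂ _∙_ (·ₘ-+ k l x) (product-+ ks ls ρ)) (swap-middle _ _ _ _)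

    word-sound : ∀ {n} (w : Word n) ρ → ⟦ w ⟧ʷ ρ ∙ product (neg w) ρ ≡ product (pos w) ρ
    word-sound (gen i) ρ = trans (cong₂ _∙_ refl (product-zeros ρ)) (trans (identityʳ _) (sym (product-unit i ρ)))
    word-sound one ρ = identityˡ _
    word-sound (v ⊙ w) ρ =
      trans (cong (⟦ v ⊙ w ⟧ʷ ρ ∙_) (product-+ (neg v) (neg w) ρ))
        (trans (swap-middle _ _ _ _)
          (trans (cong₂ _∙_ (word-sound v ρ) (word-sound w ρ)) (sym (product-+ (pos v) (pos w) ρ))))
    word-sound (inv w) ρ =
      trans (cong (⟦ inv w ⟧ʷ ρ ∙_) (sym (word-sound w ρ)))
        (trans (sym (assoc _ _ _)) (trans (cong (_∙ product (neg w) ρ) (inverseˡ _)) (identityˡ _)))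

    data Equation (n : ℕ) : Set where
      _≗_ : Word n → Word n → Equation n

    -- Exponents with negative ones moved across the equation; on concrete words both sides
    -- evaluate, so `refl` proves it.
    Same : ∀ {n} → Equation n → Set
    Same (v ≗ w) = zipWith _+_ (pos v) (neg w) ≡ zipWith _+_ (pos w) (neg v)

    Valid : ∀ {n} → Equation n → Vec Carrier n → Set
    Valid (v ≗ w) ρ = ⟦ v ⟧ʷ ρ ≡ ⟦ w ⟧ʷ ρ

    equation-sound : ∀ {n} (e : Equation n) → Same e → ∀ ρ → Valid e ρ
    equation-sound (v ≗ w) p ρ = cancelʳ (product (neg v) ρ ∙ product (neg w) ρ) (begin
      V ∙ (nv ∙ nw) ≡⟨ assoc V nv nw ⟨
      (V ∙ nv) ∙ nw ≡⟨ cong (_∙ nw) (word-sound v ρ) ⟩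
      product (pos v) ρ ∙ nw ≡⟨ product-+ (pos v) (neg w) ρ ⟨
      product (zipWith _+_ (pos v) (neg w)) ρ ≡⟨ cong (λ ks → product ks ρ) p ⟩
      product (zipWith _+_ (pos w) (neg v)) ρ ≡⟨ product-+ (pos w) (neg v) ρ ⟩
      product (pos w) ρ ∙ nv ≡⟨ cong (_∙ nv) (word-sound w ρ) ⟨
      (W ∙ nw) ∙ nv ≡⟨ assoc W nw nv ⟩
      W ∙ (nw ∙ nv) ≡⟨ cong (W ∙_) (comm nw nv) ⟩
      W ∙ (nv ∙ nw) ∎)
      where
      open ≡-Reasoning
      V W nv nw : Carrier
      V = ⟦ v ⟧ʷ ρ
      W = ⟦ w ⟧ʷ ρ
      nv = product (neg v) ρ
      nw = product (neg w) ρ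

    gatherʷ : ∀ n {P : Vec Carrier n → Set} → (∀ ρ → P ρ) → ∀ⁿ n (curryⁿ P)
    gatherʷ zero f = f []
    gatherʷ (suc n) f = λ x → gatherʷ n λ ρ → f (x ∷ ρ)

    group : ∀ n (e : N-ary n (Word n) (Equation n)) → Same (e $ⁿ tabulate gen) →
            ∀ⁿ n (curryⁿ (Valid (e $ⁿ tabulate gen)))
    group n e p = gatherʷ n (equation-sound (e $ⁿ tabulate gen) p)

  module Counting (𝔾 : FinAb) where
    open FinAb 𝔾 public
    open AbelianSolver 𝔾 public
    open IsAbelianGroup isAbelianGroup public
      using (assoc; comm; identityˡ; identityʳ; inverseˡ; inverseʳ)

    Sub : Set
    Sub = Carrier → Bool

    infix 4 _∈_ _⊑_
    infixr 7 _∩_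
    infixr 6 _∪_
    infixl 6 _∖_
    infixl 8 _⇀_
    infixl 6 _⊕_

    _∈_ : Carrier → Sub → Set
    x ∈ S = T (S x)

    _⊑_ : Sub → Sub → Set
    S ⊑ R = ∀ x → x ∈ S → x ∈ R

    _∩_ _∪_ _∖_ : Sub → Sub → Sub
    (S ∩ R) x = S x ∧ R x
    (S ∪ R) x = S x ∨ R x
    (S ∖ R) x = S x ∧ not (R x)

    full : Sub
    full _ = true

    ∑ᴳ : (Carrier → ℕ) → ℕ
    ∑ᴳ = ∑ elems

    #_ : Sub → ℕ
    # S = ∑ᴳ (λ x → 𝟙 (S x))
    infix 9 #_

    h : ℕ
    h = # full

    ≟-true : ∀ {x y} → T ⌊ x ≟ y ⌋ → x ≡ y
    ≟-true {x} {y} t with x ≟ y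
    ... | yes p = p

    ≟-refl : ∀ {x y} → x ≡ y → T ⌊ x ≟ y ⌋
    ≟-refl {x} {y} p with x ≟ y
    ... | yes _ = tt
    ... | no q = q p

    point : ∀ (f : Carrier → ℕ) a → ∑ᴳ (λ x → 𝟙 ⌊ x ≟ a ⌋ * f x) ≡ f a
    point f a = begin
      ∑ᴳ (λ x → 𝟙 ⌊ x ≟ a ⌋ * f x) ≡⟨ ∑-cong elems at ⟩
      ∑ᴳ (λ x → f a * 𝟙 ⌊ x ≟ a ⌋) ≡⟨ ∑-* elems (f a) _ ⟩
      f a * ∑ᴳ (λ x → 𝟙 ⌊ x ≟ a ⌋) ≡⟨ cong (f a *_) (once a) ⟩
      f a * 1                       ≡⟨ *-identityʳ (f a) ⟩
      f a ∎
      where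
      open ≡-Reasoning
      at : ∀ x → 𝟙 ⌊ x ≟ a ⌋ * f x ≡ f a * 𝟙 ⌊ x ≟ a ⌋
      at x with x ≟ a
      ... | yes refl = *-comm 1 (f x)
      ... | no _ = sym (*-zeroʳ (f a))

    term≤∑ : ∀ (f : Carrier → ℕ) a → f a ≤ ∑ᴳ f
    term≤∑ f a = ≤-trans (≤-reflexive (sym (point f a))) (∑-mono elems at)
      where
      at : ∀ x → 𝟙 ⌊ x ≟ a ⌋ * f x ≤ f x
      at x = ≤-trans (*-monoˡ-≤ (f x) (𝟙≤1 ⌊ x ≟ a ⌋)) (≤-reflexive (*-identityˡ (f x)))

    -- Each term is written as a sum against a point mass and the sums are exchanged; the indicators
    -- of `y = σ x` and `x = τ y` coincide.
    reindex : ∀ (σ τ : Carrier → Carrier) → (∀ x → τ (σ x) ≡ x) → (∀ x → σ (τ x) ≡ x) →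
              ∀ (f : Carrier → ℕ) → ∑ᴳ (λ x → f (σ x)) ≡ ∑ᴳ f
    reindex σ τ τσ στ f = begin
      ∑ᴳ (λ x → f (σ x)) ≡⟨ ∑-cong elems (λ x → sym (point f (σ x))) ⟩
      ∑ᴳ (λ x → ∑ᴳ (λ y → 𝟙 ⌊ y ≟ σ x ⌋ * f y)) ≡⟨ ∑-swap elems elems _ ⟩
      ∑ᴳ (λ y → ∑ᴳ (λ x → 𝟙 ⌊ y ≟ σ x ⌋ * f y)) ≡⟨ ∑-cong elems (λ y → ∑-cong elems (at y)) ⟩
      ∑ᴳ (λ y → ∑ᴳ (λ x → 𝟙 ⌊ x ≟ τ y ⌋ * f y)) ≡⟨ ∑-cong elems (λ y → point (λ _ → f y) (τ y)) ⟩
      ∑ᴳ f ∎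
      where
      open ≡-Reasoning
      at : ∀ y x → 𝟙 ⌊ y ≟ σ x ⌋ * f y ≡ 𝟙 ⌊ x ≟ τ y ⌋ * f y
      at y x with y ≟ σ x | x ≟ τ y
      ... | yes p | yes q = refl
      ... | no p | no q = refl
      ... | yes p | no q = ⊥-elim (q (sym (trans (cong τ p) (τσ x))))
      ... | no p | yes q = ⊥-elim (p (sym (trans (cong σ q) (στ y))))

    ∈-# : ∀ {S : Sub} {x} → x ∈ S → 1 ≤ # S
    ∈-# {S} {x} p = ≤-trans (≤-reflexive (sym (𝟙-true p))) (term≤∑ (λ x → 𝟙 (S x)) x)

    #-∈ : ∀ (S : Sub) → 1 ≤ # S → ∃ λ x → x ∈ S
    #-∈ S p with ∑-positive elems (λ x → 𝟙 (S x)) p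
    ... | x , q = x , at q
      where
      at : 1 ≤ 𝟙 (S x) → T (S x)
      at q with S x
      ... | true = tt

    some : Sub → Bool
    some S = 0 <ᵇ # S

    some⁺ : ∀ {S : Sub} {x} → x ∈ S → T (some S)
    some⁺ {S} p = <⇒<ᵇ (∈-# {S} p)

    some⁻ : ∀ (S : Sub) → T (some S) → ∃ λ x → x ∈ S
    some⁻ S p = #-∈ S (<ᵇ⇒< 0 (# S) p)

    search : ∀ (S : Sub) → (∃ λ x → x ∈ S) ⊎ (∀ x → ¬ (x ∈ S))
    search S with T? (some S)
    ... | yes p = inj₁ (some⁻ S p)
    ... | no q = inj₂ λ x p → q (some⁺ {S} p)

    search-all : ∀ (S : Sub) → (∃ λ x → ¬ (x ∈ S)) ⊎ (∀ x → x ∈ S)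
    search-all S with search (λ x → not (S x))
    ... | inj₁ (x , p) = inj₁ (x , λ q → at q p)
      where
      at : ∀ {b} → T b → T (not b) → ⊥
      at {true} _ ()
    ... | inj₂ q = inj₂ λ x → at (q x)
      where
      at : ∀ {b} → ¬ T (not b) → T b
      at {true} _ = tt
      at {false} q = ⊥-elim (q tt)

    #-cong : ∀ {S R : Sub} → (∀ x → S x ≡ R x) → # S ≡ # R
    #-cong p = ∑-cong elems (λ x → cong 𝟙 (p x))

    #-mono : ∀ {S R : Sub} → S ⊑ R → # S ≤ # R
    #-mono {S} {R} p = ∑-mono elems (λ x → at (p x))
      where
      at : ∀ {a b} → (T a → T b) → 𝟙 a ≤ 𝟙 b
      at {false} q = z≤n
      at {true} {true} q = ≤-refl
      at {true} {false} q = ⊥-elim (q tt)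

    #-∪∩ : ∀ (S R : Sub) → # (S ∪ R) + # (S ∩ R) ≡ # S + # R
    #-∪∩ S R = trans (sym (∑-+ elems _ _)) (trans (∑-cong elems (λ x → at (S x) (R x))) (∑-+ elems _ _))
      where
      at : ∀ a b → 𝟙 (a ∨ b) + 𝟙 (a ∧ b) ≡ 𝟙 a + 𝟙 b
      at false b = +-identityʳ _
      at true false = refl
      at true true = refl

    #-∖ : ∀ (S R : Sub) → # (S ∩ R) + # (S ∖ R) ≡ # S
    #-∖ S R = trans (sym (∑-+ elems _ _)) (∑-cong elems (λ x → at (S x) (R x)))
      where
      at : ∀ a b → 𝟙 (a ∧ b) + 𝟙 (a ∧ not b) ≡ 𝟙 a
      at false b = refl
      at true false = refl
      at true true = refl

    #≤h : ∀ (S : Sub) → # S ≤ h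
    #≤h S = #-mono {S} {full} (λ _ _ → tt)

    ∈∩⁺ : ∀ {S R : Sub} {x} → x ∈ S → x ∈ R → x ∈ S ∩ R
    ∈∩⁺ {S} {R} {x} p q with S x | R x
    ... | true | true = tt

    ∈∩ˡ : ∀ {S R : Sub} {x} → x ∈ S ∩ R → x ∈ S
    ∈∩ˡ {S} {R} {x} p with S x
    ... | true = tt

    ∈∩ʳ : ∀ {S R : Sub} {x} → x ∈ S ∩ R → x ∈ R
    ∈∩ʳ {S} {R} {x} p with S x
    ... | true = p

    ∈∪ˡ : ∀ {S R : Sub} {x} → x ∈ S → x ∈ S ∪ R
    ∈∪ˡ {S} {R} {x} p with S x
    ... | true = tt

    ∈∪ʳ : ∀ {S R : Sub} {x} → x ∈ R → x ∈ S ∪ R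
    ∈∪ʳ {S} {R} {x} p with S x
    ... | true = tt
    ... | false = p

    ∈∪⁻ : ∀ {S R : Sub} {x} → x ∈ S ∪ R → x ∈ S ⊎ x ∈ R
    ∈∪⁻ {S} {R} {x} p with S x
    ... | true = inj₁ tt
    ... | false = inj₂ p

    ∈∪-elim : ∀ (S R : Sub) {x} {C : Set} → x ∈ S ∪ R → (x ∈ S → C) → (x ∈ R → C) → C
    ∈∪-elim S R {x} p f g with ∈∪⁻ {S} {R} {x} p
    ... | inj₁ q = f q
    ... | inj₂ q = g q

    ∈∖⁺ : ∀ {S R : Sub} {x} → x ∈ S → ¬ (x ∈ R) → x ∈ S ∖ R
    ∈∖⁺ {S} {R} {x} p q with S x | R x
    ... | true | false = tt
    ... | true | true = q tt

    ∈∖ˡ : ∀ {S R : Sub} {x} → x ∈ S ∖ R → x ∈ S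
    ∈∖ˡ {S} {R} {x} p with S x
    ... | true = tt

    ∈∖ʳ : ∀ {S R : Sub} {x} → x ∈ S ∖ R → ¬ (x ∈ R)
    ∈∖ʳ {S} {R} {x} p q with S x | R x
    ... | true | true = p

    _∈?_ : ∀ x (S : Sub) → Dec (x ∈ S)
    x ∈? S = T? (S x)

    disjoint-# : ∀ (S R : Sub) → (∀ x → x ∈ S → ¬ (x ∈ R)) → # S + # R ≤ # (S ∪ R)
    disjoint-# S R d = ≤-trans (≤-reflexive (sym (#-∪∩ S R))) (≤-trans (+-monoʳ-≤ (# (S ∪ R)) none) (≤-reflexive (+-identityʳ _)))
      where
      none : # (S ∩ R) ≤ 0
      none with 1 ≤? # (S ∩ R)
      ... | no q = ≤-pred (≰⇒> q)
      ... | yes q with #-∈ (S ∩ R) q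
      ... | x , p = ⊥-elim (d x (∈∩ˡ {S} {R} p) (∈∩ʳ {S} {R} p))

    ∖-∪ : ∀ (S S′ R : Sub) → # ((S ∪ S′) ∖ R) ≤ # (S ∖ R) + # (S′ ∖ R)
    ∖-∪ S S′ R = ≤-trans (∑-mono elems (λ x → at (S x) (S′ x) (R x))) (≤-reflexive (∑-+ elems _ _))
      where
      at : ∀ a b c → 𝟙 ((a ∨ b) ∧ not c) ≤ 𝟙 (a ∧ not c) + 𝟙 (b ∧ not c)
      at false b c = ≤-refl
      at true b c = m≤m+n _ _

    ∖-trans : ∀ (S R Q : Sub) → # (S ∖ Q) ≤ # (S ∖ R) + # (R ∖ Q)
    ∖-trans S R Q = ≤-trans (∑-mono elems (λ x → at (S x) (R x) (Q x))) (≤-reflexive (∑-+ elems _ _))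
      where
      at : ∀ a b c → 𝟙 (a ∧ not c) ≤ 𝟙 (a ∧ not b) + 𝟙 (b ∧ not c)
      at false b c = z≤n
      at true true c = ≤-refl
      at true false true = z≤n
      at true false false = ≤-refl

    ∖-mono : ∀ {S S′ R R′ : Sub} → S ⊑ S′ → R′ ⊑ R → # (S ∖ R) ≤ # (S′ ∖ R′)
    ∖-mono {S} {S′} {R} {R′} p q =
      #-mono {S ∖ R} {S′ ∖ R′} λ x r → ∈∖⁺ {S′} {R′} (p x (∈∖ˡ {S} {R} r)) (λ s → ∈∖ʳ {S} {R} r (q x s))

    _⇀_ : Sub → Carrier → Sub
    (S ⇀ g) x = S (x // g)

    #-⇀ : ∀ S g → # (S ⇀ g) ≡ # S
    #-⇀ S g = reindex (_// g) (_∙ g)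
      (λ x → group 2 (λ x g → (x ⊘ g) ⊙ g ≗ x) refl x g) (λ x → group 2 (λ x g → (x ⊙ g) ⊘ g ≗ x) refl x g) (λ x → 𝟙 (S x))


    ⇀⁺ : ∀ {S : Sub} {x} g → x ∈ S → x ∙ g ∈ S ⇀ g
    ⇀⁺ {S} {x} g p = subst (_∈ S) (group 2 (λ x g → x ≗ (x ⊙ g) ⊘ g) refl x g) p

    _⊕_ : Sub → Sub → Sub
    (S ⊕ R) z = some (λ y → S y ∧ R (z // y))

    ⊕⁺ : ∀ {S R : Sub} {x y} → x ∈ S → y ∈ R → x ∙ y ∈ S ⊕ R
    ⊕⁺ {S} {R} {x} {y} p q =
      some⁺ {λ u → S u ∧ R ((x ∙ y) // u)} {x}
        (∈∩⁺ {S} {λ u → R ((x ∙ y) // u)} {x} p (subst (_∈ R) (group 2 (λ x y → y ≗ (x ⊙ y) ⊘ x) refl x y) q))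

    ⊕⁻ : ∀ {S R : Sub} {z} → z ∈ S ⊕ R → ∃ λ x → ∃ λ y → x ∈ S × y ∈ R × z ≡ x ∙ y
    ⊕⁻ {S} {R} {z} p with some⁻ (λ u → S u ∧ R (z // u)) p
    ... | x , q = x , z // x , ∈∩ˡ {S} {λ u → R (z // u)} {x} q , ∈∩ʳ {S} {λ u → R (z // u)} {x} q ,
                  group 2 (λ x z → z ≗ x ⊙ (z ⊘ x)) refl x z

    ⊕-mono : ∀ {S S′ R R′ : Sub} → S ⊑ S′ → R ⊑ R′ → S ⊕ R ⊑ S′ ⊕ R′
    ⊕-mono {S} {S′} {R} {R′} p q z r with ⊕⁻ {S} {R} r
    ... | x , y , x∈ , y∈ , refl = ⊕⁺ {S′} {R′} (p x x∈) (q y y∈)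

    ⊕-comm : ∀ (S R : Sub) → S ⊕ R ⊑ R ⊕ S
    ⊕-comm S R z r with ⊕⁻ {S} {R} r
    ... | x , y , x∈ , y∈ , refl = subst (_∈ R ⊕ S) (comm y x) (⊕⁺ {R} {S} y∈ x∈)

    #-comm : ∀ (S R : Sub) → # (S ⊕ R) ≡ # (R ⊕ S)
    #-comm S R = ≤-antisym (#-mono {S ⊕ R} {R ⊕ S} (⊕-comm S R)) (#-mono {R ⊕ S} {S ⊕ R} (⊕-comm R S))

    ⊕-∪ : ∀ (S S′ R : Sub) → (S ∪ S′) ⊕ R ⊑ (S ⊕ R) ∪ (S′ ⊕ R)
    ⊕-∪ S S′ R z r with ⊕⁻ {S ∪ S′} {R} r
    ... | x , y , x∈ , y∈ , refl with ∈∪⁻ {S} {S′} x∈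
    ... | inj₁ p = ∈∪ˡ {S ⊕ R} {S′ ⊕ R} (⊕⁺ {S} {R} p y∈)
    ... | inj₂ p = ∈∪ʳ {S ⊕ R} {S′ ⊕ R} (⊕⁺ {S′} {R} p y∈)

    ⊕-⇀ : ∀ (S R : Sub) g → (S ⇀ g) ⊕ R ⊑ (S ⊕ R) ⇀ g
    ⊕-⇀ S R g z r with ⊕⁻ {S ⇀ g} {R} r
    ... | x , y , x∈ , y∈ , refl =
      subst (_∈ S ⊕ R) (group 3 (λ x y g → (x ⊘ g) ⊙ y ≗ (x ⊙ y) ⊘ g) refl x y g) (⊕⁺ {S} {R} {x // g} x∈ y∈)

    ⇀-⊕ : ∀ (S R : Sub) g → (S ⊕ R) ⇀ g ⊑ (S ⇀ g) ⊕ R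
    ⇀-⊕ S R g z r with ⊕⁻ {S} {R} {z // g} r
    ... | x , y , x∈ , y∈ , eq =
      subst (_∈ (S ⇀ g) ⊕ R) (trans (group 3 (λ x y g → (x ⊙ g) ⊙ y ≗ (x ⊙ y) ⊙ g) refl x y g)
        (trans (cong (_∙ g) (sym eq)) (group 2 (λ z g → (z ⊘ g) ⊙ g ≗ z) refl z g)))
        (⊕⁺ {S ⇀ g} {R} {x ∙ g} {y} (⇀⁺ {S} g x∈) y∈)

    #-⇀-⊕ : ∀ (S R : Sub) g → # ((S ⇀ g) ⊕ R) ≡ # (S ⊕ R)
    #-⇀-⊕ S R g = trans (≤-antisym (#-mono {(S ⇀ g) ⊕ R} {(S ⊕ R) ⇀ g} (⊕-⇀ S R g))
                                   (#-mono {(S ⊕ R) ⇀ g} {(S ⇀ g) ⊕ R} (⇀-⊕ S R g))) (#-⇀ (S ⊕ R) g)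

    translate-⊑ : ∀ (S R : Sub) {g} → g ∈ R → S ⇀ g ⊑ S ⊕ R
    translate-⊑ S R {g} g∈ x p =
      subst (_∈ S ⊕ R) (group 2 (λ x g → (x ⊘ g) ⊙ g ≗ x) refl x g) (⊕⁺ {S} {R} {x // g} {g} p g∈)

    #≤⊕ : ∀ (S R : Sub) {g} → g ∈ R → # S ≤ # (S ⊕ R)
    #≤⊕ S R {g} g∈ = ≤-trans (≤-reflexive (sym (#-⇀ S g))) (#-mono {S ⇀ g} {S ⊕ R} (translate-⊑ S R g∈))

    -- Sums from the intersection lie in both sumsets and sums from the union in one of them;
    -- inclusion-exclusion does the rest.
    submodular : ∀ (S S′ R : Sub) → # ((S ∩ S′) ⊕ R) + # ((S ∪ S′) ⊕ R) ≤ # (S ⊕ R) + # (S′ ⊕ R)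
    submodular S S′ R = begin
      # ((S ∩ S′) ⊕ R) + # ((S ∪ S′) ⊕ R)
        ≤⟨ +-mono-≤ (#-mono {(S ∩ S′) ⊕ R} {(S ⊕ R) ∩ (S′ ⊕ R)} both)
                    (#-mono {(S ∪ S′) ⊕ R} {(S ⊕ R) ∪ (S′ ⊕ R)} (⊕-∪ S S′ R)) ⟩
      # ((S ⊕ R) ∩ (S′ ⊕ R)) + # ((S ⊕ R) ∪ (S′ ⊕ R)) ≡⟨ +-comm (# ((S ⊕ R) ∩ (S′ ⊕ R))) _ ⟩
      # ((S ⊕ R) ∪ (S′ ⊕ R)) + # ((S ⊕ R) ∩ (S′ ⊕ R)) ≡⟨ #-∪∩ (S ⊕ R) (S′ ⊕ R) ⟩
      # (S ⊕ R) + # (S′ ⊕ R) ∎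
      where
      open ≤-Reasoning
      both : (S ∩ S′) ⊕ R ⊑ (S ⊕ R) ∩ (S′ ⊕ R)
      both z r = ∈∩⁺ {S ⊕ R} {S′ ⊕ R}
        (⊕-mono {S ∩ S′} {S} {R} {R} (λ x → ∈∩ˡ {S} {S′}) (λ _ p → p) z r)
        (⊕-mono {S ∩ S′} {S′} {R} {R} (λ x → ∈∩ʳ {S} {S′}) (λ _ p → p) z r)

    corr : Sub → Carrier → ℕ
    corr S g = # (S ∩ (S ⇀ g))

    ∑-const : ∀ c → ∑ᴳ (λ _ → c) ≡ c * h
    ∑-const c = trans (∑-cong elems (λ _ → sym (*-identityʳ c))) (∑-* elems c _)

    ∑-reflect : ∀ (f : Carrier → ℕ) x → ∑ᴳ (λ g → f (x // g)) ≡ ∑ᴳ f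
    ∑-reflect f x = reindex (x //_) (x //_) involutive involutive f
      where
      involutive : ∀ g → x // (x // g) ≡ g
      involutive g = group 2 (λ x g → x ⊘ (x ⊘ g) ≗ g) refl x g

    𝟙-∧ : ∀ a b → 𝟙 (a ∧ b) ≡ 𝟙 a * 𝟙 b
    𝟙-∧ false b = refl
    𝟙-∧ true b = sym (+-identityʳ _)

    -- Double counting of the pairs `(x, g)` with `x ∈ R` and `x // g ∈ S`: for fixed `x` the
    -- quotient runs once through the group.
    ∑-meet : ∀ (S R : Sub) → ∑ᴳ (λ g → # (R ∩ (S ⇀ g))) ≡ # R * # S
    ∑-meet S R = begin
      ∑ᴳ (λ g → ∑ᴳ (λ x → 𝟙 (R x ∧ S (x // g)))) ≡⟨ ∑-swap elems elems _ ⟩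
      ∑ᴳ (λ x → ∑ᴳ (λ g → 𝟙 (R x ∧ S (x // g)))) ≡⟨ ∑-cong elems (λ x → trans (∑-cong elems (λ g → 𝟙-∧ (R x) _)) (∑-* elems (𝟙 (R x)) _)) ⟩
      ∑ᴳ (λ x → 𝟙 (R x) * ∑ᴳ (λ g → 𝟙 (S (x // g)))) ≡⟨ ∑-cong elems (λ x → trans
          (cong (𝟙 (R x) *_) (∑-reflect (λ y → 𝟙 (S y)) x)) (*-comm (𝟙 (R x)) (# S))) ⟩
      ∑ᴳ (λ x → # S * 𝟙 (R x)) ≡⟨ ∑-* elems (# S) _ ⟩
      # S * # R ≡⟨ *-comm (# S) (# R) ⟩
      # R * # S ∎
      where open ≡-Reasoning

    record Subgroup (K : Sub) : Set where
      field
        ε∈  : ε ∈ K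
        ∙∈  : ∀ {x y} → x ∈ K → y ∈ K → x ∙ y ∈ K
        ⁻¹∈ : ∀ {x} → x ∈ K → x ⁻¹ ∈ K

    Meets : Sub → Sub → Set
    Meets W K = ∀ x → ∃ λ k → k ∈ K × k ∙ x ∈ W

    ⊑-of-# : ∀ (S R : Sub) → # S ≤ # (S ∩ R) → S ⊑ R
    ⊑-of-# S R p x x∈ with x ∈? R
    ... | yes q = q
    ... | no q = ⊥-elim (<⇒≱ (∈-# {S ∖ R} (∈∖⁺ {S} {R} x∈ q))
                  (+-cancelˡ-≤ (# (S ∩ R)) _ _ (≤-trans (≤-reflexive (#-∖ S R)) (≤-trans p (≤-reflexive (sym (+-identityʳ _)))))))

  -- Isoperimetry: fragments and atoms

  module Isoperimetry (𝔾 : FinAb) where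
    open Counting 𝔾

    -- The stabiliser of `Z`, tested by comparing sizes so that it is again a Boolean set; `Stab-⊑`
    -- recovers the inclusion.
    Stab : Sub → Sub
    Stab Z g = # Z ≤ᵇ corr Z g

    Stab-⊑ : ∀ (Z : Sub) {g} → g ∈ Stab Z → Z ⊑ Z ⇀ g
    Stab-⊑ Z {g} p = ⊑-of-# Z (Z ⇀ g) (≤ᵇ⇒≤ _ _ p)

    ⊑-Stab : ∀ (Z : Sub) {g} → Z ⊑ Z ⇀ g → g ∈ Stab Z
    ⊑-Stab Z {g} p = ≤⇒≤ᵇ (#-mono {Z} {Z ∩ (Z ⇀ g)} λ x x∈ → ∈∩⁺ {Z} {Z ⇀ g} x∈ (p x x∈))

    ⇀-⊑-Stab : ∀ (Z : Sub) {g} → g ∈ Stab Z → Z ⇀ g ⊑ Z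
    ⇀-⊑-Stab Z {g} p = ⊑-of-# (Z ⇀ g) Z (≤-trans (≤-reflexive (#-⇀ Z g))
      (≤-trans (≤ᵇ⇒≤ _ _ p) (#-mono {Z ∩ (Z ⇀ g)} {(Z ⇀ g) ∩ Z}
        λ x q → ∈∩⁺ {Z ⇀ g} {Z} (∈∩ʳ {Z} {Z ⇀ g} q) (∈∩ˡ {Z} {Z ⇀ g} q))))

    Stab-subgroup : ∀ Z → Subgroup (Stab Z)
    Stab-subgroup Z = record
      { ε∈ = ⊑-Stab Z λ x p → subst (_∈ Z) (group 1 (λ x → x ≗ x ⊘ one) refl x) p
      ; ∙∈ = λ {g} {k} p q → ⊑-Stab Z λ x x∈ →
          subst (_∈ Z) (group 3 (λ x g k → (x ⊘ g) ⊘ k ≗ x ⊘ (g ⊙ k)) refl x g k) (Stab-⊑ Z q (x // g) (Stab-⊑ Z p x x∈))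
      ; ⁻¹∈ = λ {g} p → ⊑-Stab Z λ x x∈ →
          subst (_∈ Z) (group 2 (λ x g → x ⊙ g ≗ x ⊘ inv g) refl x g)
            (⇀-⊑-Stab Z p (x ∙ g) (⇀⁺ {Z} g x∈)) }

    module Fragments (W : Sub) (τ : ℕ) where

      -- Both `Z` and the complement of `Z ⊕ W` have at least `τ` elements. The two conditions are
      -- exchanged by `dual`.
      Fragment : Sub → Set
      Fragment Z = τ ≤ # Z × τ + # (Z ⊕ W) ≤ h

      ∂ : Sub → ℕ
      ∂ Z = # (Z ⊕ W) ∸ # Z

      -- Encodes the lexicographic order of the pairs `(∂ Z, # Z)`: the factor `suc h` exceeds every
      -- size.
      key : Sub → ℕ
      key Z = ∂ Z * suc h + # Z

      key-∂ : ∀ {Z C} → key C ≤ key Z → ∂ C ≤ ∂ Z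
      key-∂ {Z} {C} p with ∂ C ≤? ∂ Z
      ... | yes q = q
      ... | no q = ⊥-elim (<⇒≱ (begin-strict
          key Z                     ≤⟨ +-monoʳ-≤ (∂ Z * suc h) (#≤h Z) ⟩
          ∂ Z * suc h + h           <⟨ +-monoʳ-< (∂ Z * suc h) (n<1+n h) ⟩
          ∂ Z * suc h + suc h       ≡⟨ +-comm (∂ Z * suc h) (suc h) ⟩
          suc (∂ Z) * suc h         ≤⟨ *-monoˡ-≤ (suc h) (≰⇒> q) ⟩
          ∂ C * suc h               ≤⟨ m≤m+n _ _ ⟩
          key C                     ∎) p)
        where open ≤-Reasoning

      key-# : ∀ {Z C} → key Z ≤ key C → ∂ C ≤ ∂ Z → # Z ≤ # C
      key-# {Z} {C} p q = +-cancelˡ-≤ (∂ Z * suc h) _ _ (≤-trans p (+-monoˡ-≤ (# C) (*-monoˡ-≤ (suc h) q)))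

      Better : Sub → Sub → Set
      Better Z C = Fragment C × key C < key Z

      better? : ∀ Z C → Dec (Better Z C)
      better? Z C = ((τ ≤? # C) ×-dec (τ + # (C ⊕ W) ≤? h)) ×-dec (key C <? key Z)

      dual : Sub → Sub
      dual Z x = not ((Z ⊕ W) (x ⁻¹))

      Stuck : Sub → Set
      Stuck Z = ¬ Better Z (dual Z) × (∀ g → ¬ Better Z (Z ∩ (Z ⇀ g))) × (∀ g → ¬ Better Z (Z ∪ (Z ⇀ g)))

      improve : ∀ Z → (∃ λ C → Better Z C) ⊎ Stuck Z
      improve Z with better? Z (dual Z)
      ... | yes p = inj₁ (dual Z , p)
      ... | no p with search (λ g → ⌊ better? Z (Z ∩ (Z ⇀ g)) ⌋)
      ... | inj₁ (g , q) = inj₁ (Z ∩ (Z ⇀ g) , toWitness q)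
      ... | inj₂ q with search (λ g → ⌊ better? Z (Z ∪ (Z ⇀ g)) ⌋)
      ... | inj₁ (g , r) = inj₁ (Z ∪ (Z ⇀ g) , toWitness r)
      ... | inj₂ r = inj₂ (p , (λ g b → q g (fromWitness b)) , (λ g b → r g (fromWitness b)))

      descend : ∀ n Z → key Z ≤ n → Fragment Z → ∃ λ C → Fragment C × Stuck C × ∂ C ≤ ∂ Z
      descend n Z k f with improve Z
      ... | inj₂ s = Z , f , s , ≤-refl
      descend zero Z k f | inj₁ (C , _ , b) = ⊥-elim (n≮0 (≤-trans b k))
      descend (suc n) Z k f | inj₁ (C , f′ , b) with descend n C (≤-pred (≤-trans b k)) f′
      ... | D , g , s , d = D , g , s , ≤-trans d (key-∂ {Z} {C} (<⇒≤ b))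

      module _ {w : Carrier} (w∈ : w ∈ W) where

        ∂-eq : ∀ Z → # Z + ∂ Z ≡ # (Z ⊕ W)
        ∂-eq Z = m+[n∸m]≡n (#≤⊕ Z W w∈)

        dual-# : ∀ Z → # (dual Z) + # (Z ⊕ W) ≡ h
        dual-# Z = trans (cong (_+ # (Z ⊕ W)) (reindex _⁻¹ _⁻¹ inv-inv inv-inv (λ x → 𝟙 (not ((Z ⊕ W) x)))))
          (trans (+-comm (# (λ x → not ((Z ⊕ W) x))) _) (#-∖ full (Z ⊕ W)))
          where
          inv-inv : ∀ x → (x ⁻¹) ⁻¹ ≡ x
          inv-inv x = group 1 (λ x → inv (inv x) ≗ x) refl x

        -- If `c ∙ y` were the inverse of some `z ∈ Z`, then `z ∙ y` would be `c ⁻¹`, which the dual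
        -- excludes from `Z ⊕ W`. So the sumset of the dual avoids the negative of `Z`.
        dual-⊕ : ∀ Z → # (dual Z ⊕ W) + # Z ≤ h
        dual-⊕ Z = ≤-trans (≤-reflexive (cong (# (dual Z ⊕ W) +_) (sym (reindex _⁻¹ _⁻¹ inv-inv inv-inv (λ x → 𝟙 (Z x))))))
          (≤-trans (disjoint-# (dual Z ⊕ W) (λ x → Z (x ⁻¹)) apart) (#≤h _))
          where
          inv-inv : ∀ x → (x ⁻¹) ⁻¹ ≡ x
          inv-inv x = group 1 (λ x → inv (inv x) ≗ x) refl x
          apart : ∀ x → x ∈ dual Z ⊕ W → ¬ (x ⁻¹ ∈ Z)
          apart x p q with ⊕⁻ {dual Z} {W} p
          ... | c , y , c∈ , y∈ , refl = ∈∖ʳ {full} {λ x → (Z ⊕ W) (x ⁻¹)} {c} c∈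
            (subst (_∈ Z ⊕ W) (group 2 (λ c y → inv (c ⊙ y) ⊙ y ≗ inv c) refl c y) (⊕⁺ {Z} {W} q y∈))

        -- The dual is a fragment whose boundary is at most that of `Z`. Not being better than `Z`,
        -- it cannot be smaller, and its size is `h` minus that of `Z ⊕ W`.
        stuck-dual : ∀ Z → Fragment Z → Stuck Z → # Z + # (Z ⊕ W) ≤ h
        stuck-dual Z (τ≤ , room) (nd , _) with key Z ≤? key (dual Z)
        ... | yes k = ≤-trans (+-monoˡ-≤ (# (Z ⊕ W)) (key-# {Z} {dual Z} k ∂≤)) (≤-reflexive (dual-# Z))
          where
          ∂≤ : ∂ (dual Z) ≤ ∂ Z
          ∂≤ = lin 7 (λ d z′ s′ z s e h → (z′ ⊞ d ≐ s′) ⟨ 1 ⟩⇒ (z ⊞ e ≑ s) ⟨ 1 ⟩⇒ (z′ ⊞ s ≑ h) ⟨ 1 ⟩⇒ (s′ ⊞ z ≼ h) ⟨ 1 ⟩⇒ 1 ⊢ d ≼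
              e) (∂ (dual Z)) (# (dual Z)) (# (dual Z ⊕ W)) (# Z) (# (Z ⊕ W)) (∂ Z) (h)
                 (∂-eq (dual Z)) (∂-eq Z) (dual-# Z) (dual-⊕ Z)
        ... | no k = ⊥-elim (nd ((
              lin 4 (λ t s z′ h → (t ⊞ s ≼ h) ⟨ 1 ⟩⇒ (z′ ⊞ s ≑ h) ⟨ 1 ⟩⇒ 1 ⊢ t ≼ z′) (τ) (# (Z ⊕ W)) (# (dual Z)) (h) room (dual-# Z) ,
              lin 4 (λ t s′ z h → (t ≼ z) ⟨ 1 ⟩⇒ (s′ ⊞ z ≼ h) ⟨ 1 ⟩⇒ 1 ⊢ t ⊞ s′ ≼ h) (τ) (# (dual Z ⊕ W)) (# Z) (h) τ≤ (dual-⊕ Z)) , ≰⇒> k))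

        -- Once `I` has `τ` elements, `I` and `U` are both fragments, so neither has a boundary
        -- below `∂ Z`. Submodularity gives `∂ I + ∂ U ≤ 2 * ∂ Z`, hence `∂ I = ∂ Z`, and the tie in
        -- the key forbids `I` to be smaller than `Z`.
        stuck-corr : ∀ Z → Fragment Z → Stuck Z → ∀ g → τ ≤ corr Z g → # Z ≤ corr Z g
        stuck-corr Z (τ≤ , room) st@(_ , ni , nu) g big = key-# {Z} {I} kI ∂I≤
          where
          I U : Sub
          I = Z ∩ (Z ⇀ g)
          U = Z ∪ (Z ⇀ g)
          sI≤ : # (I ⊕ W) ≤ # (Z ⊕ W)
          sI≤ = #-mono {I ⊕ W} {Z ⊕ W} (⊕-mono {I} {Z} {W} {W} (λ x → ∈∩ˡ {Z} {Z ⇀ g}) (λ _ p → p))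
          kI : key Z ≤ key I
          kI = ≮⇒≥ λ k → ni g ((big , ≤-trans (+-monoʳ-≤ τ sI≤) room) , k)
          ∂≤I : ∂ Z ≤ ∂ I
          ∂≤I = key-∂ {I} {Z} kI
          u+i : # U + # I ≡ # Z + # Z
          u+i = trans (#-∪∩ Z (Z ⇀ g)) (cong (# Z +_) (#-⇀ Z g))
          sub : # (I ⊕ W) + # (U ⊕ W) ≤ # (Z ⊕ W) + # (Z ⊕ W)
          sub = ≤-trans (submodular Z (Z ⇀ g) W) (≤-reflexive (cong (# (Z ⊕ W) +_) (#-⇀-⊕ Z W g)))
          -- `stuck-dual` supplies the room: `U ⊕ W` has at most `# Z + # (Z ⊕ W) - τ` elements.
          roomU : τ + # (U ⊕ W) ≤ h
          roomU = lin 9 (λ t sU sI s z i e eI h → (t ≼ i) ⟨ 1 ⟩⇒ (sI ⊞ sU ≼ s ⊞ s) ⟨ 1 ⟩⇒ (i ⊞ eI ≐ sI) ⟨ 1 ⟩⇒ (e ≼ eI) ⟨ 1 ⟩⇒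
              (z ⊞ e ≑ s) ⟨ 1 ⟩⇒ (z ⊞ s ≼ h) ⟨ 1 ⟩⇒ 1 ⊢ t ⊞ sU ≼ h) (τ) (# (U ⊕ W)) (# (I ⊕ W)) (# (Z ⊕ W)) (# Z) (# I) (∂ Z)
              (∂ I) (h)
                    big sub (∂-eq I) ∂≤I (∂-eq Z) (stuck-dual Z (τ≤ , room) st)
          kU : key Z ≤ key U
          kU = ≮⇒≥ λ k → nu g ((≤-trans τ≤ (#-mono {Z} {U} (λ x → ∈∪ˡ {Z} {Z ⇀ g})) , roomU) , k)
          ∂I≤ : ∂ I ≤ ∂ Z
          ∂I≤ = lin 9 (λ sU sI s z i u e eI eU → (sI ⊞ sU ≼ s ⊞ s) ⟨ 1 ⟩⇒ (i ⊞ eI ≐ sI) ⟨ 1 ⟩⇒ (u ⊞ eU ≐ sU) ⟨ 1 ⟩⇒ (e ≼ eU) ⟨ 1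
              ⟩⇒ (z ⊞ e ≑ s) ⟨ 2 ⟩⇒ (u ⊞ i ≑ z ⊞ z) ⟨ 1 ⟩⇒ 1 ⊢ eI ≼ e) (# (U ⊕ W)) (# (I ⊕ W)) (# (Z ⊕ W)) (# Z) (# I) (# U) (∂ Z)
              (∂ I) (∂ U)
                  sub (∂-eq I) (∂-eq U) (key-∂ {U} {Z} kU) (∂-eq Z) u+i

        module _ {θ κ : ℕ} (1≤τ : 1 ≤ τ) (τ<θ : 2 * (h * τ) < θ * θ) (κ≤θ : 2 * κ ≤ θ)
                 (meets : ∀ K → Subgroup K → κ ≤ # K → Meets W K) where

          -- Correlations of a stuck set are below `τ` off its stabiliser, so their sum gives
          -- `# Z * # Z ≤ # (Stab Z) * # Z + h * τ`. With `θ ≤ # Z` this is impossible for a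
          -- stabiliser smaller than `κ`; for a larger one `W` meets all its cosets and `Z ⊕ W` is
          -- everything, which no fragment allows.
          stuck-small : ∀ Z → Fragment Z → Stuck Z → # Z < θ
          stuck-small Z fr@(τ≤ , room) st with # Z <? θ
          ... | yes p = p
          ... | no p with κ ≤? # (Stab Z)
          ... | yes q = ⊥-elim (<⇒≱ 1≤τ (+-cancelʳ-≤ (# (Z ⊕ W)) τ 0 (≤-trans room (#-mono {full} {Z ⊕ W} everything))))
            where
            everything : full ⊑ Z ⊕ W
            everything x _ with #-∈ Z (≤-trans 1≤τ τ≤)
            ... | z , z∈ with meets (Stab Z) (Stab-subgroup Z) q (x // z)
            ... | k , k∈ , kx∈ = subst (_∈ Z ⊕ W)
              (group 3 (λ x z k → (z ⊘ k) ⊙ (k ⊙ (x ⊘ z)) ≗ x) refl x z k)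
              (⊕⁺ {Z} {W} (Stab-⊑ Z k∈ z z∈) kx∈)
          ... | no q = ⊥-elim (<-irrefl refl (begin-strict
              2 * (# Z * # Z)               ≤⟨ *-monoʳ-≤ 2 square ⟩
              2 * (# (Stab Z) * # Z + h * τ) ≤⟨ *-monoʳ-≤ 2 (+-monoˡ-≤ (h * τ) (*-monoˡ-≤ (# Z) (<⇒≤ (≰⇒> q)))) ⟩
              2 * (κ * # Z + h * τ)         ≡⟨ *-distribˡ-+ 2 (κ * # Z) (h * τ) ⟩
              2 * (κ * # Z) + 2 * (h * τ)   <⟨ +-monoʳ-< (2 * (κ * # Z)) τ<θ ⟩
              2 * (κ * # Z) + θ * θ         ≡⟨ cong (_+ θ * θ) (*-assoc 2 κ (# Z)) ⟨
              2 * κ * # Z + θ * θ           ≤⟨ +-mono-≤ (*-monoˡ-≤ (# Z) (≤-trans κ≤θ θ≤)) (*-mono-≤ θ≤ θ≤) ⟩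
              # Z * # Z + # Z * # Z         ≡⟨ cong (# Z * # Z +_) (+-identityʳ (# Z * # Z)) ⟨
              2 * (# Z * # Z)               ∎))
            where
            open ≤-Reasoning
            θ≤ : θ ≤ # Z
            θ≤ = ≮⇒≥ p
            at : ∀ g → corr Z g ≤ # Z * 𝟙 (Stab Z g) + τ
            at g with τ ≤? corr Z g
            ... | no r = ≤-trans (<⇒≤ (≰⇒> r)) (m≤n+m τ _)
            ... | yes r = ≤-trans (≤-trans (#-mono {Z ∩ (Z ⇀ g)} {Z} (λ x → ∈∩ˡ {Z} {Z ⇀ g}))
                    (≤-reflexive (trans (sym (*-identityʳ (# Z))) (cong (# Z *_) (sym (𝟙-true (≤⇒≤ᵇ (stuck-corr Z fr st g r)))))))) (m≤m+n _ τ)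
            square : # Z * # Z ≤ # (Stab Z) * # Z + h * τ
            square = begin
              # Z * # Z                                  ≡⟨ ∑-meet Z Z ⟨
              ∑ᴳ (corr Z)                                ≤⟨ ∑-mono elems at ⟩
              ∑ᴳ (λ g → # Z * 𝟙 (Stab Z g) + τ)          ≡⟨ ∑-+ elems _ _ ⟩
              ∑ᴳ (λ g → # Z * 𝟙 (Stab Z g)) + ∑ᴳ (λ _ → τ) ≡⟨ cong₂ _+_ (∑-* elems (# Z) _) (∑-const τ) ⟩
              # Z * # (Stab Z) + τ * h                   ≡⟨ cong₂ _+_ (*-comm (# Z) (# (Stab Z))) (*-comm τ h) ⟩
              # (Stab Z) * # Z + h * τ                   ∎

          atom : ∀ Z → Fragment Z → ∃ λ Y → Fragment Y × # Y < θ × # (Y ⊕ W) + # Z ≤ # (Z ⊕ W) + # Y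
          atom Z fr = let Y , frY , st , d = descend (key Z) Z ≤-refl fr in
            Y , frY , stuck-small Y frY st ,
            lin 6 (λ sY z s y e eY → (y ⊞ eY ≑ sY) ⟨ 1 ⟩⇒ (z ⊞ e ≐ s) ⟨ 1 ⟩⇒ (eY ≼ e) ⟨ 1 ⟩⇒ 1 ⊢ sY ⊞ z ≼ s ⊞ y) (# (Y ⊕ W)) (# Z)
                (# (Z ⊕ W)) (# Y) (∂ Z) (∂ Y)
              (∂-eq Y) (∂-eq Z) d

          -- The boundary of `Z` is at least that of its atom `Y`, and the latter exceeds `# W - θ`,
          -- since `Y` is non-empty and has fewer than `θ` elements.
          growth : ∀ Z → Fragment Z → # Z + # W ≤ # (Z ⊕ W) + θ
          growth Z fr = let Y , (τ≤ , _) , small , d = atom Z fr in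
            lin 6 (λ sY z s y w t → (w ≼ sY) ⟨ 1 ⟩⇒ (con 1 ⊞ y ≼ t) ⟨ 1 ⟩⇒ (sY ⊞ z ≼ s ⊞ y) ⟨ 1 ⟩⇒ 1 ⊢ z ⊞ w ≼ s ⊞ t) (# (Y ⊕ W))
                (# Z) (# (Z ⊕ W)) (# Y) (# W) (θ)
              (W≤ Y τ≤) small d
            where
            W≤ : ∀ Y → τ ≤ # Y → # W ≤ # (Y ⊕ W)
            W≤ Y τ≤ = let y , y∈ = #-∈ Y (≤-trans 1≤τ τ≤) in ≤-trans (#≤⊕ W Y y∈) (≤-reflexive (#-comm W Y))

  -- Lipschitz sets

  module Lipschitz (𝔾 : FinAb) (U : FinAb.Carrier 𝔾 → Bool)
    (generates : ∀ (S : FinAb.Carrier 𝔾 → Bool) {x} → T (S x) →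
       (∀ x u → T (S x) → T (U u) → T (S (FinAb._∙_ 𝔾 x u))) → ∀ y → T (S y)) where
    open Counting 𝔾
    open Isoperimetry 𝔾

    -- `generates` is the induction principle of the generating set `U`. A single generator
    -- displaces at most `ν` points of `W`, the discrete counterpart of a Lipschitz condition on the
    -- indicator.
    record Lip (W : Sub) (ν : ℕ) : Set where
      constructor lipschitz
      field bound : ∀ u → u ∈ U → # (W ∖ (W ⇀ u)) ≤ ν
    open Lip

    Lip-⇀ : ∀ {W ν} g → Lip W ν → Lip (W ⇀ g) ν
    Lip-⇀ {W} {ν} g p .bound u u∈ = ≤-trans (≤-reflexive (trans
      (#-cong {(W ⇀ g) ∖ ((W ⇀ g) ⇀ u)} {(W ∖ (W ⇀ u)) ⇀ g}
        (λ x → cong (λ y → W (x // g) ∧ not (W y)) (group 3 (λ x g u → (x ⊘ u) ⊘ g ≗ (x ⊘ g) ⊘ u) refl x g u)))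
      (#-⇀ (W ∖ (W ⇀ u)) g))) (p .bound u u∈)

    Lip-∩ : ∀ {V W μ ν} → Lip V μ → Lip W ν → Lip (V ∩ W) (μ + ν)
    Lip-∩ {V} {W} p q .bound u u∈ = ≤-trans (∑-mono elems (λ x → at (V x) (W x) (V (x // u)) (W (x // u))))
      (≤-trans (≤-reflexive (∑-+ elems _ _)) (+-mono-≤ (p .bound u u∈) (q .bound u u∈)))
      where
      at : ∀ a b c d → 𝟙 ((a ∧ b) ∧ not (c ∧ d)) ≤ 𝟙 (a ∧ not c) + 𝟙 (b ∧ not d)
      at false b c d = z≤n
      at true false c d = z≤n
      at true true false d = s≤s z≤n
      at true true true d = ≤-refl

    Lip-∪ : ∀ {V W μ ν} → Lip V μ → Lip W ν → Lip (V ∪ W) (μ + ν)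
    Lip-∪ {V} {W} p q .bound u u∈ = ≤-trans (∑-mono elems (λ x → at (V x) (W x) (V (x // u)) (W (x // u))))
      (≤-trans (≤-reflexive (∑-+ elems _ _)) (+-mono-≤ (p .bound u u∈) (q .bound u u∈)))
      where
      at : ∀ a b c d → 𝟙 ((a ∨ b) ∧ not (c ∨ d)) ≤ 𝟙 (a ∧ not c) + 𝟙 (b ∧ not d)
      at false false c d = z≤n
      at false true true d = z≤n
      at false true false d = ≤-refl
      at true b true d = z≤n
      at true b false false = s≤s z≤n
      at true b false true = z≤n

    -- A discrete intermediate value theorem. If no generator led out of the set where `L ≤ f`, that
    -- set would be everything, against `x₁`; a point from which one leaves has value below `L + ν`.
    intermediate : ∀ (f : Carrier → ℕ) ν L → (∀ x u → u ∈ U → f x ≤ f (x ∙ u) + ν) →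
      ∀ {x₀ x₁} → L ≤ f x₀ → f x₁ < L → ∃ λ z → L ≤ f z × f z < L + ν
    intermediate f ν L lip {x₀} {x₁} p q with search (λ x → (L ≤ᵇ f x) ∧ some (λ u → U u ∧ (f (x ∙ u) <ᵇ L)))
    ... | inj₁ (x , r) =
        let u , s = some⁻ (λ u → U u ∧ (f (x ∙ u) <ᵇ L)) (∈∩ʳ {λ x → L ≤ᵇ f x} {λ x → some (λ u → U u ∧ (f (x ∙ u) <ᵇ L))} {x} r)
        in x , ≤ᵇ⇒≤ L (f x) (∈∩ˡ {λ x → L ≤ᵇ f x} {λ x → some (λ u → U u ∧ (f (x ∙ u) <ᵇ L))} {x} r) ,
           ≤-<-trans (lip x u (∈∩ˡ {U} {λ u → f (x ∙ u) <ᵇ L} {u} s))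
             (+-monoˡ-< ν (<ᵇ⇒< (f (x ∙ u)) L (∈∩ʳ {U} {λ u → f (x ∙ u) <ᵇ L} {u} s)))
    ... | inj₂ none = ⊥-elim (<⇒≱ q (≤ᵇ⇒≤ L (f x₁) (generates S {x₀} (≤⇒≤ᵇ p) closed x₁)))
      where
      S : Sub
      S x = L ≤ᵇ f x
      closed : ∀ x u → x ∈ S → u ∈ U → x ∙ u ∈ S
      closed x u x∈ u∈ with L ≤? f (x ∙ u)
      ... | yes r = ≤⇒≤ᵇ r
      ... | no r = ⊥-elim (none x (∈∩⁺ {S} {λ x → some (λ u → U u ∧ (f (x ∙ u) <ᵇ L))} {x} x∈
                    (some⁺ {λ u → U u ∧ (f (x ∙ u) <ᵇ L)} {u} (∈∩⁺ {U} {λ u → f (x ∙ u) <ᵇ L} {u} u∈ (<⇒<ᵇ (≰⇒> r))))))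

    corr-Lip : ∀ {X ν} → Lip X ν → ∀ z u → u ∈ U → corr X z ≤ corr X (z ∙ u) + ν
    corr-Lip {X} {ν} p z u u∈ = ≤-trans (∑-mono elems (λ x → at (X x) (X (x // z)) (X (x // (z ∙ u)))))
      (≤-trans (≤-reflexive (∑-+ elems _ _)) (+-monoʳ-≤ (corr X (z ∙ u)) (≤-trans (≤-reflexive (trans
        (#-cong {(X ⇀ z) ∖ (X ⇀ (z ∙ u))} {(X ∖ (X ⇀ u)) ⇀ z}
          (λ x → cong (λ y → X (x // z) ∧ not (X y)) (group 3 (λ x z u → x ⊘ (z ⊙ u) ≗ (x ⊘ z) ⊘ u) refl x z u)))
        (#-⇀ (X ∖ (X ⇀ u)) z))) (p .bound u u∈))))
      where
      at : ∀ a b c → 𝟙 (a ∧ b) ≤ 𝟙 (a ∧ c) + 𝟙 (b ∧ not c)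
      at false b c = z≤n
      at true false c = z≤n
      at true true true = ≤-refl
      at true true false = ≤-refl

    1≤h : 1 ≤ h
    1≤h = ∈-# {full} {ε} tt

    -- The average of `corr X` is `# X * # X / h`, and some value does not exceed the average.
    corr-small : ∀ X → ∃ λ z → h * corr X z ≤ # X * # X
    corr-small X with search (λ z → h * corr X z ≤ᵇ # X * # X)
    ... | inj₁ (z , p) = z , ≤ᵇ⇒≤ _ _ p
    ... | inj₂ none = ⊥-elim (<-irrefl refl (begin-strict
        # X * # X * h           <⟨ *-monoˡ-< h {{>-nonZero 1≤h}} (n<1+n (# X * # X)) ⟩
        suc (# X * # X) * h     ≡⟨ ∑-const (suc (# X * # X)) ⟨
        ∑ᴳ (λ _ → suc (# X * # X)) ≤⟨ ∑-mono elems (λ z → ≰⇒> (λ q → none z (≤⇒≤ᵇ q))) ⟩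
        ∑ᴳ (λ z → h * corr X z) ≡⟨ ∑-* elems h _ ⟩
        h * ∑ᴳ (corr X)         ≡⟨ cong (h *_) (∑-meet X X) ⟩
        h * (# X * # X)         ≡⟨ *-comm h _ ⟩
        # X * # X * h           ∎))
      where open ≤-Reasoning

    module Cosets {W ν} (lip : Lip W ν) {K} (sub : Subgroup K) where
      open Subgroup sub

      inCoset : Carrier → ℕ
      inCoset x = # (W ∩ (K ⇀ x))

      inCoset-step : ∀ x u → u ∈ U → inCoset (x ∙ u) ≤ inCoset x + ν
      inCoset-step x u u∈ = ≤-trans (∑-mono elems (λ y → at (W y) (W (y // u)) (K (y // (x ∙ u))) (K ((y // u) // x))
          (cong K (group 3 (λ x y u → y ⊘ (x ⊙ u) ≗ (y ⊘ u) ⊘ x) refl x y u))))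
        (≤-trans (≤-reflexive (∑-+ elems _ _)) (+-mono-≤ (≤-reflexive (#-⇀ (W ∩ (K ⇀ x)) u)) (lip .bound u u∈)))
        where
        at : ∀ a b c d → c ≡ d → 𝟙 (a ∧ c) ≤ 𝟙 (b ∧ d) + 𝟙 (a ∧ not b)
        at false b c .c refl = z≤n
        at true true c .c refl = m≤m+n _ _
        at true false c .c refl = 𝟙≤1 c

      inCoset-K : ∀ x k → k ∈ K → inCoset (x ∙ k) ≤ inCoset x
      inCoset-K x k k∈ = #-mono {W ∩ (K ⇀ (x ∙ k))} {W ∩ (K ⇀ x)} λ y p →
        ∈∩⁺ {W} {K ⇀ x} {y} (∈∩ˡ {W} {K ⇀ (x ∙ k)} {y} p)
          (subst (_∈ K) (group 3 (λ x y k → (y ⊘ (x ⊙ k)) ⊙ k ≗ y ⊘ x) refl x y k)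
            (∙∈ (∈∩ʳ {W} {K ⇀ (x ∙ k)} {y} p) k∈))

      level : ℕ → Sub
      level j x = inCoset x ≤ᵇ j * ν

      level-up : ∀ j {x} → x ∈ level j → x ∈ level (suc j)
      level-up j {x} p = ≤⇒≤ᵇ (≤-trans (≤ᵇ⇒≤ (inCoset x) (j * ν) p) (m≤n+m (j * ν) ν))

      level-K : ∀ j {x} → x ∈ level j → K ⇀ x ⊑ level j
      level-K j {x} p y q = ≤⇒≤ᵇ (≤-trans
        (subst (λ z → inCoset z ≤ inCoset x) (group 2 (λ x y → x ⊙ (y ⊘ x) ≗ y) refl x y) (inCoset-K x (y // x) q))
        (≤ᵇ⇒≤ (inCoset x) (j * ν) p))

      -- The levels are unions of cosets of `K`, starting from a coset that `W` misses. A generator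
      -- raises the count by at most `ν`, so either `level j` is closed under `U`, hence everything,
      -- or `level (suc j)` acquires a further coset.
      levels : ∀ {x₀} → inCoset x₀ ≡ 0 → ∀ j → (∀ x → x ∈ level j) ⊎ suc j * # K ≤ # (level j)
      levels {x₀} z zero = inj₂ (≤-trans (≤-reflexive (trans (+-identityʳ (# K)) (sym (#-⇀ K x₀))))
        (#-mono {K ⇀ x₀} {level 0} (level-K 0 (≤⇒≤ᵇ (≤-reflexive z)))))
      levels {x₀} z (suc j) with levels z j
      ... | inj₁ all = inj₁ (λ x → level-up j (all x))
      ... | inj₂ p with search (level (suc j) ∖ level j)
      ... | inj₁ (x , q) = inj₂ (≤-trans (+-mono-≤ (≤-reflexive (sym (#-⇀ K x))) p)
            (≤-trans (disjoint-# (K ⇀ x) (level j) apart) (#-mono {(K ⇀ x) ∪ level j} {level (suc j)} into)))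
          where
          apart : ∀ y → y ∈ K ⇀ x → ¬ (y ∈ level j)
          apart y r s = ∈∖ʳ {level (suc j)} {level j} {x} q (level-K j s x
            (subst (_∈ K) (group 2 (λ x y → inv (y ⊘ x) ≗ x ⊘ y) refl x y) (⁻¹∈ r)))
          into : (K ⇀ x) ∪ level j ⊑ level (suc j)
          into y r with ∈∪⁻ {K ⇀ x} {level j} {y} r
          ... | inj₁ s = level-K (suc j) (∈∖ˡ {level (suc j)} {level j} {x} q) y s
          ... | inj₂ s = level-up j s
      ... | inj₂ none = inj₁ λ x → level-up j (generates (level j) start closed x)
          where
          start : x₀ ∈ level j
          start = ≤⇒≤ᵇ (≤-trans (≤-reflexive z) z≤n)
          closed : ∀ x u → x ∈ level j → u ∈ U → x ∙ u ∈ level j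
          closed x u x∈ u∈ with (x ∙ u) ∈? level j
          ... | yes r = r
          ... | no r = ⊥-elim (none (x ∙ u) (∈∖⁺ {level (suc j)} {level j} {x ∙ u}
                (≤⇒≤ᵇ (≤-trans (inCoset-step x u u∈) (≤-trans (+-monoˡ-≤ ν (≤ᵇ⇒≤ (inCoset x) (j * ν) x∈)) (≤-reflexive (+-comm (j * ν) ν))))) r))

      -- If one coset were missed, then after `n` levels, at least the index of `K`, every coset
      -- would contain at most `n * ν` points of `W`, too few to add up to `# W`.
      equidistribution : ∀ n κ → h ≤ n * κ → κ ≤ # K → h * (n * ν) < # W * κ → Meets W K
      equidistribution n κ h≤ κ≤ big x with search (λ k → K k ∧ W (k ∙ x))
      ... | inj₁ (k , p) = k , ∈∩ˡ {K} {λ k → W (k ∙ x)} {k} p , ∈∩ʳ {K} {λ k → W (k ∙ x)} {k} p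
      ... | inj₂ none with levels {x} empty n
        where
        empty : inCoset x ≡ 0
        empty with 1 ≤? inCoset x
        ... | no q = n≤0⇒n≡0 (≤-pred (≰⇒> q))
        ... | yes q = let y , r = #-∈ (W ∩ (K ⇀ x)) q in
          ⊥-elim (none (y // x) (∈∩⁺ {K} {λ k → W (k ∙ x)} {y // x} (∈∩ʳ {W} {K ⇀ x} {y} r)
            (subst (_∈ W) (group 2 (λ x y → y ≗ (y ⊘ x) ⊙ x) refl x y) (∈∩ˡ {W} {K ⇀ x} {y} r))))
      ... | inj₂ p = ⊥-elim (<⇒≱ (∈-# {K} ε∈) (+-cancelʳ-≤ (n * # K) (# K) 0
            (≤-trans p (≤-trans (#≤h (level n)) (≤-trans h≤ (*-monoʳ-≤ n κ≤))))))
      ... | inj₁ all = ⊥-elim (<⇒≱ big (begin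
          # W * κ          ≤⟨ *-monoʳ-≤ (# W) κ≤ ⟩
          # W * # K        ≡⟨ ∑-meet K W ⟨
          ∑ᴳ inCoset       ≤⟨ ∑-mono elems (λ x → ≤ᵇ⇒≤ (inCoset x) (n * ν) (all x)) ⟩
          ∑ᴳ (λ _ → n * ν) ≡⟨ ∑-const (n * ν) ⟩
          n * ν * h        ≡⟨ *-comm (n * ν) h ⟩
          h * (n * ν)      ∎))
        where open ≤-Reasoning

    module LipGrowth {τ θ κ n : ℕ} (1≤τ : 1 ≤ τ) (τ<θ : 2 * (h * τ) < θ * θ) (κ≤θ : 2 * κ ≤ θ) (h≤ : h ≤ n * κ) where

      -- The form of the growth bound used from here on: it applies to every set assembled from a
      -- few translates of a Lipschitz set.
      Lip-growth : ∀ {W ν} → Lip W ν → h * (n * ν) < # W * κ →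
        ∀ Z → τ ≤ # Z → τ + # (Z ⊕ W) ≤ h → # Z + # W ≤ # (Z ⊕ W) + θ
      Lip-growth {W} {ν} lip big Z τ≤ room =
        let w , w∈ = #-∈ W nonempty in
        Fragments.growth W τ w∈ 1≤τ τ<θ κ≤θ
          (λ K sub κ≤ → Cosets.equidistribution lip sub n κ h≤ κ≤ big) Z (τ≤ , room)
        where
        positive : ∀ {a} b {c} → a < b * c → 1 ≤ b
        positive (suc b) _ = s≤s z≤n
        nonempty : 1 ≤ # W
        nonempty = positive (# W) big

  -- Shrinking a critical set by intersecting it with translates of itself

  module Shrinking (𝔾 : FinAb) (U : FinAb.Carrier 𝔾 → Bool)
    (generates : ∀ (S : FinAb.Carrier 𝔾 → Bool) {x} → T (S x) →
       (∀ x u → T (S x) → T (U u) → T (S (FinAb._∙_ 𝔾 x u))) → ∀ y → T (S y)) where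
    open Counting 𝔾
    open Lipschitz 𝔾 U generates

    corr-ε : ∀ X → corr X ε ≡ # X
    corr-ε X = #-cong {X ∩ (X ⇀ ε)} {X} λ x →
      trans (cong (λ y → X x ∧ X y) (group 1 (λ x → x ⊘ one ≗ x) refl x)) (idem (X x))
      where
      idem : ∀ b → b ∧ b ≡ b
      idem true = refl
      idem false = refl

    submodular-corr : ∀ X z A → # (A ⊕ (X ∩ (X ⇀ z))) + # (A ⊕ (X ∪ (X ⇀ z))) ≤ # (A ⊕ X) + # (A ⊕ X)
    submodular-corr X z A = begin
      # (A ⊕ (X ∩ (X ⇀ z))) + # (A ⊕ (X ∪ (X ⇀ z))) ≡⟨ cong₂ _+_ (#-comm A (X ∩ (X ⇀ z))) (#-comm A (X ∪ (X ⇀ z))) ⟩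
      # ((X ∩ (X ⇀ z)) ⊕ A) + # ((X ∪ (X ⇀ z)) ⊕ A) ≤⟨ submodular X (X ⇀ z) A ⟩
      # (X ⊕ A) + # ((X ⇀ z) ⊕ A) ≡⟨ cong₂ _+_ (#-comm X A) (trans (#-⇀-⊕ X A z) (#-comm X A)) ⟩
      # (A ⊕ X) + # (A ⊕ X) ∎
      where open ≤-Reasoning

    corr-∪ : ∀ X z → # (X ∪ (X ⇀ z)) + corr X z ≡ # X + # X
    corr-∪ X z = trans (#-∪∩ X (X ⇀ z)) (cong (# X +_) (#-⇀ X z))

    -- The excess of `A ⊕ X` is recorded as `D - θ`. With this shift the loss `θ` in the growth
    -- bound is absorbed, and a shrinking step exactly doubles `D`.
    record Critical (A : Sub) (θ R : ℕ) (X : Sub) (ν D : ℕ) : Set where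
      field
        lip  : Lip X ν
        crit : # (A ⊕ X) + θ ≤ # A + # X + D
        free : R + # (A ⊕ X) ≤ h

    module _ {τ θ κ n : ℕ} (1≤τ : 1 ≤ τ) (τ<θ : 2 * (h * τ) < θ * θ) (κ≤θ : 2 * κ ≤ θ) (h≤ : h ≤ n * κ)
             (A : Sub) (τ≤A : τ ≤ # A) {R w v xlo xhi ν′ D′ : ℕ}
             (room : w + D′ + τ ≤ R) (w-small : h * w ≤ xhi * R) (xlo≤ : xlo + w ≤ xhi) (v+ν′ : v + ν′ ≤ w)
             (large : h * (n * ν′) < xlo * κ) where
      open LipGrowth {τ} {θ} {κ} {n} 1≤τ τ<θ κ≤θ h≤

      -- The correlation is `# X` at `ε` and somewhere below `L = # X - w`, so by the intermediate
      -- value lemma it falls into `[L, L + ν)` at some `z`. Criticality passes to `I`: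
      -- submodularity bounds `A ⊕ I` by twice `A ⊕ X` less `A ⊕ V`, and the growth bound makes
      -- `A ⊕ V` large.
      shrink-step : ∀ X {ν D} → Critical A θ R X ν D → ν + ν ≤ ν′ → D ≤ D′ → xhi < # X →
        ∃ λ I → Critical A θ R I (ν + ν) (D + D) × xlo ≤ # I × # I + v ≤ # X
      shrink-step X {ν} {D} C ν≤ D≤ xhi< = I , record { lip = lipI ; crit = critI ; free = freeI } , xlo≤I , decrease
        where
        open Critical C
        x : ℕ
        x = # X
        1≤R : 1 ≤ R
        1≤R = lin 4 (λ w D t R → (con 1 ≼ t) ⟨ 1 ⟩⇒ (w ⊞ D ⊞ t ≼ R) ⟨ 1 ⟩⇒ 1 ⊢ con 1 ≼ R) w (D′) (τ) R 1≤τ room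
        x+R≤h : x + R ≤ h
        x+R≤h = let a , a∈ = #-∈ A (≤-trans 1≤τ τ≤A) in
          lin 4 (λ x R s h → (R ⊞ s ≼ h) ⟨ 1 ⟩⇒ (x ≼ s) ⟨ 1 ⟩⇒ 1 ⊢ x ⊞ R ≼ h) x R (# (A ⊕ X)) h free
            (≤-trans (#≤⊕ X A a∈) (≤-reflexive (#-comm X A)))
        w≤x : w ≤ x
        w≤x = lin 4 (λ l w g x → (l ⊞ w ≼ g) ⟨ 1 ⟩⇒ (con 1 ⊞ g ≼ x) ⟨ 1 ⟩⇒ 1 ⊢ w ≼ x) (xlo) w (xhi) x xlo≤ xhi<
        L : ℕ
        L = x ∸ w
        L+w : L + w ≡ x
        L+w = m∸n+n≡m w≤x
        -- The smallest correlation is at most `x * x / h`, and `x + R ≤ h` keeps this below `x` by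
        -- more than `w`.
        low : ∀ {z₁} → h * corr X z₁ ≤ x * x → corr X z₁ < L
        low {z₁} p with corr X z₁ <? L
        ... | yes q = q
        ... | no q = ⊥-elim (<-irrefl refl (begin-strict
            h * x               ≡⟨ cong (h *_) L+w ⟨
            h * (L + w)         ≡⟨ *-distribˡ-+ h L w ⟩
            h * L + h * w       ≤⟨ +-mono-≤ (≤-trans (*-monoʳ-≤ h (≮⇒≥ q)) p) w-small ⟩
            x * x + xhi * R     <⟨ +-monoʳ-< (x * x) (*-monoˡ-< R {{>-nonZero 1≤R}} xhi<) ⟩
            x * x + x * R       ≡⟨ *-distribˡ-+ x x R ⟨
            x * (x + R)         ≤⟨ *-monoʳ-≤ x x+R≤h ⟩
            x * h               ≡⟨ *-comm x h ⟩
            h * x               ∎))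
          where open ≤-Reasoning
        found : ∃ λ z → L ≤ corr X z × corr X z < L + ν
        found = let z₁ , p = corr-small X in
          intermediate (corr X) ν L (corr-Lip lip) {ε} {z₁}
            (≤-trans (m∸n≤m x w) (≤-reflexive (sym (corr-ε X)))) (low p)
        z : Carrier
        z = proj₁ found
        I V : Sub
        I = X ∩ (X ⇀ z)
        V = X ∪ (X ⇀ z)
        lipI : Lip I (ν + ν)
        lipI = Lip-∩ lip (Lip-⇀ z lip)
        xlo≤I : xlo ≤ # I
        xlo≤I = lin 6 (λ l w g x L i → (l ⊞ w ≼ g) ⟨ 1 ⟩⇒ (con 1 ⊞ g ≼ x) ⟨ 1 ⟩⇒ (L ⊞ w ≑ x) ⟨ 1 ⟩⇒ (L ≼ i) ⟨ 1 ⟩⇒ 1 ⊢ l ≼ i) (xlo) w (xhi) x L (# I)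
          xlo≤ xhi< L+w (proj₁ (proj₂ found))
        decrease : # I + v ≤ # X
        decrease = lin 7 (λ v m w L x i ν → (v ⊞ m ≼ w) ⟨ 2 ⟩⇒ (L ⊞ w ≐ x) ⟨ 2 ⟩⇒ (con 1 ⊞ i ≼ L ⊞ ν) ⟨ 2 ⟩⇒ (ν ⊞ ν ≼ m) ⟨ 1 ⟩⇒ 2
            ⊢ i ⊞ v ≼ x) v (ν′) w L x (# I) ν
          v+ν′ L+w (proj₂ (proj₂ found)) ν≤
        enough : ∀ {y} → xlo ≤ y → h * (n * (ν + ν)) < y * κ
        enough p = ≤-<-trans (*-monoʳ-≤ h (*-monoʳ-≤ n ν≤)) (<-≤-trans large (*-monoˡ-≤ κ p))
        freeI : R + # (A ⊕ I) ≤ h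
        freeI = ≤-trans (+-monoʳ-≤ R (#-mono {A ⊕ I} {A ⊕ X}
          (⊕-mono {A} {A} {I} {X} (λ _ p → p) (λ _ → ∈∩ˡ {X} {X ⇀ z})))) free
        growI : # A + # I ≤ # (A ⊕ I) + θ
        growI = Lip-growth lipI (enough xlo≤I) A τ≤A
          (lin 6 (λ t s R h w D → (R ⊞ s ≼ h) ⟨ 1 ⟩⇒ (w ⊞ D ⊞ t ≼ R) ⟨ 1 ⟩⇒ 1 ⊢ t ⊞ s ≼ h) (τ) (# (A ⊕ I)) R h w (D′) freeI room)
        -- `A ⊕ V` exceeds `A ⊕ X` by at most `(# X - # I) + D`, hence by at most `w + D′`, which
        -- the reserve `R` covers.
        roomV : τ + # (A ⊕ V) ≤ h
        roomV = lin 14 (λ t sV sI s a i x θ D E R h w L → (sI ⊞ sV ≼ s ⊞ s) ⟨ 1 ⟩⇒ (a ⊞ i ≼ sI ⊞ θ) ⟨ 1 ⟩⇒ (s ⊞ θ ≼ a ⊞ x ⊞ D) ⟨ 1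
            ⟩⇒ (D ≼ E) ⟨ 1 ⟩⇒ (L ⊞ w ≑ x) ⟨ 1 ⟩⇒ (L ≼ i) ⟨ 1 ⟩⇒ (R ⊞ s ≼ h) ⟨ 1 ⟩⇒ (w ⊞ E ⊞ t ≼ R) ⟨ 1 ⟩⇒ 1 ⊢ t ⊞ sV ≼ h) (τ)
            (# (A ⊕ V)) (# (A ⊕ I)) (# (A ⊕ X)) (# A) (# I) x θ D (D′) R h w L
          (submodular-corr X z A) growI crit D≤ L+w (proj₁ (proj₂ found)) free room
        growV : # A + # V ≤ # (A ⊕ V) + θ
        growV = Lip-growth (Lip-∪ lip (Lip-⇀ z lip))
          (enough (≤-trans xlo≤I (#-mono {I} {V} (λ y p → ∈∪ˡ {X} {X ⇀ z} (∈∩ˡ {X} {X ⇀ z} p))))) A τ≤A roomV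
        critI : # (A ⊕ I) + θ ≤ # A + # I + (D + D)
        critI = lin 9 (λ sV sI s a i v x θ D → (sI ⊞ sV ≼ s ⊞ s) ⟨ 1 ⟩⇒ (a ⊞ v ≼ sV ⊞ θ) ⟨ 1 ⟩⇒ (s ⊞ θ ≼ a ⊞ x ⊞ D) ⟨ 2 ⟩⇒
            (v ⊞ i ≑ x ⊞ x) ⟨ 1 ⟩⇒ 1 ⊢ sI ⊞ θ ≼ a ⊞ i ⊞ (D ⊞ D)) (# (A ⊕ V)) (# (A ⊕ I)) (# (A ⊕ X)) (# A) (# I) (# V) x θ D
          (submodular-corr X z A) growV crit (corr-∪ X z)

      -- Each step removes at least `v` points and doubles `ν` and `D`. The number `m` bounds the
      -- steps still to be made, whence the factor `2 ^ m`.
      shrink : ∀ m X {ν D} → Critical A θ R X ν D → 2 ^ m * ν ≤ ν′ → 2 ^ m * D ≤ D′ → xlo ≤ # X → # X ≤ xhi + m * v →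
        ∃ λ Y → Critical A θ R Y ν′ D′ × xlo ≤ # Y × # Y ≤ xhi
      shrink m X {ν} {D} C p q lo hi with # X ≤? xhi
      ... | yes r = X , record
            { lip = lipschitz λ u u∈ → ≤-trans (Lip.bound (Critical.lip C) u u∈) (≤-trans (once-more ν) p)
            ; crit = ≤-trans (Critical.crit C) (+-monoʳ-≤ (# A + # X) (≤-trans (once-more D) q))
            ; free = Critical.free C } , lo , r
        where
        once-more : ∀ k → k ≤ 2 ^ m * k
        once-more k = ≤-trans (≤-reflexive (sym (*-identityˡ k))) (*-monoˡ-≤ k (m^n>0 2 m))
      shrink zero X C p q lo hi | no r = ⊥-elim (r (≤-trans hi (≤-reflexive (+-identityʳ xhi))))
      shrink (suc m) X {ν} {D} C p q lo hi | no r =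
        let I , C′ , lo′ , dec = shrink-step X C (double≤ p) (≤-trans (m≤m+n D D) (double≤ q)) (≰⇒> r) in
        shrink m I C′ (≤-trans (≤-reflexive (half ν)) p) (≤-trans (≤-reflexive (half D)) q) lo′
          (lin 5 (λ i v x g mv → (i ⊞ v ≼ x) ⟨ 1 ⟩⇒ (x ≼ g ⊞ (v ⊞ mv)) ⟨ 1 ⟩⇒ 1 ⊢ i ≼ g ⊞ mv) (# I) v (# X) (xhi) (m * v) dec hi)
        where
        half : ∀ k → 2 ^ m * (k + k) ≡ 2 ^ suc m * k
        half k = trans (cong (2 ^ m *_) (cong (k +_) (sym (+-identityʳ k))))
          (trans (sym (*-assoc (2 ^ m) 2 k)) (cong (_* k) (*-comm (2 ^ m) 2)))
        double≤ : ∀ {k l} → 2 ^ suc m * k ≤ l → k + k ≤ l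
        double≤ {k} r = ≤-trans (≤-trans (≤-reflexive (sym (*-identityˡ (k + k)))) (*-monoˡ-≤ (k + k) (m^n>0 2 m)))
          (≤-trans (≤-reflexive (half k)) r)

  -- A small set that adds like an interval

  module Doubling (𝔾 : FinAb) (U : FinAb.Carrier 𝔾 → Bool)
    (generates : ∀ (S : FinAb.Carrier 𝔾 → Bool) {x} → T (S x) →
       (∀ x u → T (S x) → T (U u) → T (S (FinAb._∙_ 𝔾 x u))) → ∀ y → T (S y)) where
    open Counting 𝔾
    open Lipschitz 𝔾 U generates
    open Shrinking 𝔾 U generates

    corr-⇀ : ∀ X t g → corr (X ⇀ t) g ≡ corr X g
    corr-⇀ X t g = trans (#-cong {(X ⇀ t) ∩ ((X ⇀ t) ⇀ g)} {(X ∩ (X ⇀ g)) ⇀ t}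
        (λ x → cong (λ y → X (x // t) ∧ X y) (group 3 (λ x t g → (x ⊘ g) ⊘ t ≗ (x ⊘ t) ⊘ g) refl x t g)))
      (#-⇀ (X ∩ (X ⇀ g)) t)

    ⊕-⇀ʳ : ∀ A X t → # (A ⊕ (X ⇀ t)) ≡ # (A ⊕ X)
    ⊕-⇀ʳ A X t = trans (#-comm A (X ⇀ t)) (trans (#-⇀-⊕ X A t) (#-comm X A))

    ε∈⇀ : ∀ {X} g → ε ∈ X → g ∈ X ⇀ g
    ε∈⇀ {X} g p = subst (_∈ X) (group 1 (λ g → one ≗ g ⊘ g) refl g) p

    -- The model is the interval `X = [0, g]`: `X` and `X + g` hardly overlap, and `X + y` is
    -- covered by these two for each `y ∈ X`.
    record Segment (A : Sub) (s D R ν : ℕ) : Set where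
      field
        X     : Sub
        g     : Carrier
        ε∈X   : ε ∈ X
        g∈X   : g ∈ X
        lip   : Lip X ν
        crit  : # (A ⊕ X) ≤ # A + # X + D
        free  : R + # (A ⊕ X) ≤ h
        apart : corr X g ≤ s
        close : ∀ y → y ∈ X → # ((X ⇀ y) ∖ (X ∪ (X ⇀ g))) ≤ s

    module _ {τ θ κ n : ℕ} (1≤τ : 1 ≤ τ) (τ<θ : 2 * (h * τ) < θ * θ) (κ≤θ : 2 * κ ≤ θ) (h≤ : h ≤ n * κ)
             (A : Sub) {ν D R xlo : ℕ} (large : h * (n * (3 * ν)) < xlo * κ) where
      open LipGrowth {τ} {θ} {κ} {n} 1≤τ τ<θ κ≤θ h≤

      module _ (X : Sub) (g : Carrier) (ε∈X : ε ∈ X) (g∈X : g ∈ X) (lip : Lip X ν)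
               (crit : # (A ⊕ X) + θ ≤ # A + # X + D) (free : R + # (A ⊕ X) ≤ h) (xlo≤ : xlo ≤ # X)
               (roomR : 2 * # X + 2 * D + τ ≤ R) (roomA : # X + D + τ ≤ # A) where

        private
          V W AA : Sub
          V = X ∪ (X ⇀ g)
          W = A ∩ (A ⇀ g)
          AA = A ∪ (A ⇀ g)
          s x a f : ℕ
          s = # (A ⊕ X)
          x = # X
          a = # A
          f = corr X g

          enough : ∀ {y m} → m ≤ 3 * ν → xlo ≤ y → h * (n * m) < y * κ
          enough p q = ≤-<-trans (*-monoʳ-≤ h (*-monoʳ-≤ n p)) (<-≤-trans large (*-monoˡ-≤ κ q))

          τ≤A : τ ≤ a
          τ≤A = lin 4 (λ t x D a → (x ⊞ D ⊞ t ≼ a) ⟨ 1 ⟩⇒ 1 ⊢ t ≼ a) (τ) x D a roomA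

          X⊑V : X ⊑ V
          X⊑V _ = ∈∪ˡ {X} {X ⇀ g}

          AX⊑AV : A ⊕ X ⊑ A ⊕ V
          AX⊑AV = ⊕-mono {A} {A} {X} {V} (λ _ p → p) X⊑V

          -- `A ⇀ g` lies in both `A ⊕ X` and `A ⊕ (X ⇀ g)`, because `g` and `ε` belong to `X`, and
          -- is therefore counted twice.
          AV-upper : # (A ⊕ V) + a ≤ s + s
          AV-upper = begin
            # (A ⊕ V) + a ≤⟨ +-mono-≤ (#-mono {A ⊕ V} {S ∪ S′} union) (≤-trans (≤-reflexive (sym (#-⇀ A g))) (#-mono {A ⇀ g} {S ∩ S′} inter)) ⟩
            # (S ∪ S′) + # (S ∩ S′) ≡⟨ #-∪∩ S S′ ⟩
            # S + # S′ ≡⟨ cong (# S +_) (⊕-⇀ʳ A X g) ⟩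
            s + s ∎
            where
            open ≤-Reasoning
            S S′ : Sub
            S = A ⊕ X
            S′ = A ⊕ (X ⇀ g)
            union : A ⊕ V ⊑ S ∪ S′
            union z p = ∈∪-elim (X ⊕ A) ((X ⇀ g) ⊕ A) (⊕-∪ X (X ⇀ g) A z (⊕-comm A V z p))
              (λ r → ∈∪ˡ {S} {S′} (⊕-comm X A z r))
              (λ r → ∈∪ʳ {S} {S′} (⊕-comm (X ⇀ g) A z r))
            inter : A ⇀ g ⊑ S ∩ S′
            inter z p = ∈∩⁺ {S} {S′} (translate-⊑ A X g∈X z p) (translate-⊑ A (X ⇀ g) (ε∈⇀ {X} g ε∈X) z p)

          growV : a + # V ≤ # (A ⊕ V) + θ
          growV = Lip-growth (Lip-∪ lip (Lip-⇀ g lip))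
            (enough (lin 1 (λ ν → 1 ⊢ ν ⊞ ν ≼ 3 ⊠ ν) ν) (≤-trans xlo≤ (#-mono {X} {V} X⊑V))) A τ≤A
            (lin 9 (λ t av a s x D R θ h → (av ⊞ a ≼ s ⊞ s) ⟨ 1 ⟩⇒ (s ⊞ θ ≼ a ⊞ x ⊞ D) ⟨ 1 ⟩⇒ (R ⊞ s ≼ h) ⟨ 1 ⟩⇒
                (2 ⊠ x ⊞ 2 ⊠ D ⊞ t ≼ R) ⟨ 1 ⟩⇒ 1 ⊢ t ⊞ av ≼ h) (τ) (# (A ⊕ V)) a s x D R θ h
              AV-upper crit free roomR)

          AA⊑ : AA ⊑ A ⊕ X
          AA⊑ z p = ∈∪-elim (A) (A ⇀ g) p
              (λ q → subst (_∈ A ⊕ X) (identityʳ z) (⊕⁺ {A} {X} q ε∈X))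
              (λ q → translate-⊑ A X g∈X z q)

          AA+W : # AA + # W ≡ a + a
          AA+W = corr-∪ A g

          τ≤W : τ ≤ # W
          τ≤W = lin 8 (λ t w b a s x D θ → (b ≼ s) ⟨ 1 ⟩⇒ (b ⊞ w ≑ a ⊞ a) ⟨ 1 ⟩⇒ (s ⊞ θ ≼ a ⊞ x ⊞ D) ⟨ 1 ⟩⇒ (x ⊞ D ⊞ t ≼ a) ⟨ 1 ⟩⇒
              1 ⊢ t ≼ w) (τ) (# W) (# AA) a s x D θ
            (#-mono {AA} {A ⊕ X} AA⊑) AA+W crit roomA

          growW : # W + x ≤ # (W ⊕ X) + θ
          growW = Lip-growth lip (enough (lin 1 (λ ν → 1 ⊢ ν ≼ 3 ⊠ ν) ν) xlo≤) W τ≤W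
            (lin 7 (λ t wx s x D R h → (wx ≼ s) ⟨ 1 ⟩⇒ (R ⊞ s ≼ h) ⟨ 1 ⟩⇒ (2 ⊠ x ⊞ 2 ⊠ D ⊞ t ≼ R) ⟨ 1 ⟩⇒ 1 ⊢ t ⊞ wx ≼ h) (τ) (# (W ⊕ X)) s x D R h
              (#-mono {W ⊕ X} {A ⊕ X} (⊕-mono {W} {A} {X} {X} (λ _ → ∈∩ˡ {A} {A ⇀ g}) (λ _ p → p))) free roomR)

          AV⊑ : A ⊕ V ⊑ X ⊕ AA
          AV⊑ z p = let y , v , y∈ , v∈ , eq = ⊕⁻ {A} {V} p in
            subst (_∈ X ⊕ AA) (sym eq) (∈∪-elim (X) (X ⇀ g) v∈
              (λ q → subst (_∈ X ⊕ AA) (comm v y) (⊕⁺ {X} {AA} q (∈∪ˡ {A} {A ⇀ g} y∈)))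
              (λ q → subst (_∈ X ⊕ AA) (group 3 (λ v y g → (v ⊘ g) ⊙ (y ⊙ g) ≗ y ⊙ v) refl v y g)
                                  (⊕⁺ {X} {AA} q (∈∪ʳ {A} {A ⇀ g} (⇀⁺ {A} g y∈)))))

          -- `A ⊕ V` is contained in `X ⊕ AA`, which makes the latter large. Submodularity for `A`
          -- and `A ⇀ g` then bounds `X ⊕ W` from above, and the growth bound turns this into a
          -- bound on `W`.
          W-upper : # W + x ≤ a + 2 * D + f
          W-upper = lin 13 (λ w wx wx′ aa av s s′ x a D f θ v → (wx ⊞ aa ≼ s′ ⊞ s′) ⟨ 1 ⟩⇒ (s′ ≐ s) ⟨ 2 ⟩⇒ (wx′ ≐ wx) ⟨ 1 ⟩⇒
              (av ≼ aa) ⟨ 1 ⟩⇒ (a ⊞ v ≼ av ⊞ θ) ⟨ 1 ⟩⇒ (w ⊞ x ≼ wx′ ⊞ θ) ⟨ 1 ⟩⇒ (v ⊞ f ≑ x ⊞ x) ⟨ 1 ⟩⇒ (s ⊞ θ ≼ a ⊞ x ⊞ D) ⟨ 2 ⟩⇒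
              1 ⊢ w ⊞ x ≼ a ⊞ 2 ⊠ D ⊞ f) (# W) (# (X ⊕ W)) (# (W ⊕ X)) (# (X ⊕ AA)) (# (A ⊕ V)) s (# (X ⊕ A)) x a D f θ (# V)
            (submodular-corr A g X) (#-comm X A) (#-comm W X) (#-mono {A ⊕ V} {X ⊕ AA} AV⊑) growV growW (corr-∪ X g) crit

        -- Adjoining `Y` to `V` enlarges the sumset with `A` by at most `s - # AA`, since `AA ⇀ y`
        -- lies in both `A ⊕ V` and `A ⊕ Y`. By `W-upper` this difference is at most `3 * D + f`, so
        -- the growth bound for `V₃` leaves little of `Y` outside `V`.
        doubling : ∀ y → y ∈ X → # ((X ⇀ y) ∖ (X ∪ (X ⇀ g))) ≤ 2 * f + 5 * D
        doubling y y∈ =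
          lin 13 (λ b v v3 av3 av aa w a s x D f θ → (v ⊞ b ≼ v3) ⟨ 1 ⟩⇒ (a ⊞ v3 ≼ av3 ⊞ θ) ⟨ 1 ⟩⇒ (av3 ⊞ aa ≼ av ⊞ s) ⟨ 1 ⟩⇒
              (aa ⊞ w ≑ a ⊞ a) ⟨ 1 ⟩⇒ (av ⊞ a ≼ s ⊞ s) ⟨ 1 ⟩⇒ (w ⊞ x ≼ a ⊞ 2 ⊠ D ⊞ f) ⟨ 1 ⟩⇒ (s ⊞ θ ≼ a ⊞ x ⊞ D) ⟨ 3 ⟩⇒
              (v ⊞ f ≑ x ⊞ x) ⟨ 1 ⟩⇒ 1 ⊢ b ≼ 2 ⊠ f ⊞ 5 ⊠ D) (# (Y ∖ V)) (# V) (# V₃) (# (A ⊕ V₃)) (# (A ⊕ V)) (# AA) (# W) a s x D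
              f θ
            (≤-trans (disjoint-# V (Y ∖ V) (λ z p q → ∈∖ʳ {Y} {V} q p)) (#-mono {V ∪ (Y ∖ V)} {V₃} into))
            growV₃ AV₃-upper AA+W AV-upper W-upper crit (corr-∪ X g)
          where
          Y V₃ S S′ : Sub
          Y = X ⇀ y
          V₃ = V ∪ Y
          S = A ⊕ V
          S′ = A ⊕ Y
          into : V ∪ (Y ∖ V) ⊑ V₃
          into z p = ∈∪-elim (V) (Y ∖ V) p
              (λ q → ∈∪ˡ {V} {Y} q)
              (λ q → ∈∪ʳ {V} {Y} (∈∖ˡ {Y} {V} q))
          union : A ⊕ V₃ ⊑ S ∪ S′
          union z p = ∈∪-elim (V ⊕ A) (Y ⊕ A) (⊕-∪ V Y A z (⊕-comm A V₃ z p))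
              (λ r → ∈∪ˡ {S} {S′} (⊕-comm V A z r))
              (λ r → ∈∪ʳ {S} {S′} (⊕-comm Y A z r))
          inter : AA ⇀ y ⊑ S ∩ S′
          inter z p = ∈∪-elim (A) (A ⇀ g) {z // y} p
              (λ q → ∈∩⁺ {S} {S′} (AX⊑AV z (translate-⊑ A X y∈ z q)) (translate-⊑ A Y (ε∈⇀ {X} y ε∈X) z q))
              (λ q → subst (_∈ S ∩ S′) (group 3 (λ z y g → ((z ⊘ y) ⊘ g) ⊙ (g ⊙ y) ≗ z) refl z y g)
                             (∈∩⁺ {S} {S′} (⊕⁺ {A} {V} q (∈∪ʳ {X} {X ⇀ g} (subst (_∈ X) (group 2 (λ y g → y ≗ (g ⊙ y) ⊘ g) refl y g) y∈)))
                                           (⊕⁺ {A} {Y} q (⇀⁺ {X} y g∈X))))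
          AV₃-upper : # (A ⊕ V₃) + # AA ≤ # (A ⊕ V) + s
          AV₃-upper = begin
            # (A ⊕ V₃) + # AA ≤⟨ +-mono-≤ (#-mono {A ⊕ V₃} {S ∪ S′} union) (≤-trans (≤-reflexive (sym (#-⇀ AA y))) (#-mono {AA ⇀ y} {S ∩ S′} inter)) ⟩
            # (S ∪ S′) + # (S ∩ S′) ≡⟨ #-∪∩ S S′ ⟩
            # S + # S′ ≡⟨ cong (# S +_) (⊕-⇀ʳ A X y) ⟩
            # S + s ∎
            where open ≤-Reasoning
          growV₃ : a + # V₃ ≤ # (A ⊕ V₃) + θ
          growV₃ = Lip-growth (Lip-∪ (Lip-∪ lip (Lip-⇀ g lip)) (Lip-⇀ y lip))
            (enough (lin 1 (λ ν → 1 ⊢ ν ⊞ ν ⊞ ν ≼ 3 ⊠ ν) ν)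
              (≤-trans xlo≤ (#-mono {X} {V₃} λ z p → ∈∪ˡ {V} {Y} (X⊑V z p)))) A τ≤A
            (lin 12 (λ t av3 av aa w a s x D R θ h → (av3 ⊞ aa ≼ av ⊞ s) ⟨ 1 ⟩⇒ (av ⊞ a ≼ s ⊞ s) ⟨ 1 ⟩⇒ (aa ⊞ w ≑ a ⊞ a) ⟨ 1 ⟩⇒
                (w ≼ a) ⟨ 1 ⟩⇒ (s ⊞ θ ≼ a ⊞ x ⊞ D) ⟨ 2 ⟩⇒ (R ⊞ s ≼ h) ⟨ 1 ⟩⇒ (2 ⊠ x ⊞ 2 ⊠ D ⊞ t ≼ R) ⟨ 1 ⟩⇒ 1 ⊢ t ⊞ av3 ≼ h) (τ)
                (# (A ⊕ V₃)) (# (A ⊕ V)) (# AA) (# W) a s x D R θ h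
              AV₃-upper AV-upper AA+W (#-mono {W} {A} (λ _ → ∈∩ˡ {A} {A ⇀ g})) crit free roomR)

      -- The correlation at `g` has to be small for `X` and `X ⇀ g` to be apart, yet positive so
      -- that some translate of `X` contains both `ε` and `g`.
      segment : ∀ X {s₁ s} → Lip X ν → # (A ⊕ X) + θ ≤ # A + # X + D → R + # (A ⊕ X) ≤ h → xlo ≤ # X →
        2 * # X + 2 * D + τ ≤ R → # X + D + τ ≤ # A →
        1 ≤ s₁ → s₁ ≤ # X → # X * # X < h * s₁ → 2 * (s₁ + ν) + 5 * D ≤ s →
        Σ (Segment A s D R ν) λ S → # (Segment.X S) ≡ # X
      segment X {s₁} {s} lip crit free lo roomR roomA 1≤s s≤ small s-big = record
        { X = X′ ; g = g ; ε∈X = ε∈X′ ; g∈X = g∈X′ ; lip = Lip-⇀ t lip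
        ; crit = ≤-trans (m≤m+n _ θ) crit′ ; free = free′
        ; apart = lin 6 (λ c c′ a ν D s → (c ≐ c′) ⟨ 2 ⟩⇒ (con 1 ⊞ c′ ≼ a ⊞ ν) ⟨ 2 ⟩⇒ (2 ⊠ (a ⊞ ν) ⊞ 5 ⊠ D ≼ s) ⟨ 1 ⟩⇒ 2 ⊢ c ≼ s)
            (corr X′ g) (corr X g) (s₁) ν D s
                    (corr-⇀ X t g) (proj₂ (proj₂ found)) s-big
        ; close = λ y y∈ → lin 7 (λ b c c′ a ν D s → (b ≼ 2 ⊠ c ⊞ 5 ⊠ D) ⟨ 1 ⟩⇒ (c ≐ c′) ⟨ 2 ⟩⇒ (con 1 ⊞ c′ ≼ a ⊞ ν) ⟨ 2 ⟩⇒
            (2 ⊠ (a ⊞ ν) ⊞ 5 ⊠ D ≼ s) ⟨ 1 ⟩⇒ 1 ⊢ b ≼ s) (# ((X′ ⇀ y) ∖ (X′ ∪ (X′ ⇀ g)))) (corr X′ g) (corr X g) (s₁) ν D s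
                    (doubling X′ g ε∈X′ g∈X′ (Lip-⇀ t lip) crit′ free′ lo′ roomR′ roomA′ y y∈) (corr-⇀ X t g) (proj₂ (proj₂ found)) s-big
        } , #X′
        where
        found : ∃ λ z → s₁ ≤ corr X z × corr X z < s₁ + ν
        found = let z₁ , p = corr-small X in
          intermediate (corr X) ν s₁ (corr-Lip lip) {ε} {z₁} (≤-trans s≤ (≤-reflexive (sym (corr-ε X))))
            (*-cancelˡ-< h _ _ (≤-<-trans p small))
        g : Carrier
        g = proj₁ found
        meet : ∃ λ p → p ∈ X ∩ (X ⇀ g)
        meet = #-∈ (X ∩ (X ⇀ g)) (≤-trans 1≤s (proj₁ (proj₂ found)))
        -- Translation by `t` sends `p // g` to `ε` and `p` to `g`.
        p t : Carrier
        p = proj₁ meet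
        t = (p // g) ⁻¹
        X′ : Sub
        X′ = X ⇀ t
        ε∈X′ : ε ∈ X′
        ε∈X′ = subst (_∈ X) (group 2 (λ p g → p ⊘ g ≗ one ⊘ inv (p ⊘ g)) refl p g) (∈∩ʳ {X} {X ⇀ g} (proj₂ meet))
        g∈X′ : g ∈ X′
        g∈X′ = subst (_∈ X) (group 2 (λ p g → p ≗ g ⊘ inv (p ⊘ g)) refl p g) (∈∩ˡ {X} {X ⇀ g} (proj₂ meet))
        #X′ : # X′ ≡ # X
        #X′ = #-⇀ X t
        #AX′ : # (A ⊕ X′) ≡ # (A ⊕ X)
        #AX′ = ⊕-⇀ʳ A X t
        crit′ : # (A ⊕ X′) + θ ≤ # A + # X′ + D
        crit′ = lin 7 (λ q r y x a θ D → (q ≐ r) ⟨ 1 ⟩⇒ (y ≑ x) ⟨ 1 ⟩⇒ (r ⊞ θ ≼ a ⊞ x ⊞ D) ⟨ 1 ⟩⇒ 1 ⊢ q ⊞ θ ≼ a ⊞ y ⊞ D)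
            (# (A ⊕ X′)) (# (A ⊕ X)) (# X′) (# X) (# A) θ D
          #AX′ #X′ crit
        free′ : R + # (A ⊕ X′) ≤ h
        free′ = subst (λ k → R + k ≤ h) (sym #AX′) free
        lo′ : xlo ≤ # X′
        lo′ = subst (xlo ≤_) (sym #X′) lo
        roomR′ : 2 * # X′ + 2 * D + τ ≤ R
        roomR′ = subst (λ k → 2 * k + 2 * D + τ ≤ R) (sym #X′) roomR
        roomA′ : # X′ + D + τ ≤ # A
        roomA′ = subst (λ k → k + D + τ ≤ # A) (sym #X′) roomA

  -- Tiling a group by translates of a small set

  -- `k` lies between 3 below and 6 above a multiple of `n`; the shift by 3 avoids negative numbers.
  Zone : ℕ → ℕ → Set
  Zone n k = ∃ λ v → ∃ λ r → r ≤ 9 × k + 3 ≡ v * n + r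

  -- a ≡ c modulo n up to an error between −9 and 9.
  Offset : ℕ → ℕ → ℕ → Set
  Offset n a c = ∃ λ u → ∃ λ v → ∃ λ e → e ≤ 18 × a + 9 + u * n ≡ c + e + v * n

  -- The errors are `i - b` in `[0, 4]`, `l - c` in `[1, 3]` and that of `k` in `[-3, 6]`; with
  -- either sign of `k` their combination stays within 9.
  offset : ∀ {n b c i l k} → b ≤ i → i ≤ b + 4 → c + 1 ≤ l → l ≤ c + 3 → Zone n k → i ≡ l + k ⊎ l ≡ i + k → Offset n b c
  offset {n} {b} {c} {i} {l} {k} b≤ ≤b c≤ ≤c (v , r , r≤ , zone) (inj₁ eq) =
    0 , v , e , e≤ , ≤-antisym
      (lin 10 (λ b c i l k e r t t′ vn → (t ⊞ b ≐ i) ⟨ 1 ⟩⇒ (t′ ⊞ (c ⊞ con 1) ≑ l) ⟨ 1 ⟩⇒ (i ≐ l ⊞ k) ⟨ 1 ⟩⇒ (k ⊞ con 3 ≐ vn ⊞ r)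
          ⟨ 1 ⟩⇒ (e ⊞ t ≑ r ⊞ t′ ⊞ con 7) ⟨ 1 ⟩⇒ 1 ⊢ b ⊞ con 9 ⊞ con 0 ≼ c ⊞ e ⊞ vn) b c i l k e r t t′ (v * n) T1 T2 eq zone T3)
      (lin 10 (λ b c i l k e r t t′ vn → (t ⊞ b ≑ i) ⟨ 1 ⟩⇒ (t′ ⊞ (c ⊞ con 1) ≐ l) ⟨ 1 ⟩⇒ (i ≑ l ⊞ k) ⟨ 1 ⟩⇒ (k ⊞ con 3 ≑ vn ⊞ r)
          ⟨ 1 ⟩⇒ (e ⊞ t ≐ r ⊞ t′ ⊞ con 7) ⟨ 1 ⟩⇒ 1 ⊢ c ⊞ e ⊞ vn ≼ b ⊞ con 9 ⊞ con 0) b c i l k e r t t′ (v * n) T1 T2 eq zone T3)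
    where
    t t′ e : ℕ
    t = i ∸ b
    t′ = l ∸ (c + 1)
    e = (r + t′ + 7) ∸ t
    T1 : t + b ≡ i
    T1 = m∸n+n≡m b≤
    T2 : t′ + (c + 1) ≡ l
    T2 = m∸n+n≡m c≤
    T3 : e + t ≡ r + t′ + 7
    T3 = m∸n+n≡m (lin 5 (λ b i t r t′ → (t ⊞ b ≐ i) ⟨ 1 ⟩⇒ (i ≼ b ⊞ con 4) ⟨ 1 ⟩⇒ 1 ⊢ t ≼ r ⊞ t′ ⊞ con 7) b i t r t′ T1 ≤b)
    e≤ : e ≤ 18
    e≤ = lin 6 (λ e t r t′ c l → (e ⊞ t ≐ r ⊞ t′ ⊞ con 7) ⟨ 1 ⟩⇒ (r ≼ con 9) ⟨ 1 ⟩⇒ (t′ ⊞ (c ⊞ con 1) ≐ l) ⟨ 1 ⟩⇒ (l ≼ c ⊞ con 3)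
        ⟨ 1 ⟩⇒ 1 ⊢ e ≼ con 18) e t r t′ c l T3 r≤ T2 ≤c
  offset {n} {b} {c} {i} {l} {k} b≤ ≤b c≤ ≤c (v , r , r≤ , zone) (inj₂ eq) =
    v , 0 , e , e≤ , ≤-antisym
      (lin 10 (λ b c i l k e r t t′ vn → (t ⊞ b ≐ i) ⟨ 1 ⟩⇒ (t′ ⊞ (c ⊞ con 1) ≑ l) ⟨ 1 ⟩⇒ (l ≑ i ⊞ k) ⟨ 1 ⟩⇒ (k ⊞ con 3 ≑ vn ⊞ r)
          ⟨ 1 ⟩⇒ (e ⊞ (t ⊞ r) ≑ t′ ⊞ con 13) ⟨ 1 ⟩⇒ 1 ⊢ b ⊞ con 9 ⊞ vn ≼ c ⊞ e ⊞ con 0) b c i l k e r t t′ (v * n) T1 T2 eq zone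
          T3)
      (lin 10 (λ b c i l k e r t t′ vn → (t ⊞ b ≑ i) ⟨ 1 ⟩⇒ (t′ ⊞ (c ⊞ con 1) ≐ l) ⟨ 1 ⟩⇒ (l ≐ i ⊞ k) ⟨ 1 ⟩⇒ (k ⊞ con 3 ≐ vn ⊞ r)
          ⟨ 1 ⟩⇒ (e ⊞ (t ⊞ r) ≐ t′ ⊞ con 13) ⟨ 1 ⟩⇒ 1 ⊢ c ⊞ e ⊞ con 0 ≼ b ⊞ con 9 ⊞ vn) b c i l k e r t t′ (v * n) T1 T2 eq zone
          T3)
    where
    t t′ e : ℕ
    t = i ∸ b
    t′ = l ∸ (c + 1)
    e = (t′ + 13) ∸ (t + r)
    T1 : t + b ≡ i
    T1 = m∸n+n≡m b≤
    T2 : t′ + (c + 1) ≡ l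
    T2 = m∸n+n≡m c≤
    T3 : e + (t + r) ≡ t′ + 13
    T3 = m∸n+n≡m (lin 5 (λ b i t r t′ → (t ⊞ b ≐ i) ⟨ 1 ⟩⇒ (i ≼ b ⊞ con 4) ⟨ 1 ⟩⇒ (r ≼ con 9) ⟨ 1 ⟩⇒ 1 ⊢ t ⊞ r ≼ t′ ⊞ con 13) b i t r t′ T1 ≤b r≤)
    e≤ : e ≤ 18
    e≤ = lin 6 (λ e t r t′ c l → (e ⊞ (t ⊞ r) ≐ t′ ⊞ con 13) ⟨ 1 ⟩⇒ (t′ ⊞ (c ⊞ con 1) ≐ l) ⟨ 1 ⟩⇒ (l ≼ c ⊞ con 3) ⟨ 1 ⟩⇒ 1 ⊢ e ≼
        con 18) e t r t′ c l T3 T2 ≤c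

  module Walk (𝔾 : FinAb) (U : FinAb.Carrier 𝔾 → Bool)
    (generates : ∀ (S : FinAb.Carrier 𝔾 → Bool) {x} → T (S x) →
       (∀ x u → T (S x) → T (U u) → T (S (FinAb._∙_ 𝔾 x u))) → ∀ y → T (S y))
    (X : FinAb.Carrier 𝔾 → Bool) (g : FinAb.Carrier 𝔾) where
    open Counting 𝔾
    open Lipschitz 𝔾 U generates
    open Shrinking 𝔾 U generates
    open Doubling 𝔾 U generates

    x : ℕ
    x = # X

    ⇀-⇀ : ∀ p t z → (X ⇀ p ⇀ t) z ≡ (X ⇀ (p ∙ t)) z
    ⇀-⇀ p t z = cong X (group 3 (λ z p t → (z ⊘ t) ⊘ p ≗ z ⊘ (p ⊙ t)) refl z p t)

    miss : Carrier → Carrier → Carrier → ℕ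
    miss p q r = # ((X ⇀ p) ∖ ((X ⇀ q) ∪ (X ⇀ r)))

    miss-shift : ∀ p q r t → miss (p ∙ t) (q ∙ t) (r ∙ t) ≡ miss p q r
    miss-shift p q r t = trans (#-cong {(X ⇀ (p ∙ t)) ∖ ((X ⇀ (q ∙ t)) ∪ (X ⇀ (r ∙ t)))} {((X ⇀ p) ∖ ((X ⇀ q) ∪ (X ⇀ r))) ⇀ t}
        λ z → cong₂ _∧_ (sym (⇀-⇀ p t z)) (cong not (cong₂ _∨_ (sym (⇀-⇀ q t z)) (sym (⇀-⇀ r t z)))))
      (#-⇀ ((X ⇀ p) ∖ ((X ⇀ q) ∪ (X ⇀ r))) t)

    meet-corr : ∀ p q → # ((X ⇀ p) ∩ (X ⇀ q)) ≡ corr X (q // p)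
    meet-corr p q = trans (#-cong {(X ⇀ p) ∩ (X ⇀ q)} {(X ∩ (X ⇀ (q // p))) ⇀ p}
        λ z → cong (λ y → X (z // p) ∧ X y) (group 3 (λ z p q → z ⊘ q ≗ (z ⊘ p) ⊘ (q ⊘ p)) refl z p q))
      (#-⇀ (X ∩ (X ⇀ (q // p))) p)

    corr-sym : ∀ p q → corr X (q // p) ≡ corr X (p // q)
    corr-sym p q = trans (sym (meet-corr p q)) (trans
      (#-cong {(X ⇀ p) ∩ (X ⇀ q)} {(X ⇀ q) ∩ (X ⇀ p)} λ z → ∧-comm′ (X (z // p)) (X (z // q))) (meet-corr q p))
      where
      ∧-comm′ : ∀ a b → a ∧ b ≡ b ∧ a
      ∧-comm′ true true = refl
      ∧-comm′ true false = refl
      ∧-comm′ false true = refl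
      ∧-comm′ false false = refl

    infix 4 _~_
    -- The translates of `X` by `p` and `q` meet, so that the two points are about one step `g` or
    -- less apart; `near-trio` makes this precise.
    _~_ : Carrier → Carrier → Set
    p ~ q = 1 ≤ corr X (q // p)

    ~-sym : ∀ {p q} → p ~ q → q ~ p
    ~-sym {p} {q} r = ≤-trans r (≤-reflexive (corr-sym p q))

    ~-shift : ∀ {p q} t → p ~ q → p ∙ t ~ q ∙ t
    ~-shift {p} {q} t r = subst (λ y → 1 ≤ corr X y) (group 3 (λ p q t → q ⊘ p ≗ (q ⊙ t) ⊘ (p ⊙ t)) refl p q t) r

    meets⇒~ : ∀ {p q z} → z ∈ X ⇀ p → z ∈ X ⇀ q → p ~ q
    meets⇒~ {p} {q} {z} a b = ≤-trans (∈-# {(X ⇀ p) ∩ (X ⇀ q)} {z} (∈∩⁺ {X ⇀ p} {X ⇀ q} {z} a b)) (≤-reflexive (meet-corr p q))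

    ~⇒meets : ∀ {p q} → p ~ q → ∃ λ z → z ∈ X ⇀ p × z ∈ X ⇀ q
    ~⇒meets {p} {q} r =
      let z , m = #-∈ ((X ⇀ p) ∩ (X ⇀ q)) (≤-trans r (≤-reflexive (sym (meet-corr p q))))
      in z , ∈∩ˡ {X ⇀ p} {X ⇀ q} {z} m , ∈∩ʳ {X ⇀ p} {X ⇀ q} {z} m

    trio : Carrier → Sub
    trio q = (X ⇀ (q // g)) ∪ ((X ⇀ q) ∪ (X ⇀ (q ∙ g)))

    f : ℕ → ℕ
    f k = corr X (k ·ₘ g)

    Xₙ : ℕ → Sub
    Xₙ j = X ⇀ (j ·ₘ g)

    meet-f : ∀ i k → # (Xₙ i ∩ Xₙ (i + k)) ≡ f k
    meet-f i k = trans (meet-corr (i ·ₘ g) ((i + k) ·ₘ g)) (cong (corr X) (trans (cong (_// (i ·ₘ g)) (·ₘ-+ i k g))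
      (group 2 (λ a b → (a ⊙ b) ⊘ a ≗ b) refl (i ·ₘ g) (k ·ₘ g))))

    segments : ℕ → Sub
    segments zero = Xₙ 0
    segments (suc m) = segments m ∪ Xₙ (suc m)

    segments⁺ : ∀ {m} j {z} → j ≤ m → z ∈ Xₙ j → z ∈ segments m
    segments⁺ {zero} zero _ p = p
    segments⁺ {suc m} j {z} j≤ p with j ≤? m
    ... | yes q = ∈∪ˡ {segments m} {Xₙ (suc m)} {z} (segments⁺ j q p)
    ... | no q with ≤-antisym j≤ (≰⇒> q)
    ... | refl = ∈∪ʳ {segments m} {Xₙ (suc m)} {z} p

    segments⁻ : ∀ m {z} → z ∈ segments m → ∃ λ j → j ≤ m × z ∈ Xₙ j
    segments⁻ zero p = 0 , z≤n , p
    segments⁻ (suc m) {z} p = ∈∪-elim (segments m) (Xₙ (suc m)) {z} p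
      (λ q → let j , j≤ , r = segments⁻ m q in j , m≤n⇒m≤1+n j≤ , r) (λ q → suc m , ≤-refl , q)

    #-segments-≤ : ∀ m → # (segments m) ≤ suc m * x
    #-segments-≤ zero = ≤-reflexive (trans (#-⇀ X (0 ·ₘ g)) (sym (+-identityʳ x)))
    #-segments-≤ (suc m) = lin 6 (λ u i s y x mx → (u ⊞ i ≐ s ⊞ y) ⟨ 1 ⟩⇒ (y ≐ x) ⟨ 1 ⟩⇒ (s ≼ mx) ⟨ 1 ⟩⇒ 1 ⊢ u ≼ x ⊞ mx)
        (# (segments (suc m))) (# (segments m ∩ Xₙ (suc m))) (# (segments m)) (# (Xₙ (suc m))) x (suc m * x)
      (#-∪∩ (segments m) (Xₙ (suc m))) (#-⇀ X (suc m ·ₘ g)) (#-segments-≤ m)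

    module _ {s : ℕ} (ε∈X : ε ∈ X) (g∈X : g ∈ X) (apart : corr X g ≤ s)
             (close : ∀ y → y ∈ X → # ((X ⇀ y) ∖ (X ∪ (X ⇀ g))) ≤ s) (s-small : 100 * s < x) where

      f1 : f 1 ≤ s
      f1 = subst (λ y → corr X y ≤ s) (sym (identityʳ g)) apart

      miss-close : ∀ {y} t → y ∈ X → miss (y ∙ t) t (g ∙ t) ≤ s
      miss-close {y} t y∈ = ≤-trans (≤-reflexive (trans (cong (λ u → miss (y ∙ t) u (g ∙ t)) (sym (identityˡ t)))
        (trans (miss-shift y ε g t) (#-cong {(X ⇀ y) ∖ ((X ⇀ ε) ∪ (X ⇀ g))} {(X ⇀ y) ∖ (X ∪ (X ⇀ g))}
          λ z → cong (λ u → X (z // y) ∧ not (X u ∨ X (z // g))) (group 1 (λ z → z ⊘ one ≗ z) refl z))))) (close y y∈)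

      corr-∙ : ∀ p → corr X ((p ∙ g) // p) ≤ s
      corr-∙ p = subst (λ y → corr X y ≤ s) (group 2 (λ p g → g ≗ (p ⊙ g) ⊘ p) refl p g) apart

      -- `X ⇀ y` is shared between `X` and `X ⇀ g`. Its part in `X`, moved by `g`, is the part of
      -- `X ⇀ (y ∙ g)` in `X ⇀ g`. Thus the parts of `X ⇀ g` found in `Y` and in `Y′` together have
      -- nearly the size of `Y`, and they hardly overlap.
      miss-cover : ∀ {y} → y ∈ X → miss g y (y ∙ g) ≤ 2 * s
      miss-cover {y} y∈ =
        lin 11 (λ m pu x p py py′ c ye yn d s → (pu ⊞ m ≐ p) ⟨ 1 ⟩⇒ (p ≐ x) ⟨ 1 ⟩⇒ (py ⊞ py′ ≼ pu ⊞ c) ⟨ 1 ⟩⇒ (c ≼ s) ⟨ 1 ⟩⇒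
            (py′ ≑ ye) ⟨ 1 ⟩⇒ (yn ≼ ye ⊞ py ⊞ d) ⟨ 1 ⟩⇒ (yn ≑ x) ⟨ 1 ⟩⇒ (d ≼ s) ⟨ 1 ⟩⇒ 1 ⊢ m ≼ 2 ⊠ s) (miss g y (y ∙ g))
            (# (P ∩ (Y ∪ Y′))) x (# P) (# (P ∩ Y)) (# (P ∩ Y′)) (# (Y ∩ Y′)) (# (Y ∩ E)) (# Y) (miss y ε g) s
        (#-∖ P (Y ∪ Y′)) (#-⇀ X g) split (≤-trans (≤-reflexive (meet-corr y (y ∙ g))) (corr-∙ y)) shifted inner (#-⇀ X y)
        (subst (λ u → miss u ε g ≤ s) (identityʳ y) (subst (λ u → miss (y ∙ ε) ε u ≤ s) (identityʳ g) (miss-close ε y∈)))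
        where
        P Y Y′ E : Sub
        P = X ⇀ g
        Y = X ⇀ y
        Y′ = X ⇀ (y ∙ g)
        E = X ⇀ ε
        split : # (P ∩ Y) + # (P ∩ Y′) ≤ # (P ∩ (Y ∪ Y′)) + # (Y ∩ Y′)
        split = ≤-trans (≤-reflexive (sym (∑-+ elems _ _))) (≤-trans (∑-mono elems λ z → at (P z) (Y z) (Y′ z)) (≤-reflexive (∑-+ elems _ _)))
          where
          at : ∀ a b c → 𝟙 (a ∧ b) + 𝟙 (a ∧ c) ≤ 𝟙 (a ∧ (b ∨ c)) + 𝟙 (b ∧ c)
          at false b c = z≤n
          at true true true = ≤-refl
          at true true false = ≤-refl
          at true false true = ≤-refl
          at true false false = ≤-refl
        shifted : # (P ∩ Y′) ≡ # (Y ∩ E)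
        shifted = trans (meet-corr g (y ∙ g)) (trans (cong (corr X) (group 2 (λ y g → (y ⊙ g) ⊘ g ≗ y ⊘ one) refl y g))
          (trans (corr-sym ε y) (sym (meet-corr y ε))))
        inner : # Y ≤ # (Y ∩ E) + # (P ∩ Y) + miss y ε g
        inner = ≤-trans (∑-mono elems λ z → at (Y z) (E z) (P z)) (≤-reflexive (trans (∑-+ elems _ _) (cong (_+ miss y ε g) (∑-+ elems _ _))))
          where
          at : ∀ a b c → 𝟙 a ≤ 𝟙 (a ∧ b) + 𝟙 (c ∧ a) + 𝟙 (a ∧ not (b ∨ c))
          at false b c = z≤n
          at true true c = s≤s z≤n
          at true false true = ≤-refl
          at true false false = ≤-refl

      -- A common point gives `x₁ ∙ p = x₂ ∙ q` with `x₁` and `x₂` in `X`. By `miss-cover` the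
      -- translate by `p` is covered by those at `x₁ ∙ p // g` and `x₁ ∙ p`; rewritten in terms of
      -- `x₂ ∙ q`, these are covered by `close`.
      near-trio : ∀ {p q} → p ~ q → # ((X ⇀ p) ∖ trio q) ≤ 4 * s
      near-trio {p} {q} r =
        let z , a , b = ~⇒meets r
            x₁ = z // p
            x₂ = z // q
            t = p // g
            Y = X ⇀ (x₁ ∙ t)
            Y′ = X ⇀ ((x₁ ∙ g) ∙ t)
            first : # ((X ⇀ p) ∖ (Y ∪ Y′)) ≤ 2 * s
            first = subst (λ u → # ((X ⇀ u) ∖ (Y ∪ Y′)) ≤ 2 * s) (group 2 (λ p g → g ⊙ (p ⊘ g) ≗ p) refl p g)
                      (≤-trans (≤-reflexive (miss-shift g x₁ (x₁ ∙ g) t)) (miss-cover a))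
            second : # (Y ∖ trio q) ≤ s
            second = subst (λ u → # ((X ⇀ u) ∖ trio q) ≤ s) (group 4 (λ z p q g → (z ⊘ q) ⊙ (q ⊘ g) ≗ (z ⊘ p) ⊙ (p ⊘ g)) refl z p q g)
                       (≤-trans (∖-mono {X ⇀ (x₂ ∙ (q // g))} {X ⇀ (x₂ ∙ (q // g))} {trio q} {(X ⇀ (q // g)) ∪ (X ⇀ (g ∙ (q // g)))} (λ _ w → w)
                          λ y w → ∈∪-elim (X ⇀ (q // g)) (X ⇀ (g ∙ (q // g))) {y} w
                            (λ v → ∈∪ˡ {X ⇀ (q // g)} {(X ⇀ q) ∪ (X ⇀ (q ∙ g))} {y} v)
                            (λ v → ∈∪ʳ {X ⇀ (q // g)} {(X ⇀ q) ∪ (X ⇀ (q ∙ g))} {y} (∈∪ˡ {X ⇀ q} {X ⇀ (q ∙ g)} {y}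
                               (subst (_∈ X) (group 3 (λ y q g → y ⊘ (g ⊙ (q ⊘ g)) ≗ y ⊘ q) refl y q g) v))))
                         (miss-close (q // g) b))
            third : # (Y′ ∖ trio q) ≤ s
            third = subst (λ u → # ((X ⇀ u) ∖ trio q) ≤ s) (group 4 (λ z p q g → (z ⊘ q) ⊙ q ≗ ((z ⊘ p) ⊙ g) ⊙ (p ⊘ g)) refl z p q g)
                       (≤-trans (∖-mono {X ⇀ (x₂ ∙ q)} {X ⇀ (x₂ ∙ q)} {trio q} {(X ⇀ q) ∪ (X ⇀ (g ∙ q))} (λ _ w → w)
                          λ y w → ∈∪ʳ {X ⇀ (q // g)} {(X ⇀ q) ∪ (X ⇀ (q ∙ g))} {y} (subst (λ u → T (X (y // q) ∨ X (y // u))) (comm g q) w))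
                         (miss-close q b))
        in lin 6 (λ m a b c d s → (m ≼ a ⊞ b) ⟨ 1 ⟩⇒ (a ≼ 2 ⊠ s) ⟨ 1 ⟩⇒ (b ≼ c ⊞ d) ⟨ 1 ⟩⇒ (c ≼ s) ⟨ 1 ⟩⇒ (d ≼ s) ⟨ 1 ⟩⇒ 1 ⊢ m ≼ 4
            ⊠ s) (# ((X ⇀ p) ∖ trio q)) (# ((X ⇀ p) ∖ (Y ∪ Y′))) (# ((Y ∪ Y′) ∖ trio q)) (# (Y ∖ trio q)) (# (Y′ ∖ trio q)) s
             (∖-trans (X ⇀ p) (Y ∪ Y′) (trio q)) first (∖-∪ Y Y′ (trio q)) second third

      -- For `z` in `X ∩ Xₙ (suc k)` the translate `X ⇀ z` is nearly covered by `Xₙ 0` and `Xₙ 1`,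
      -- and also by the two translates from index `suc k` on. The four mutual overlaps have to
      -- account for almost all of it.
      f-return : ∀ k → 1 ≤ f (suc k) → x ≤ f k + 2 * f (suc k) + f (suc (suc k)) + 2 * s
      f-return k pos =
        let G = suc k ·ₘ g
            z , m = #-∈ (X ∩ (X ⇀ G)) pos
            z∈ = ∈∩ˡ {X} {X ⇀ G} {z} m
            y∈ = ∈∩ʳ {X} {X ⇀ G} {z} m
            Z = X ⇀ z
            X₀ = Xₙ 0
            X₁ = Xₙ 1
            Xₖ = Xₙ (suc k)
            Xₖ₊ = Xₙ (suc (suc k))
            near₀ : # (Z ∖ (X₀ ∪ X₁)) ≤ s
            near₀ = subst (λ u → # ((X ⇀ z) ∖ ((X ⇀ ε) ∪ (X ⇀ u))) ≤ s) refl
                      (subst (λ u → miss u ε (g ∙ ε) ≤ s) (identityʳ z) (miss-close ε z∈))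
            nearₖ : # (Z ∖ (Xₖ ∪ Xₖ₊)) ≤ s
            nearₖ = subst (λ u → miss u G (g ∙ G) ≤ s) (group 2 (λ z G → (z ⊘ G) ⊙ G ≗ z) refl z G) (miss-close G y∈)
            total : # Z ≤ # (X₀ ∩ Xₖ) + # (X₁ ∩ Xₖ) + # (X₀ ∩ Xₖ₊) + # (X₁ ∩ Xₖ₊) + # (Z ∖ (X₀ ∪ X₁)) + # (Z ∖ (Xₖ ∪ Xₖ₊))
            total = ≤-trans (∑-mono elems λ y → at (Z y) (X₀ y) (X₁ y) (Xₖ y) (Xₖ₊ y))
              (≤-reflexive (trans (∑-+ elems _ _) (cong (_+ # (Z ∖ (Xₖ ∪ Xₖ₊))) (trans (∑-+ elems _ _) (cong (_+ # (Z ∖ (X₀ ∪ X₁)))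
                (trans (∑-+ elems _ _) (cong (_+ # (X₁ ∩ Xₖ₊)) (trans (∑-+ elems _ _) (cong (_+ # (X₀ ∩ Xₖ₊)) (∑-+ elems _ _))))))))))
        in lin 12 (λ x zc a b c d m n fk fk1 fk2 s → (zc ≑ x) ⟨ 1 ⟩⇒ (zc ≼ a ⊞ b ⊞ c ⊞ d ⊞ m ⊞ n) ⟨ 1 ⟩⇒ (m ≼ s) ⟨ 1 ⟩⇒ (n ≼ s) ⟨
            1 ⟩⇒ (a ≐ fk1) ⟨ 1 ⟩⇒ (b ≐ fk) ⟨ 1 ⟩⇒ (c ≐ fk2) ⟨ 1 ⟩⇒ (d ≐ fk1) ⟨ 1 ⟩⇒ 1 ⊢ x ≼ fk ⊞ 2 ⊠ fk1 ⊞ fk2 ⊞ 2 ⊠ s) x (# Z)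
            (# (X₀ ∩ Xₖ)) (# (X₁ ∩ Xₖ)) (# (X₀ ∩ Xₖ₊)) (# (X₁ ∩ Xₖ₊)) (# (Z ∖ (X₀ ∪ X₁))) (# (Z ∖ (Xₖ ∪ Xₖ₊))) (f k) (f (suc k))
            (f (suc (suc k))) s
            (#-⇀ X z) total near₀ nearₖ (meet-f 0 (suc k)) (meet-f 1 k) (meet-f 0 (suc (suc k))) (meet-f 1 (suc k))
        where
        at : ∀ a b c d e → 𝟙 a ≤ 𝟙 (b ∧ d) + 𝟙 (c ∧ d) + 𝟙 (b ∧ e) + 𝟙 (c ∧ e) + 𝟙 (a ∧ not (b ∨ c)) + 𝟙 (a ∧ not (d ∨ e))
        at false b c d e = z≤n
        at true true c true e = s≤s z≤n
        at true true true false true = s≤s z≤n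
        at true true true false false = s≤s z≤n
        at true true false false true = s≤s z≤n
        at true true false false false = s≤s z≤n
        at true false true true e = s≤s z≤n
        at true false true false true = ≤-refl
        at true false true false false = ≤-refl
        at true false false d e = m≤m+n _ _

      -- Overlaps below `x / 8` cannot satisfy the inequality of `f-return`, so a small overlap must
      -- vanish altogether.
      f-zero : ∀ {n} → (∀ i → 2 ≤ i → i < n → 8 * f i < x) → ∀ i → 2 ≤ i → suc i < n → f i ≡ 0
      f-zero low (suc zero) (s≤s ()) _
      f-zero {n} low (suc (suc k)) 2≤ i< with 1 ≤? f (suc (suc k))
      ... | no q = n≤0⇒n≡0 (≤-pred (≰⇒> q))
      ... | yes q = ⊥-elim (<-irrefl refl
          (lin 5 (λ x a b c s → (x ≼ a ⊞ 2 ⊠ b ⊞ c ⊞ 2 ⊠ s) ⟨ 200 ⟩⇒ (8 ⊠ a ≼ x) ⟨ 25 ⟩⇒ (con 1 ⊞ 8 ⊠ b ≼ x) ⟨ 146 ⟩⇒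
              (con 1 ⊞ 8 ⊠ c ≼ x) ⟨ 25 ⟩⇒ (con 1 ⊞ 100 ⊠ s ≼ x) ⟨ 4 ⟩⇒ 175 ⊢ con 1 ⊞ x ≼ x) x (f (suc k)) (f (suc (suc k)))
              (f (suc (suc (suc k)))) s
            (f-return (suc k) q) (before k i<) (low _ 2≤ (<-trans (n<1+n _) i<)) (low _ (m≤n⇒m≤1+n 2≤) i<) s-small))
        where
        before : ∀ k → suc (suc (suc k)) < n → 8 * f (suc k) ≤ x
        before zero _ = lin 3 (λ a s x → (a ≼ s) ⟨ 200 ⟩⇒ (con 1 ⊞ 100 ⊠ s ≼ x) ⟨ 2 ⟩⇒ 25 ⊢ 8 ⊠ a ≼ x) (f 1) s x f1 s-small
        before (suc k) p = <⇒≤ (low (suc (suc k)) (s≤s (s≤s z≤n)) (<-trans (n<1+n _) (<-trans (n<1+n _) p)))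

      -- Only consecutive translates overlap, in at most `s` points each.
      #-segments : ∀ m → (∀ i → 2 ≤ i → i ≤ m → f i ≡ 0) → suc m * x ≤ # (segments m) + suc m * s
      #-segments zero z = lin 3 (λ x s y → (y ≑ x) ⟨ 1 ⟩⇒ 1 ⊢ 1 ⊠ x ≼ y ⊞ 1 ⊠ s) x s (# (Xₙ 0)) (#-⇀ X (0 ·ₘ g))
      #-segments (suc m) z = lin 8 (λ x mx u i p y s ms → (u ⊞ i ≑ p ⊞ y) ⟨ 1 ⟩⇒ (y ≑ x) ⟨ 1 ⟩⇒ (i ≼ s) ⟨ 1 ⟩⇒ (mx ≼ p ⊞ ms) ⟨ 1
          ⟩⇒ 1 ⊢ x ⊞ mx ≼ u ⊞ (s ⊞ ms)) x (suc m * x) (# (segments (suc m))) (# (segments m ∩ Xₙ (suc m))) (# (segments m))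
          (# (Xₙ (suc m))) s (suc m * s)
        (#-∪∩ (segments m) (Xₙ (suc m))) (#-⇀ X (suc m ·ₘ g)) inter (#-segments m (λ i 2≤ i≤ → z i 2≤ (m≤n⇒m≤1+n i≤)))
        where
        only : segments m ∩ Xₙ (suc m) ⊑ Xₙ m ∩ Xₙ (m + 1)
        only y p =
          let j , j≤ , y∈ = segments⁻ m (∈∩ˡ {segments m} {Xₙ (suc m)} {y} p)
              y∈′ = ∈∩ʳ {segments m} {Xₙ (suc m)} {y} p
          in ∈∩⁺ {Xₙ m} {Xₙ (m + 1)} {y} (last j j≤ y∈ y∈′) (subst (λ k → y ∈ Xₙ k) (+-comm 1 m) y∈′)
          where
          last : ∀ j → j ≤ m → y ∈ Xₙ j → y ∈ Xₙ (suc m) → y ∈ Xₙ m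
          last j j≤ y∈ y∈′ with m≤n⇒m<n∨m≡n j≤
          ... | inj₂ refl = y∈
          ... | inj₁ j< = ⊥-elim (<⇒≱ (∈-# {Xₙ j ∩ Xₙ (suc m)} {y} (∈∩⁺ {Xₙ j} {Xₙ (suc m)} {y} y∈ y∈′))
                (≤-reflexive (trans (cong (λ k → # (Xₙ j ∩ Xₙ k)) (sym (m+[n∸m]≡n (m≤n⇒m≤1+n j≤))))
                  (trans (meet-f j (suc m ∸ j)) (z (suc m ∸ j) gap (m∸n≤m (suc m) j))))))
            where
            gap : 2 ≤ suc m ∸ j
            gap = m+n≤o⇒m≤o∸n 2 (s≤s j<)
        inter : # (segments m ∩ Xₙ (suc m)) ≤ s
        inter = ≤-trans (#-mono {segments m ∩ Xₙ (suc m)} {Xₙ m ∩ Xₙ (m + 1)} only) (≤-trans (≤-reflexive (meet-f m 1)) f1)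

      x>0 : 1 ≤ x
      x>0 = ≤-trans (s≤s z≤n) s-small

      least : ∀ m → (∃ λ n → 2 ≤ n × x ≤ 8 * f n × (∀ i → 2 ≤ i → i < n → 8 * f i < x)) ⊎ (∀ i → 2 ≤ i → i ≤ m → 8 * f i < x)
      least zero = inj₂ λ i 2≤ i≤ → ⊥-elim (<⇒≱ (s≤s z≤n) (≤-trans 2≤ i≤))
      least (suc m) with least m
      ... | inj₁ r = inj₁ r
      ... | inj₂ low with 2 ≤? suc m | x ≤? 8 * f (suc m)
      ... | yes p | yes q = inj₁ (suc m , p , q , λ i 2≤ i< → low i 2≤ (≤-pred i<))
      ... | no p | _ = inj₂ λ i 2≤ i≤ → ⊥-elim (p (≤-trans 2≤ i≤))
      ... | yes p | no q = inj₂ λ i 2≤ i≤ → at i 2≤ (m≤n⇒m<n∨m≡n i≤)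
        where
        at : ∀ i → 2 ≤ i → i < suc m ⊎ i ≡ suc m → 8 * f i < x
        at i 2≤ (inj₁ i<) = low i 2≤ (≤-pred i<)
        at i 2≤ (inj₂ refl) = ≰⇒> q

      -- Without a return `h + 1` consecutive translates would be nearly disjoint and overfill the
      -- group.
      return-time : ∃ λ n → 2 ≤ n × x ≤ 8 * f n × (∀ i → 2 ≤ i → i < n → 8 * f i < x)
      return-time with least (suc (suc h))
      ... | inj₁ r = r
      ... | inj₂ low = ⊥-elim (<-irrefl refl (begin-strict
          suc h * s + h            <⟨ +-monoʳ-< (suc h * s) (n<1+n h) ⟩
          suc h * s + suc h        ≡⟨ trans (+-comm (suc h * s) (suc h)) (sym (*-suc (suc h) s)) ⟩
          suc h * suc s            ≤⟨ *-monoʳ-≤ (suc h) (lin 2 (λ s x → (con 1 ⊞ 100 ⊠ s ≼ x) ⟨ 1 ⟩⇒ 1 ⊢ con 1 ⊞ s ≼ x) s x s-small) ⟩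
          suc h * x                ≤⟨ #-segments h (λ i 2≤ i≤ → f-zero {suc (suc (suc h))} (λ j 2≤j j< → low j 2≤j (≤-pred j<)) i
              2≤ (s≤s (s≤s (m≤n⇒m≤1+n i≤)))) ⟩
          # (segments h) + suc h * s ≤⟨ +-monoˡ-≤ (suc h * s) (#≤h (segments h)) ⟩
          h + suc h * s            ≡⟨ +-comm h (suc h * s) ⟩
          suc h * s + h            ∎))
        where open ≤-Reasoning

      common : ∀ (S R R′ : Sub) → # (S ∖ R) + # (S ∖ R′) < # S → ∃ λ z → z ∈ R × z ∈ R′
      common S R R′ p =
        let z , m = #-∈ (R ∩ R′) (+-cancelʳ-< (# (S ∖ R) + # (S ∖ R′)) 0 _ (<-≤-trans p
                      (≤-trans (∑-mono elems λ z → at (S z) (R z) (R′ z))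
                          (≤-reflexive (trans (∑-+ elems _ _) (cong (# (R ∩ R′) +_) (∑-+ elems _ _)))))))
        in z , ∈∩ˡ {R} {R′} {z} m , ∈∩ʳ {R} {R′} {z} m
        where
        at : ∀ a b c → 𝟙 a ≤ 𝟙 (b ∧ c) + (𝟙 (a ∧ not b) + 𝟙 (a ∧ not c))
        at false b c = z≤n
        at true true true = ≤-refl
        at true true false = ≤-refl
        at true false c = s≤s z≤n

      trio-index : ∀ j {z} → 1 ≤ j → z ∈ trio (j ·ₘ g) → ∃ λ i → j ≤ suc i × i ≤ suc j × z ∈ Xₙ i
      trio-index (suc j) {z} _ p = ∈∪-elim (X ⇀ (suc j ·ₘ g // g)) ((X ⇀ (suc j ·ₘ g)) ∪ (X ⇀ (suc j ·ₘ g ∙ g))) {z} p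
        (λ q → j , ≤-refl , m≤n⇒m≤1+n (m≤n⇒m≤1+n ≤-refl) ,
          subst (_∈ X) (group 3 (λ z g G → z ⊘ ((g ⊙ G) ⊘ g) ≗ z ⊘ G) refl z g (j ·ₘ g)) q)
        (λ q → ∈∪-elim (X ⇀ (suc j ·ₘ g)) (X ⇀ (suc j ·ₘ g ∙ g)) {z} q
          (λ r → suc j , m≤n⇒m≤1+n ≤-refl , m≤n⇒m≤1+n ≤-refl , r)
          (λ r → suc (suc j) , m≤n⇒m≤1+n (m≤n⇒m≤1+n ≤-refl) , ≤-refl , subst (λ u → z ∈ X ⇀ u) (comm (suc j ·ₘ g) g) r))

      meet-index : ∀ {i l z} → z ∈ Xₙ i → z ∈ Xₙ l → i ≤ l → 1 ≤ f (l ∸ i)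
      meet-index {i} {l} {z} a b i≤ = ≤-trans (∈-# {Xₙ i ∩ Xₙ l} {z} (∈∩⁺ {Xₙ i} {Xₙ l} {z} a b))
        (≤-reflexive (trans (cong (λ k → # (Xₙ i ∩ Xₙ k)) (sym (m+[n∸m]≡n i≤))) (meet-f i (l ∸ i))))

      ~-multiple : ∀ {p} i j → p ~ i ·ₘ g → p ∙ j ·ₘ g ~ (i + j) ·ₘ g
      ~-multiple {p} i j r = subst (λ u → p ∙ j ·ₘ g ~ u) (sym (·ₘ-+ i j g)) (~-shift (j ·ₘ g) r)

      window : ℕ → ℕ → Sub
      window lo k = segments k ⇀ (lo ·ₘ g)

      window⁺ : ∀ lo k i {z} → lo ≤ i → i ≤ lo + k → z ∈ Xₙ i → z ∈ window lo k
      window⁺ lo k i {z} lo≤ ≤hi p = segments⁺ {k} (i ∸ lo) {z // lo ·ₘ g} (m≤n+o⇒m∸n≤o i lo ≤hi)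
        (subst (_∈ X) (trans (cong (z //_) (trans (cong (_·ₘ g) (sym (m+[n∸m]≡n lo≤))) (·ₘ-+ lo (i ∸ lo) g)))
          (group 3 (λ z a b → z ⊘ (a ⊙ b) ≗ (z ⊘ a) ⊘ b) refl z (lo ·ₘ g) ((i ∸ lo) ·ₘ g))) p)

      window⁻ : ∀ lo k {z} → z ∈ window lo k → ∃ λ i → lo ≤ i × i ≤ lo + k × z ∈ Xₙ i
      window⁻ lo k {z} p =
        let j , j≤ , r = segments⁻ k {z // lo ·ₘ g} p
        in lo + j , m≤m+n lo j , +-monoʳ-≤ lo j≤ ,
           subst (_∈ X) (trans (group 3 (λ z a b → (z ⊘ a) ⊘ b ≗ z ⊘ (a ⊙ b)) refl z (lo ·ₘ g) (j ·ₘ g)) (cong (z //_) (sym (·ₘ-+ lo j g)))) r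

      trio-⊑-window : ∀ j lo k → 1 ≤ j → suc lo ≤ j → suc j ≤ lo + k → trio (j ·ₘ g) ⊑ window lo k
      trio-⊑-window j lo k 1≤j lo≤ ≤hi z p =
        let i , j≤ , i≤ , r = trio-index j {z} 1≤j p
        in window⁺ lo k i {z} (≤-pred (≤-trans lo≤ j≤)) (≤-trans i≤ ≤hi) r

      module _ {n : ℕ} (2≤n : 2 ≤ n) (returns : x ≤ 8 * f n) (low : ∀ i → 2 ≤ i → i < n → 8 * f i < x)
               {ν : ℕ} (lip : Lip X ν) (ν≤s : ν ≤ s) where

        round-trip : ε ~ n ·ₘ g
        round-trip = subst (λ u → 1 ≤ corr X u) (group 1 (λ u → u ≗ u ⊘ one) refl (n ·ₘ g)) (positive (f n) (≤-trans x>0 returns))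
          where
          positive : ∀ k → 1 ≤ 8 * k → 1 ≤ k
          positive (suc k) _ = s≤s z≤n

        wrap : ∀ j → j ·ₘ g ~ (n + j) ·ₘ g
        wrap j = subst (λ u → u ~ (n + j) ·ₘ g) (identityˡ (j ·ₘ g)) (~-multiple n j round-trip)

        whole : Sub
        whole = segments (suc n)

        ⊑-∖ : ∀ (S R : Sub) → S ⊑ R → # (S ∖ R) ≤ 0
        ⊑-∖ S R p = ≮⇒≥ λ q → let z , m = #-∈ (S ∖ R) q in ∈∖ʳ {S} {R} {z} m (p z (∈∖ˡ {S} {R} {z} m))

        -- Only `j = 0` on the left and `j = suc n` on the right leave the range of indices. There
        -- `ε ~ n ·ₘ g`, shifted one step back or two steps forward, moves the translate by a full
        -- turn.
        trio-whole : ∀ j → j ≤ suc n → # (trio (j ·ₘ g) ∖ whole) ≤ 8 * s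
        trio-whole j j≤ = lin 6 (λ t l mr m r s → (t ≼ l ⊞ mr) ⟨ 1 ⟩⇒ (mr ≼ m ⊞ r) ⟨ 1 ⟩⇒ (l ≼ 4 ⊠ s) ⟨ 1 ⟩⇒ (m ≼ con 0) ⟨ 1 ⟩⇒
            (r ≼ 4 ⊠ s) ⟨ 1 ⟩⇒ 1 ⊢ t ≼ 8 ⊠ s) (# (trio (j ·ₘ g) ∖ whole)) (# (L ∖ whole)) (# ((M ∪ R) ∖ whole)) (# (M ∖ whole))
            (# (R ∖ whole)) s
          (∖-∪ L (M ∪ R) whole) (∖-∪ M R whole) (left j j≤) (⊑-∖ M whole (λ z → segments⁺ {suc n} j {z} j≤)) (right j (m≤n⇒m<n∨m≡n j≤))
          where
          L M R : Sub
          L = X ⇀ (j ·ₘ g // g)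
          M = X ⇀ (j ·ₘ g)
          R = X ⇀ (j ·ₘ g ∙ g)
          left : ∀ i → i ≤ suc n → # ((X ⇀ (i ·ₘ g // g)) ∖ whole) ≤ 4 * s
          left (suc i) i≤ = ≤-trans (⊑-∖ (X ⇀ (suc i ·ₘ g // g)) whole (λ z p → segments⁺ {suc n} i {z} (≤-trans (m≤n⇒m≤1+n ≤-refl) i≤)
            (subst (_∈ X) (group 3 (λ z g G → z ⊘ ((g ⊙ G) ⊘ g) ≗ z ⊘ G) refl z g (i ·ₘ g)) p))) z≤n
          left zero _ = ≤-trans (∖-mono {X ⇀ (ε // g)} {X ⇀ (ε // g)} {whole} {trio (n ·ₘ g // g)} (λ _ p → p) (inside n 2≤n ≤-refl))
            (near-trio (~-shift (g ⁻¹) round-trip))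
            where
            inside : ∀ m → 2 ≤ m → m ≤ n → trio (m ·ₘ g // g) ⊑ whole
            inside (suc zero) (s≤s ())
            inside (suc (suc m)) 2≤ m≤ z p =
              let i , _ , i≤ , r = trio-index (suc m) {z} (s≤s z≤n)
                    (subst (λ u → z ∈ trio u) (group 2 (λ g G → (g ⊙ (g ⊙ G)) ⊘ g ≗ g ⊙ G) refl g (m ·ₘ g)) p)
              in segments⁺ {suc n} i {z} (≤-trans i≤ (m≤n⇒m≤1+n m≤)) r
          right : ∀ i → i < suc n ⊎ i ≡ suc n → # ((X ⇀ (i ·ₘ g ∙ g)) ∖ whole) ≤ 4 * s
          right i (inj₁ i<) = ≤-trans (⊑-∖ (X ⇀ (i ·ₘ g ∙ g)) whole (λ z p → segments⁺ {suc n} (suc i) {z} i<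
            (subst (λ u → z ∈ X ⇀ u) (comm (i ·ₘ g) g) p))) z≤n
          right i (inj₂ refl) = ≤-trans (∖-mono {X ⇀ (suc n ·ₘ g ∙ g)} {X ⇀ ((n + 2) ·ₘ g)} {whole} {trio (2 ·ₘ g)}
              (λ z p → subst (λ u → z ∈ X ⇀ u) (trans (comm (suc n ·ₘ g) g) (cong (_·ₘ g) (+-comm 2 n))) p)
              (λ z p → let k , _ , k≤ , r = trio-index 2 {z} (s≤s z≤n) p in segments⁺ {suc n} k {z} (≤-trans k≤ (s≤s 2≤n)) r))
            (near-trio (~-sym (wrap 2)))

        near-whole : ∀ {p} j → j ≤ suc n → p ~ j ·ₘ g → # ((X ⇀ p) ∖ whole) ≤ 12 * s
        near-whole {p} j j≤ r = lin 4 (λ m a b s → (m ≼ a ⊞ b) ⟨ 1 ⟩⇒ (a ≼ 4 ⊠ s) ⟨ 1 ⟩⇒ (b ≼ 8 ⊠ s) ⟨ 1 ⟩⇒ 1 ⊢ m ≼ 12 ⊠ s)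
            (# ((X ⇀ p) ∖ whole)) (# ((X ⇀ p) ∖ trio (j ·ₘ g))) (# (trio (j ·ₘ g) ∖ whole)) s
          (∖-trans (X ⇀ p) (trio (j ·ₘ g)) whole) (near-trio r) (trio-whole j j≤)

        meets-whole : ∀ p → # ((X ⇀ p) ∖ whole) < x → ∃ λ j → j ≤ suc n × p ~ j ·ₘ g
        meets-whole p q =
          let z , m = #-∈ ((X ⇀ p) ∩ whole) (lin 4 (λ i d y x → (i ⊞ d ≑ y) ⟨ 1 ⟩⇒ (y ≑ x) ⟨ 1 ⟩⇒ (con 1 ⊞ d ≼ x) ⟨ 1 ⟩⇒ 1 ⊢ con 1
                  ≼ i) (# ((X ⇀ p) ∩ whole)) (# ((X ⇀ p) ∖ whole)) (# (X ⇀ p)) x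
                        (#-∖ (X ⇀ p) whole) (#-⇀ X p) q)
              j , j≤ , r = segments⁻ (suc n) {z} (∈∩ʳ {X ⇀ p} {whole} {z} m)
          in j , j≤ , meets⇒~ {p} {j ·ₘ g} {z} (∈∩ˡ {X ⇀ p} {whole} {z} m) r

        -- The set of `p` for which `X ⇀ p` does not lie wholly outside `whole` is closed under `U`:
        -- meeting one `Xₙ j` already forces all but `12 * s` points into `whole`, and a generator
        -- costs at most `ν ≤ s` more.
        cover : ∀ p → ∃ λ j → j ≤ suc n × p ~ j ·ₘ g
        cover p = meets-whole p (<ᵇ⇒< _ _ (generates S {ε} start closed p))
          where
          S : Sub
          S p = # ((X ⇀ p) ∖ whole) <ᵇ x
          start : ε ∈ S
          start = <⇒<ᵇ (≤-<-trans (⊑-∖ (X ⇀ ε) whole (λ z → segments⁺ {suc n} 0 {z} z≤n)) x>0)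
          closed : ∀ p u → p ∈ S → u ∈ U → p ∙ u ∈ S
          closed p u p∈ u∈ =
            let j , j≤ , r = meets-whole p (<ᵇ⇒< _ _ p∈) in
            <⇒<ᵇ (lin 11 (λ d a b c c′ e P P′ x s ν → (d ≼ a ⊞ b) ⟨ 1 ⟩⇒ (b ≼ 12 ⊠ s) ⟨ 1 ⟩⇒ (c ⊞ e ≑ P) ⟨ 1 ⟩⇒ (c′ ⊞ a ≐ P′) ⟨ 1
                ⟩⇒ (c ≼ c′) ⟨ 1 ⟩⇒ (P ≑ x) ⟨ 1 ⟩⇒ (P′ ≐ x) ⟨ 1 ⟩⇒ (e ≼ ν) ⟨ 1 ⟩⇒ (ν ≼ s) ⟨ 1 ⟩⇒ (con 1 ⊞ 100 ⊠ s ≼ x) ⟨ 1 ⟩⇒ 1 ⊢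
                con 1 ⊞ d ≼ x) (# (P′ ∖ whole)) (# (P′ ∖ P)) (# (P ∖ whole)) (# (P ∩ P′)) (# (P′ ∩ P)) (# (P ∖ P′)) (# P) (# P′) x
                s ν
              (∖-trans P′ P whole) (near-whole j j≤ r) (#-∖ P P′) (#-∖ P′ P)
              (#-mono {P ∩ P′} {P′ ∩ P} λ z m → ∈∩⁺ {P′} {P} {z} (∈∩ʳ {P} {P′} {z} m) (∈∩ˡ {P} {P′} {z} m))
              (#-⇀ X p) (#-⇀ X (p ∙ u))
              (≤-trans (≤-reflexive (trans (#-cong {P ∖ P′} {(X ∖ (X ⇀ u)) ⇀ p} λ z →
                  cong (λ y → X (z // p) ∧ not (X y)) (group 3 (λ z p u → z ⊘ (p ⊙ u) ≗ (z ⊘ p) ⊘ u) refl z p u)) (#-⇀ (X ∖ (X ⇀ u)) p)))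
                (Lip.bound lip u u∈)) ν≤s s-small)
            where
            P P′ : Sub
            P = X ⇀ p
            P′ = X ⇀ (p ∙ u)

        -- Sums over all `p` the fact that `whole` contains all but `12 * s` points of `X ⇀ p`.
        whole-large : h * x ≤ suc (suc n) * x * x + h * (12 * s)
        whole-large = begin
          h * x ≡⟨ *-comm h x ⟩
          x * h ≡⟨ ∑-const x ⟨
          ∑ᴳ (λ _ → x) ≤⟨ ∑-mono elems at ⟩
          ∑ᴳ (λ p → # (whole ∩ (X ⇀ p)) + 12 * s) ≡⟨ ∑-+ elems _ _ ⟩
          ∑ᴳ (λ p → # (whole ∩ (X ⇀ p))) + ∑ᴳ (λ _ → 12 * s) ≡⟨ cong₂ _+_ (∑-meet X whole) (trans (∑-const (12 * s)) (*-comm (12 * s) h)) ⟩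
          # whole * x + h * (12 * s) ≤⟨ +-monoˡ-≤ (h * (12 * s)) (*-monoˡ-≤ x (#-segments-≤ (suc n))) ⟩
          suc (suc n) * x * x + h * (12 * s) ∎
          where
          open ≤-Reasoning
          at : ∀ p → x ≤ # (whole ∩ (X ⇀ p)) + 12 * s
          at p = let j , j≤ , r = cover p in
            lin 6 (λ x P c c′ d s → (P ≑ x) ⟨ 1 ⟩⇒ (c ⊞ d ≑ P) ⟨ 1 ⟩⇒ (c ≼ c′) ⟨ 1 ⟩⇒ (d ≼ 12 ⊠ s) ⟨ 1 ⟩⇒ 1 ⊢ x ≼ c′ ⊞ 12 ⊠ s) x
                (# (X ⇀ p)) (# ((X ⇀ p) ∩ whole)) (# (whole ∩ (X ⇀ p))) (# ((X ⇀ p) ∖ whole)) s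
            (#-⇀ X p) (#-∖ (X ⇀ p) whole)
            (#-mono {(X ⇀ p) ∩ whole} {whole ∩ (X ⇀ p)} λ z m → ∈∩⁺ {whole} {X ⇀ p} {z} (∈∩ʳ {X ⇀ p} {whole} {z} m) (∈∩ˡ {X ⇀ p} {whole} {z} m))
            (near-whole j j≤ r)

        -- By `f-zero` an index with overlap is at most 1 or at least `n - 1`. If it is beyond
        -- `n + 6`, going back one turn makes `trio (1 ·ₘ g)` meet the trio at `k - n + 1`; the
        -- overlap so obtained has an index that must again be at least `n - 1`, so `k` is near
        -- `2 * n`.
        zone : ∀ k → k ≤ 2 * n + 6 → 1 ≤ f k → Zone n k
        zone k k≤ pos with k ≤? 1
        ... | yes p = 0 , k + 3 , lin 1 (λ k → (k ≼ con 1) ⟨ 1 ⟩⇒ 1 ⊢ k ⊞ con 3 ≼ con 9) k p , refl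
        ... | no p with suc k <? n
        ... | yes q = ⊥-elim (<⇒≱ pos (≤-reflexive (f-zero low k (≰⇒> p) q)))
        ... | no q with k ≤? n + 6
        ... | yes r = 1 , (k + 3) ∸ (1 * n) , m≤n+o⇒m∸n≤o (k + 3) (1 * n)
            (lin 2 (λ k n → (k ≼ n ⊞ con 6) ⟨ 1 ⟩⇒ 1 ⊢ k ⊞ con 3 ≼ 1 ⊠ n ⊞ con 9) k n r) ,
                      sym (m+[n∸m]≡n (lin 2 (λ k n → (n ≼ con 1 ⊞ k) ⟨ 1 ⟩⇒ 1 ⊢ 1 ⊠ n ≼ k ⊞ con 3) k n (≮⇒≥ q)))
        ... | no r = 2 , (k + 3) ∸ (2 * n) , m≤n+o⇒m∸n≤o (k + 3) (2 * n)
            (lin 2 (λ k n → (k ≼ 2 ⊠ n ⊞ con 6) ⟨ 1 ⟩⇒ 1 ⊢ k ⊞ con 3 ≼ 2 ⊠ n ⊞ con 9) k n k≤) ,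
                     sym (m+[n∸m]≡n wide)
          where
          k₁ : ℕ
          k₁ = k ∸ n
          n+k₁ : n + k₁ ≡ k
          n+k₁ = m+[n∸m]≡n (lin 2 (λ n k → (con 1 ⊞ n ⊞ con 6 ≼ k) ⟨ 1 ⟩⇒ 1 ⊢ n ≼ k) n k (≰⇒> r))
          near₁ : (n + (k₁ + 1)) ·ₘ g ~ 1 ·ₘ g
          near₁ = ~-sym (subst₂-~ (identityˡ (1 ·ₘ g)) (cong (_·ₘ g) (trans (cong (_+ 1) (sym n+k₁)) (+-assoc n k₁ 1)))
            (~-multiple k 1 (subst (λ u → 1 ≤ corr X u) (group 1 (λ u → u ≗ u ⊘ one) refl (k ·ₘ g)) pos)))
            where
            subst₂-~ : ∀ {p p′ q q′} → p ≡ p′ → q ≡ q′ → p ~ q → p′ ~ q′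
            subst₂-~ refl refl w = w
          S : Sub
          S = X ⇀ ((n + (k₁ + 1)) ·ₘ g)
          both : ∃ λ z → z ∈ trio (1 ·ₘ g) × z ∈ trio ((k₁ + 1) ·ₘ g)
          both = common S (trio (1 ·ₘ g)) (trio ((k₁ + 1) ·ₘ g))
            (lin 5 (λ a b y x s → (a ≼ 4 ⊠ s) ⟨ 1 ⟩⇒ (b ≼ 4 ⊠ s) ⟨ 1 ⟩⇒ (y ≑ x) ⟨ 1 ⟩⇒ (con 1 ⊞ 100 ⊠ s ≼ x) ⟨ 1 ⟩⇒ 1 ⊢ con 1 ⊞ a
                ⊞ b ≼ y) (# (S ∖ trio (1 ·ₘ g))) (# (S ∖ trio ((k₁ + 1) ·ₘ g))) (# S) x s
              (near-trio near₁) (near-trio (~-sym (wrap (k₁ + 1)))) (#-⇀ X ((n + (k₁ + 1)) ·ₘ g)) s-small)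
          wide : 2 * n ≤ k + 3
          wide =
            let z , a , b = both
                i , _ , i≤ , i∈ = trio-index 1 {z} (s≤s z≤n) a
                l , l≤ , ≤l , l∈ = trio-index (k₁ + 1) {z} (m≤n+m 1 k₁) b
                i≤l = lin 5 (λ i l j n k → (i ≼ con 2) ⟨ 7 ⟩⇒ (j ⊞ con 1 ≼ con 1 ⊞ l) ⟨ 2 ⟩⇒ (n ⊞ j ≑ k) ⟨ 2 ⟩⇒
                    (con 1 ⊞ n ⊞ con 6 ≼ k) ⟨ 2 ⟩⇒ 7 ⊢ i ≼ l) i l (k₁) n k i≤ l≤ n+k₁ (≰⇒> r)
                m = l ∸ i
                m+i : m + i ≡ l
                m+i = m∸n+n≡m i≤l
                m≥2 = lin 6 (λ m i l j n k → (m ⊞ i ≑ l) ⟨ 2 ⟩⇒ (i ≼ con 2) ⟨ 2 ⟩⇒ (j ⊞ con 1 ≼ con 1 ⊞ l) ⟨ 2 ⟩⇒ (n ⊞ j ≑ k) ⟨ 2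
                    ⟩⇒ (con 1 ⊞ n ⊞ con 6 ≼ k) ⟨ 2 ⟩⇒ 5 ⊢ con 2 ≼ m) m i l (k₁) n k m+i i≤ l≤ n+k₁ (≰⇒> r)
                big : n ≤ suc m
                big = ≮⇒≥ λ w → <⇒≱ (meet-index {i} {l} {z} i∈ l∈ i≤l) (≤-reflexive (f-zero low m m≥2 w))
            in lin 6 (λ n m i l j k → (n ≼ con 1 ⊞ m) ⟨ 1 ⟩⇒ (m ⊞ i ≐ l) ⟨ 1 ⟩⇒ (l ≼ con 1 ⊞ (j ⊞ con 1)) ⟨ 1 ⟩⇒ (n ⊞ j ≐ k) ⟨ 1
                ⟩⇒ 1 ⊢ 2 ⊠ n ≼ k ⊞ con 3) n m i l (k₁) k big m+i ≤l n+k₁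

        relate : ∀ {b c i l z} → b ≤ i → i ≤ b + 4 → c + 1 ≤ l → l ≤ c + 3 → b ≤ suc n + suc n → c ≤ suc n →
          z ∈ Xₙ i → z ∈ Xₙ l → Offset n b c
        relate {b} {c} {i} {l} {z} b≤ ≤b c≤ ≤c b-small c-small i∈ l∈ with ≤-total l i
        ... | inj₁ l≤i = offset {n} b≤ ≤b c≤ ≤c
                (zone (i ∸ l) (≤-trans (m≤n+o⇒m∸n≤o i l (lin 5 (λ i l b c n → (i ≼ b ⊞ con 4) ⟨ 1 ⟩⇒ (c ⊞ con 1 ≼ l) ⟨ 0 ⟩⇒
                    (b ≼ (con 1 ⊞ n) ⊞ (con 1 ⊞ n)) ⟨ 1 ⟩⇒ 1 ⊢ i ≼ l ⊞ (2 ⊠ n ⊞ con 6)) i l b c n ≤b c≤ b-small)) ≤-refl)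
                  (meet-index {l} {i} {z} l∈ i∈ l≤i)) (inj₁ (sym (m+[n∸m]≡n l≤i)))
        ... | inj₂ i≤l = offset {n} b≤ ≤b c≤ ≤c
                (zone (l ∸ i) (m≤n+o⇒m∸n≤o l i (lin 4 (λ i l c n → (l ≼ c ⊞ con 3) ⟨ 1 ⟩⇒ (c ≼ con 1 ⊞ n) ⟨ 1 ⟩⇒ 1 ⊢ l ≼ i ⊞
                    (2 ⊠ n ⊞ con 6)) i l c n ≤c c-small))
                  (meet-index {i} {l} {z} i∈ l∈ i≤l)) (inj₂ (sym (m+[n∸m]≡n i≤l)))

        -- The translate by `p ∙ q`, advanced two steps, lies nearly in the translates with index
        -- `a + b` to `a + b + 4` and nearly in those with index `c + 1` to `c + 3`, so two of these
        -- meet. Advancing by two steps keeps all indices natural numbers.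
        quasi-hom : ∀ {p q a b c} → a ≤ suc n → b ≤ suc n → c ≤ suc n →
          p ~ a ·ₘ g → q ~ b ·ₘ g → p ∙ q ~ c ·ₘ g → Offset n (a + b) c
        quasi-hom {p} {q} {a} {b} {c} a≤ b≤ c≤ pa qb pqc =
          let z , z∈ , z∈′ = common S W (trio ((c + 2) ·ₘ g))
                (lin 5 (λ m k y x s → (m ≼ 16 ⊠ s) ⟨ 1 ⟩⇒ (k ≼ 4 ⊠ s) ⟨ 1 ⟩⇒ (y ≑ x) ⟨ 1 ⟩⇒ (con 1 ⊞ 100 ⊠ s ≼ x) ⟨ 1 ⟩⇒ 1 ⊢ con 1
                    ⊞ m ⊞ k ≼ y) (# (S ∖ W)) (# (S ∖ trio ((c + 2) ·ₘ g))) (# S) x s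
                  first (near-trio (~-multiple c 2 pqc)) (#-⇀ X ((p ∙ q) ∙ 2 ·ₘ g)) s-small)
              i , i≥ , i≤ , i∈ = window⁻ (a + b) 4 {z} z∈
              l , l≥ , l≤ , l∈ = trio-index (c + 2) {z} (≤-trans (s≤s z≤n) (m≤n+m 2 c)) z∈′
          in relate {a + b} {c} {i} {l} {z} i≥ i≤
               (lin 2 (λ c l → (c ⊞ con 2 ≼ con 1 ⊞ l) ⟨ 1 ⟩⇒ 1 ⊢ c ⊞ con 1 ≼ l) c l l≥)
                  (lin 2 (λ c l → (l ≼ con 1 ⊞ (c ⊞ con 2)) ⟨ 1 ⟩⇒ 1 ⊢ l ≼ c ⊞ con 3) c l l≤)
               (+-mono-≤ a≤ b≤) c≤ i∈ l∈
          where
          t : Carrier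
          t = q ∙ 1 ·ₘ g
          S W Tr : Sub
          S = X ⇀ ((p ∙ q) ∙ 2 ·ₘ g)
          W = window (a + b) 4
          Tr = trio ((a + 1) ·ₘ g)
          P₁ P₂ P₃ : Sub
          P₁ = X ⇀ ((a + 1) ·ₘ g // g)
          P₂ = X ⇀ ((a + 1) ·ₘ g)
          P₃ = X ⇀ ((a + 1) ·ₘ g ∙ g)
          S⊑ : # (S ∖ (Tr ⇀ t)) ≤ 4 * s
          S⊑ = ≤-trans (≤-reflexive (trans (#-cong {S ∖ (Tr ⇀ t)} {((X ⇀ (p ∙ 1 ·ₘ g)) ∖ Tr) ⇀ t} λ z →
              cong (λ y → X y ∧ not (Tr (z // t))) (group 4 (λ z p q g → z ⊘ ((p ⊙ q) ⊙ (g ⊙ (g ⊙ one))) ≗ (z ⊘ (q ⊙ (g ⊙ one))) ⊘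
                  (p ⊙ (g ⊙ one))) refl z p q g))
              (#-⇀ ((X ⇀ (p ∙ 1 ·ₘ g)) ∖ Tr) t)))
            (near-trio (~-multiple a 1 pa))
          piece : ∀ i → a ≤ i → i ≤ a + 2 → # ((X ⇀ (i ·ₘ g ∙ t)) ∖ W) ≤ 4 * s
          piece i i≥ i≤ = ≤-trans (∖-mono {X ⇀ (i ·ₘ g ∙ t)} {X ⇀ (q ∙ (1 + i) ·ₘ g)} {W} {trio ((b + (1 + i)) ·ₘ g)}
              (λ z m → subst (_∈ X) (group 4 (λ z q g G → z ⊘ (G ⊙ (q ⊙ (g ⊙ one))) ≗ z ⊘ (q ⊙ (g ⊙ G))) refl z q g (i ·ₘ g)) m)
              (trio-⊑-window (b + (1 + i)) (a + b) 4 (≤-trans (s≤s z≤n) (m≤n+m (suc i) b))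
                (lin 3 (λ a b i → (a ≼ i) ⟨ 1 ⟩⇒ 1 ⊢ con 1 ⊞ (a ⊞ b) ≼ b ⊞ (con 1 ⊞ i)) a b i i≥)
                    (lin 3 (λ a b i → (i ≼ a ⊞ con 2) ⟨ 1 ⟩⇒ 1 ⊢ con 1 ⊞ (b ⊞ (con 1 ⊞ i)) ≼ a ⊞ b ⊞ con 4) a b i i≤)))
            (near-trio (~-multiple b (1 + i) qb))
          a+1 : (a + 1) ·ₘ g ≡ g ∙ a ·ₘ g
          a+1 = cong (_·ₘ g) (+-comm a 1)
          at₁ : ∀ z → (P₁ ⇀ t) z ≡ (X ⇀ (a ·ₘ g ∙ t)) z
          at₁ z = cong X (trans (cong (λ u → (z // t) // (u // g)) a+1) (group 4
              (λ z t g G → (z ⊘ t) ⊘ ((g ⊙ G) ⊘ g) ≗ z ⊘ (G ⊙ t)) refl z t g (a ·ₘ g)))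
          at₂ : ∀ z → (P₂ ⇀ t) z ≡ (X ⇀ ((a + 1) ·ₘ g ∙ t)) z
          at₂ z = cong X (group 3 (λ z t G → (z ⊘ t) ⊘ G ≗ z ⊘ (G ⊙ t)) refl z t ((a + 1) ·ₘ g))
          at₃ : ∀ z → (P₃ ⇀ t) z ≡ (X ⇀ ((a + 2) ·ₘ g ∙ t)) z
          at₃ z = cong X (trans (cong (λ u → (z // t) // (u ∙ g)) a+1) (trans
            (group 4 (λ z t g G → (z ⊘ t) ⊘ ((g ⊙ G) ⊙ g) ≗ z ⊘ ((g ⊙ (g ⊙ G)) ⊙ t)) refl z t g (a ·ₘ g))
            (cong (λ u → z // (u ∙ t)) (cong (_·ₘ g) (+-comm 2 a)))))
          deficit : ∀ {S S′ : Sub} → (∀ z → S z ≡ S′ z) → # (S′ ∖ W) ≤ 4 * s → # (S ∖ W) ≤ 4 * s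
          deficit {S} {S′} e d = ≤-trans (≤-reflexive (#-cong {S ∖ W} {S′ ∖ W} λ z → cong (_∧ not (W z)) (e z))) d
          first : # (S ∖ W) ≤ 16 * s
          first = lin 8 (λ m u v d1 d23 d2 d3 s → (m ≼ u ⊞ v) ⟨ 1 ⟩⇒ (u ≼ 4 ⊠ s) ⟨ 1 ⟩⇒ (v ≼ d1 ⊞ d23) ⟨ 1 ⟩⇒ (d23 ≼ d2 ⊞ d3) ⟨ 1
              ⟩⇒ (d1 ≼ 4 ⊠ s) ⟨ 1 ⟩⇒ (d2 ≼ 4 ⊠ s) ⟨ 1 ⟩⇒ (d3 ≼ 4 ⊠ s) ⟨ 1 ⟩⇒ 1 ⊢ m ≼ 16 ⊠ s) (# (S ∖ W)) (# (S ∖ (Tr ⇀ t)))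
              (# ((Tr ⇀ t) ∖ W)) (# ((P₁ ⇀ t) ∖ W)) (# (((P₂ ∪ P₃) ⇀ t) ∖ W)) (# ((P₂ ⇀ t) ∖ W)) (# ((P₃ ⇀ t) ∖ W)) s
            (∖-trans S (Tr ⇀ t) W) S⊑ (∖-∪ (P₁ ⇀ t) ((P₂ ∪ P₃) ⇀ t) W) (∖-∪ (P₂ ⇀ t) (P₃ ⇀ t) W)
            (deficit {P₁ ⇀ t} at₁ (piece a ≤-refl (m≤m+n a 2))) (deficit {P₂ ⇀ t} at₂ (piece (a + 1) (m≤m+n a 1) (+-monoʳ-≤ a (s≤s z≤n))))
            (deficit {P₃ ⇀ t} at₃ (piece (a + 2) (m≤m+n a 2) ≤-refl))

        -- The comparison of `quasi-hom` again; knowing that `y` lies in `Xₙ j` yields the first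
        -- window directly from `miss-close`.
        position : ∀ {y j c} → j ≤ n → c ≤ suc n → y ∈ Xₙ j → y ~ c ·ₘ g → Offset n j c
        position {y} {j} {c} j≤ c≤ y∈ yc =
          let z , z∈ , z∈′ = common S W (trio ((c + 2) ·ₘ g))
                (lin 5 (λ m k u x s → (m ≼ s) ⟨ 1 ⟩⇒ (k ≼ 4 ⊠ s) ⟨ 1 ⟩⇒ (u ≑ x) ⟨ 1 ⟩⇒ (con 1 ⊞ 100 ⊠ s ≼ x) ⟨ 1 ⟩⇒ 1 ⊢ con 1 ⊞ m
                    ⊞ k ≼ u) (# (S ∖ W)) (# (S ∖ trio ((c + 2) ·ₘ g))) (# S) x s
                  first (near-trio (~-multiple c 2 yc)) (#-⇀ X (y ∙ 2 ·ₘ g)) s-small)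
              i , i≥ , i≤ , i∈ = window⁻ j 4 {z} z∈
              l , l≥ , l≤ , l∈ = trio-index (c + 2) {z} (≤-trans (s≤s z≤n) (m≤n+m 2 c)) z∈′
          in relate {j} {c} {i} {l} {z} i≥ i≤
               (lin 2 (λ c l → (c ⊞ con 2 ≼ con 1 ⊞ l) ⟨ 1 ⟩⇒ 1 ⊢ c ⊞ con 1 ≼ l) c l l≥)
                  (lin 2 (λ c l → (l ≼ con 1 ⊞ (c ⊞ con 2)) ⟨ 1 ⟩⇒ 1 ⊢ l ≼ c ⊞ con 3) c l l≤)
               (lin 2 (λ j n → (j ≼ n) ⟨ 1 ⟩⇒ 1 ⊢ j ≼ (con 1 ⊞ n) ⊞ (con 1 ⊞ n)) j n j≤) c≤ i∈ l∈
          where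
          S W : Sub
          S = X ⇀ (y ∙ 2 ·ₘ g)
          W = window j 4
          t : Carrier
          t = (j + 2) ·ₘ g
          first : # (S ∖ W) ≤ s
          first = ≤-trans (∖-mono {S} {X ⇀ ((y // j ·ₘ g) ∙ t)} {W} {(X ⇀ t) ∪ (X ⇀ (g ∙ t))}
              (λ z m → subst (_∈ X) (trans (group 4 (λ z y G H → z ⊘ (y ⊙ H) ≗ z ⊘ ((y ⊘ G) ⊙ (G ⊙ H))) refl z y (j ·ₘ g) (2 ·ₘ g))
                (cong (λ u → z // ((y // j ·ₘ g) ∙ u)) (sym (·ₘ-+ j 2 g)))) m)
              (λ z m → ∈∪-elim (X ⇀ t) (X ⇀ (g ∙ t)) {z} m
                (λ w → window⁺ j 4 (j + 2) {z} (m≤m+n j 2) (+-monoʳ-≤ j (s≤s (s≤s z≤n))) w)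
                (λ w → window⁺ j 4 (suc (j + 2)) {z} (≤-trans (m≤m+n j 2) (n≤1+n _)) (lin 1 (λ j → 1 ⊢ con 1 ⊞ (j ⊞ con 2) ≼ j ⊞ con 4) j) w)))
            (miss-close t y∈)

  -- Averaging a quasi-homomorphism

  infix 4 _≅_[_]
  -- Congruence without subtraction: multiples of the modulus may be added on either side.
  _≅_[_] : ℕ → ℕ → ℕ → Set
  a ≅ b [ M ] = ∃ λ u → ∃ λ v → a + u * M ≡ b + v * M

  ≅-refl : ∀ {a M} → a ≅ a [ M ]
  ≅-refl = 0 , 0 , refl

  ≅-sym : ∀ {a b M} → a ≅ b [ M ] → b ≅ a [ M ]
  ≅-sym (u , v , p) = v , u , sym p

  ≅-trans : ∀ {a b c M} → a ≅ b [ M ] → b ≅ c [ M ] → a ≅ c [ M ]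
  ≅-trans {a} {b} {c} {M} (u , v , p) (u′ , v′ , q) = u + u′ , v + v′ ,
    trans (cong (a +_) (*-distribʳ-+ M u u′)) (trans
      ((λ h0 h1 → ≤-antisym (lin 7 (λ a b c U V U′ V′ → (a ⊞ U ≐ b ⊞ V) ⟨ 1 ⟩⇒ (b ⊞ U′ ≐ c ⊞ V′) ⟨ 1 ⟩⇒ 1 ⊢ a ⊞ (U ⊞ U′) ≼ c ⊞
          (V ⊞ V′)) a b c (u * M) (v * M) (u′ * M) (v′ * M) h0 h1) (lin 7
          (λ a b c U V U′ V′ → (a ⊞ U ≑ b ⊞ V) ⟨ 1 ⟩⇒ (b ⊞ U′ ≑ c ⊞ V′) ⟨ 1 ⟩⇒ 1 ⊢ c ⊞ (V ⊞ V′) ≼ a ⊞ (U ⊞ U′)) a b c (u * M)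
          (v * M) (u′ * M) (v′ * M) h0 h1)) p q)
      (sym (cong (c +_) (*-distribʳ-+ M v v′))))

  ≅-+ : ∀ {a b c d M} → a ≅ b [ M ] → c ≅ d [ M ] → a + c ≅ b + d [ M ]
  ≅-+ {a} {b} {c} {d} {M} (u , v , p) (u′ , v′ , q) = u + u′ , v + v′ ,
    trans (cong (a + c +_) (*-distribʳ-+ M u u′)) (trans
      ((λ h0 h1 → ≤-antisym (lin 8 (λ a b c d U V U′ V′ → (a ⊞ U ≐ b ⊞ V) ⟨ 1 ⟩⇒ (c ⊞ U′ ≐ d ⊞ V′) ⟨ 1 ⟩⇒ 1 ⊢ a ⊞ c ⊞ (U ⊞ U′) ≼ b
          ⊞ d ⊞ (V ⊞ V′)) a b c d (u * M) (v * M) (u′ * M) (v′ * M) h0 h1)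
          (lin 8 (λ a b c d U V U′ V′ → (a ⊞ U ≑ b ⊞ V) ⟨ 1 ⟩⇒ (c ⊞ U′ ≑ d ⊞ V′) ⟨ 1 ⟩⇒ 1 ⊢ b ⊞ d ⊞ (V ⊞ V′) ≼ a ⊞ c ⊞ (U ⊞ U′)) a
          b c d (u * M) (v * M) (u′ * M) (v′ * M) h0 h1)) p q)
      (sym (cong (b + d +_) (*-distribʳ-+ M v v′))))

  ≅-cancel : ∀ {a b c d M} → a + c ≅ b + d [ M ] → c ≅ d [ M ] → a ≅ b [ M ]
  ≅-cancel {a} {b} {c} {d} {M} (u , v , p) (u′ , v′ , q) = u + v′ , v + u′ ,
    trans (cong (a +_) (*-distribʳ-+ M u v′)) (trans
      ((λ h0 h1 → ≤-antisym (lin 8 (λ a b c d U V U′ V′ → (a ⊞ c ⊞ U ≐ b ⊞ d ⊞ V) ⟨ 1 ⟩⇒ (c ⊞ U′ ≑ d ⊞ V′) ⟨ 1 ⟩⇒ 1 ⊢ a ⊞ (U ⊞ V′)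
          ≼ b ⊞ (V ⊞ U′)) a b c d (u * M) (v * M) (u′ * M) (v′ * M) h0 h1)
          (lin 8 (λ a b c d U V U′ V′ → (a ⊞ c ⊞ U ≑ b ⊞ d ⊞ V) ⟨ 1 ⟩⇒ (c ⊞ U′ ≐ d ⊞ V′) ⟨ 1 ⟩⇒ 1 ⊢ b ⊞ (V ⊞ U′) ≼ a ⊞ (U ⊞ V′)) a
          b c d (u * M) (v * M) (u′ * M) (v′ * M) h0 h1)) p q)
      (sym (cong (b +_) (*-distribʳ-+ M v u′))))

  ≅-% : ∀ {a b M} .{{_ : NonZero M}} → a ≅ b [ M ] → a % M ≡ b % M
  ≅-% {a} {b} {M} (u , v , p) = trans (sym ([m+kn]%n≡m%n a u M)) (trans (cong (_% M) p) ([m+kn]%n≡m%n b v M))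

  %-≅ : ∀ a M .{{_ : NonZero M}} → a ≅ a % M [ M ]
  %-≅ a M = 0 , a / M , trans (+-identityʳ a) (m≡m%n+[m/n]*n a M)

  ≅-unique : ∀ {a b M} .{{_ : NonZero M}} → a < M → b < M → a ≅ b [ M ] → a ≡ b
  ≅-unique a< b< p = trans (sym (m<n⇒m%n≡m a<)) (trans (≅-% p) (m<n⇒m%n≡m b<))

  -- The defect of ψ is a bounded integer cocycle, and its average over the group is a coboundary for it.
  module Averaging (𝔾 : FinAb) {n : ℕ} (n>36 : 36 < n) (ψ : FinAb.Carrier 𝔾 → ℕ)
    (quasi : ∀ p q → Offset n (ψ p + ψ q) (ψ (FinAb._∙_ 𝔾 p q))) where
    open Counting 𝔾

    private
      instance
        n≢0 : NonZero n
        n≢0 = >-nonZero (≤-trans (s≤s z≤n) n>36)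

    -- The defect `ψ p + ψ q - ψ (p ∙ q)` modulo `n`, shifted by 9 to become a natural number up to
    -- 18.
    E : Carrier → Carrier → ℕ
    E p q = proj₁ (proj₂ (proj₂ (quasi p q)))

    E≤ : ∀ p q → E p q ≤ 18
    E≤ p q = proj₁ (proj₂ (proj₂ (proj₂ (quasi p q))))

    E-≅ : ∀ p q → ψ p + ψ q + 9 ≅ ψ (p ∙ q) + E p q [ n ]
    E-≅ p q = let u , v , _ , _ , eq = quasi p q in u , v , eq

    -- Associativity gives the identity modulo `n`. Both sides are at most 36, so `n > 36` makes it
    -- an identity of integers, which is what allows averaging.
    cocycle : ∀ p q r → E p q + E (p ∙ q) r ≡ E q r + E p (q ∙ r)
    cocycle p q r = ≅-unique (below (E≤ p q) (E≤ (p ∙ q) r)) (below (E≤ q r) (E≤ p (q ∙ r)))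
      (≅-cancel {c = ψ ((p ∙ q) ∙ r)} {d = ψ (p ∙ (q ∙ r))}
        (≅-trans (≅-sym left) right) (subst (λ y → ψ ((p ∙ q) ∙ r) ≅ ψ y [ n ]) (assoc p q r) ≅-refl))
      where
      below : ∀ {a b} → a ≤ 18 → b ≤ 18 → a + b < n
      below {a} {b} p q = lin 3 (λ a b n → (a ≼ con 18) ⟨ 1 ⟩⇒ (b ≼ con 18) ⟨ 1 ⟩⇒ (con 1 ⊞ con 36 ≼ n) ⟨ 1 ⟩⇒ 1 ⊢ con 1 ⊞ a ⊞ b ≼ n) a b n p q n>36
      left : ψ p + ψ q + ψ r + 18 ≅ (E p q + E (p ∙ q) r) + ψ ((p ∙ q) ∙ r) [ n ]
      left = ≅-cancel {c = ψ (p ∙ q)} {d = ψ (p ∙ q)}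
        (subst₂-≅ ((≤-antisym (lin 4 (λ a b c d → 1 ⊢ a ⊞ b ⊞ con 9 ⊞ (d ⊞ c ⊞ con 9) ≼ a ⊞ b ⊞ c ⊞ con 18 ⊞ d) (ψ p) (ψ q) (ψ r)
            (ψ (p ∙ q)) ) (lin 4 (λ a b c d → 1 ⊢ a ⊞ b ⊞ c ⊞ con 18 ⊞ d ≼ a ⊞ b ⊞ con 9 ⊞ (d ⊞ c ⊞ con 9)) (ψ p) (ψ q) (ψ r)
            (ψ (p ∙ q)) )))
          ((≤-antisym (lin 4 (λ d e f k → 1 ⊢ d ⊞ e ⊞ (k ⊞ f) ≼ e ⊞ f ⊞ k ⊞ d) (ψ (p ∙ q)) (E p q) (E (p ∙ q) r) (ψ ((p ∙ q) ∙ r))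
              ) (lin 4 (λ d e f k → 1 ⊢ e ⊞ f ⊞ k ⊞ d ≼ d ⊞ e ⊞ (k ⊞ f)) (ψ (p ∙ q)) (E p q) (E (p ∙ q) r) (ψ ((p ∙ q) ∙ r)) )))
          (≅-+ (E-≅ p q) (E-≅ (p ∙ q) r))) ≅-refl
        where
        subst₂-≅ : ∀ {a b c d} → a ≡ b → c ≡ d → a ≅ c [ n ] → b ≅ d [ n ]
        subst₂-≅ refl refl r = r
      right : ψ p + ψ q + ψ r + 18 ≅ (E q r + E p (q ∙ r)) + ψ (p ∙ (q ∙ r)) [ n ]
      right = ≅-cancel {c = ψ (q ∙ r)} {d = ψ (q ∙ r)}
        (subst₂-≅ ((≤-antisym (lin 4 (λ a b c d → 1 ⊢ b ⊞ c ⊞ con 9 ⊞ (a ⊞ d ⊞ con 9) ≼ a ⊞ b ⊞ c ⊞ con 18 ⊞ d) (ψ p) (ψ q) (ψ r)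
            (ψ (q ∙ r)) ) (lin 4 (λ a b c d → 1 ⊢ a ⊞ b ⊞ c ⊞ con 18 ⊞ d ≼ b ⊞ c ⊞ con 9 ⊞ (a ⊞ d ⊞ con 9)) (ψ p) (ψ q) (ψ r)
            (ψ (q ∙ r)) )))
          ((≤-antisym (lin 4 (λ d e f k → 1 ⊢ d ⊞ e ⊞ (k ⊞ f) ≼ e ⊞ f ⊞ k ⊞ d) (ψ (q ∙ r)) (E q r) (E p (q ∙ r)) (ψ (p ∙ (q ∙ r)))
              ) (lin 4 (λ d e f k → 1 ⊢ e ⊞ f ⊞ k ⊞ d ≼ d ⊞ e ⊞ (k ⊞ f)) (ψ (q ∙ r)) (E q r) (E p (q ∙ r)) (ψ (p ∙ (q ∙ r))) )))
          (≅-+ (E-≅ q r) (E-≅ p (q ∙ r)))) ≅-refl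
        where
        subst₂-≅ : ∀ {a b c d} → a ≡ b → c ≡ d → a ≅ c [ n ] → b ≅ d [ n ]
        subst₂-≅ refl refl r = r

    F : Carrier → ℕ
    F p = ∑ᴳ (E p)

    F≤ : ∀ p → F p ≤ 18 * h
    F≤ p = ≤-trans (∑-mono elems (E≤ p)) (≤-reflexive (∑-const 18))

    -- The cocycle identity summed over `r`, since `q ∙ r` runs through the group together with `r`.
    F-coboundary : ∀ p q → h * E p q + F (p ∙ q) ≡ F p + F q
    F-coboundary p q = begin
      h * E p q + F (p ∙ q) ≡⟨ cong (_+ F (p ∙ q)) (trans (*-comm h (E p q)) (sym (∑-const (E p q)))) ⟩
      ∑ᴳ (λ _ → E p q) + F (p ∙ q) ≡⟨ ∑-+ elems _ _ ⟨
      ∑ᴳ (λ r → E p q + E (p ∙ q) r) ≡⟨ ∑-cong elems (cocycle p q) ⟩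
      ∑ᴳ (λ r → E q r + E p (q ∙ r)) ≡⟨ ∑-+ elems _ _ ⟩
      F q + ∑ᴳ (λ r → E p (q ∙ r)) ≡⟨ cong (F q +_) (reindex (q ∙_) (_// q)
          (λ r → group 2 (λ q r → (q ⊙ r) ⊘ q ≗ r) refl q r) (λ r → group 2 (λ q r → q ⊙ (r ⊘ q) ≗ r) refl q r) (E p)) ⟩
      F q + F p ≡⟨ +-comm (F q) (F p) ⟩
      F p + F q ∎
      where open ≡-Reasoning

    M : ℕ
    M = n * h

    opaque
      -- `ψ p + 9` minus the average `F p / h`, multiplied by `h` to be integral and read modulo
      -- `M = n * h`. Adding `M` prevents truncation.
      Φ : Carrier → ℕ
      Φ p = (h * ψ p + 9 * h + M) ∸ F p

      Φ-eq : ∀ p → Φ p + F p ≡ h * ψ p + 9 * h + M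
      Φ-eq p = m∸n+n≡m (≤-trans (F≤ p) (≤-trans (*-monoˡ-≤ h (≤-trans (lin 1 (λ n → (con 1 ⊞ con 36 ≼ n) ⟨ 18 ⟩⇒ 37 ⊢ con 18 ≼ n)
          n n>36) ≤-refl)) (m≤n+m M _)))

    Φ-hom : ∀ p q → Φ p + Φ q ≅ Φ (p ∙ q) [ M ]
    Φ-hom p q =
      let u , v , e , _ , eq = quasi p q in
      u , suc v , (λ h0 h1 h2 h3 h4 → ≤-antisym (lin 14 (λ a b c Fa Fb Fc pa pb pc he h M uM vM → (a ⊞ Fa ≐ pa ⊞ 9 ⊠ h ⊞ M) ⟨ 1 ⟩⇒
          (b ⊞ Fb ≐ pb ⊞ 9 ⊠ h ⊞ M) ⟨ 1 ⟩⇒ (c ⊞ Fc ≑ pc ⊞ 9 ⊠ h ⊞ M) ⟨ 1 ⟩⇒ (he ⊞ Fc ≐ Fa ⊞ Fb) ⟨ 1 ⟩⇒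
          (pa ⊞ pb ⊞ 9 ⊠ h ⊞ uM ≐ pc ⊞ he ⊞ vM) ⟨ 1 ⟩⇒ 1 ⊢ a ⊞ b ⊞ uM ≼ c ⊞ (M ⊞ vM)) (Φ p) (Φ q) (Φ (p ∙ q)) (F p) (F q)
          (F (p ∙ q)) (h * ψ p) (h * ψ q) (h * ψ (p ∙ q)) (h * e) h M (u * M) (v * M) h0 h1 h2 h3 h4)
          (lin 14 (λ a b c Fa Fb Fc pa pb pc he h M uM vM → (a ⊞ Fa ≑ pa ⊞ 9 ⊠ h ⊞ M) ⟨ 1 ⟩⇒ (b ⊞ Fb ≑ pb ⊞ 9 ⊠ h ⊞ M) ⟨ 1 ⟩⇒
          (c ⊞ Fc ≐ pc ⊞ 9 ⊠ h ⊞ M) ⟨ 1 ⟩⇒ (he ⊞ Fc ≑ Fa ⊞ Fb) ⟨ 1 ⟩⇒ (pa ⊞ pb ⊞ 9 ⊠ h ⊞ uM ≑ pc ⊞ he ⊞ vM) ⟨ 1 ⟩⇒ 1 ⊢ c ⊞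
          (M ⊞ vM) ≼ a ⊞ b ⊞ uM) (Φ p) (Φ q) (Φ (p ∙ q)) (F p) (F q) (F (p ∙ q)) (h * ψ p) (h * ψ q) (h * ψ (p ∙ q)) (h * e) h M
          (u * M) (v * M) h0 h1 h2 h3 h4))
        (Φ-eq p) (Φ-eq q) (Φ-eq (p ∙ q)) (F-coboundary p q) (scaled u v e eq)
      where
      assoc₃ : ∀ w → h * (w * n) ≡ w * M
      assoc₃ w = trans (*-comm h (w * n)) (*-assoc w n h)
      scaled : ∀ u v e → ψ p + ψ q + 9 + u * n ≡ ψ (p ∙ q) + e + v * n → h * ψ p + h * ψ q + 9 * h + u * M ≡ h * ψ (p ∙ q) + h * e + v * M
      scaled u v e eq = begin
        h * ψ p + h * ψ q + 9 * h + u * M ≡⟨ cong₂ _+_ (cong₂ _+_ (sym (*-distribˡ-+ h (ψ p) (ψ q))) (*-comm 9 h)) (sym (assoc₃ u)) ⟩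
        h * (ψ p + ψ q) + h * 9 + h * (u * n) ≡⟨ cong (_+ h * (u * n)) (*-distribˡ-+ h (ψ p + ψ q) 9) ⟨
        h * (ψ p + ψ q + 9) + h * (u * n) ≡⟨ *-distribˡ-+ h _ _ ⟨
        h * (ψ p + ψ q + 9 + u * n) ≡⟨ cong (h *_) eq ⟩
        h * (ψ (p ∙ q) + e + v * n) ≡⟨ *-distribˡ-+ h _ _ ⟩
        h * (ψ (p ∙ q) + e) + h * (v * n) ≡⟨ cong₂ _+_ (*-distribˡ-+ h _ _) (assoc₃ v) ⟩
        h * ψ (p ∙ q) + h * e + v * M ∎
        where open ≡-Reasoning

    -- Read as `Φ p = h * j ± 18 * h`: the correction `F p` and the offset each contribute up to
    -- `18 * h` to `r`.
    Φ-position : ∀ {p j} → Offset n j (ψ p) → ∃ λ r → r ≤ 36 * h × Φ p + r ≅ h * j + 18 * h [ M ]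
    Φ-position {p} {j} (u , v , e , e≤ , eq) = F p + h * e ,
      ≤-trans (+-mono-≤ (F≤ p) (≤-trans (*-monoʳ-≤ h e≤) (≤-reflexive (*-comm h 18)))) (lin 1 (λ h → 1 ⊢ 18 ⊠ h ⊞ 18 ⊠ h ≼ 36 ⊠ h) h) ,
      v , suc u , (λ h0 h1 → ≤-antisym (lin 9 (λ a Fa he pa hj h M uM vM → (a ⊞ Fa ≐ pa ⊞ 9 ⊠ h ⊞ M) ⟨ 1 ⟩⇒
          (hj ⊞ 9 ⊠ h ⊞ uM ≑ pa ⊞ he ⊞ vM) ⟨ 1 ⟩⇒ 1 ⊢ a ⊞ (Fa ⊞ he) ⊞ vM ≼ hj ⊞ 18 ⊠ h ⊞ (M ⊞ uM)) (Φ p) (F p) (h * e) (h * ψ p)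
          (h * j) h M (u * M) (v * M) h0 h1) (lin 9 (λ a Fa he pa hj h M uM vM → (a ⊞ Fa ≑ pa ⊞ 9 ⊠ h ⊞ M) ⟨ 1 ⟩⇒
          (hj ⊞ 9 ⊠ h ⊞ uM ≐ pa ⊞ he ⊞ vM) ⟨ 1 ⟩⇒ 1 ⊢ hj ⊞ 18 ⊠ h ⊞ (M ⊞ uM) ≼ a ⊞ (Fa ⊞ he) ⊞ vM) (Φ p) (F p) (h * e) (h * ψ p)
          (h * j) h M (u * M) (v * M) h0 h1)) (Φ-eq p) scaled
      where
      assoc₃ : ∀ w → h * (w * n) ≡ w * M
      assoc₃ w = trans (*-comm h (w * n)) (*-assoc w n h)
      scaled : h * j + 9 * h + u * M ≡ h * ψ p + h * e + v * M
      scaled = begin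
        h * j + 9 * h + u * M ≡⟨ cong₂ _+_ (cong (h * j +_) (*-comm 9 h)) (sym (assoc₃ u)) ⟩
        h * j + h * 9 + h * (u * n) ≡⟨ cong (_+ h * (u * n)) (*-distribˡ-+ h j 9) ⟨
        h * (j + 9) + h * (u * n) ≡⟨ *-distribˡ-+ h _ _ ⟨
        h * (j + 9 + u * n) ≡⟨ cong (h *_) eq ⟩
        h * (ψ p + e + v * n) ≡⟨ *-distribˡ-+ h _ _ ⟩
        h * (ψ p + e) + h * (v * n) ≡⟨ cong₂ _+_ (*-distribˡ-+ h _ _) (assoc₃ v) ⟩
        h * ψ p + h * e + v * M ∎
        where open ≡-Reasoning

  -- The image of a homomorphism into a cyclic group

  module CyclicImage (𝔾 : FinAb) {M : ℕ} (M>0 : 1 ≤ M) (Φ : FinAb.Carrier 𝔾 → ℕ)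
    (hom : ∀ p q → Φ p + Φ q ≅ Φ (FinAb._∙_ 𝔾 p q) [ M ]) where
    open Counting 𝔾

    private
      instance
        M≢0 : NonZero M
        M≢0 = >-nonZero M>0

    Attained : ℕ → Set
    Attained a = ∃ λ p → Φ p ≅ a [ M ]

    attained? : ∀ a → Attained a ⊎ ¬ Attained a
    attained? a with search (λ p → Φ p % M ≡ᵇ a % M)
    ... | inj₁ (p , q) = inj₁ (p , ≅-trans (%-≅ (Φ p) M) (≅-trans (subst (λ y → Φ p % M ≅ y [ M ]) (≡ᵇ⇒≡ (Φ p % M) (a % M) q)
        ≅-refl) (≅-sym (%-≅ a M))))
    ... | inj₂ none = inj₂ λ { (p , q) → none p (≡⇒≡ᵇ (Φ p % M) (a % M) (≅-% q)) }

    Φε : Φ ε ≅ 0 [ M ]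
    Φε = ≅-cancel {a = Φ ε} {b = 0} {c = Φ ε} {d = Φ ε} (subst (λ y → Φ ε + Φ ε ≅ Φ y [ M ]) (identityˡ ε) (hom ε ε)) ≅-refl

    -- The least positive attained residue generates the image, which is therefore cyclic of order
    -- `M / d`.
    Least : ℕ → Set
    Least d = 1 ≤ d × Attained d × (∀ a → 1 ≤ a → a < d → ¬ Attained a)

    least-attained : ∀ m → (∃ Least) ⊎ (∀ a → 1 ≤ a → a ≤ m → ¬ Attained a)
    least-attained zero = inj₂ λ a 1≤ a≤ → ⊥-elim (<⇒≱ 1≤ a≤)
    least-attained (suc m) with least-attained m
    ... | inj₁ r = inj₁ r
    ... | inj₂ low with attained? (suc m)
    ... | inj₁ r = inj₁ (suc m , s≤s z≤n , r , λ a 1≤ a< → low a 1≤ (≤-pred a<))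
    ... | inj₂ q = inj₂ λ a 1≤ a≤ → at a 1≤ (m≤n⇒m<n∨m≡n a≤)
      where
      at : ∀ a → 1 ≤ a → a < suc m ⊎ a ≡ suc m → ¬ Attained a
      at a 1≤ (inj₁ a<) = low a 1≤ (≤-pred a<)
      at a 1≤ (inj₂ refl) = q

    opaque
      least : ∃ Least
      least with least-attained M
      ... | inj₁ r = r
      ... | inj₂ low = ⊥-elim (low M M>0 ≤-refl (ε , ≅-trans Φε (1 , 0 , refl)))

    d : ℕ
    d = proj₁ least

    d>0 : 1 ≤ d
    d>0 = proj₁ (proj₂ least)

    p₀ : Carrier
    p₀ = proj₁ (proj₁ (proj₂ (proj₂ least)))

    Φp₀ : Φ p₀ ≅ d [ M ]
    Φp₀ = proj₂ (proj₁ (proj₂ (proj₂ least)))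

    d-least : ∀ {p a} → 1 ≤ a → Φ p ≅ a [ M ] → d ≤ a
    d-least {p} {a} 1≤ q with d ≤? a
    ... | yes r = r
    ... | no r = ⊥-elim (proj₂ (proj₂ (proj₂ least)) a 1≤ (≰⇒> r) (p , q))

    private
      instance
        d≢0 : NonZero d
        d≢0 = >-nonZero d>0

    multiple : ∀ k → Φ (k ·ₘ p₀) ≅ k * d [ M ]
    multiple zero = Φε
    multiple (suc k) = ≅-trans (≅-sym (hom p₀ (k ·ₘ p₀))) (≅-+ Φp₀ (multiple k))

    -- Division with remainder: subtracting multiples of `p₀` attains the remainder, which is
    -- smaller than `d` and so must vanish.
    attained-% : ∀ {p a} → Φ p ≅ a [ M ] → a % d ≡ 0
    attained-% {p} {a} q with 1 ≤? a % d
    ... | no r = n≤0⇒n≡0 (≤-pred (≰⇒> r))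
    ... | yes r = ⊥-elim (<⇒≱ (m%n<n a d) (d-least {p // k ·ₘ p₀} r
        (≅-cancel {c = Φ (k ·ₘ p₀)} {d = k * d}
          (≅-trans (subst (λ y → Φ (p // k ·ₘ p₀) + Φ (k ·ₘ p₀) ≅ Φ y [ M ]) (group 2 (λ p q → (p ⊘ q) ⊙ q ≗ p) refl p (k ·ₘ p₀))
              (hom (p // k ·ₘ p₀) (k ·ₘ p₀)))
            (subst (λ y → Φ p ≅ y [ M ]) (m≡m%n+[m/n]*n a d) q)) (multiple k))))
      where
      k : ℕ
      k = a / d

    exact : ∀ {p a} → Φ p ≅ a [ M ] → a / d * d ≡ a
    exact {p} {a} q = trans (cong (_+ a / d * d) (sym (attained-% q))) (sym (m≡m%n+[m/n]*n a d))

    opaque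
      N : ℕ
      N = M / d

      Nd : N * d ≡ M
      Nd = exact {ε} (≅-trans Φε (1 , 0 , refl))

      κ : Carrier → ℕ
      κ p = Φ p / d

      κd : ∀ p → κ p * d ≡ Φ p
      κd p = exact {p} ≅-refl

    N>0 : 1 ≤ N
    N>0 = positive N Nd
      where
      positive : ∀ k → k * d ≡ M → 1 ≤ k
      positive zero eq = ⊥-elim (<⇒≱ M>0 (≤-reflexive (sym eq)))
      positive (suc k) _ = s≤s z≤n

    private
      instance
        N≢0 : NonZero N
        N≢0 = >-nonZero N>0

    divide : ∀ {a b} → a * d ≅ b * d [ M ] → a ≅ b [ N ]
    divide {a} {b} (u , v , eq) = u , v , *-cancelʳ-≡ (a + u * N) (b + v * N) d (begin
      (a + u * N) * d ≡⟨ *-distribʳ-+ d a (u * N) ⟩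
      a * d + u * N * d ≡⟨ cong (a * d +_) (trans (*-assoc u N d) (cong (u *_) Nd)) ⟩
      a * d + u * M ≡⟨ eq ⟩
      b * d + v * M ≡⟨ cong (b * d +_) (trans (*-assoc v N d) (cong (v *_) Nd)) ⟨
      b * d + v * N * d ≡⟨ *-distribʳ-+ d b (v * N) ⟨
      (b + v * N) * d ∎)
      where open ≡-Reasoning

    κ-hom : ∀ p q → κ p + κ q ≅ κ (p ∙ q) [ N ]
    κ-hom p q = divide (subst₂-≅ (trans (cong₂ _+_ (sym (κd p)) (sym (κd q))) (sym (*-distribʳ-+ d (κ p) (κ q)))) (sym (κd (p ∙ q))) (hom p q))
      where
      subst₂-≅ : ∀ {a b c e} → a ≡ b → c ≡ e → a ≅ c [ M ] → b ≅ e [ M ]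
      subst₂-≅ refl refl r = r

    κ-onto : ∀ i → ∃ λ p → κ p ≅ i [ N ]
    κ-onto i = i ·ₘ p₀ , divide (subst (λ y → y ≅ i * d [ M ]) (sym (κd (i ·ₘ p₀))) (multiple i))

  -- Counting the fibres of a homomorphism onto a cyclic group

  module Fibres (𝔾 : FinAb) {N : ℕ} .{{_ : NonZero N}} (κ : FinAb.Carrier 𝔾 → ℕ)
    (κ-hom : ∀ p q → κ p + κ q ≅ κ (FinAb._∙_ 𝔾 p q) [ N ]) (κ-onto : ∀ i → ∃ λ p → κ p ≅ i [ N ]) where
    open Counting 𝔾

    k₀ : ℕ
    k₀ = # (λ p → κ p % N ≡ᵇ 0)

    rot : ℕ → Carrier → ℕ
    rot c p = (κ p + c) % N

    rot< : ∀ c p → rot c p < N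
    rot< c p = m%n<n (κ p + c) N

    Bool-≡ : ∀ {a b} → (T a → T b) → (T b → T a) → a ≡ b
    Bool-≡ {true} {true} _ _ = refl
    Bool-≡ {false} {false} _ _ = refl
    Bool-≡ {true} {false} p _ = ⊥-elim (p tt)
    Bool-≡ {false} {true} _ q = ⊥-elim (q tt)

    -- Translation by an element lying over `c - i` carries the fibre onto the kernel.
    fibre : ∀ c i → i < N → # (λ p → rot c p ≡ᵇ i) ≡ k₀
    fibre c i i< = let t , κt = κ-onto (c + (N ∸ i)) in
      trans (#-cong {λ p → rot c p ≡ᵇ i} {λ p → κ (p ∙ t) % N ≡ᵇ 0} (λ p → Bool-≡
          (λ q → ≡⇒≡ᵇ (κ (p ∙ t) % N) 0 (trans (≅-% (≅-trans (≅-sym (κ-hom p t)) (there p t κt (≡ᵇ⇒≡ (rot c p) i q)))) (zero-% N)))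
          (λ q → ≡⇒≡ᵇ (rot c p) i (trans (≅-% (back p t κt (≡ᵇ⇒≡ (κ (p ∙ t) % N) 0 q))) (m<n⇒m%n≡m i<)))))
        (reindex (_∙ t) (_// t) (λ p → group 2 (λ p t → (p ⊙ t) ⊘ t ≗ p) refl p t)
            (λ p → group 2 (λ p t → (p ⊘ t) ⊙ t ≗ p) refl p t) (λ p → 𝟙 (κ p % N ≡ᵇ 0)))
      where
      zero-% : ∀ N .{{_ : NonZero N}} → 0 % N ≡ 0
      zero-% (suc _) = refl
      i+ : i + (N ∸ i) ≡ N
      i+ = m+[n∸m]≡n (<⇒≤ i<)
      there : ∀ p t → κ t ≅ c + (N ∸ i) [ N ] → rot c p ≡ i → κ p + κ t ≅ 0 [ N ]
      there p t κt eq = ≅-trans (≅-+ {κ p} ≅-refl κt) (≅-trans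
        (subst (λ y → κ p + (c + (N ∸ i)) ≅ y [ N ]) (sym (+-assoc (κ p) c (N ∸ i))) ≅-refl)
        (≅-trans (≅-+ {c = N ∸ i} (%-≅ (κ p + c) N) ≅-refl)
          (subst (λ y → y + (N ∸ i) ≅ 0 [ N ]) (sym eq) (0 , 1 , trans (+-identityʳ _) (trans i+ (sym (+-identityʳ N)))))))
      back : ∀ p t → κ t ≅ c + (N ∸ i) [ N ] → κ (p ∙ t) % N ≡ 0 → κ p + c ≅ i [ N ]
      back p t κt eq = ≅-cancel {c = N ∸ i} {d = N ∸ i} (≅-trans
        (subst (λ y → κ p + c + (N ∸ i) ≅ y [ N ]) (+-assoc (κ p) c (N ∸ i)) ≅-refl)
        (≅-trans (≅-sym (≅-+ {κ p} ≅-refl κt)) (≅-trans (κ-hom p t) (≅-trans (%-≅ (κ (p ∙ t)) N)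
          (subst (λ y → y ≅ i + (N ∸ i) [ N ]) (sym eq) (1 , 0 , trans (+-identityʳ N) (trans (sym i+) (sym (+-identityʳ _)))))))))
        ≅-refl

    below-count : ∀ c b → b ≤ N → # (λ p → rot c p <ᵇ b) ≡ b * k₀
    below-count c zero _ = ∑-zero elems
      where
      ∑-zero : ∀ {A : Set} (xs : List A) → ∑ xs (λ _ → 0) ≡ 0
      ∑-zero [] = refl
      ∑-zero (_ ∷ xs) = ∑-zero xs
    below-count c (suc b) b< = trans (∑-cong elems (λ p → at (rot c p)))
      (trans (∑-+ elems _ _) (cong₂ _+_ (fibre c b b<) (below-count c b (<⇒≤ b<))))
      where
      at : ∀ r → 𝟙 (r <ᵇ suc b) ≡ 𝟙 (r ≡ᵇ b) + 𝟙 (r <ᵇ b)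
      at r with <-cmp r b
      ... | tri< r< r≢ _ = trans (𝟙-true (<⇒<ᵇ (m≤n⇒m≤1+n r<))) (sym (cong₂ _+_ (𝟙-false (λ t → r≢ (≡ᵇ⇒≡ r b t))) (𝟙-true (<⇒<ᵇ r<))))
      ... | tri≈ r≮ r≡ _ = trans (𝟙-true (<⇒<ᵇ (s≤s (≤-reflexive r≡)))) (sym (cong₂ _+_ (𝟙-true (≡⇒≡ᵇ r b r≡)) (𝟙-false (λ t → r≮ (<ᵇ⇒< r b t)))))
      ... | tri> r≮ r≢ r> = trans (𝟙-false (λ t → <⇒≱ (<ᵇ⇒< r (suc b) t) r>))
          (sym (cong₂ _+_ (𝟙-false (λ t → r≢ (≡ᵇ⇒≡ r b t))) (𝟙-false (λ t → r≮ (<ᵇ⇒< r b t)))))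

    total-count : N * k₀ ≡ h
    total-count = trans (sym (below-count 0 N ≤-refl)) (#-cong {λ p → rot 0 p <ᵇ N} {full} λ p → Bool-≡ (λ _ → tt) (λ _ → <⇒<ᵇ (rot< 0 p)))

  -- Arcs

  module Arcs (𝔾 : FinAb) {N : ℕ} .{{_ : NonZero N}} (κ : FinAb.Carrier 𝔾 → ℕ)
    (κ-hom : ∀ p q → κ p + κ q ≅ κ (FinAb._∙_ 𝔾 p q) [ N ]) (κ-onto : ∀ i → ∃ λ p → κ p ≅ i [ N ]) where
    open Counting 𝔾
    open Fibres 𝔾 κ κ-hom κ-onto

    arc : ℕ → ℕ → Sub
    arc c ℓ p = rot c p <ᵇ ℓ

    interval-count : ∀ c a b → a ≤ b → b ≤ N → # (λ p → (a ≤ᵇ rot c p) ∧ (rot c p <ᵇ b)) + a * k₀ ≡ b * k₀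
    interval-count c a b a≤ b≤ = trans (cong (# (λ p → (a ≤ᵇ rot c p) ∧ (rot c p <ᵇ b)) +_) (sym (below-count c a (≤-trans a≤ b≤))))
      (trans (sym (∑-+ elems _ _)) (trans (∑-cong elems (λ p → at (rot c p))) (below-count c b b≤)))
      where
      at : ∀ r → 𝟙 ((a ≤ᵇ r) ∧ (r <ᵇ b)) + 𝟙 (r <ᵇ a) ≡ 𝟙 (r <ᵇ b)
      at r with a ≤? r
      ... | yes p = trans (cong₂ _+_ (cong 𝟙 (left p)) (𝟙-false (λ t → <⇒≱ (<ᵇ⇒< r a t) p))) (+-identityʳ _)
        where
        left : a ≤ r → (a ≤ᵇ r) ∧ (r <ᵇ b) ≡ (r <ᵇ b)
        left p = Bool-≡ (λ t → T-∧ʳ {a ≤ᵇ r} t) (λ t → ∈∩⁺ {λ _ → a ≤ᵇ r} {λ _ → r <ᵇ b} {ε} (≤⇒≤ᵇ p) t)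
      ... | no p = trans (cong₂ _+_ (𝟙-false {(a ≤ᵇ r) ∧ (r <ᵇ b)} (λ t → p (≤ᵇ⇒≤ a r (T-∧ˡ t)))) (𝟙-true (<⇒<ᵇ (≰⇒> p))))
        (sym (𝟙-true (<⇒<ᵇ (<-≤-trans (≰⇒> p) a≤))))

    minimise : ∀ (W : Sub) (f : Carrier → ℕ) m {w} → w ∈ W → f w ≤ m → ∃ λ v → v ∈ W × (∀ u → u ∈ W → f v ≤ f u)
    minimise W f m {w} w∈ fw≤ with search (λ u → W u ∧ (f u <ᵇ f w))
    ... | inj₂ none = w , w∈ , λ u u∈ → ≮⇒≥ λ lt → none u (∈∩⁺ {W} {λ u → f u <ᵇ f w} {u} u∈ (<⇒<ᵇ lt))
    minimise W f zero {w} w∈ fw≤ | inj₁ (u , p) = ⊥-elim (n≮0 (<-≤-trans (<ᵇ⇒< (f u) (f w) (∈∩ʳ {W} {λ u → f u <ᵇ f w} {u} p)) fw≤))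
    minimise W f (suc m) {w} w∈ fw≤ | inj₁ (u , p) =
      minimise W f m (∈∩ˡ {W} {λ u → f u <ᵇ f w} {u} p) (≤-pred (<-≤-trans (<ᵇ⇒< (f u) (f w) (∈∩ʳ {W} {λ u → f u <ᵇ f w} {u} p)) fw≤))

    rot-≅ : ∀ c p → κ p + c ≅ rot c p [ N ]
    rot-≅ c p = %-≅ (κ p + c) N

    rot-unique : ∀ {c p y} → y < N → κ p + c ≅ y [ N ] → rot c p ≡ y
    rot-unique {c} {p} y< q = ≅-unique (rot< c p) y< (≅-trans (≅-sym (rot-≅ c p)) q)

    κ-// : ∀ q w → κ (q // w) + κ w ≅ κ q [ N ]
    κ-// q w = subst (λ y → κ (q // w) + κ w ≅ κ y [ N ]) (group 2 (λ q w → (q ⊘ w) ⊙ w ≗ q) refl q w) (κ-hom (q // w) w)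

    ≡-≅ : ∀ {a b} → a ≡ b → a ≅ b [ N ]
    ≡-≅ refl = ≅-refl

    -- `S` nearly fills an arc and `W ⊕ S` is critical; the aim is an arc containing `W` and nearly
    -- filled by it. Trimming the arc of `S` by `L` at each end gives an ideal sumset `C`, contained
    -- in `W ⊕ S` up to `b * ε₁` points. Cut at a point outside `C`, the circle becomes a line on
    -- which `C` is a union of intervals starting at the points of `W`, and a gap between them would
    -- make `C` too large.
    module _ (S W : Sub) {c ℓ ε₁ d₁ b L : ℕ} (ℓ≤N : ℓ ≤ N) (S⊑ : S ⊑ arc c ℓ) (dense : ℓ * k₀ ≤ # S + ε₁)
             {w₀ : Carrier} (w₀∈ : w₀ ∈ W) (crit : # (W ⊕ S) ≤ # W + # S + d₁) (1≤L : 1 ≤ L) (N≤bL : N ≤ b * L)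
             (room : # (W ⊕ S) + b * ε₁ < h) (long : (4 * L + 2) * k₀ + d₁ + b * ε₁ < ℓ * k₀) where

      private
        instance
          L≢0 : NonZero L
          L≢0 = >-nonZero 1≤L

        long′ : 4 * L + 2 < ℓ
        long′ = *-cancelʳ-< k₀ _ _ (≤-<-trans (≤-trans (m≤m+n _ d₁) (m≤m+n _ (b * ε₁))) long)

        ℓ′ : ℕ
        ℓ′ = ℓ ∸ 2 * L
        ℓ′-eq : ℓ′ + 2 * L ≡ ℓ
        ℓ′-eq = m∸n+n≡m (lin 2 (λ L ℓ → (con 1 ⊞ 4 ⊠ L ⊞ con 2 ≼ ℓ) ⟨ 1 ⟩⇒ 2 ⊢ 2 ⊠ L ≼ ℓ) L ℓ long′)
        ℓ′>0 : 1 ≤ ℓ′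
        ℓ′>0 = lin 3 (λ m L ℓ → (m ⊞ 2 ⊠ L ≑ ℓ) ⟨ 1 ⟩⇒ (con 1 ⊞ 4 ⊠ L ⊞ con 2 ≼ ℓ) ⟨ 1 ⟩⇒ 3 ⊢ con 1 ≼ m) (ℓ′) L ℓ ℓ′-eq long′

        middle : ℕ → Bool
        middle r = (L ≤ᵇ r) ∧ (r + L <ᵇ ℓ)

        C : Sub
        C q = some (λ w → W w ∧ middle (rot c (q // w)))

        C⁺ : ∀ {q w} → w ∈ W → L ≤ rot c (q // w) → rot c (q // w) + L < ℓ → q ∈ C
        C⁺ {q} {w} w∈ lo hi = some⁺ {λ w → W w ∧ middle (rot c (q // w))} {w}
          (∈∩⁺ {W} {λ w → middle (rot c (q // w))} {w} w∈ (∈∩⁺ {λ w → L ≤ᵇ rot c (q // w)} {λ w → rot c (q // w) + L <ᵇ ℓ} {w} (≤⇒≤ᵇ lo) (<⇒<ᵇ hi)))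

        C⁻ : ∀ {q} → q ∈ C → ∃ λ w → w ∈ W × L ≤ rot c (q // w) × rot c (q // w) + L < ℓ
        C⁻ {q} p =
          let w , m = some⁻ (λ w → W w ∧ middle (rot c (q // w))) p
              m′ = ∈∩ʳ {W} {λ w → middle (rot c (q // w))} {w} m
          in w , ∈∩ˡ {W} {λ w → middle (rot c (q // w))} {w} m ,
             ≤ᵇ⇒≤ L _ (∈∩ˡ {λ w → L ≤ᵇ rot c (q // w)} {λ w → rot c (q // w) + L <ᵇ ℓ} {w} m′) ,
             <ᵇ⇒< _ ℓ (∈∩ʳ {λ w → L ≤ᵇ rot c (q // w)} {λ w → rot c (q // w) + L <ᵇ ℓ} {w} m′)

        block : Carrier → ℕ
        block w = κ w % N / L

        block< : ∀ w → block w < b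
        block< w = m<n*o⇒m/o<n (<-≤-trans (m%n<n (κ w) N) N≤bL)

        same-block : ∀ {u w} → block u ≡ block w → κ u % N < κ w % N + L
        same-block {u} {w} eq = begin-strict
          κ u % N ≡⟨ m≡m%n+[m/n]*n (κ u % N) L ⟩
          κ u % N % L + block u * L <⟨ +-monoˡ-< (block u * L) (m%n<n (κ u % N) L) ⟩
          L + block u * L ≡⟨ cong (λ k → L + k * L) eq ⟩
          L + block w * L ≤⟨ +-monoʳ-≤ L (≤-trans (m≤n+m _ (κ w % N % L)) (≤-reflexive (sym (m≡m%n+[m/n]*n (κ w % N) L)))) ⟩
          L + κ w % N ≡⟨ +-comm L _ ⟩
          κ w % N + L ∎
          where open ≤-Reasoning

        -- Elements of one block differ by less than `L`, exactly the length trimmed at each end.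
        inside : ∀ {q u w} → block u ≡ block w → L ≤ rot c (q // w) → rot c (q // w) + L < ℓ → q // u ∈ arc c ℓ
        inside {q} {u} {w} eq lo hi = <⇒<ᵇ (subst (_< ℓ) (sym (rot-unique {c} {q // u} (<-≤-trans y< ℓ≤N) cong-y)) y<)
          where
          r k k′ y : ℕ
          r = rot c (q // w)
          k = κ w % N
          k′ = κ u % N
          y = (r + k) ∸ k′
          y+k′ : y + k′ ≡ r + k
          y+k′ = m∸n+n≡m (lin 4 (λ r k k′ L → (L ≼ r) ⟨ 1 ⟩⇒ (con 1 ⊞ k′ ≼ k ⊞ L) ⟨ 1 ⟩⇒ 1 ⊢ k′ ≼ r ⊞ k) r k k′ L lo (same-block {u} {w} eq))
          y< : y < ℓ
          y< = lin 6 (λ y r k k′ L ℓ → (y ⊞ k′ ≐ r ⊞ k) ⟨ 1 ⟩⇒ (con 1 ⊞ k ≼ k′ ⊞ L) ⟨ 1 ⟩⇒ (con 1 ⊞ r ⊞ L ≼ ℓ) ⟨ 1 ⟩⇒ 1 ⊢ con 1 ⊞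
              y ≼ ℓ) y r k k′ L ℓ y+k′ (same-block {w} {u} (sym eq)) hi
          cong-y : κ (q // u) + c ≅ y [ N ]
          cong-y = ≅-cancel {c = κ u} {d = k′} (≅-trans
              (≅-trans (≡-≅ ((≤-antisym (lin 3 (λ a c u → 1 ⊢ a ⊞ c ⊞ u ≼ a ⊞ u ⊞ c) (κ (q // u)) c (κ u) )
                  (lin 3 (λ a c u → 1 ⊢ a ⊞ u ⊞ c ≼ a ⊞ c ⊞ u) (κ (q // u)) c (κ u) ))))
                (≅-trans (≅-+ {c = c} (≅-trans (κ-// q u) (≅-sym (κ-// q w))) ≅-refl)
                    (≡-≅ ((≤-antisym (lin 3 (λ a c w → 1 ⊢ a ⊞ w ⊞ c ≼ a ⊞ c ⊞ w) (κ (q // w)) c (κ w) )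
                    (lin 3 (λ a c w → 1 ⊢ a ⊞ c ⊞ w ≼ a ⊞ w ⊞ c) (κ (q // w)) c (κ w) ))))))
              (≅-trans (≅-+ (rot-≅ c (q // w)) (%-≅ (κ w) N)) (≡-≅ (sym y+k′)))) (%-≅ (κ u) N)

        missing : Sub
        missing = arc c ℓ ∖ S

        missing≤ : # missing ≤ ε₁
        missing≤ = lin 6 (λ m i t lk s e → (i ⊞ m ≐ t) ⟨ 1 ⟩⇒ (t ≐ lk) ⟨ 1 ⟩⇒ (lk ≼ s ⊞ e) ⟨ 1 ⟩⇒ (s ≼ i) ⟨ 1 ⟩⇒ 1 ⊢ m ≼ e)
            (# missing) (# (arc c ℓ ∩ S)) (# (arc c ℓ)) (ℓ * k₀) (# S) (ε₁)
          (#-∖ (arc c ℓ) S) (below-count c ℓ ℓ≤N) dense (#-mono {S} {arc c ℓ ∩ S} λ x p → ∈∩⁺ {arc c ℓ} {S} {x} (S⊑ x p) p)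

        -- One representative of `W` per block suffices, so the points of `C` outside `W ⊕ S` lie in
        -- `b` translates of `missing` instead of one for every element of `W`.
        bad : ℕ → Sub
        bad zero _ = false
        bad (suc a) with search (λ w → W w ∧ ⌊ Data.Nat.Properties._≟_ (block w) a ⌋)
        ... | inj₁ (w , _) = bad a ∪ (missing ⇀ w)
        ... | inj₂ _ = bad a

        bad≤ : ∀ a → # (bad a) ≤ a * ε₁
        bad≤ zero = ≤-reflexive (below-count-zero elems)
          where
          below-count-zero : ∀ {A : Set} (xs : List A) → ∑ xs (λ _ → 0) ≡ 0
          below-count-zero [] = refl
          below-count-zero (_ ∷ xs) = below-count-zero xs
        bad≤ (suc a) with search (λ w → W w ∧ ⌊ Data.Nat.Properties._≟_ (block w) a ⌋)
        ... | inj₁ (w , _) = lin 7 (λ u i p m m′ e ae → (u ⊞ i ≐ p ⊞ m) ⟨ 1 ⟩⇒ (m ≐ m′) ⟨ 1 ⟩⇒ (m′ ≼ e) ⟨ 1 ⟩⇒ (p ≼ ae) ⟨ 1 ⟩⇒ 1 ⊢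
            u ≼ e ⊞ ae) (# (bad a ∪ (missing ⇀ w))) (# (bad a ∩ (missing ⇀ w))) (# (bad a)) (# (missing ⇀ w)) (# missing) (ε₁)
            (a * ε₁) (#-∪∩ (bad a) (missing ⇀ w)) (#-⇀ missing w) missing≤ (bad≤ a)
        ... | inj₂ _ = ≤-trans (bad≤ a) (m≤n+m (a * ε₁) ε₁)

        bad⁺ : ∀ a {q w} → w ∈ W → block w < a → L ≤ rot c (q // w) → rot c (q // w) + L < ℓ → ¬ (q ∈ W ⊕ S) → q ∈ bad a
        bad⁺ (suc a) {q} {w} w∈ bl< lo hi q∉ with search (λ w → W w ∧ ⌊ Data.Nat.Properties._≟_ (block w) a ⌋)
        ... | inj₂ none = bad⁺ a w∈ (≤∧≢⇒< (≤-pred bl<) (λ eq → none w (∈∩⁺ {W} {λ w → ⌊ Data.Nat.Properties._≟_ (block w) a ⌋}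
            {w} w∈ (fromWitness eq)))) lo hi q∉
        ... | inj₁ (u , p) with m≤n⇒m<n∨m≡n (≤-pred bl<)
        ... | inj₁ lt = ∈∪ˡ {bad a} {missing ⇀ u} {q} (bad⁺ a w∈ lt lo hi q∉)
        ... | inj₂ eq = ∈∪ʳ {bad a} {missing ⇀ u} {q} (∈∖⁺ {arc c ℓ} {S} {q // u}
              (inside {q} {u} {w} (trans (toWitness (∈∩ʳ {W} {λ w → ⌊ Data.Nat.Properties._≟_ (block w) a ⌋} {u} p)) (sym eq)) lo hi)
              (λ s∈ → q∉ (subst (_∈ W ⊕ S) (group 2 (λ q u → u ⊙ (q ⊘ u) ≗ q) refl q u)
                  (⊕⁺ {W} {S} (∈∩ˡ {W} {λ w → ⌊ Data.Nat.Properties._≟_ (block w) a ⌋} {u} p) s∈))))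

        C≤ : # C ≤ # (W ⊕ S) + b * ε₁
        C≤ = lin 5 (λ C i m s e → (i ⊞ m ≑ C) ⟨ 1 ⟩⇒ (i ≼ s) ⟨ 1 ⟩⇒ (m ≼ e) ⟨ 1 ⟩⇒ 1 ⊢ C ≼ s ⊞ e) (# C) (# (C ∩ (W ⊕ S)))
            (# (C ∖ (W ⊕ S))) (# (W ⊕ S)) (b * ε₁)
          (#-∖ C (W ⊕ S)) (#-mono {C ∩ (W ⊕ S)} {W ⊕ S} λ q → ∈∩ʳ {C} {W ⊕ S} {q})
          (≤-trans (#-mono {C ∖ (W ⊕ S)} {bad b} λ q p →
            let w , w∈ , lo , hi = C⁻ (∈∖ˡ {C} {W ⊕ S} {q} p) in bad⁺ b w∈ (block< w) lo hi (∈∖ʳ {C} {W ⊕ S} {q} p)) (bad≤ b))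

        outside : ∃ λ z → ¬ (z ∈ C)
        outside with search-all C
        ... | inj₁ r = r
        ... | inj₂ all = ⊥-elim (<⇒≱ room (≤-trans (#-mono {full} {C} (λ x _ → all x)) C≤))

        z : Carrier
        z = proj₁ outside

        -- `c₂` rotates the cut point `z` to the last position `N - 1`. `c₁` stands for
        -- `c₂ - c + L`: then the interval contributed by `w` starts, in the coordinate of `c₂`, at
        -- `rot c₁ w`.
        c₁ c₂ : ℕ
        c₂ = (N ∸ κ z % N) + (N ∸ 1)
        c₁ = c₂ + (N ∸ c % N) + L

        N>0 : 1 ≤ N
        N>0 = ≤-<-trans z≤n (m%n<n 0 N)

        N∸1 : N ∸ 1 + 1 ≡ N
        N∸1 = m∸n+n≡m N>0

        zN : κ z + c₂ ≅ N ∸ 1 [ N ]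
        zN = ≅-trans (≅-+ (%-≅ (κ z) N) ≅-refl) (0 , 1 ,
          (λ h0 → ≤-antisym (lin 4 (λ k m o N → (k ⊞ m ≐ N) ⟨ 1 ⟩⇒ 1 ⊢ k ⊞ (m ⊞ o) ⊞ con 0 ≼ o ⊞ (N ⊞ con 0)) (κ z % N)
              (N ∸ κ z % N) (N ∸ 1) N h0) (lin 4 (λ k m o N → (k ⊞ m ≑ N) ⟨ 1 ⟩⇒ 1 ⊢ o ⊞ (N ⊞ con 0) ≼ k ⊞ (m ⊞ o) ⊞ con 0)
              (κ z % N) (N ∸ κ z % N) (N ∸ 1) N h0)) (m+[n∸m]≡n (<⇒≤ (m%n<n (κ z) N))))

        c₁c : c₁ + c ≅ c₂ + L [ N ]
        c₁c = ≅-trans (≅-+ {c₁} ≅-refl (%-≅ c N)) (0 , 1 ,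
          (λ h0 → ≤-antisym (lin 5 (λ k m c₂ L N → (k ⊞ m ≐ N) ⟨ 1 ⟩⇒ 1 ⊢ c₂ ⊞ m ⊞ L ⊞ k ⊞ con 0 ≼ c₂ ⊞ L ⊞ (N ⊞ con 0)) (c % N)
              (N ∸ c % N) c₂ L N h0) (lin 5 (λ k m c₂ L N → (k ⊞ m ≑ N) ⟨ 1 ⟩⇒ 1 ⊢ c₂ ⊞ L ⊞ (N ⊞ con 0) ≼ c₂ ⊞ m ⊞ L ⊞ k ⊞ con 0)
              (c % N) (N ∸ c % N) c₂ L N h0)) (m+[n∸m]≡n (<⇒≤ (m%n<n c N))))

        reach : ∀ {q w j} → w ∈ W → j < ℓ′ → rot c₂ q ≡ rot c₁ w + j → q ∈ C
        reach {q} {w} {j} w∈ j< eq = C⁺ w∈ (subst (L ≤_) (sym at-q) (m≤m+n L j)) (subst (λ y → y + L < ℓ) (sym at-q) hi)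
          where
          hi : L + j + L < ℓ
          hi = lin 4 (λ L j m ℓ → (m ⊞ 2 ⊠ L ≐ ℓ) ⟨ 1 ⟩⇒ (con 1 ⊞ j ≼ m) ⟨ 1 ⟩⇒ 1 ⊢ con 1 ⊞ L ⊞ j ⊞ L ≼ ℓ) L j (ℓ′) ℓ ℓ′-eq j<
          at-q : rot c (q // w) ≡ L + j
          at-q = rot-unique (<-≤-trans (≤-<-trans (m≤m+n _ L) hi) ℓ≤N)
            (≅-cancel {c = κ w + c₂} {d = κ w + c₂} (≅-trans
              (≡-≅ ((≤-antisym (lin 4 (λ a c k c₂ → 1 ⊢ a ⊞ c ⊞ (k ⊞ c₂) ≼ (a ⊞ k) ⊞ c₂ ⊞ c) (κ (q // w)) c (κ w) c₂ )
                  (lin 4 (λ a c k c₂ → 1 ⊢ (a ⊞ k) ⊞ c₂ ⊞ c ≼ a ⊞ c ⊞ (k ⊞ c₂)) (κ (q // w)) c (κ w) c₂ ))))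
              (≅-trans (≅-+ {c = c} (≅-trans (≅-+ {c = c₂} (κ-// q w) ≅-refl)
                  (≅-trans (rot-≅ c₂ q) (≅-trans (≡-≅ eq) (≅-+ {c = j} (≅-sym (rot-≅ c₁ w)) ≅-refl)))) ≅-refl)
                (≅-trans (≡-≅ ((≤-antisym (lin 4 (λ k c₁ j c → 1 ⊢ k ⊞ c₁ ⊞ j ⊞ c ≼ (c₁ ⊞ c) ⊞ (k ⊞ j)) (κ w) c₁ j c )
                    (lin 4 (λ k c₁ j c → 1 ⊢ (c₁ ⊞ c) ⊞ (k ⊞ j) ≼ k ⊞ c₁ ⊞ j ⊞ c) (κ w) c₁ j c ))))
                  (≅-trans (≅-+ {c = κ w + j} c₁c ≅-refl) (≡-≅ ((≤-antisym
                      (lin 4 (λ k c₂ j L → 1 ⊢ c₂ ⊞ L ⊞ (k ⊞ j) ≼ L ⊞ j ⊞ (k ⊞ c₂)) (κ w) c₂ j L )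
                      (lin 4 (λ k c₂ j L → 1 ⊢ L ⊞ j ⊞ (k ⊞ c₂) ≼ c₂ ⊞ L ⊞ (k ⊞ j)) (κ w) c₂ j L )))))))) ≅-refl)

        -- An interval running past the end would contain the cut point `z`, which is not in `C`.
        early : ∀ {w} → w ∈ W → rot c₁ w + ℓ′ < N
        early {w} w∈ with rot c₁ w + ℓ′ <? N
        ... | yes p = p
        ... | no p = ⊥-elim (proj₂ outside (reach {z} {w} {j} w∈
              (lin 5 (λ j r m o N → (j ⊞ r ≐ o) ⟨ 1 ⟩⇒ (o ⊞ con 1 ≐ N) ⟨ 1 ⟩⇒ (N ≼ r ⊞ m) ⟨ 1 ⟩⇒ 1 ⊢ con 1 ⊞ j ≼ m) j (rot c₁ w)
                  (ℓ′) (N ∸ 1) N j+r N∸1 (≮⇒≥ p))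
              (trans (rot-unique (lin 2 (λ o N → (o ⊞ con 1 ≐ N) ⟨ 1 ⟩⇒ 1 ⊢ con 1 ⊞ o ≼ N) (N ∸ 1) N N∸1) zN) (trans (sym j+r) (+-comm j _)))))
          where
          j : ℕ
          j = (N ∸ 1) ∸ rot c₁ w
          j+r : j + rot c₁ w ≡ N ∸ 1
          j+r = m∸n+n≡m (lin 3 (λ r o N → (con 1 ⊞ r ≼ N) ⟨ 1 ⟩⇒ (o ⊞ con 1 ≑ N) ⟨ 1 ⟩⇒ 1 ⊢ r ≼ o) (rot c₁ w) (N ∸ 1) N (rot< c₁ w) N∸1)

        lowest : ∃ λ v → v ∈ W × (∀ u → u ∈ W → rot c₁ v ≤ rot c₁ u)
        lowest = minimise W (rot c₁) (rot c₁ w₀) w₀∈ ≤-refl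

        highest-below : ∀ t {w} → w ∈ W → rot c₁ w ≤ t → ∃ λ v → v ∈ W × rot c₁ v ≤ t × (∀ u → u ∈ W → rot c₁ u ≤ t → rot c₁ u ≤ rot c₁ v)
        highest-below t {w} w∈ w≤ =
          let V = λ u → W u ∧ (rot c₁ u ≤ᵇ t)
              v , v∈ , min = minimise V (λ u → t ∸ rot c₁ u) t {w} (∈∩⁺ {W} {λ u → rot c₁ u ≤ᵇ t} {w} w∈ (≤⇒≤ᵇ w≤)) (m∸n≤m t (rot c₁ w))
              v≤ = ≤ᵇ⇒≤ _ _ (∈∩ʳ {W} {λ u → rot c₁ u ≤ᵇ t} {v} v∈)
          in v , ∈∩ˡ {W} {λ u → rot c₁ u ≤ᵇ t} {v} v∈ , v≤ ,
             λ u u∈ u≤ → lin 5 (λ a b t a′ b′ → (a′ ⊞ a ≐ t) ⟨ 1 ⟩⇒ (b′ ⊞ b ≑ t) ⟨ 1 ⟩⇒ (b′ ≼ a′) ⟨ 1 ⟩⇒ 1 ⊢ a ≼ b) (rot c₁ u)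
                (rot c₁ v) t (t ∸ rot c₁ u) (t ∸ rot c₁ v)
               (m∸n+n≡m u≤) (m∸n+n≡m v≤) (min u (∈∩⁺ {W} {λ u → rot c₁ u ≤ᵇ t} {u} u∈ (≤⇒≤ᵇ u≤)))

        highest : ∃ λ v → v ∈ W × rot c₁ v ≤ N × (∀ u → u ∈ W → rot c₁ u ≤ N → rot c₁ u ≤ rot c₁ v)
        highest = highest-below N w₀∈ (<⇒≤ (rot< c₁ w₀))

        pmin pmax : ℕ
        pmin = rot c₁ (proj₁ lowest)
        pmax = rot c₁ (proj₁ highest)

        ≤pmax : ∀ u → u ∈ W → rot c₁ u ≤ pmax
        ≤pmax u u∈ = proj₂ (proj₂ (proj₂ highest)) u u∈ (<⇒≤ (rot< c₁ u))

        pmin≤pmax : pmin ≤ pmax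
        pmin≤pmax = proj₂ (proj₂ lowest) _ (proj₁ (proj₂ highest))

        pmax+ℓ′ : pmax + ℓ′ < N
        pmax+ℓ′ = early (proj₁ (proj₂ highest))

        Covered : ℕ → Set
        Covered t = ∃ λ w → w ∈ W × rot c₁ w ≤ t × t < rot c₁ w + ℓ′

        covered? : ∀ t → Dec (Covered t)
        covered? t with search (λ w → W w ∧ ((rot c₁ w ≤ᵇ t) ∧ (t <ᵇ rot c₁ w + ℓ′)))
        ... | inj₁ (w , p) = let q = ∈∩ʳ {W} {λ w → (rot c₁ w ≤ᵇ t) ∧ (t <ᵇ rot c₁ w + ℓ′)} {w} p in
            yes (w , ∈∩ˡ {W} {λ w → (rot c₁ w ≤ᵇ t) ∧ (t <ᵇ rot c₁ w + ℓ′)} {w} p , ≤ᵇ⇒≤ _ _ (T-∧ˡ q) , <ᵇ⇒< _ _ (T-∧ʳ {rot c₁ w ≤ᵇ t} q))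
        ... | inj₂ none = no λ { (w , w∈ , a , b) → none w (∈∩⁺ {W} {λ w → (rot c₁ w ≤ᵇ t) ∧ (t <ᵇ rot c₁ w + ℓ′)} {w} w∈
            (∈∩⁺ {λ w → rot c₁ w ≤ᵇ t} {λ w → t <ᵇ rot c₁ w + ℓ′} {w} (≤⇒≤ᵇ a) (<⇒<ᵇ b))) }

        ℓJ : ℕ
        ℓJ = suc (pmax ∸ pmin)
        ℓJ-eq : ℓJ + pmin ≡ suc pmax
        ℓJ-eq = cong suc (m∸n+n≡m pmin≤pmax)

        between : ℕ → ℕ → Sub
        between a e q = (a ≤ᵇ rot c₂ q) ∧ (rot c₂ q <ᵇ e)

        -- `C` then contains all positions from `pmin` up to `pmax + ℓ′`, and comparison with the
        -- size of `W ⊕ S` bounds the spread of `W`.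
        no-gap : (∀ t → pmin ≤ t → t ≤ pmax → Covered t) → ℓJ * k₀ ≤ # W + (2 * L + 1) * k₀ + d₁ + b * ε₁
        no-gap cov = lin 13 (λ J w s C ws e d B pk qk lk LK a → (B ≼ C) ⟨ 1 ⟩⇒ (C ≼ ws ⊞ e) ⟨ 1 ⟩⇒ (ws ≼ w ⊞ s ⊞ d) ⟨ 1 ⟩⇒
            (B ⊞ pk ≑ qk) ⟨ 1 ⟩⇒ (J ⊞ pk ⊞ lk ≐ qk ⊞ LK) ⟨ 1 ⟩⇒ (s ≼ a) ⟨ 1 ⟩⇒ (a ≐ lk) ⟨ 1 ⟩⇒ 1 ⊢ J ≼ w ⊞ LK ⊞ d ⊞ e) (ℓJ * k₀)
            (# W) (# S) (# C) (# (W ⊕ S)) (b * ε₁) (d₁) (# (between pmin (pmax + ℓ′))) (pmin * k₀) ((pmax + ℓ′) * k₀) (ℓ * k₀)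
            ((2 * L + 1) * k₀) (# (arc c ℓ))
          (#-mono {between pmin (pmax + ℓ′)} {C} into) C≤ crit (interval-count c₂ pmin (pmax + ℓ′) (≤-trans pmin≤pmax (m≤m+n _ _)) (<⇒≤ pmax+ℓ′))
          arithmetic (#-mono {S} {arc c ℓ} S⊑) (below-count c ℓ ℓ≤N)
          where
          arithmetic : ℓJ * k₀ + pmin * k₀ + ℓ * k₀ ≡ (pmax + ℓ′) * k₀ + (2 * L + 1) * k₀
          arithmetic = trans (cong (_+ ℓ * k₀) (sym (*-distribʳ-+ k₀ ℓJ pmin))) (trans (sym (*-distribʳ-+ k₀ (ℓJ + pmin) ℓ)) (trans
            (cong (_* k₀) ((λ h0 h1 → ≤-antisym (lin 6 (λ j p l m q L → (j ⊞ p ≐ con 1 ⊞ q) ⟨ 1 ⟩⇒ (m ⊞ 2 ⊠ L ≑ l) ⟨ 1 ⟩⇒ 1 ⊢ j ⊞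
                p ⊞ l ≼ q ⊞ m ⊞ (2 ⊠ L ⊞ con 1)) (ℓJ) (pmin) (ℓ) (ℓ′) (pmax) L h0 h1)
                (lin 6 (λ j p l m q L → (j ⊞ p ≑ con 1 ⊞ q) ⟨ 1 ⟩⇒ (m ⊞ 2 ⊠ L ≐ l) ⟨ 1 ⟩⇒ 1 ⊢ q ⊞ m ⊞ (2 ⊠ L ⊞ con 1) ≼ j ⊞ p ⊞ l)
                (ℓJ) (pmin) (ℓ) (ℓ′) (pmax) L h0 h1)) ℓJ-eq ℓ′-eq))
            (*-distribʳ-+ k₀ (pmax + ℓ′) (2 * L + 1))))
          into : between pmin (pmax + ℓ′) ⊑ C
          into q p with rot c₂ q ≤? pmax
          ... | yes r = let w , w∈ , lo , hi = cov (rot c₂ q) (≤ᵇ⇒≤ _ _ (T-∧ˡ p)) r in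
                reach {q} {w} {rot c₂ q ∸ rot c₁ w} w∈ (lin 4 (λ j a b m → (j ⊞ b ≐ a) ⟨ 1 ⟩⇒ (con 1 ⊞ a ≼ b ⊞ m) ⟨ 1 ⟩⇒ 1 ⊢ con 1
                    ⊞ j ≼ m) (rot c₂ q ∸ rot c₁ w) (rot c₂ q) (rot c₁ w) (ℓ′) (m∸n+n≡m lo) hi) (sym (m+[n∸m]≡n lo))
          ... | no r = let lo = <⇒≤ (≰⇒> r) in
                reach {q} {proj₁ highest} {rot c₂ q ∸ pmax} (proj₁ (proj₂ highest))
                  (lin 4 (λ j a b m → (j ⊞ b ≐ a) ⟨ 1 ⟩⇒ (con 1 ⊞ a ≼ b ⊞ m) ⟨ 1 ⟩⇒ 1 ⊢ con 1 ⊞ j ≼ m) (rot c₂ q ∸ pmax)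
                      (rot c₂ q) (pmax) (ℓ′) (m∸n+n≡m lo) (<ᵇ⇒< _ _ (T-∧ʳ {pmin ≤ᵇ rot c₂ q} p))) (sym (m+[n∸m]≡n lo))

        -- With a gap at `t`, the interval of the last element before `t` and that of the very last
        -- element are disjoint. Apart from their first positions they avoid the starting points,
        -- which form a translate of `W`. So `C` has at least `# W + 2 * (ℓ′ - 1) * k₀` elements,
        -- more than criticality permits.
        gap-impossible : ∀ t → pmin ≤ t → t ≤ pmax → ¬ Covered t → ⊥
        gap-impossible t lo hi nc = <⇒≱ long
          (lin 23 (λ w w′ s C ws e d a lk B₂ B₃ u v r1 r2 q1 q2 LK m k r q L2 → (C ≼ ws ⊞ e) ⟨ 1 ⟩⇒ (ws ≼ w ⊞ s ⊞ d) ⟨ 1 ⟩⇒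
              (s ≼ a) ⟨ 1 ⟩⇒ (a ≐ lk) ⟨ 1 ⟩⇒ (w′ ≑ w) ⟨ 1 ⟩⇒ (B₂ ⊞ r1 ≑ r2) ⟨ 1 ⟩⇒ (B₃ ⊞ q1 ≑ q2) ⟨ 1 ⟩⇒ (B₂ ⊞ B₃ ≼ u) ⟨ 1 ⟩⇒
              (w′ ⊞ u ≼ v) ⟨ 1 ⟩⇒ (v ≼ C) ⟨ 1 ⟩⇒ (r1 ≐ k ⊞ r) ⟨ 1 ⟩⇒ (q1 ≐ k ⊞ q) ⟨ 1 ⟩⇒ (r2 ≑ r ⊞ m) ⟨ 1 ⟩⇒ (q2 ≑ q ⊞ m) ⟨ 1 ⟩⇒
              (m ⊞ L2 ≑ lk) ⟨ 2 ⟩⇒ (LK ≑ 2 ⊠ L2 ⊞ 2 ⊠ k) ⟨ 1 ⟩⇒ 1 ⊢ lk ≼ LK ⊞ d ⊞ e) (# W) (# (W ⇀ t₀)) (# S) (# C) (# (W ⊕ S))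
              (b * ε₁) (d₁) (# (arc c ℓ)) (ℓ * k₀) (# E₂) (# E₃) (# (E₂ ∪ E₃)) (# ((W ⇀ t₀) ∪ (E₂ ∪ E₃))) (suc r₁ * k₀)
              ((r₁ + ℓ′) * k₀) (suc pmax * k₀) ((pmax + ℓ′) * k₀) ((4 * L + 2) * k₀) (ℓ′ * k₀) (k₀) (r₁ * k₀) (pmax * k₀)
              (2 * L * k₀)
            C≤ crit (#-mono {S} {arc c ℓ} S⊑) (below-count c ℓ ℓ≤N) (#-⇀ W t₀)
            (interval-count c₂ (suc r₁) (r₁ + ℓ′) (≤-trans (≤-reflexive (+-comm 1 r₁)) (+-monoʳ-≤ r₁ ℓ′>0)) (<⇒≤ (early v∈)))
            (interval-count c₂ (suc pmax) (pmax + ℓ′) (≤-trans (≤-reflexive (+-comm 1 pmax)) (+-monoʳ-≤ pmax ℓ′>0)) (<⇒≤ pmax+ℓ′))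
            (disjoint-# E₂ E₃ (λ q a b → <⇒≱ (<-≤-trans (<ᵇ⇒< _ _ (T-∧ʳ {suc r₁ ≤ᵇ rot c₂ q} a)) (≤-trans gap hi)) (<⇒≤ (≤ᵇ⇒≤ _ _ (T-∧ˡ b)))))
            (disjoint-# (W ⇀ t₀) (E₂ ∪ E₃) sep)
            (#-mono {(W ⇀ t₀) ∪ (E₂ ∪ E₃)} {C} into)
            refl refl (*-distribʳ-+ k₀ r₁ ℓ′) (*-distribʳ-+ k₀ pmax ℓ′)
            (trans (sym (*-distribʳ-+ k₀ ℓ′ (2 * L))) (cong (_* k₀) ℓ′-eq))
            (trans (cong (_* k₀) ((≤-antisym (lin 1 (λ L → 1 ⊢ 4 ⊠ L ⊞ con 2 ≼ 2 ⊠ (2 ⊠ L) ⊞ con 2) L )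
                (lin 1 (λ L → 1 ⊢ 2 ⊠ (2 ⊠ L) ⊞ con 2 ≼ 4 ⊠ L ⊞ con 2) L ))))
                (trans (*-distribʳ-+ k₀ (2 * (2 * L)) 2) (cong (_+ 2 * k₀) (*-assoc 2 (2 * L) k₀)))))
          where
          top : ∃ λ v → v ∈ W × rot c₁ v ≤ t × (∀ u → u ∈ W → rot c₁ u ≤ t → rot c₁ u ≤ rot c₁ v)
          top = highest-below t (proj₁ (proj₂ lowest)) lo
          v : Carrier
          v = proj₁ top
          v∈ : v ∈ W
          v∈ = proj₁ (proj₂ top)
          r₁ : ℕ
          r₁ = rot c₁ v
          gap : r₁ + ℓ′ ≤ t
          gap = ≮⇒≥ λ lt → nc (v , v∈ , proj₁ (proj₂ (proj₂ top)) , lt)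
          -- Translation by `t₀` reconciles the two coordinates: a point of `W ⇀ t₀` has as its
          -- `c₂`-position the `c₁`-position of the element of `W` it comes from.
          t₀ : Carrier
          t₀ = proj₁ (κ-onto (c₁ + (N ∸ c₂ % N)))
          t₀-≅ : κ t₀ + c₂ ≅ c₁ [ N ]
          t₀-≅ = ≅-trans (≅-+ (proj₂ (κ-onto (c₁ + (N ∸ c₂ % N)))) (%-≅ c₂ N)) (0 , 1 ,
            (λ h0 → ≤-antisym (lin 4 (λ a k m N → (k ⊞ m ≐ N) ⟨ 1 ⟩⇒ 1 ⊢ a ⊞ m ⊞ k ⊞ con 0 ≼ a ⊞ (N ⊞ con 0)) (c₁) (c₂ % N)
                (N ∸ c₂ % N) N h0) (lin 4 (λ a k m N → (k ⊞ m ≑ N) ⟨ 1 ⟩⇒ 1 ⊢ a ⊞ (N ⊞ con 0) ≼ a ⊞ m ⊞ k ⊞ con 0) (c₁) (c₂ % N)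
                (N ∸ c₂ % N) N h0)) (m+[n∸m]≡n (<⇒≤ (m%n<n c₂ N))))
          moved : ∀ q → rot c₂ q ≡ rot c₁ (q // t₀)
          moved q = rot-unique (rot< c₁ _) (≅-trans (≅-+ {c = c₂} (≅-sym (κ-// q t₀)) ≅-refl)
            (≅-trans (≡-≅ (+-assoc (κ (q // t₀)) (κ t₀) c₂)) (≅-trans (≅-+ {κ (q // t₀)} ≅-refl t₀-≅) (rot-≅ c₁ (q // t₀)))))
          E₂ E₃ : Sub
          E₂ = between (suc r₁) (r₁ + ℓ′)
          E₃ = between (suc pmax) (pmax + ℓ′)
          sep : ∀ q → q ∈ W ⇀ t₀ → ¬ (q ∈ E₂ ∪ E₃)
          sep q q∈ e = ∈∪-elim E₂ E₃ {q} e
            (λ a → <⇒≱ (≤ᵇ⇒≤ _ _ (T-∧ˡ a)) (≤-trans (≤-reflexive (moved q)) (proj₂ (proj₂ (proj₂ top)) (q // t₀) q∈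
              (≤-trans (≤-reflexive (sym (moved q))) (≤-trans (<⇒≤ (<ᵇ⇒< _ _ (T-∧ʳ {suc r₁ ≤ᵇ rot c₂ q} a))) gap)))))
            (λ a → <⇒≱ (≤ᵇ⇒≤ _ _ (T-∧ˡ a)) (≤-trans (≤-reflexive (moved q)) (≤pmax (q // t₀) q∈)))
          forward : ∀ q r → (∀ {j} → j < ℓ′ → rot c₂ q ≡ r + j → q ∈ C) → suc r ≤ rot c₂ q → rot c₂ q < r + ℓ′ → q ∈ C
          forward q r k lo hi = k {rot c₂ q ∸ r} (lin 4 (λ j a r m → (j ⊞ r ≐ a) ⟨ 1 ⟩⇒ (con 1 ⊞ a ≼ r ⊞ m) ⟨ 1 ⟩⇒ 1 ⊢ con 1 ⊞ j ≼
              m) (rot c₂ q ∸ r) (rot c₂ q) r (ℓ′) (m∸n+n≡m (<⇒≤ lo)) hi) (sym (m+[n∸m]≡n (<⇒≤ lo)))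
          into : (W ⇀ t₀) ∪ (E₂ ∪ E₃) ⊑ C
          into q p = ∈∪-elim (W ⇀ t₀) (E₂ ∪ E₃) {q} p
            (λ a → reach {q} {q // t₀} {0} a ℓ′>0 (trans (moved q) (sym (+-identityʳ _))))
            (λ e → ∈∪-elim E₂ E₃ {q} e
              (λ a → forward q r₁ (reach {q} v∈) (≤ᵇ⇒≤ _ _ (T-∧ˡ a)) (<ᵇ⇒< _ _ (T-∧ʳ {suc r₁ ≤ᵇ rot c₂ q} a)))
              (λ a → forward q pmax (reach {q} (proj₁ (proj₂ highest))) (≤ᵇ⇒≤ _ _ (T-∧ˡ a)) (<ᵇ⇒< _ _ (T-∧ʳ {suc pmax ≤ᵇ rot c₂ q} a))))

      arc-hull : ∃ λ c′ → ∃ λ ℓ″ → ℓ″ ≤ N × W ⊑ arc c′ ℓ″ × ℓ″ * k₀ ≤ # W + (2 * L + 1) * k₀ + d₁ + b * ε₁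
      arc-hull = c₁ + (N ∸ pmin) , ℓJ , lin 5 (λ j p q m N → (j ⊞ p ≐ con 1 ⊞ q) ⟨ 1 ⟩⇒ (con 1 ⊞ q ⊞ m ≼ N) ⟨ 1 ⟩⇒ 1 ⊢ j ≼ N) (ℓJ)
          (pmin) (pmax) (ℓ′) N ℓJ-eq pmax+ℓ′ , hull , bound
        where
        hull : W ⊑ arc (c₁ + (N ∸ pmin)) ℓJ
        hull w w∈ = <⇒<ᵇ (subst (_< ℓJ) (sym (rot-unique {c₁ + (N ∸ pmin)} {w}
            (<-≤-trans y< (lin 5 (λ j p q m N → (j ⊞ p ≐ con 1 ⊞ q) ⟨ 1 ⟩⇒ (con 1 ⊞ q ⊞ m ≼ N) ⟨ 1 ⟩⇒ 1 ⊢ j ≼ N) (ℓJ) (pmin)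
            (pmax) (ℓ′) N ℓJ-eq pmax+ℓ′)) yc)) y<)
          where
          y : ℕ
          y = rot c₁ w ∸ pmin
          y+ : y + pmin ≡ rot c₁ w
          y+ = m∸n+n≡m (proj₂ (proj₂ lowest) w w∈)
          y< : y < ℓJ
          y< = lin 5 (λ y p r j q → (y ⊞ p ≐ r) ⟨ 1 ⟩⇒ (r ≼ q) ⟨ 1 ⟩⇒ (j ⊞ p ≑ con 1 ⊞ q) ⟨ 1 ⟩⇒ 1 ⊢ con 1 ⊞ y ≼ j) y (pmin)
              (rot c₁ w) (ℓJ) (pmax) y+ (≤pmax w w∈) ℓJ-eq
          yc : κ w + (c₁ + (N ∸ pmin)) ≅ y [ N ]
          yc = ≅-trans (≡-≅ (sym (+-assoc (κ w) c₁ (N ∸ pmin)))) (≅-trans (≅-+ {c = N ∸ pmin} (rot-≅ c₁ w) ≅-refl) (0 , 1 ,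
            (λ h0 h1 → ≤-antisym (lin 5 (λ y p r m N → (y ⊞ p ≑ r) ⟨ 1 ⟩⇒ (p ⊞ m ≐ N) ⟨ 1 ⟩⇒ 1 ⊢ r ⊞ m ⊞ con 0 ≼ y ⊞ (N ⊞ con 0))
                y (pmin) (rot c₁ w) (N ∸ pmin) N h0 h1) (lin 5 (λ y p r m N → (y ⊞ p ≐ r) ⟨ 1 ⟩⇒ (p ⊞ m ≑ N) ⟨ 1 ⟩⇒ 1 ⊢ y ⊞
                (N ⊞ con 0) ≼ r ⊞ m ⊞ con 0) y (pmin) (rot c₁ w) (N ∸ pmin) N h0 h1)) y+
                (m+[n∸m]≡n (<⇒≤ (rot< c₁ (proj₁ lowest))))))
        bound : ℓJ * k₀ ≤ # W + (2 * L + 1) * k₀ + d₁ + b * ε₁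
        bound with anyUpTo? (λ t → (pmin ≤? t) ×-dec ¬? (covered? t)) (suc pmax)
        ... | yes (t , t< , lo , nc) = ⊥-elim (gap-impossible t lo (≤-pred t<) nc)
        ... | no none = no-gap λ t lo hi → decidable-stable (covered? t) λ nc → none (t , s≤s hi , lo , nc)

  -- Subgroups as groups

  module Generated (𝔾 : FinAb) (U : FinAb.Carrier 𝔾 → Bool) where
    open Counting 𝔾

    Closed : Sub → Set
    Closed S = ∀ x u → x ∈ S → u ∈ U → x ∙ u ∈ S

    Minimal : Sub → Set
    Minimal S = ∀ R → ε ∈ R → Closed R → S ⊑ R

    -- `n` bounds the number of elements still outside `S`; every round that is not yet closed adds
    -- at least one.
    saturate : ∀ n S → h ≤ # S + n → ε ∈ S → Minimal S → ∃ λ C → ε ∈ C × Closed C × Minimal C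
    saturate n S h≤ ε∈ min with search ((S ⊕ U) ∖ S)
    ... | inj₂ none = S , ε∈ , closed , min
      where
      closed : Closed S
      closed x u x∈ u∈ with (x ∙ u) ∈? S
      ... | yes p = p
      ... | no p = ⊥-elim (none (x ∙ u) (∈∖⁺ {S ⊕ U} {S} (⊕⁺ {S} {U} x∈ u∈) p))
    saturate zero S h≤ ε∈ min | inj₁ (x , p) =
      ⊥-elim (<⇒≱ (∈-# {(S ⊕ U) ∖ S} {x} p)
        (lin 4 (λ o s u h → (h ≼ s ⊞ con 0) ⟨ 1 ⟩⇒ (s ⊞ o ≼ u) ⟨ 1 ⟩⇒ (u ≼ h) ⟨ 1 ⟩⇒ 1 ⊢ o ≼ con 0) (# ((S ⊕ U) ∖ S)) (# S) (# (S ∪ ((S ⊕ U) ∖ S))) h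
          h≤ (disjoint-# S ((S ⊕ U) ∖ S) (λ y a b → ∈∖ʳ {S ⊕ U} {S} b a)) (#≤h (S ∪ ((S ⊕ U) ∖ S)))))
    saturate (suc n) S h≤ ε∈ min | inj₁ (x , p) =
      saturate n S′ (lin 5 (λ o s s′ h n → (h ≼ s ⊞ (con 1 ⊞ n)) ⟨ 1 ⟩⇒ (s ⊞ o ≼ s′) ⟨ 1 ⟩⇒ (con 1 ≼ o) ⟨ 1 ⟩⇒ 1 ⊢ h ≼ s′ ⊞ n)
          (# ((S ⊕ U) ∖ S)) (# S) (# S′) h n
          h≤ (disjoint-# S ((S ⊕ U) ∖ S) (λ y a b → ∈∖ʳ {S ⊕ U} {S} b a)) (∈-# {(S ⊕ U) ∖ S} {x} p))
        (∈∪ˡ {S} {(S ⊕ U) ∖ S} ε∈) min′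
      where
      S′ : Sub
      S′ = S ∪ ((S ⊕ U) ∖ S)
      min′ : Minimal S′
      min′ R εR closed y q = ∈∪-elim S ((S ⊕ U) ∖ S) q (min R εR closed y)
        (λ r → let a , u , a∈ , u∈ , eq = ⊕⁻ {S} {U} (∈∖ˡ {S ⊕ U} {S} r) in
          subst (_∈ R) (sym eq) (closed a u (min R εR closed a a∈) u∈))

    span : ∃ λ C → ε ∈ C × Closed C × Minimal C
    span = saturate h (λ x → ⌊ x ≟ ε ⌋) (m≤n+m h (# (λ x → ⌊ x ≟ ε ⌋))) (≟-refl refl)
      λ R εR _ x p → subst (_∈ R) (sym (≟-true p)) εR

    module _ (U-sym : ∀ u → u ∈ U → u ⁻¹ ∈ U) {C : Sub} (ε∈ : ε ∈ C) (closed : Closed C) (min : Minimal C) where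

      -- Minimality applied to a translate of `C` gives products and, applied to its reflection,
      -- inverses; the latter is where `U-sym` enters.
      span-subgroup : Subgroup C
      span-subgroup = record
        { ε∈ = ε∈
        ; ∙∈ = λ {x} {y} x∈ y∈ → min (λ y → C (x ∙ y)) (subst (_∈ C) (sym (identityʳ x)) x∈)
                 (λ y u p u∈ → subst (_∈ C) (assoc x y u) (closed (x ∙ y) u p u∈)) y y∈
        ; ⁻¹∈ = λ {x} x∈ → min (λ y → C (y ⁻¹)) (subst (_∈ C) (group 0 (one ≗ inv one) refl) ε∈)
                 (λ y u p u∈ → subst (_∈ C) (group 2 (λ y u → inv y ⊙ inv u ≗ inv (y ⊙ u)) refl y u) (closed (y ⁻¹) (u ⁻¹) p (U-sym u u∈))) x x∈ }

  module SubgroupAsGroup (𝔾 : FinAb) (H : FinAb.Carrier 𝔾 → Bool) (sub : Counting.Subgroup 𝔾 H) where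
    open Counting 𝔾
    open Subgroup sub

    Elem : Set
    Elem = Σ Carrier (_∈ H)

    Elem-≡ : ∀ {p q : Elem} → proj₁ p ≡ proj₁ q → p ≡ q
    Elem-≡ {x , p} {.x , q} refl = cong (x ,_) (T-irrelevant p q)

    infixl 7 _∘_
    _∘_ : Elem → Elem → Elem
    (x , p) ∘ (y , q) = x ∙ y , ∙∈ p q

    inverse : Elem → Elem
    inverse (x , p) = x ⁻¹ , ⁻¹∈ p

    isAbelianGroupᴴ : IsAbelianGroup _≡_ _∘_ (ε , ε∈) inverse
    isAbelianGroupᴴ = record
      { isGroup = record
        { isMonoid = record
          { isSemigroup = record
            { isMagma = record { isEquivalence = Relation.Binary.PropositionalEquality.isEquivalence ; ∙-cong = cong₂ _∘_ }
            ; assoc = λ p q r → Elem-≡ (assoc (proj₁ p) (proj₁ q) (proj₁ r)) }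
          ; identity = (λ p → Elem-≡ (identityˡ (proj₁ p))) , (λ p → Elem-≡ (identityʳ (proj₁ p))) }
        ; inverse = (λ p → Elem-≡ (inverseˡ (proj₁ p))) , (λ p → Elem-≡ (inverseʳ (proj₁ p)))
        ; ⁻¹-cong = cong inverse }
      ; comm = λ p q → Elem-≡ (comm (proj₁ p) (proj₁ q)) }

    keep : List Carrier → List Elem
    keep [] = []
    keep (x ∷ xs) with T? (H x)
    ... | yes p = (x , p) ∷ keep xs
    ... | no _ = keep xs

    ∑-keep : ∀ xs (f : Carrier → ℕ) → ∑ (keep xs) (λ p → f (proj₁ p)) ≡ ∑ xs (λ x → 𝟙 (H x) * f x)
    ∑-keep [] f = refl
    ∑-keep (x ∷ xs) f with T? (H x)
    ... | yes p = cong₂ _+_ (trans (sym (*-identityˡ (f x))) (cong (_* f x) (sym (𝟙-true p)))) (∑-keep xs f)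
    ... | no p = trans (∑-keep xs f) (cong (λ y → y * f x + ∑ xs (λ x → 𝟙 (H x) * f x)) (sym (𝟙-false p)))

    _≟ᴴ_ : (p q : Elem) → Dec (p ≡ q)
    p ≟ᴴ q = map′ Elem-≡ (cong proj₁) (proj₁ p ≟ proj₁ q)

    ⌊≟ᴴ⌋ : ∀ p q → ⌊ p ≟ᴴ q ⌋ ≡ ⌊ proj₁ p ≟ proj₁ q ⌋
    ⌊≟ᴴ⌋ p q with proj₁ p ≟ proj₁ q
    ... | yes _ = refl
    ... | no _ = refl

    group-of : FinAb
    group-of = record
      { Carrier = Elem ; _∙_ = _∘_ ; ε = ε , ε∈ ; _⁻¹ = inverse
      ; isAbelianGroup = isAbelianGroupᴴ ; _≟_ = _≟ᴴ_ ; elems = keep elems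
      ; once = λ a → trans (∑-cong (keep elems) (λ p → cong 𝟙 (⌊≟ᴴ⌋ p a)))
          (trans (∑-keep elems (λ x → 𝟙 ⌊ x ≟ proj₁ a ⌋))
            (trans (∑-cong elems (λ x → *-comm (𝟙 (H x)) _)) (trans (point (λ x → 𝟙 (H x)) (proj₁ a)) (𝟙-true (proj₂ a))))) }

    module ℍ = Counting group-of

    restrict : Sub → ℍ.Sub
    restrict S p = S (proj₁ p)

    #-restrict : ∀ S → ℍ.# restrict S ≡ # (H ∩ S)
    #-restrict S = trans (∑-keep elems (λ x → 𝟙 (S x))) (∑-cong elems (λ x → sym (𝟙-∧ (H x) (S x))))

    #-restrict-⊑ : ∀ S → S ⊑ H → ℍ.# restrict S ≡ # S
    #-restrict-⊑ S p = trans (#-restrict S) (≤-antisym (#-mono {H ∩ S} {S} (λ x → ∈∩ʳ {H} {S} {x}))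
      (#-mono {S} {H ∩ S} (λ x x∈ → ∈∩⁺ {H} {S} {x} (p x x∈) x∈)))

    h-restrict : ℍ.h ≡ # H
    h-restrict = trans (#-restrict full) (#-cong {H ∩ full} {H} (λ x → ∧-true (H x)))
      where
      ∧-true : ∀ b → b ∧ true ≡ b
      ∧-true true = refl
      ∧-true false = refl

    ⊕-restrict : ∀ (S R : Sub) → S ⊑ H → ∀ p → p ℍ.∈ restrict (S ⊕ R) → p ℍ.∈ restrict S ℍ.⊕ restrict R
    ⊕-restrict S R S⊑ (z , z∈) q =
      let x , y , x∈ , y∈ , eq = ⊕⁻ {S} {R} q
          y∈H = subst (_∈ H) (trans (cong (x ⁻¹ ∙_) eq) (group 2 (λ x y → inv x ⊙ (x ⊙ y) ≗ y) refl x y)) (∙∈ (⁻¹∈ (S⊑ x x∈)) z∈)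
      in subst (ℍ._∈ restrict S ℍ.⊕ restrict R) (Elem-≡ {x ∙ y , ∙∈ (S⊑ x x∈) y∈H} {z , z∈} (sym eq))
          (ℍ.⊕⁺ {restrict S} {restrict R} {x , S⊑ x x∈} {y , y∈H} x∈ y∈)

    restrict-⊕ : ∀ (S R : Sub) p → p ℍ.∈ restrict S ℍ.⊕ restrict R → p ℍ.∈ restrict (S ⊕ R)
    restrict-⊕ S R p q =
      let x , y , x∈ , y∈ , eq = ℍ.⊕⁻ {restrict S} {restrict R} {p} q in
      subst (λ w → w ∈ S ⊕ R) (sym (cong proj₁ eq)) (⊕⁺ {S} {R} x∈ y∈)

    #-⊕-restrict : ∀ (S R : Sub) → S ⊑ H → ℍ.# (restrict S ℍ.⊕ restrict R) ≡ # (H ∩ (S ⊕ R))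
    #-⊕-restrict S R S⊑ = trans (≤-antisym (ℍ.#-mono {restrict S ℍ.⊕ restrict R} {restrict (S ⊕ R)} (restrict-⊕ S R))
      (ℍ.#-mono {restrict (S ⊕ R)} {restrict S ℍ.⊕ restrict R} (⊕-restrict S R S⊑))) (#-restrict (S ⊕ R))

    extend : ℍ.Sub → Sub
    extend K x with T? (H x)
    ... | yes p = K (x , p)
    ... | no _ = false

    extend⁻ : ∀ K {x} → x ∈ extend K → Σ (x ∈ H) λ p → (x , p) ℍ.∈ K
    extend⁻ K {x} q with T? (H x)
    ... | yes p = p , q

    extend⁺ : ∀ K {x} (p : x ∈ H) → (x , p) ℍ.∈ K → x ∈ extend K
    extend⁺ K {x} p q with T? (H x)
    ... | yes p′ = subst (λ w → (x , w) ℍ.∈ K) (T-irrelevant p p′) q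
    ... | no n = n p

    #-extend : ∀ K → # (extend K) ≡ ℍ.# K
    #-extend K = sym (trans (ℍ.#-cong {K} {restrict (extend K)} (λ p → same p)) (#-restrict-⊑ (extend K) (λ x q → proj₁ (extend⁻ K q))))
      where
      same : ∀ p → K p ≡ restrict (extend K) p
      same (x , p) with T? (H x)
      ... | yes p′ = cong (λ w → K (x , w)) (T-irrelevant p p′)
      ... | no n = ⊥-elim (n p)

    extend-subgroup : ∀ {K} → ℍ.Subgroup K → Subgroup (extend K)
    extend-subgroup {K} s = record
      { ε∈ = extend⁺ K ε∈ (ℍ.Subgroup.ε∈ s)
      ; ∙∈ = λ a b → let p , a′ = extend⁻ K a ; q , b′ = extend⁻ K b in extend⁺ K (∙∈ p q) (ℍ.Subgroup.∙∈ s a′ b′)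
      ; ⁻¹∈ = λ a → let p , a′ = extend⁻ K a in extend⁺ K (⁻¹∈ p) (ℍ.Subgroup.⁻¹∈ s a′) }

    -- Minimality needs a set containing the identity, while `S` is only known to contain `x`. It is
    -- therefore applied to the elements `z` with `x ∘ z` in `S`, extended to the ambient group.
    restrict-generates : ∀ {U : Sub} → U ⊑ H → Generated.Minimal 𝔾 U H →
      ∀ (S : ℍ.Sub) {x} → x ℍ.∈ S → (∀ x u → x ℍ.∈ S → u ℍ.∈ restrict U → x ∘ u ℍ.∈ S) → ∀ y → y ℍ.∈ S
    restrict-generates {U} U⊑ min S {x} x∈ closed y =
      let R = extend (λ z → S (x ∘ z))
          q , r = extend⁻ (λ z → S (x ∘ z)) (min R (extend⁺ (λ z → S (x ∘ z)) ε∈ (subst (ℍ._∈ S) (Elem-≡ (sym (identityʳ (proj₁ x)))) x∈))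
            (λ z u z∈ u∈ → let p , w = extend⁻ (λ z → S (x ∘ z)) z∈ in
              extend⁺ (λ z → S (x ∘ z)) (∙∈ p (U⊑ u u∈)) (subst (ℍ._∈ S) (Elem-≡ (assoc (proj₁ x) z u)) (closed (x ∘ (z , p)) (u , U⊑ u u∈) w u∈)))
            (proj₁ y // proj₁ x) (∙∈ (proj₂ y) (⁻¹∈ (proj₂ x))))
      in subst (ℍ._∈ S) (Elem-≡ (group 2 (λ x y → x ⊙ (y ⊘ x) ≗ y) refl (proj₁ x) (proj₁ y))) r

  -- The structure theorem in a generated group

  -- One homomorphism `κ` serves both sets. An arc of length `ℓ` has `ℓ * k₀` elements, so by the
  -- last two fields at most `h / E` elements of each arc are missing.
  record BohrPair (𝔾 : FinAb) (A B : FinAb.Carrier 𝔾 → Bool) (E k : ℕ) : Set where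
    open Counting 𝔾
    field
      N      : ℕ
      {{N≢0}} : NonZero N
      k<N    : k < N
      κ      : Carrier → ℕ
      κ-hom  : ∀ p q → κ p + κ q ≅ κ (p ∙ q) [ N ]
      κ-onto : ∀ i → ∃ λ p → κ p ≅ i [ N ]
    open Fibres 𝔾 κ κ-hom κ-onto using (k₀)
    open Arcs 𝔾 κ κ-hom κ-onto using (arc)
    field
      cA ℓA cB ℓB : ℕ
      ℓA≤ : ℓA ≤ N
      ℓB≤ : ℓB ≤ N
      A⊑  : A ⊑ arc cA ℓA
      B⊑  : B ⊑ arc cB ℓB
      A-dense : E * (ℓA * k₀) ≤ E * # A + h
      B-dense : E * (ℓB * k₀) ≤ E * # B + h

  -- As `24 * s ≤ x`, half of the left side absorbs the error term.
  tiling-bound : ∀ {h x n s} → 2 ≤ n → 100 * s < x → h * x ≤ suc (suc n) * x * x + h * (12 * s) → h ≤ 4 * (n * x)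
  tiling-bound {h} {x} {n} {s} 2≤n s-small whole = *-cancelʳ-≤ h (4 * (n * x)) x {{>-nonZero (≤-trans (s≤s z≤n) s-small)}} (begin
    h * x ≤⟨ lin 3 (λ hx w hs → (hx ≼ w ⊞ hs) ⟨ 2 ⟩⇒ (2 ⊠ hs ≼ hx) ⟨ 1 ⟩⇒ 1 ⊢ hx ≼ 2 ⊠ w) (h * x) (suc (suc n) * x * x) (h * (12 * s)) whole half ⟩
    2 * (suc (suc n) * x * x) ≤⟨ *-monoʳ-≤ 2 (*-monoˡ-≤ x (*-monoˡ-≤ x (lin 1 (λ n → (con 2 ≼ n) ⟨ 1 ⟩⇒ 1 ⊢ con 2 ⊞ n ≼ 2 ⊠ n) n 2≤n))) ⟩
    2 * (2 * n * x * x) ≡⟨ solve-∀ℕ n x ⟩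
    4 * (n * x) * x ∎)
    where
    open ≤-Reasoning
    solve-∀ℕ : ∀ n x → 2 * (2 * n * x * x) ≡ 4 * (n * x) * x
    solve-∀ℕ = solve-∀
    half : 2 * (h * (12 * s)) ≤ h * x
    half = ≤-trans (≤-reflexive (regroup h s)) (*-monoʳ-≤ h (lin 2 (λ s x → (con 1 ⊞ 100 ⊠ s ≼ x) ⟨ 6 ⟩⇒ 25 ⊢ 24 ⊠ s ≼ x) s x s-small))
      where
      regroup : ∀ h s → 2 * (h * (12 * s)) ≡ h * (24 * s)
      regroup = solve-∀

  -- A bootstrap: the crude bound, inserted into the error term only, makes the leading term sharp.
  tiling-bound′ : ∀ {h x n s} → 100 * s < x → h * x ≤ suc (suc n) * x * x + h * (12 * s) → h ≤ 4 * (n * x) →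
    h ≤ suc (suc n) * x + 48 * (n * s)
  tiling-bound′ {h} {x} {n} {s} s-small whole h≤ = *-cancelʳ-≤ h _ x {{>-nonZero (≤-trans (s≤s z≤n) s-small)}} (begin
    h * x ≤⟨ whole ⟩
    suc (suc n) * x * x + h * (12 * s) ≤⟨ +-monoʳ-≤ (suc (suc n) * x * x) (*-monoˡ-≤ (12 * s) h≤) ⟩
    suc (suc n) * x * x + 4 * (n * x) * (12 * s) ≡⟨ regroup n x s ⟩
    (suc (suc n) * x + 48 * (n * s)) * x ∎)
    where
    open ≤-Reasoning
    regroup : ∀ n x s → suc (suc n) * x * x + 4 * (n * x) * (12 * s) ≡ (suc (suc n) * x + 48 * (n * s)) * x
    regroup = solve-∀

  quotient-bound : ∀ e n x z {h} → 1 ≤ z → e * z ≤ h → h ≤ 4 * (n * x) → x ≤ z → e ≤ 4 * n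
  quotient-bound e n x z {h} 1≤z lo hi x≤ = *-cancelʳ-≤ e (4 * n) z {{>-nonZero 1≤z}}
    (≤-trans lo (≤-trans hi (≤-trans (*-monoʳ-≤ 4 (*-monoʳ-≤ n x≤)) (≤-reflexive (sym (*-assoc 4 n z))))))

  -- `l` is about `(m + 112) * h / n` and `h` about `n * x`, against `suc m` nearly disjoint
  -- translates. Of the excess `113 * x`, 111 translates come from the widened arc and 2 from the
  -- overlapping ends of the full turn.
  dense-bound : ∀ {n m l h x s y} → n * l ≤ (m + 112) * h → h ≤ suc (suc n) * x + 48 * (n * s) → m + 112 ≤ n → 1 ≤ n →
    suc m * x ≤ y + suc m * s → l ≤ y + (113 * x + (m + 112) * (49 * s))
  dense-bound {n} {m} {l} {h} {x} {s} {y} count h≤ m≤ 1≤n tiles = begin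
    l ≤⟨ *-cancelˡ-≤ n {{>-nonZero 1≤n}} (begin
      n * l ≤⟨ count ⟩
      (m + 112) * h ≤⟨ *-monoʳ-≤ (m + 112) h≤ ⟩
      (m + 112) * (suc (suc n) * x + 48 * (n * s)) ≡⟨ expand m n x s ⟩
      n * ((m + 112) * (x + 48 * s)) + (m + 112) * (2 * x) ≤⟨ +-monoʳ-≤ (n * ((m + 112) * (x + 48 * s))) (*-monoˡ-≤ (2 * x) m≤) ⟩
      n * ((m + 112) * (x + 48 * s)) + n * (2 * x) ≡⟨ *-distribˡ-+ n ((m + 112) * (x + 48 * s)) (2 * x) ⟨
      n * ((m + 112) * (x + 48 * s) + 2 * x) ∎) ⟩
    (m + 112) * (x + 48 * s) + 2 * x ≡⟨ collect m x s ⟩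
    suc m * x + (113 * x + (m + 112) * (48 * s)) ≤⟨ +-monoˡ-≤ (113 * x + (m + 112) * (48 * s)) tiles ⟩
    y + suc m * s + (113 * x + (m + 112) * (48 * s)) ≤⟨ +-monoˡ-≤ (113 * x + (m + 112) * (48 * s))
        (+-monoʳ-≤ y (*-monoˡ-≤ s (lin 1 (λ m → 1 ⊢ con 1 ⊞ m ≼ m ⊞ con 112) m))) ⟩
    y + (m + 112) * s + (113 * x + (m + 112) * (48 * s)) ≡⟨ finish y m x s ⟩
    y + (113 * x + (m + 112) * (49 * s)) ∎
    where
    open ≤-Reasoning
    expand : ∀ m n x s → (m + 112) * (suc (suc n) * x + 48 * (n * s)) ≡ n * ((m + 112) * (x + 48 * s)) + (m + 112) * (2 * x)
    expand = solve-∀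
    collect : ∀ m x s → (m + 112) * (x + 48 * s) + 2 * x ≡ suc m * x + (113 * x + (m + 112) * (48 * s))
    collect = solve-∀
    finish : ∀ y m x s → y + (m + 112) * s + (113 * x + (m + 112) * (48 * s)) ≡ y + (113 * x + (m + 112) * (49 * s))
    finish = solve-∀

  arc-count : ∀ {n m ℓ k₀ N d h} → 1 ≤ h → ℓ * d ≤ (m + 112) * h → N * k₀ ≡ h → N * d ≡ n * h → n * (ℓ * k₀) ≤ (m + 112) * h
  arc-count {n} {m} {ℓ} {k₀} {N} {d} {h} 1≤h ℓd Nk Nd = *-cancelʳ-≤ (n * (ℓ * k₀)) ((m + 112) * h) h {{>-nonZero 1≤h}} (begin
    n * (ℓ * k₀) * h ≡⟨ swap₁ n (ℓ * k₀) h ⟩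
    n * h * (ℓ * k₀) ≡⟨ cong (_* (ℓ * k₀)) Nd ⟨
    N * d * (ℓ * k₀) ≡⟨ swap₂ N d ℓ k₀ ⟩
    ℓ * d * (N * k₀) ≡⟨ cong (ℓ * d *_) Nk ⟩
    ℓ * d * h ≤⟨ *-monoˡ-≤ h ℓd ⟩
    (m + 112) * h * h ∎)
    where
    open ≤-Reasoning
    swap₁ : ∀ a b c → a * b * c ≡ a * c * b
    swap₁ = solve-∀
    swap₂ : ∀ N d ℓ k → N * d * (ℓ * k) ≡ ℓ * d * (N * k)
    swap₂ = solve-∀

  block-cover : ∀ N b .{{_ : NonZero b}} → N ≤ b * suc (N / b)
  block-cover N b = begin
    N ≡⟨ m≡m%n+[m/n]*n N b ⟩
    N % b + N / b * b ≤⟨ +-monoˡ-≤ (N / b * b) (<⇒≤ (m%n<n N b)) ⟩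
    b + N / b * b ≡⟨ *-comm (suc (N / b)) b ⟩
    b * suc (N / b) ∎
    where open ≤-Reasoning

  block-size : ∀ N b k .{{_ : NonZero b}} → b * (suc (N / b) * k) ≤ N * k + b * k
  block-size N b k = begin
    b * (suc (N / b) * k) ≡⟨ regroup b (N / b) k ⟩
    N / b * b * k + b * k ≤⟨ +-monoˡ-≤ (b * k) (*-monoˡ-≤ k (m/n*n≤m N b)) ⟩
    N * k + b * k ∎
    where
    open ≤-Reasoning
    regroup : ∀ b q k → b * (suc q * k) ≡ q * b * k + b * k
    regroup = solve-∀

  next-multiple : ∀ a d .{{_ : NonZero d}} → a < suc (a / d) * d
  next-multiple a d = begin-strict
    a ≡⟨ m≡m%n+[m/n]*n a d ⟩
    a % d + a / d * d <⟨ +-monoˡ-< (a / d * d) (m%n<n a d) ⟩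
    d + a / d * d ∎
    where open ≤-Reasoning

  opaque
    floor : ∀ a b → 1 ≤ b → ∃ λ q → q * b ≤ a × a < b + q * b
    floor a b 1≤b = _/_ a b {{>-nonZero 1≤b}} , m/n*n≤m a b {{>-nonZero 1≤b}} , next-multiple a b {{>-nonZero 1≤b}}

  module Structure (𝔾 : FinAb) (U : FinAb.Carrier 𝔾 → Bool)
    (generates : ∀ (S : FinAb.Carrier 𝔾 → Bool) {x} → T (S x) →
       (∀ x u → T (S x) → T (U u) → T (S (FinAb._∙_ 𝔾 x u))) → ∀ y → T (S y)) where
    open Counting 𝔾
    open Lipschitz 𝔾 U generates
    open Shrinking 𝔾 U generates
    open Doubling 𝔾 U generates

    module _ {E k β ν ν′ τ θ κ′ n₁ : ℕ} (E-big : 1000 ≤ E) (k≤E : k ≤ E) (β>0 : 1 ≤ β)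
             (1≤τ : 1 ≤ τ) (τ<θ : 2 * (h * τ) < θ * θ) (κ≤θ : 2 * κ′ ≤ θ) (h≤ : h ≤ n₁ * κ′)
             (ν≤ : 2 ^ (2 * E ^ 16) * ν ≤ ν′) (θ≤ : 2 ^ (2 * E ^ 16) * (ν + θ) ≤ 2 * β) (ν′≤β : ν′ ≤ β) (τ≤β : τ ≤ β)
             (large : h * (n₁ * (3 * ν′)) < E ^ 16 * β * κ′) (h-lo : E ^ 30 * β ≤ h) (h-hi : h ≤ 2 * (E ^ 30 * β))
             (A B : Sub) (A-big : h ≤ E * # A) (B-big : h ≤ E * # B) (lipB : Lip B ν)
             (crit : # (A ⊕ B) ≤ # A + # B + ν) (free : h + E * # (A ⊕ B) ≤ E * h) where

      private
        instance
          E≢0 : NonZero E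
          E≢0 = >-nonZero (≤-trans (s≤s z≤n) E-big)

        -- The scales: `h` is about `pw 30`, the reserve `R` is `pw 29`, the long union of
        -- translates has about `pw 28` elements, `X` between `pw 16` and `pw 17`, overlaps are at
        -- most `pw 6`, and the error of criticality is `2 * pw 0`.
        pw : ℕ → ℕ
        pw i = E ^ i * β

        pw-suc : ∀ i → E * pw i ≡ pw (suc i)
        pw-suc i = sym (*-assoc E (E ^ i) β)

        up : ∀ i j → i < j → 1000 * pw i ≤ pw j
        up i (suc j) (s≤s i≤) = ≤-trans (*-mono-≤ E-big (*-monoˡ-≤ β (^-monoʳ-≤ E i≤))) (≤-reflexive (pw-suc j))

        β≡ : pw 0 ≡ β
        β≡ = +-identityʳ β

        R : ℕ
        R = pw 29

        cancelE : ∀ {a b} → E * a ≤ E * b → a ≤ b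
        cancelE {a} {b} = *-cancelˡ-≤ E

        R≤A : R ≤ # A
        R≤A = cancelE (≤-trans (≤-reflexive (pw-suc 29)) (≤-trans h-lo A-big))

        R≤B : R ≤ # B
        R≤B = cancelE (≤-trans (≤-reflexive (pw-suc 29)) (≤-trans h-lo B-big))

        free′ : R + # (A ⊕ B) ≤ h
        free′ = cancelE (≤-trans (≤-reflexive (*-distribˡ-+ E R _)) (≤-trans
            (+-monoˡ-≤ (E * # (A ⊕ B)) (≤-trans (≤-reflexive (pw-suc 29)) h-lo)) free))

        A-nonempty : ∃ λ a → a ∈ A
        A-nonempty = #-∈ A (≤-trans 1≤τ (≤-trans τ≤β (lin 4 (λ b p q a → (p ≑ b) ⟨ 1000 ⟩⇒ (1000 ⊠ p ≼ q) ⟨ 1 ⟩⇒ (q ≼ a) ⟨ 1 ⟩⇒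
            1000 ⊢ b ≼ a) (β) (pw 0) (pw 29) (# A) β≡ (up 0 29 (s≤s z≤n)) R≤A)))

        B-nonempty : ∃ λ b → b ∈ B
        B-nonempty = #-∈ B (≤-trans 1≤τ (≤-trans τ≤β (lin 4 (λ b p q a → (p ≑ b) ⟨ 1000 ⟩⇒ (1000 ⊠ p ≼ q) ⟨ 1 ⟩⇒ (q ≼ a) ⟨ 1 ⟩⇒
            1000 ⊢ b ≼ a) (β) (pw 0) (pw 29) (# B) β≡ (up 0 29 (s≤s z≤n)) R≤B)))

        A+R≤h : # A + R ≤ h
        A+R≤h = lin 4 (λ a R s h → (a ≼ s) ⟨ 1 ⟩⇒ (R ⊞ s ≼ h) ⟨ 1 ⟩⇒ 1 ⊢ a ⊞ R ≼ h) (# A) R (# (A ⊕ B)) h (#≤⊕ A B (proj₂ B-nonempty)) free′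

        pure : pw 17 * R ≡ E ^ 2 * (pw 15 * R)
        pure = trans (cong (_* R) (trans (cong (_* β) (^-distribˡ-+-* E 2 15)) (*-assoc (E ^ 2) (E ^ 15) β))) (*-assoc (E ^ 2) (pw 15) R)

        w-small : h * pw 15 ≤ pw 17 * R
        w-small = begin
          h * pw 15                     ≤⟨ *-monoˡ-≤ (pw 15) h-hi ⟩
          2 * pw 30 * pw 15             ≡⟨ cong (λ y → 2 * y * pw 15) (pw-suc 29) ⟨
          2 * (E * R) * pw 15           ≡⟨ trans (cong (_* pw 15) (sym (*-assoc 2 E R)))
              (trans (*-assoc (2 * E) R (pw 15)) (cong (2 * E *_) (*-comm R (pw 15)))) ⟩
          2 * E * (pw 15 * R)           ≤⟨ *-monoˡ-≤ (pw 15 * R) (≤-trans (*-monoˡ-≤ E (≤-trans (s≤s (s≤s z≤n)) E-big))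
              (≤-reflexive (cong (E *_) (sym (*-identityʳ E))))) ⟩
          E ^ 2 * (pw 15 * R)           ≡⟨ pure ⟨
          pw 17 * R                     ∎
          where open ≤-Reasoning

        large′ : h * (n₁ * ν′) < pw 16 * κ′
        large′ = ≤-<-trans (*-monoʳ-≤ h (*-monoʳ-≤ n₁ (m≤n*m ν′ 3))) large

        -- Every step removes at least `pw 14` points and `h` is at most `2 * pw 30`, so
        -- `2 * E ^ 16` steps suffice. This fixes the exponent in the hypotheses on `ν` and `θ`.
        steps : # B ≤ pw 17 + 2 * E ^ 16 * pw 14
        steps = ≤-trans (#≤h B) (≤-trans h-hi (≤-trans (≤-reflexive (trans
            (cong (2 *_) (trans (cong (_* β) (^-distribˡ-+-* E 16 14)) (*-assoc (E ^ 16) (E ^ 14) β)))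
            (sym (*-assoc 2 (E ^ 16) (pw 14))))) (m≤n+m _ (pw 17))))

        1≤β : ∀ i → 1 ≤ pw i
        1≤β i = ≤-trans (*-mono-≤ (m^n>0 E i) β>0) ≤-refl

        pw-+ : ∀ i j → pw (i + j) ≡ E ^ i * pw j
        pw-+ i j = trans (cong (_* β) (^-distribˡ-+-* E i j)) (*-assoc (E ^ i) (E ^ j) β)

        cancel-pow : ∀ i {a b} → E ^ i * a ≤ E ^ i * b → a ≤ b
        cancel-pow i = *-cancelˡ-≤ (E ^ i) {{m^n≢0 E i}}

        opaque
          shrunk : ∃ λ X → Critical A θ R X ν′ (2 * β) × pw 16 ≤ # X × # X ≤ pw 17
          shrunk = shrink {τ} {θ} {κ′} {n₁} 1≤τ τ<θ κ≤θ h≤ A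
            (lin 5 (λ t b p q a → (t ≼ b) ⟨ 1000 ⟩⇒ (p ≑ b) ⟨ 1000 ⟩⇒ (1000 ⊠ p ≼ q) ⟨ 1 ⟩⇒ (q ≼ a) ⟨ 1 ⟩⇒ 1000 ⊢ t ≼ a) (τ) (β)
                (pw 0) (pw 29) (# A) τ≤β β≡ (up 0 29 (s≤s z≤n)) R≤A)
            {R} {pw 15} {pw 14} {pw 16} {pw 17} {ν′} {2 * β}
            (lin 5 (λ w b p t r → (p ≑ b) ⟨ 3000 ⟩⇒ (t ≼ b) ⟨ 1000 ⟩⇒ (1000 ⊠ w ≼ r) ⟨ 1 ⟩⇒ (1000 ⊠ p ≼ r) ⟨ 3 ⟩⇒ 1000 ⊢ w ⊞ 2 ⊠ b
                ⊞ t ≼ r) (pw 15) (β) (pw 0) (τ) (pw 29) β≡ τ≤β (up 15 29 (m≤m+n 16 13)) (up 0 29 (m≤m+n 1 28)))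
            w-small
            (lin 3 (λ a w z → (1000 ⊠ a ≼ z) ⟨ 1 ⟩⇒ (1000 ⊠ w ≼ z) ⟨ 1 ⟩⇒ 1000 ⊢ a ⊞ w ≼ z) (pw 16) (pw 15) (pw 17)
                (up 16 17 ≤-refl) (up 15 17 (m≤m+n 16 1)))
            (lin 5 (λ v n b p w → (p ≑ b) ⟨ 1000 ⟩⇒ (n ≼ b) ⟨ 1000 ⟩⇒ (1000 ⊠ v ≼ w) ⟨ 1 ⟩⇒ (1000 ⊠ p ≼ w) ⟨ 1 ⟩⇒ 1000 ⊢ v ⊞ n ≼
                w) (pw 14) (ν′) (β) (pw 0) (pw 15) β≡ ν′≤β (up 14 15 ≤-refl) (up 0 15 (m≤m+n 1 14)))
            -- The initial error is `ν + θ`: the excess `ν` after the shift by `θ` built into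
            -- `Critical`.
            large′ (2 * E ^ 16) B {ν} {ν + θ}
            (record { lip = lipB ; crit = lin 5 (λ s t a b n → (s ≼ a ⊞ b ⊞ n) ⟨ 1 ⟩⇒ 1 ⊢ s ⊞ t ≼ a ⊞ b ⊞ (n ⊞ t)) (# (A ⊕ B)) (θ)
                (# A) (# B) (ν) crit ; free = free′ })
            ν≤ θ≤ (lin 3 (λ a r b → (1000 ⊠ a ≼ r) ⟨ 1 ⟩⇒ (r ≼ b) ⟨ 1 ⟩⇒ 1000 ⊢ a ≼ b) (pw 16) (pw 29) (# B) (up 16 29 (m≤m+n 17 12)) R≤B) steps

        X₀ : Sub
        X₀ = proj₁ shrunk
        C₀ : Critical A θ R X₀ ν′ (2 * β)
        C₀ = proj₁ (proj₂ shrunk)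
        x-lo₀ : pw 16 ≤ # X₀
        x-lo₀ = proj₁ (proj₂ (proj₂ shrunk))
        x-hi₀ : # X₀ ≤ pw 17
        x-hi₀ = proj₂ (proj₂ (proj₂ shrunk))

        -- Puts the smallest correlation of `X₀` below `pw 5`, the overlap aimed at in `segment`.
        square : # X₀ * # X₀ < h * pw 5
        square = begin-strict
          # X₀ * # X₀            ≤⟨ *-mono-≤ x-hi₀ x-hi₀ ⟩
          pw 17 * pw 17          ≡⟨ cong (_* pw 17) (pw-+ 12 5) ⟩
          E ^ 12 * pw 5 * pw 17  ≡⟨ *-assoc (E ^ 12) (pw 5) (pw 17) ⟩
          E ^ 12 * (pw 5 * pw 17) <⟨ *-monoˡ-< (pw 5 * pw 17) {{>-nonZero (*-mono-≤ (1≤β 5) (1≤β 17))}}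
              (^-monoʳ-< E (≤-trans (s≤s (s≤s z≤n)) E-big) (n<1+n 12)) ⟩
          E ^ 13 * (pw 5 * pw 17) ≡⟨ cong (E ^ 13 *_) (*-comm (pw 5) (pw 17)) ⟩
          E ^ 13 * (pw 17 * pw 5) ≡⟨ *-assoc (E ^ 13) (pw 17) (pw 5) ⟨
          E ^ 13 * pw 17 * pw 5   ≡⟨ cong (_* pw 5) (pw-+ 13 17) ⟨
          pw 30 * pw 5            ≤⟨ *-monoˡ-≤ (pw 5) h-lo ⟩
          h * pw 5                ∎
          where open ≤-Reasoning

        opaque
          seg : Σ (Segment A (pw 6) (2 * β) R ν′) λ S → # (Segment.X S) ≡ # X₀
          seg = segment {τ} {θ} {κ′} {n₁} 1≤τ τ<θ κ≤θ h≤ A {ν′} {2 * β} {R} {pw 16} large X₀ {pw 5} {pw 6}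
            (Critical.lip C₀) (Critical.crit C₀) (Critical.free C₀) x-lo₀
            (lin 6 (λ x z b p t r → (x ≼ z) ⟨ 2000 ⟩⇒ (p ≑ b) ⟨ 5000 ⟩⇒ (t ≼ b) ⟨ 1000 ⟩⇒ (1000 ⊠ z ≼ r) ⟨ 2 ⟩⇒ (1000 ⊠ p ≼ r) ⟨ 5
                ⟩⇒ 1000 ⊢ 2 ⊠ x ⊞ 2 ⊠ (2 ⊠ b) ⊞ t ≼ r) (# X₀) (pw 17) (β) (pw 0) (τ) (pw 29) x-hi₀ β≡ τ≤β (up 17 29 (m≤m+n 18 11))
                (up 0 29 (m≤m+n 1 28)))
            (lin 7 (λ x z b p t r a → (x ≼ z) ⟨ 1000 ⟩⇒ (p ≑ b) ⟨ 3000 ⟩⇒ (t ≼ b) ⟨ 1000 ⟩⇒ (1000 ⊠ z ≼ r) ⟨ 1 ⟩⇒ (1000 ⊠ p ≼ r) ⟨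
                3 ⟩⇒ (r ≼ a) ⟨ 4 ⟩⇒ 1000 ⊢ x ⊞ 2 ⊠ b ⊞ t ≼ a) (# X₀) (pw 17) (β) (pw 0) (τ) (pw 29) (# A) x-hi₀ β≡ τ≤β
                (up 17 29 (m≤m+n 18 11)) (up 0 29 (m≤m+n 1 28)) R≤A)
            (1≤β 5) (lin 3 (λ a b x → (1000 ⊠ a ≼ b) ⟨ 1 ⟩⇒ (b ≼ x) ⟨ 1 ⟩⇒ 1000 ⊢ a ≼ x) (pw 5) (pw 16) (# X₀) (up 5 16 (m≤m+n 6 10)) x-lo₀) square
            (lin 5 (λ a n b p s → (n ≼ b) ⟨ 1000 ⟩⇒ (p ≑ b) ⟨ 6000 ⟩⇒ (1000 ⊠ a ≼ s) ⟨ 1 ⟩⇒ (1000 ⊠ p ≼ s) ⟨ 6 ⟩⇒ 500 ⊢ 2 ⊠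
                (a ⊞ n) ⊞ 5 ⊠ (2 ⊠ b) ≼ s) (pw 5) (ν′) (β) (pw 0) (pw 6) ν′≤β β≡ (up 5 6 ≤-refl) (up 0 6 (m≤m+n 1 5)))

        open Segment (proj₁ seg) renaming (crit to critX; free to freeX)

        x s D : ℕ
        x = # X
        s = pw 6
        D = 2 * β

        x-lo : pw 16 ≤ x
        x-lo = ≤-trans x-lo₀ (≤-reflexive (sym (proj₂ seg)))
        x-hi : x ≤ pw 17
        x-hi = ≤-trans (≤-reflexive (proj₂ seg)) x-hi₀
        s-small : 100 * s < x
        s-small = lin 3 (λ s p x → (1000 ⊠ s ≼ p) ⟨ 101 ⟩⇒ (p ≼ x) ⟨ 101 ⟩⇒ (con 1 ≼ s) ⟨ 1000 ⟩⇒ 1000 ⊢ con 1 ⊞ 100 ⊠ s ≼ x) s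
            (pw 16) x (up 6 16 (m≤m+n 7 9)) x-lo (1≤β 6)
        D≤s : D ≤ s
        D≤s = lin 3 (λ b p s → (p ≑ b) ⟨ 1000 ⟩⇒ (1000 ⊠ p ≼ s) ⟨ 1 ⟩⇒ 500 ⊢ 2 ⊠ b ≼ s) (β) (pw 0) s β≡ (up 0 6 (m≤m+n 1 5))
        ν′≤s : ν′ ≤ s
        ν′≤s = lin 3 (λ n b s → (n ≼ b) ⟨ 2 ⟩⇒ (2 ⊠ b ≼ s) ⟨ 1 ⟩⇒ 2 ⊢ n ≼ s) (ν′) (β) s ν′≤β D≤s

      open Walk 𝔾 U generates X g using (_~_; f; Xₙ; segments; segments⁺; segments⁻; f-zero; #-segments; return-time; cover; whole-large; quasi-hom; position)

      private
        opaque
          returned : ∃ λ n → 2 ≤ n × x ≤ 8 * f n × (∀ i → 2 ≤ i → i < n → 8 * f i < x)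
          returned = return-time ε∈X g∈X apart close s-small
        n : ℕ
        n = proj₁ returned
        2≤n : 2 ≤ n
        2≤n = proj₁ (proj₂ returned)
        low : ∀ i → 2 ≤ i → i < n → 8 * f i < x
        low = proj₂ (proj₂ (proj₂ returned))
        returns : x ≤ 8 * f n
        returns = proj₁ (proj₂ (proj₂ returned))

        opaque
          covered : ∀ p → ∃ λ j → j ≤ suc n × p ~ j ·ₘ g
          covered = cover ε∈X g∈X apart close s-small 2≤n returns low lip ν′≤s
        ψ : Carrier → ℕ
        ψ p = proj₁ (covered p)
        ψ≤ : ∀ p → ψ p ≤ suc n
        ψ≤ p = proj₁ (proj₂ (covered p))
        ψ~ : ∀ p → p ~ ψ p ·ₘ g
        ψ~ p = proj₂ (proj₂ (covered p))

        opaque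
          quasi : ∀ p q → Offset n (ψ p + ψ q) (ψ (p ∙ q))
          quasi p q = quasi-hom ε∈X g∈X apart close s-small 2≤n returns low lip ν′≤s {p = p} {q = q} {a = ψ p} {b = ψ q}
              {c = ψ (p ∙ q)} (ψ≤ p) (ψ≤ q) (ψ≤ (p ∙ q)) (ψ~ p) (ψ~ q) (ψ~ (p ∙ q))

        opaque
          place : ∀ {y j} → j ≤ n → y ∈ Xₙ j → Offset n j (ψ y)
          place {y} {j} j≤ y∈ = position ε∈X g∈X apart close s-small 2≤n returns low lip ν′≤s {y = y} {j = j} {c = ψ y} j≤ (ψ≤ y) y∈ (ψ~ y)

        opaque
          whole≤ : h * x ≤ suc (suc n) * x * x + h * (12 * s)
          whole≤ = whole-large ε∈X g∈X apart close s-small 2≤n returns low lip ν′≤s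

        instance
          x≢0 : NonZero x
          x≢0 = >-nonZero (≤-trans (s≤s z≤n) s-small)

        h≤4nx : h ≤ 4 * (n * x)
        h≤4nx = tiling-bound {h} {x} {n} {s} 2≤n s-small whole≤

        h≤nx : h ≤ suc (suc n) * x + 48 * (n * s)
        h≤nx = tiling-bound′ {h} {x} {n} {s} s-small whole≤ h≤4nx

        E13≤4n : E ^ 13 ≤ 4 * n
        E13≤4n = quotient-bound (E ^ 13) n x (pw 17) (1≤β 17) (≤-trans (≤-reflexive (sym (pw-+ 13 17))) h-lo) h≤4nx x-hi

        E-pow : ∀ i → 1000 * E ^ i ≤ E ^ suc i
        E-pow i = *-monoˡ-≤ (E ^ i) E-big

        n>36 : 36 < n
        n>36 = lin 3 (λ n e e′ → (e ≼ 4 ⊠ n) ⟨ 37 ⟩⇒ (1000 ⊠ e′ ≼ e) ⟨ 37 ⟩⇒ (con 1 ≼ e′) ⟨ 37000 ⟩⇒ 1000 ⊢ con 1 ⊞ con 36 ≼ n) n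
            (E ^ 13) (E ^ 12) E13≤4n (E-pow 12) (m^n>0 E 12)

      open Averaging 𝔾 n>36 ψ quasi using (M; Φ; Φ-hom; Φ-position)

      private
        h>0 : 1 ≤ h
        h>0 = ≤-trans (1≤β 30) h-lo

        instance
          h≢0 : NonZero h
          h≢0 = >-nonZero h>0

        M>0 : 1 ≤ M
        M>0 = *-mono-≤ (≤-trans (s≤s z≤n) 2≤n) h>0

      open CyclicImage 𝔾 M>0 Φ Φ-hom using (d; d>0; p₀; d-least; multiple; exact; N; Nd; κ; κd; N>0; divide; κ-hom; κ-onto)

      private
        instance
          N≢0 : NonZero N
          N≢0 = >-nonZero N>0
          d≢0 : NonZero d
          d≢0 = >-nonZero d>0

        -- Any positive attained residue bounds `d`. At `20 ·ₘ g` the value is `20 * h` up to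
        -- `18 * h`, hence between `2 * h` and `38 * h`; 20 is chosen to exceed the uncertainty.
        d≤ : d ≤ 38 * h
        d≤ =
          let y = 20 ·ₘ g
              r , r≤ , eq = Φ-position {y} {20} (place (lin 1 (λ n → (con 1 ⊞ con 36 ≼ n) ⟨ 20 ⟩⇒ 37 ⊢ con 20 ≼ n) n n>36)
                  (subst (_∈ X) (group 1 (λ y → one ≗ y ⊘ y) refl y) ε∈X))
              a = (38 * h) ∸ r
              a+r : a + r ≡ 38 * h
              a+r = m∸n+n≡m (lin 2 (λ r h → (r ≼ 36 ⊠ h) ⟨ 1 ⟩⇒ 1 ⊢ r ≼ 38 ⊠ h) r h r≤)
          in ≤-trans (d-least {y} {a} (lin 3 (λ a r h → (a ⊞ r ≑ 38 ⊠ h) ⟨ 1 ⟩⇒ (r ≼ 36 ⊠ h) ⟨ 1 ⟩⇒ (con 1 ≼ h) ⟨ 2 ⟩⇒ 2 ⊢ con 1 ≼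
              a) a r h a+r r≤ h>0)
               (≅-cancel {c = r} {d = r} (subst (λ z → Φ y + r ≅ z [ M ])
                  (trans ((λ h0 → ≤-antisym (lin 2 (λ hj h → (hj ≐ 20 ⊠ h) ⟨ 1 ⟩⇒ 1 ⊢ hj ⊞ 18 ⊠ h ≼ 38 ⊠ h) (h * 20) h h0)
                  (lin 2 (λ hj h → (hj ≑ 20 ⊠ h) ⟨ 1 ⟩⇒ 1 ⊢ 38 ⊠ h ≼ hj ⊞ 18 ⊠ h) (h * 20) h h0)) (*-comm h 20)) (sym a+r)) eq)
                  ≅-refl))
               (m∸n≤m (38 * h) r)

        n≤38N : n ≤ 38 * N
        n≤38N = *-cancelʳ-≤ n (38 * N) h (begin
          n * h ≡⟨ Nd ⟨
          N * d ≤⟨ *-monoʳ-≤ N d≤ ⟩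
          N * (38 * h) ≡⟨ trans (sym (*-assoc N 38 h)) (cong (_* h) (*-comm N 38)) ⟩
          38 * N * h ∎)
          where open ≤-Reasoning

        E<N : E < N
        E<N = lin 6 (λ e e1 e2 e13 n N → (e1 ≑ e) ⟨ 1001000 ⟩⇒ (1000 ⊠ e1 ≼ e2) ⟨ 1001 ⟩⇒ (e2 ≼ e13) ⟨ 1001 ⟩⇒ (e13 ≼ 4 ⊠ n) ⟨
            1001 ⟩⇒ (n ≼ 38 ⊠ N) ⟨ 4004 ⟩⇒ (con 1000 ≼ e) ⟨ 1000 ⟩⇒ 1000000 ⊢ con 1 ⊞ e ≼ N) (E) (E ^ 1) (E ^ 2) (E ^ 13) n N
          (*-identityʳ E) (E-pow 1) (^-monoʳ-≤ E (m≤m+n 2 11)) E13≤4n n≤38N E-big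

      open Fibres 𝔾 κ κ-hom κ-onto using (k₀; below-count; total-count)
      open Arcs 𝔾 κ κ-hom κ-onto using (arc; rot-unique; arc-hull)

      private
        k₀≤ : k₀ ≤ pw 18
        k₀≤ = cancel-pow 13 (begin
          E ^ 13 * k₀ ≤⟨ *-monoˡ-≤ k₀ E13≤4n ⟩
          4 * n * k₀ ≤⟨ *-monoˡ-≤ k₀ (*-monoʳ-≤ 4 n≤38N) ⟩
          4 * (38 * N) * k₀ ≡⟨ trans (cong (_* k₀) (sym (*-assoc 4 38 N))) (*-assoc 152 N k₀) ⟩
          152 * (N * k₀) ≡⟨ cong (152 *_) total-count ⟩
          152 * h ≤⟨ *-monoʳ-≤ 152 h-hi ⟩
          152 * (2 * pw 30) ≤⟨ lin 2 (λ a b → (1000 ⊠ a ≼ b) ⟨ 38 ⟩⇒ 125 ⊢ 152 ⊠ (2 ⊠ a) ≼ b) (pw 30) (pw 31) (up 30 31 ≤-refl) ⟩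
          pw 31 ≡⟨ pw-+ 13 18 ⟩
          E ^ 13 * pw 18 ∎)
          where open ≤-Reasoning

        opaque
          width : ℕ → ℕ
          width i = suc (_/_ N (E ^ i) {{m^n≢0 E i}})

          width>0 : ∀ i → 1 ≤ width i
          width>0 i = s≤s z≤n

          width-cover : ∀ i → N ≤ E ^ i * width i
          width-cover i = block-cover N (E ^ i) {{m^n≢0 E i}}

          width-block : ∀ i → E ^ i * (width i * k₀) ≤ N * k₀ + E ^ i * k₀
          width-block i = block-size N (E ^ i) k₀ {{m^n≢0 E i}}

        width-size : ∀ i j → i + j ≡ 30 → width i * k₀ ≤ 2 * pw j + pw 18
        width-size i j i+j = cancel-pow i (begin
          E ^ i * (width i * k₀) ≤⟨ width-block i ⟩
          N * k₀ + E ^ i * k₀ ≤⟨ +-mono-≤ (≤-trans (≤-reflexive total-count) h-hi) (*-monoʳ-≤ (E ^ i) k₀≤) ⟩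
          2 * pw 30 + E ^ i * pw 18 ≡⟨ cong (_+ E ^ i * pw 18) (trans (cong (λ k → 2 * pw k) (sym i+j))
              (trans (cong (2 *_) (pw-+ i j)) (swap 2 (E ^ i) (pw j)))) ⟩
          E ^ i * (2 * pw j) + E ^ i * pw 18 ≡⟨ *-distribˡ-+ (E ^ i) (2 * pw j) (pw 18) ⟨
          E ^ i * (2 * pw j + pw 18) ∎)
          where
          open ≤-Reasoning
          swap : ∀ a b c → a * (b * c) ≡ b * (a * c)
          swap = solve-∀

        -- The union of q = m + 1 consecutive translates of X has about pw 28 elements.
        q m : ℕ
        q = proj₁ (floor (pw 28) x (≤-trans (s≤s z≤n) s-small))
        m = q ∸ 1

        qx≤ : q * x ≤ pw 28
        qx≤ = proj₁ (proj₂ (floor (pw 28) x (≤-trans (s≤s z≤n) s-small)))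

        qx> : pw 28 < x + q * x
        qx> = proj₂ (proj₂ (floor (pw 28) x (≤-trans (s≤s z≤n) s-small)))

        1≤q : 1 ≤ q
        1≤q = positive q x (<-≤-trans qx> ≤-refl) (lin 3 (λ x a b → (x ≼ a) ⟨ 1000 ⟩⇒ (1000 ⊠ a ≼ b) ⟨ 1 ⟩⇒ 1000 ⊢ x ≼ b) x
            (pw 17) (pw 28) x-hi (up 17 28 (m≤m+n 18 10)))
          where
          positive : ∀ q x {b} → b < x + q * x → x ≤ b → 1 ≤ q
          positive zero x lt le = ⊥-elim (<⇒≱ lt (≤-trans (≤-reflexive (+-identityʳ x)) le))
          positive (suc q) x _ _ = s≤s z≤n

        q≡ : suc m ≡ q
        q≡ = m+[n∸m]≡n 1≤q

        q≤ : q ≤ E ^ 12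
        q≤ = *-cancelʳ-≤ q (E ^ 12) (pw 16) {{>-nonZero (1≤β 16)}} (≤-trans (*-monoʳ-≤ q x-lo) (≤-trans qx≤ (≤-reflexive (pw-+ 12 16))))

        qs≤ : suc m * s ≤ pw 18
        qs≤ = ≤-trans (*-monoˡ-≤ s (≤-trans (≤-reflexive q≡) q≤)) (≤-reflexive (sym (pw-+ 12 6)))

        m+112≤n : m + 112 ≤ n
        m+112≤n = lin 5 (λ m q e e′ n → (con 1 ⊞ m ≐ q) ⟨ 125 ⟩⇒ (q ≼ e) ⟨ 125 ⟩⇒ (1000 ⊠ e ≼ e′) ⟨ 14 ⟩⇒ (e′ ≼ 4 ⊠ n) ⟨ 14 ⟩⇒
            (con 1 ≼ e) ⟨ 13875 ⟩⇒ 125 ⊢ m ⊞ con 112 ≼ n) m q (E ^ 12) (E ^ 13) n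
          q≡ q≤ (E-pow 12) E13≤4n (m^n>0 E 12)

        S : Sub
        S = segments m

        tiles : suc m * x ≤ # S + suc m * s
        tiles = #-segments ε∈X g∈X apart close s-small m (λ i 2≤i i≤ → f-zero ε∈X g∈X apart close s-small low i 2≤i
          (lin 3 (λ i m n → (i ≼ m) ⟨ 1 ⟩⇒ (m ⊞ con 112 ≼ n) ⟨ 1 ⟩⇒ 1 ⊢ con 1 ⊞ con 1 ⊞ i ≼ n) i m n i≤ m+112≤n))

        -- A further translate of `X` adds at most `x + D`, because `A ⇀ (suc m ·ₘ g)` lies in the
        -- old sumset, by `g ∈ X`, and in the new one, by `ε ∈ X`.
        A⊕S≤ : ∀ m → # (A ⊕ segments m) ≤ # A + suc m * (x + D)
        A⊕S≤ zero = lin 5 (λ s t a x D → (s ≐ t) ⟨ 1 ⟩⇒ (t ≼ a ⊞ x ⊞ D) ⟨ 1 ⟩⇒ 1 ⊢ s ≼ a ⊞ 1 ⊠ (x ⊞ D)) (# (A ⊕ Xₙ 0)) (# (A ⊕ X))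
            (# A) x D (⊕-⇀ʳ A X (0 ·ₘ g)) critX
        A⊕S≤ (suc m) = lin 11 (λ u uv i p q t a a′ x D r → (u ≼ uv) ⟨ 1 ⟩⇒ (uv ⊞ i ≐ p ⊞ q) ⟨ 1 ⟩⇒ (a′ ≼ i) ⟨ 1 ⟩⇒ (a′ ≑ a) ⟨ 1 ⟩⇒
            (q ≐ t) ⟨ 1 ⟩⇒ (t ≼ a ⊞ x ⊞ D) ⟨ 1 ⟩⇒ (p ≼ a ⊞ r) ⟨ 1 ⟩⇒ 1 ⊢ u ≼ a ⊞ (x ⊞ D ⊞ r)) (# (A ⊕ segments (suc m)))
            (# (P ∪ Q)) (# (P ∩ Q)) (# P) (# Q) (# (A ⊕ X)) (# A) (# (A ⇀ (suc m ·ₘ g))) x D (suc m * (x + D))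
          (#-mono {A ⊕ segments (suc m)} {P ∪ Q} union) (#-∪∩ P Q) (#-mono {A ⇀ (suc m ·ₘ g)} {P ∩ Q} inter) (#-⇀ A (suc m ·ₘ g))
          (⊕-⇀ʳ A X (suc m ·ₘ g)) critX (A⊕S≤ m)
          where
          P Q : Sub
          P = A ⊕ segments m
          Q = A ⊕ Xₙ (suc m)
          union : A ⊕ segments (suc m) ⊑ P ∪ Q
          union z p = ∈∪-elim (segments m ⊕ A) (Xₙ (suc m) ⊕ A) {z} (⊕-∪ (segments m) (Xₙ (suc m)) A z (⊕-comm A (segments (suc m)) z p))
            (λ r → ∈∪ˡ {P} {Q} {z} (⊕-comm (segments m) A z r)) (λ r → ∈∪ʳ {P} {Q} {z} (⊕-comm (Xₙ (suc m)) A z r))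
          inter : A ⇀ (suc m ·ₘ g) ⊑ P ∩ Q
          inter z p = ∈∩⁺ {P} {Q} {z}
            (translate-⊑ A (segments m) (segments⁺ {m} m {suc m ·ₘ g} ≤-refl
                (subst (_∈ X) (group 2 (λ g G → g ≗ (g ⊙ G) ⊘ G) refl g (m ·ₘ g)) g∈X)) z p)
            (translate-⊑ A (Xₙ (suc m)) (ε∈⇀ {X} (suc m ·ₘ g) ε∈X) z p)

        -- In units of `d`, `c` rounds up the `18 * h` by which `Φ` may fall short and `ℓ` covers
        -- the range `(m + 36) * h` of `Φ` on `S`. Rounding costs two further units of at most
        -- `38 * h`, which gives `112 = 36 + 2 * 38`.
        c′ ℓ′ c ℓ : ℕ
        c′ = proj₁ (floor (18 * h) d d>0)
        ℓ′ = proj₁ (floor ((m + 36) * h) d d>0)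
        c = suc c′
        ℓ = suc (suc ℓ′)

        cd> : 18 * h < c * d
        cd> = proj₂ (proj₂ (floor (18 * h) d d>0))
        cd≤ : c * d ≤ d + 18 * h
        cd≤ = +-monoʳ-≤ d (proj₁ (proj₂ (floor (18 * h) d d>0)))
        ℓd> : d + (m + 36) * h < ℓ * d
        ℓd> = +-monoʳ-< d (proj₂ (proj₂ (floor ((m + 36) * h) d d>0)))
        ℓd≤ : ℓ * d ≤ (m + 112) * h
        ℓd≤ = ≤-trans (+-monoʳ-≤ d (+-monoʳ-≤ d (proj₁ (proj₂ (floor ((m + 36) * h) d d>0)))))
          (≤-trans (+-mono-≤ d≤ (+-monoˡ-≤ ((m + 36) * h) d≤)) (≤-reflexive (gather-h m h)))
          where
          gather-h : ∀ m h → 38 * h + (38 * h + (m + 36) * h) ≡ (m + 112) * h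
          gather-h = solve-∀
        ℓ≤N : ℓ ≤ N
        ℓ≤N = *-cancelʳ-≤ ℓ N d (≤-trans ℓd≤ (≤-trans (*-monoˡ-≤ h m+112≤n) (≤-reflexive (sym Nd))))

        S⊑ : S ⊑ arc c ℓ
        S⊑ y y∈ =
          let j , j≤ , y∈ⱼ = segments⁻ m {y} y∈
              r , r≤ , eq = Φ-position {y} {j} (place {y} {j} (lin 3 (λ j m n → (j ≼ m) ⟨ 1 ⟩⇒ (m ⊞ con 112 ≼ n) ⟨ 1 ⟩⇒ 1 ⊢ j ≼ n)
                  j m n j≤ m+112≤n) y∈ⱼ)
          in on-arc y j r j≤ r≤ eq
          where
          on-arc : ∀ y j r → j ≤ m → r ≤ 36 * h → Φ y + r ≅ h * j + 18 * h [ M ] → y ∈ arc c ℓ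
          on-arc y j r j≤ r≤ eq = <⇒<ᵇ (subst (_< ℓ) (sym (rot-unique {c} {y} (<-≤-trans t′< ℓ≤N) z≅)) t′<)
            where
            t t′ : ℕ
            t = (h * j + 18 * h + c * d) ∸ r
            t′ = t / d
            t+r : t + r ≡ h * j + 18 * h + c * d
            t+r = m∸n+n≡m (lin 4 (λ r h hj cd → (r ≼ 36 ⊠ h) ⟨ 1 ⟩⇒ (con 1 ⊞ 18 ⊠ h ≼ cd) ⟨ 1 ⟩⇒ 1 ⊢ r ≼ hj ⊞ 18 ⊠ h ⊞ cd) r h (h * j) (c * d) r≤ cd>)
            total : (κ y + c) * d ≅ t [ M ]
            total = ≅-cancel {c = r} {d = r} (≅-trans
              (0 , 0 , cong (_+ 0) (trans (cong (_+ r) (trans (*-distribʳ-+ d (κ y) c) (cong (_+ c * d) (κd y))))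
                  ((≤-antisym (lin 3 (λ a b r → 1 ⊢ a ⊞ b ⊞ r ≼ a ⊞ r ⊞ b) (Φ y) (c * d) r )
                  (lin 3 (λ a b r → 1 ⊢ a ⊞ r ⊞ b ≼ a ⊞ b ⊞ r) (Φ y) (c * d) r )))))
              (≅-trans (≅-+ {c = c * d} eq ≅-refl) (0 , 0 , cong (_+ 0) (sym t+r)))) ≅-refl
            attained : Φ (y ∙ c ·ₘ p₀) ≅ t [ M ]
            attained = ≅-trans (≅-sym (hom′ y (c ·ₘ p₀))) (≅-trans (≅-+ {Φ y} ≅-refl (multiple c)) (≅-trans
              (0 , 0 , cong (_+ 0) (trans (cong (_+ c * d) (sym (κd y))) (sym (*-distribʳ-+ d (κ y) c)))) total))
              where
              hom′ : ∀ p q → Φ p + Φ q ≅ Φ (p ∙ q) [ M ]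
              hom′ = Φ-hom
            t′d : t′ * d ≡ t
            t′d = exact attained
            z≅ : κ y + c ≅ t′ [ N ]
            z≅ = divide (subst (λ w → (κ y + c) * d ≅ w [ M ]) (sym t′d) total)
            t′< : t′ < ℓ
            t′< = *-cancelʳ-< d t′ ℓ (≤-<-trans (≤-reflexive t′d) (≤-<-trans
              (lin 8 (λ t r hj h cd mh d hm → (t ⊞ r ≐ hj ⊞ 18 ⊠ h ⊞ cd) ⟨ 1 ⟩⇒ (cd ≼ d ⊞ 18 ⊠ h) ⟨ 1 ⟩⇒ (hj ≼ hm) ⟨ 1 ⟩⇒
                  (mh ≑ hm ⊞ 36 ⊠ h) ⟨ 1 ⟩⇒ 1 ⊢ t ≼ d ⊞ mh) t r (h * j) h (c * d) ((m + 36) * h) d (h * m)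
                t+r cd≤ (*-monoʳ-≤ h j≤) (trans (*-distribʳ-+ h m 36) (cong (_+ 36 * h) (*-comm m h)))) ℓd>))

        ε₁ d₁ : ℕ
        ε₁ = 113 * x + (m + 112) * (49 * s)
        d₁ = suc m * (s + D)

        ε₁≤ : ε₁ ≤ pw 19
        ε₁≤ = lin 7 (λ x a b ms q s c → (x ≼ a) ⟨ 113000000 ⟩⇒ (1000 ⊠ a ≼ b) ⟨ 118439 ⟩⇒ (ms ≐ 49 ⊠ q ⊞ 5439 ⊠ s) ⟨ 1000000 ⟩⇒
            (q ≼ c) ⟨ 49000000 ⟩⇒ (1000 ⊠ c ≼ b) ⟨ 49000 ⟩⇒ (1000 ⊠ s ≼ a) ⟨ 5439000 ⟩⇒ 1000000 ⊢ 113 ⊠ x ⊞ ms ≼ b) x (pw 17)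
            (pw 19) ((m + 112) * (49 * s)) (suc m * s) s (pw 18)
          x-hi (up 17 19 (m≤m+n 18 1)) (regroup m s) qs≤ (up 18 19 ≤-refl) (up 6 17 (m≤m+n 7 10))
          where
          regroup : ∀ m s → (m + 112) * (49 * s) ≡ 49 * (suc m * s) + 5439 * s
          regroup = solve-∀

        d₁≤ : d₁ ≤ 2 * pw 18
        d₁≤ = ≤-trans (*-monoʳ-≤ (suc m) (+-monoʳ-≤ s D≤s)) (≤-trans (≤-reflexive (regroup (suc m) s)) (*-monoʳ-≤ 2 qs≤))
          where
          regroup : ∀ m s → m * (s + s) ≡ 2 * (m * s)
          regroup = solve-∀

        dense : ℓ * k₀ ≤ # S + ε₁
        dense = dense-bound {n} {m} {ℓ * k₀} {h} {x} {s} {# S}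
          (arc-count {n} {m} {ℓ} {k₀} {N} {d} {h} h>0 ℓd≤ total-count Nd) h≤nx m+112≤n (≤-trans (s≤s z≤n) 2≤n) tiles

        critS : # (A ⊕ S) ≤ # A + # S + d₁
        critS = lin 8 (λ u a S mx ms mD xd sd → (u ≼ a ⊞ xd) ⟨ 1 ⟩⇒ (xd ≐ mx ⊞ mD) ⟨ 1 ⟩⇒ (sd ≑ ms ⊞ mD) ⟨ 1 ⟩⇒ (mx ≼ S ⊞ ms) ⟨ 1
            ⟩⇒ 1 ⊢ u ≼ a ⊞ S ⊞ sd) (# (A ⊕ S)) (# A) (# S) (suc m * x) (suc m * s) (suc m * D) (suc m * (x + D)) (suc m * (s + D))
          (A⊕S≤ m) (*-distribˡ-+ (suc m) x D) (*-distribˡ-+ (suc m) s D) tiles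

        qx₁ : suc m * x ≤ pw 28
        qx₁ = ≤-trans (≤-reflexive (cong (_* x) q≡)) qx≤
        qx₂ : pw 28 < x + suc m * x
        qx₂ = <-≤-trans qx> (≤-reflexive (cong (λ k → x + k * x) (sym q≡)))

        E5ε₁ : E ^ 5 * ε₁ ≤ pw 24
        E5ε₁ = ≤-trans (*-monoʳ-≤ (E ^ 5) ε₁≤) (≤-reflexive (sym (pw-+ 5 19)))

        opaque
          -- The number of blocks balances two errors: `E ^ 5` translates of a defect of size
          -- `pw 19` amount to `pw 24`, and blocks of about one `E ^ 5`-th of the circle cost about
          -- `pw 25`.
          hullA : ∃ λ c′ → ∃ λ ℓ″ → ℓ″ ≤ N × A ⊑ arc c′ ℓ″ × ℓ″ * k₀ ≤ # A + (2 * width 5 + 1) * k₀ + d₁ + E ^ 5 * ε₁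
          hullA = arc-hull S A {c} {ℓ} {ε₁} {d₁} {E ^ 5} {width 5} ℓ≤N S⊑ dense (proj₂ A-nonempty) critS (width>0 5) (width-cover 5)
            (lin 12 (λ u a xd mx mD ms p18 p28 p29 h e p24 → (u ≼ a ⊞ xd) ⟨ 500000 ⟩⇒ (xd ≐ mx ⊞ mD) ⟨ 500000 ⟩⇒ (mD ≼ ms) ⟨
                500000 ⟩⇒ (ms ≼ p18) ⟨ 500000 ⟩⇒ (mx ≼ p28) ⟨ 500000 ⟩⇒ (a ⊞ p29 ≼ h) ⟨ 500000 ⟩⇒ (e ≼ p24) ⟨ 500000 ⟩⇒
                (1000 ⊠ p24 ≼ p28) ⟨ 500 ⟩⇒ (1000 ⊠ p18 ≼ p28) ⟨ 500 ⟩⇒ (1000 ⊠ p28 ≼ p29) ⟨ 1001 ⟩⇒ (con 1 ≼ p28) ⟨ 500000 ⟩⇒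
                500000 ⊢ con 1 ⊞ u ⊞ e ≼ h) (# (A ⊕ S)) (# A) (suc m * (x + D)) (suc m * x) (suc m * D) (suc m * s) (pw 18)
                (pw 28) (pw 29) h (E ^ 5 * ε₁) (pw 24)
              (A⊕S≤ m) (*-distribˡ-+ (suc m) x D) (*-monoʳ-≤ (suc m) D≤s) qs≤ qx₁ A+R≤h E5ε₁ (up 24 28 (m≤m+n 25 3))
                  (up 18 28 (m≤m+n 19 9)) (up 28 29 ≤-refl) (1≤β 28))
            (lin 17 (λ K w k d e lk S a mx ms x p17 p18 p24 p25 p27 p28 → (K ≐ 4 ⊠ w ⊞ 2 ⊠ k) ⟨ 100000000 ⟩⇒ (w ≼ 2 ⊠ p25 ⊞ p18) ⟨
                400000000 ⟩⇒ (k ≼ p18) ⟨ 200000000 ⟩⇒ (d ≼ 2 ⊠ p18) ⟨ 100000000 ⟩⇒ (e ≼ p24) ⟨ 100000000 ⟩⇒ (S ≼ a) ⟨ 100000000 ⟩⇒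
                (a ≐ lk) ⟨ 100000000 ⟩⇒ (mx ≼ S ⊞ ms) ⟨ 100000000 ⟩⇒ (ms ≼ p18) ⟨ 100000000 ⟩⇒ (con 1 ⊞ p28 ≼ x ⊞ mx) ⟨ 100000000
                ⟩⇒ (x ≼ p17) ⟨ 100000000 ⟩⇒ (1000 ⊠ p17 ≼ p28) ⟨ 100000 ⟩⇒ (1000 ⊠ p18 ≼ p25) ⟨ 900000 ⟩⇒ (1000 ⊠ p24 ≼ p25) ⟨
                100000 ⟩⇒ (1000 ⊠ p25 ≼ p27) ⟨ 801000 ⟩⇒ (1000 ⊠ p27 ≼ p28) ⟨ 801 ⟩⇒ 100000000 ⊢ con 1 ⊞ K ⊞ d ⊞ e ≼ lk)
                ((4 * width 5 + 2) * k₀) (width 5 * k₀) (k₀) (d₁) (E ^ 5 * ε₁) (ℓ * k₀) (# S) (# (arc c ℓ)) (suc m * x)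
                (suc m * s) x (pw 17) (pw 18) (pw 24) (pw 25) (pw 27) (pw 28)
              (regroup (width 5) k₀) (width-size 5 25 refl) k₀≤ d₁≤ E5ε₁ (#-mono {S} {arc c ℓ} S⊑) (below-count c ℓ ℓ≤N) tiles qs≤ qx₂ x-hi
              (up 17 28 (m≤m+n 18 10)) (up 18 25 (m≤m+n 19 6)) (up 24 25 ≤-refl) (up 25 27 (m≤m+n 26 1)) (up 27 28 ≤-refl))
            where
            regroup : ∀ w k → (4 * w + 2) * k ≡ 4 * (w * k) + 2 * k
            regroup = solve-∀

        cA ℓA : ℕ
        cA = proj₁ hullA
        ℓA = proj₁ (proj₂ hullA)
        ℓA≤ : ℓA ≤ N
        ℓA≤ = proj₁ (proj₂ (proj₂ hullA))
        A⊑ : A ⊑ arc cA ℓA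
        A⊑ = proj₁ (proj₂ (proj₂ (proj₂ hullA)))

        regroup₂ : ∀ w k → (2 * w + 1) * k ≡ 2 * (w * k) + k
        regroup₂ = solve-∀
        regroup₄ : ∀ w k → (4 * w + 2) * k ≡ 4 * (w * k) + 2 * k
        regroup₄ = solve-∀

        denseA : ℓA * k₀ ≤ # A + pw 26
        denseA = lin 11 (λ l a K w k d e p18 p24 p25 p26 → (l ≼ a ⊞ K ⊞ d ⊞ e) ⟨ 500000 ⟩⇒ (K ≐ 2 ⊠ w ⊞ k) ⟨ 500000 ⟩⇒
            (w ≼ 2 ⊠ p25 ⊞ p18) ⟨ 1000000 ⟩⇒ (k ≼ p18) ⟨ 500000 ⟩⇒ (d ≼ 2 ⊠ p18) ⟨ 500000 ⟩⇒ (e ≼ p24) ⟨ 500000 ⟩⇒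
            (1000 ⊠ p18 ≼ p25) ⟨ 2500 ⟩⇒ (1000 ⊠ p24 ≼ p25) ⟨ 500 ⟩⇒ (1000 ⊠ p25 ≼ p26) ⟨ 2003 ⟩⇒ 500000 ⊢ l ≼ a ⊞ p26) (ℓA * k₀)
            (# A) ((2 * width 5 + 1) * k₀) (width 5 * k₀) (k₀) (d₁) (E ^ 5 * ε₁) (pw 18) (pw 24) (pw 25) (pw 26)
          (proj₂ (proj₂ (proj₂ (proj₂ hullA)))) (regroup₂ (width 5) k₀) (width-size 5 25 refl) k₀≤ d₁≤ E5ε₁
              (up 18 25 (m≤m+n 19 6)) (up 24 25 ≤-refl) (up 25 26 ≤-refl)

        ν≤β : ν ≤ β
        ν≤β = ≤-trans (≤-trans (≤-reflexive (sym (*-identityˡ ν))) (*-monoˡ-≤ ν (m^n>0 2 (2 * E ^ 16)))) (≤-trans ν≤ ν′≤β)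

        E2p : E ^ 2 * pw 26 ≡ pw 28
        E2p = sym (pw-+ 2 26)

        opaque
          -- Now `A` is the filled arc, with defect `pw 26`. With `E ^ 2` blocks both errors stay
          -- near `pw 28`, below the permitted `pw 29`.
          hullB : ∃ λ c′ → ∃ λ ℓ″ → ℓ″ ≤ N × B ⊑ arc c′ ℓ″ × ℓ″ * k₀ ≤ # B + (2 * width 2 + 1) * k₀ + ν + E ^ 2 * pw 26
          hullB = arc-hull A B {cA} {ℓA} {pw 26} {ν} {E ^ 2} {width 2} ℓA≤ A⊑ denseA (proj₂ B-nonempty)
            (lin 5 (λ u v a b n → (u ≐ v) ⟨ 1 ⟩⇒ (v ≼ a ⊞ b ⊞ n) ⟨ 1 ⟩⇒ 1 ⊢ u ≼ b ⊞ a ⊞ n) (# (B ⊕ A)) (# (A ⊕ B)) (# A) (# B) (ν)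
                (#-comm B A) crit) (width>0 2) (width-cover 2)
            (lin 6 (λ u v e p28 p29 h → (u ≐ v) ⟨ 500 ⟩⇒ (p29 ⊞ v ≼ h) ⟨ 500 ⟩⇒ (e ≐ p28) ⟨ 500 ⟩⇒ (1000 ⊠ p28 ≼ p29) ⟨ 1 ⟩⇒
                (con 1 ≼ p28) ⟨ 500 ⟩⇒ 500 ⊢ con 1 ⊞ u ⊞ e ≼ h) (# (B ⊕ A)) (# (A ⊕ B)) (E ^ 2 * pw 26) (pw 28) (pw 29) h
              (#-comm B A) free′ E2p (up 28 29 ≤-refl) (1≤β 28))
            (lin 13 (λ K w k n b p0 e lk a c p18 p28 p29 → (K ≐ 4 ⊠ w ⊞ 2 ⊠ k) ⟨ 1000000 ⟩⇒ (w ≼ 2 ⊠ p28 ⊞ p18) ⟨ 4000000 ⟩⇒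
                (k ≼ p18) ⟨ 2000000 ⟩⇒ (n ≼ b) ⟨ 1000000 ⟩⇒ (p0 ≑ b) ⟨ 1000000 ⟩⇒ (1000 ⊠ p0 ≼ p28) ⟨ 1000 ⟩⇒ (e ≐ p28) ⟨ 1000000
                ⟩⇒ (p29 ≼ a) ⟨ 10007 ⟩⇒ (a ≼ c) ⟨ 10007 ⟩⇒ (c ≐ lk) ⟨ 10007 ⟩⇒ (1000 ⊠ p18 ≼ p28) ⟨ 6000 ⟩⇒ (1000 ⊠ p28 ≼ p29) ⟨
                10007 ⟩⇒ (con 1 ≼ p28) ⟨ 1000000 ⟩⇒ 1000000 ⊢ con 1 ⊞ K ⊞ n ⊞ e ≼ lk) ((4 * width 2 + 2) * k₀) (width 2 * k₀) (k₀)
                (ν) (β) (pw 0) (E ^ 2 * pw 26) (ℓA * k₀) (# A) (# (arc cA ℓA)) (pw 18) (pw 28) (pw 29)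
              (regroup₄ (width 2) k₀) (width-size 2 28 refl) k₀≤ ν≤β β≡ (up 0 28 (m≤m+n 1 27)) E2p R≤A (#-mono {A} {arc cA ℓA} A⊑)
                  (below-count cA ℓA ℓA≤) (up 18 28 (m≤m+n 19 9)) (up 28 29 ≤-refl) (1≤β 28))

        within : ∀ {a b} → a ≤ b + pw 29 → E * a ≤ E * b + h
        within {a} {b} p = ≤-trans (*-monoʳ-≤ E p) (≤-trans (≤-reflexive (*-distribˡ-+ E b (pw 29)))
            (+-monoʳ-≤ (E * b) (≤-trans (≤-reflexive (pw-suc 29)) h-lo)))

      bohr-pair : BohrPair 𝔾 A B E k
      bohr-pair = record
        { N = N ; k<N = ≤-<-trans k≤E E<N ; κ = κ ; κ-hom = κ-hom ; κ-onto = κ-onto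
        ; cA = cA ; ℓA = ℓA ; cB = proj₁ hullB ; ℓB = proj₁ (proj₂ hullB)
        ; ℓA≤ = ℓA≤ ; ℓB≤ = proj₁ (proj₂ (proj₂ hullB)) ; A⊑ = A⊑ ; B⊑ = proj₁ (proj₂ (proj₂ (proj₂ hullB)))
        ; A-dense = within (lin 4 (λ l a p26 p29 → (l ≼ a ⊞ p26) ⟨ 1000 ⟩⇒ (1000 ⊠ p26 ≼ p29) ⟨ 1 ⟩⇒ 1000 ⊢ l ≼ a ⊞ p29) (ℓA * k₀)
            (# A) (pw 26) (pw 29) denseA (up 26 29 (m≤m+n 27 2)))
        ; B-dense = within (lin 12 (λ l a K w k n b p0 e p18 p28 p29 → (l ≼ a ⊞ K ⊞ n ⊞ e) ⟨ 250000 ⟩⇒ (K ≐ 2 ⊠ w ⊞ k) ⟨ 250000 ⟩⇒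
            (w ≼ 2 ⊠ p28 ⊞ p18) ⟨ 500000 ⟩⇒ (k ≼ p18) ⟨ 250000 ⟩⇒ (n ≼ b) ⟨ 250000 ⟩⇒ (p0 ≑ b) ⟨ 250000 ⟩⇒ (1000 ⊠ p0 ≼ p28) ⟨ 250
            ⟩⇒ (e ≐ p28) ⟨ 250000 ⟩⇒ (1000 ⊠ p18 ≼ p28) ⟨ 750 ⟩⇒ (1000 ⊠ p28 ≼ p29) ⟨ 1251 ⟩⇒ 250000 ⊢ l ≼ a ⊞ p29)
            (proj₁ (proj₂ hullB) * k₀) (# B) ((2 * width 2 + 1) * k₀) (width 2 * k₀) (k₀) (ν) (β) (pw 0) (E ^ 2 * pw 26) (pw 18)
            (pw 28) (pw 29)
            (proj₂ (proj₂ (proj₂ (proj₂ hullB)))) (regroup₂ (width 2) k₀) (width-size 2 28 refl) k₀≤ ν≤β β≡ (up 0 28 (m≤m+n 1 27))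
                E2p (up 18 28 (m≤m+n 19 9)) (up 28 29 ≤-refl)) }

  -- `2 * (h * τ)` is at most `4 * H * θ * τ`, which is half of `θ * θ`.
  scale-tower : ∀ {h H θ τ} → θ ≡ 8 * H * τ → 1 ≤ H * θ * τ → h ≤ 2 * (H * θ) → 2 * (h * τ) < θ * θ
  scale-tower {h} {H} {θ} {τ} eq 1≤ h≤ = begin-strict
    2 * (h * τ) ≤⟨ *-monoʳ-≤ 2 (*-monoˡ-≤ τ h≤) ⟩
    2 * (2 * (H * θ) * τ) ≡⟨ regroup H θ τ ⟩
    4 * (H * θ * τ) <⟨ *-monoˡ-< (H * θ * τ) {{>-nonZero 1≤}} (m≤m+n 5 3) ⟩
    8 * (H * θ * τ) ≡⟨ regroup′ H θ τ ⟩
    8 * H * τ * θ ≡⟨ cong (_* θ) eq ⟨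
    θ * θ ∎
    where
    open ≤-Reasoning
    regroup : ∀ H θ τ → 2 * (2 * (H * θ) * τ) ≡ 4 * (H * θ * τ)
    regroup = solve-∀
    regroup′ : ∀ H θ τ → 8 * (H * θ * τ) ≡ 8 * H * τ * θ
    regroup′ = solve-∀

  floor-double : ∀ Z {h} → 1 ≤ Z → ∀ a → Z * a ≤ h → 1 ≤ a → ∃ λ μ → a ≤ μ × Z * μ ≤ h × h ≤ 2 * (Z * μ)
  floor-double Z {h} 1≤Z a Za≤ 1≤a =
    let μ , lo , hi = floor h Z 1≤Z
        a≤μ = ≤-pred (*-cancelˡ-< Z a (suc μ) (≤-<-trans Za≤ (<-≤-trans hi (≤-reflexive (trans (cong (Z +_) (*-comm μ Z)) (sym (*-suc Z μ)))))))
        lo′ = ≤-trans (≤-reflexive (*-comm Z μ)) lo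
    in μ , a≤μ , lo′ , lin 4 (λ h Z m m′ → (con 1 ⊞ h ≼ Z ⊞ m) ⟨ 1 ⟩⇒ (m ≐ m′) ⟨ 1 ⟩⇒ (Z ≼ m′) ⟨ 1 ⟩⇒ 1 ⊢ h ≼ 2 ⊠ m′) h Z (μ * Z)
        (Z * μ) hi (*-comm μ Z)
         (≤-trans (≤-reflexive (sym (*-identityʳ Z))) (*-monoʳ-≤ Z (≤-trans 1≤a a≤μ)))

  -- The choice of scales for the structure theorem

  module Threshold (E k : ℕ) (E-big : 1000 ≤ E) (k≤E : k ≤ E) where

    private
      -- `P` is the total loss of the shrinking steps. With `τ = E ^ 15 * μ` and `θ = 8 * H * τ` the
      -- constants satisfy `Z * μ = H * θ = E ^ 30 * (P * θ)`, so that `β = P * θ` puts `h` between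
      -- `E ^ 30 * β` and twice that.
      P H Z : ℕ
      P = 2 ^ (2 * E ^ 16)
      H = P * E ^ 30
      Z = 8 * H * H * E ^ 15

      1≤E : 1 ≤ E
      1≤E = ≤-trans (s≤s z≤n) E-big

      instance
        E≢0 : NonZero E
        E≢0 = >-nonZero 1≤E

      1≤P : 1 ≤ P
      1≤P = m^n>0 2 (2 * E ^ 16)
      1≤H : 1 ≤ H
      1≤H = *-mono-≤ 1≤P (m^n>0 E 30)
      1≤Z : 1 ≤ Z
      1≤Z = *-mono-≤ (*-mono-≤ (*-mono-≤ (s≤s (z≤n {7})) 1≤H) 1≤H) (m^n>0 E 15)

    opaque
      N₀ : ℕ
      N₀ = Z * P

      N₀-def : N₀ ≡ Z * P
      N₀-def = refl

    module _ (𝔾 : FinAb) (U : FinAb.Carrier 𝔾 → Bool)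
      (generates : ∀ (S : FinAb.Carrier 𝔾 → Bool) {x} → T (S x) →
         (∀ x u → T (S x) → T (U u) → T (S (FinAb._∙_ 𝔾 x u))) → ∀ y → T (S y)) where
      open Counting 𝔾
      open Lipschitz 𝔾 U generates

      -- All scales are multiples of `μ`, about `h / Z`; `N₀` is what ensures that `μ` is at least
      -- `P * suc ν`.
      structure : ∀ {A B : Sub} {ν} → N₀ * suc ν ≤ h → h ≤ E * # A → h ≤ E * # B → Lip B ν →
        # (A ⊕ B) ≤ # A + # B + ν → h + E * # (A ⊕ B) ≤ E * h → BohrPair 𝔾 A B E k
      structure {A} {B} {ν} big A-big B-big lip crit free =
        let μ , Pν≤ , lo , hi = floor-double Z 1≤Z (P * suc ν) (≤-trans (≤-reflexive
                (trans (sym (*-assoc Z P (suc ν))) (cong (_* suc ν) (sym N₀-def)))) big) (*-mono-≤ 1≤P (s≤s z≤n)) in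
        build μ Pν≤ lo hi
        where
        build : ∀ μ → P * suc ν ≤ μ → Z * μ ≤ h → h ≤ 2 * (Z * μ) → BohrPair 𝔾 A B E k
        build μ Pν≤ lo hi = Structure.bohr-pair 𝔾 U generates {E} {k} {P * θ} {ν} {μ} {τ} {θ} {4 * H * τ} {4 * H}
          E-big k≤E (*-mono-≤ 1≤P 1≤θ) 1≤τ
          (scale-tower {h} {H} {θ} {τ} refl (*-mono-≤ (*-mono-≤ 1≤H 1≤θ) 1≤τ) (≤-trans hi (≤-reflexive (cong (2 *_) Zμ))))
          (≤-reflexive (double H τ)) (≤-trans hi (≤-reflexive (trans (cong (2 *_) Zμ) (cosets H τ))))
          (≤-trans (*-monoʳ-≤ P (n≤1+n ν)) Pν≤)
          (≤-trans (*-monoʳ-≤ P (+-monoˡ-≤ θ (≤-trans ν≤μ (≤-trans μ≤τ τ≤θ)))) (≤-reflexive (twice P θ)))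
          (≤-trans μ≤τ (≤-trans τ≤θ (≤-trans (≤-reflexive (sym (*-identityˡ θ))) (*-monoˡ-≤ θ 1≤P))))
          (≤-trans τ≤θ (≤-trans (≤-reflexive (sym (*-identityˡ θ))) (*-monoˡ-≤ θ 1≤P)))
          large (≤-trans (≤-reflexive (sym EPθ)) lo) (≤-trans hi (≤-reflexive (cong (2 *_) EPθ)))
          A B A-big B-big lip crit free
          where
          τ θ : ℕ
          τ = E ^ 15 * μ
          θ = 8 * H * τ
          1≤μ : 1 ≤ μ
          1≤μ = ≤-trans (*-mono-≤ 1≤P (s≤s (z≤n {ν}))) Pν≤
          1≤τ : 1 ≤ τ
          1≤τ = *-mono-≤ (m^n>0 E 15) 1≤μ
          1≤θ : 1 ≤ θ
          1≤θ = *-mono-≤ (*-mono-≤ (s≤s (z≤n {7})) 1≤H) 1≤τ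
          μ≤τ : μ ≤ τ
          μ≤τ = ≤-trans (≤-reflexive (sym (*-identityˡ μ))) (*-monoˡ-≤ μ (m^n>0 E 15))
          τ≤θ : τ ≤ θ
          τ≤θ = ≤-trans (≤-reflexive (sym (*-identityˡ τ))) (*-monoˡ-≤ τ (*-mono-≤ (s≤s (z≤n {7})) 1≤H))
          ν≤μ : ν ≤ μ
          ν≤μ = ≤-trans (n≤1+n ν) (≤-trans (≤-trans (≤-reflexive (sym (*-identityˡ (suc ν)))) (*-monoˡ-≤ (suc ν) 1≤P)) Pν≤)
          regroup : ∀ H e m → 8 * H * H * e * m ≡ H * (8 * H * (e * m))
          regroup = solve-∀
          Zμ : Z * μ ≡ H * θ
          Zμ = regroup H (E ^ 15) μ
          double : ∀ H t → 2 * (4 * H * t) ≡ 8 * H * t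
          double = solve-∀
          cosets : ∀ H t → 2 * (H * (8 * H * t)) ≡ 4 * H * (4 * H * t)
          cosets = solve-∀
          twice : ∀ P t → P * (t + t) ≡ 2 * (P * t)
          twice = solve-∀
          EPθ : Z * μ ≡ E ^ 30 * (P * θ)
          EPθ = trans Zμ (move P (E ^ 30) θ)
            where
            move : ∀ p e t → p * e * t ≡ e * (p * t)
            move = solve-∀
          large : h * (4 * H * (3 * μ)) < E ^ 16 * (P * θ) * (4 * H * τ)
          large = begin-strict
            h * (4 * H * (3 * μ)) ≤⟨ *-monoˡ-≤ (4 * H * (3 * μ)) (≤-trans hi (≤-reflexive (cong (2 *_) EPθ))) ⟩
            2 * (E ^ 30 * (P * θ)) * (4 * H * (3 * μ)) ≡⟨ r₁ (E ^ 30) (P * θ) H μ ⟩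
            24 * (E ^ 30 * (P * θ * H * μ)) <⟨ *-monoˡ-< (E ^ 30 * (P * θ * H * μ))
                {{>-nonZero (*-mono-≤ (m^n>0 E 30) (*-mono-≤ (*-mono-≤ (*-mono-≤ 1≤P 1≤θ) 1≤H) 1≤μ))}}
                (≤-trans (m≤m+n 25 975) E-big) ⟩
            E * (E ^ 30 * (P * θ * H * μ)) ≤⟨ m≤m+n _ _ ⟩
            4 * (E * (E ^ 30 * (P * θ * H * μ))) ≡⟨ cong (4 *_) (trans (sym (*-assoc E (E ^ 30) _))
                (cong (_* (P * θ * H * μ)) (^-distribˡ-+-* E 16 15))) ⟩
            4 * (E ^ 16 * E ^ 15 * (P * θ * H * μ)) ≡⟨ r₂ (E ^ 16) (E ^ 15) (P * θ) H μ ⟩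
            E ^ 16 * (P * θ) * (4 * H * (E ^ 15 * μ)) ∎
            where
            open ≤-Reasoning
            r₁ : ∀ e p H m → 2 * (e * p) * (4 * H * (3 * m)) ≡ 24 * (e * (p * H * m))
            r₁ = solve-∀
            r₂ : ∀ e f p H m → 4 * (e * f * (p * H * m)) ≡ e * p * (4 * H * (f * m))
            r₂ = solve-∀

  -- Reduction to a subgroup

  module Reduction (𝔾 : FinAb) where
    open Counting 𝔾

    module Critical₁ (A B : Sub) {E D d : ℕ}
      (hits : ∀ K → Subgroup K → h ≤ D * # K → Meets B K)
      (crit : # (A ⊕ B) ≤ # A + # B + d) (free : h + E * # (A ⊕ B) ≤ E * h)
      {a₀ : Carrier} (a₀∈ : a₀ ∈ A) where

      ∁ : Sub → Sub
      ∁ S x = not (S x)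

      ∁⁺ : ∀ {S : Sub} {x} → ¬ (x ∈ S) → x ∈ ∁ S
      ∁⁺ {S} {x} p = ∈∖⁺ {full} {S} {x} tt p

      ∁⁻ : ∀ {S : Sub} {x} → x ∈ ∁ S → ¬ (x ∈ S)
      ∁⁻ {S} {x} p = ∈∖ʳ {full} {S} {x} p

      #-∁ : ∀ S → # S + # (∁ S) ≡ h
      #-∁ S = #-∖ full S

      -- Two levels of constants: `τ` and `θ` confine the size of `Y`, while the primed ones belong
      -- to the growth bound inside `H`, whose error must be small compared with `Y`.
      module InSubgroup (H : Sub) (sub : Subgroup H) (H-index : h ≤ D * # H)
        (Y : Sub) (ε∈Y : ε ∈ Y) (Y⊑H : Y ⊑ H) (critY : # (Y ⊕ B) ≤ # Y + # B + d)
        {τ θ τ′ θ′ κ′ ξ₀ : ℕ} (1≤τ : 1 ≤ τ) (τ≤Y : τ ≤ # Y) (Y<θ : # Y < θ)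
        (1≤τ′ : 1 ≤ τ′) (τ′<θ′ : 2 * (h * τ′) < θ′ * θ′) (κ′≤θ′ : 2 * κ′ ≤ θ′) (κ′-index : h ≤ D * κ′)
        (τ′≤τ : τ′ ≤ τ) (θ′<τ : 2 * θ′ + d < τ) (ξ₀-big : h * τ′ ≤ τ * ξ₀) where
        open Subgroup sub
        open SubgroupAsGroup 𝔾 H sub

        P : Sub
        P = Y ⊕ B

        B⊑P : B ⊑ P
        B⊑P x p = subst (_∈ P) (identityˡ x) (⊕⁺ {Y} {B} ε∈Y p)

        coset-trans : ∀ {x y z} → y ∈ H ⇀ x → z ∈ H ⇀ y → z ∈ H ⇀ x
        coset-trans {x} {y} {z} p q = subst (_∈ H) (group 3 (λ x y z → (y ⊘ x) ⊙ (z ⊘ y) ≗ z ⊘ x) refl x y z) (∙∈ p q)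

        coset-sym : ∀ {x y} → y ∈ H ⇀ x → x ∈ H ⇀ y
        coset-sym {x} {y} p = subst (_∈ H) (group 2 (λ x y → inv (y ⊘ x) ≗ x ⊘ y) refl x y) (⁻¹∈ p)

        shift : Sub → Carrier → Sub
        shift S x b = S (b ∙ x)

        #-shift : ∀ S x → # (H ∩ shift S x) ≡ # ((H ⇀ x) ∩ S)
        #-shift S x = trans (sym (#-⇀ (H ∩ shift S x) x)) (#-cong {(H ∩ shift S x) ⇀ x} {(H ⇀ x) ∩ S}
          λ z → cong (λ y → H (z // x) ∧ S y) (group 2 (λ z x → (z ⊘ x) ⊙ x ≗ z) refl z x))

        ⊕-shift : ∀ R S x → # (H ∩ (R ⊕ shift S x)) ≡ # ((H ⇀ x) ∩ (R ⊕ S))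
        ⊕-shift R S x = trans (≤-antisym (#-mono {H ∩ (R ⊕ shift S x)} {H ∩ shift (R ⊕ S) x} into)
            (#-mono {H ∩ shift (R ⊕ S) x} {H ∩ (R ⊕ shift S x)} back)) (#-shift (R ⊕ S) x)
          where
          into : H ∩ (R ⊕ shift S x) ⊑ H ∩ shift (R ⊕ S) x
          into z p =
            let y , b , y∈ , b∈ , eq = ⊕⁻ {R} {shift S x} {z} (∈∩ʳ {H} {R ⊕ shift S x} {z} p) in
            ∈∩⁺ {H} {shift (R ⊕ S) x} {z} (∈∩ˡ {H} {R ⊕ shift S x} {z} p)
              (subst (_∈ R ⊕ S) (trans (sym (assoc y b x)) (cong (_∙ x) (sym eq))) (⊕⁺ {R} {S} y∈ b∈))
          back : H ∩ shift (R ⊕ S) x ⊑ H ∩ (R ⊕ shift S x)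
          back z p =
            let y , b , y∈ , b∈ , eq = ⊕⁻ {R} {S} {z ∙ x} (∈∩ʳ {H} {shift (R ⊕ S) x} {z} p) in
            ∈∩⁺ {H} {R ⊕ shift S x} {z} (∈∩ˡ {H} {shift (R ⊕ S) x} {z} p)
              (subst (_∈ R ⊕ shift S x) (trans (sym (assoc y b (x ⁻¹))) (trans (cong (_∙ x ⁻¹) (sym eq))
                  (group 2 (λ z x → (z ⊙ x) ⊙ inv x ≗ z) refl z x)))
                (⊕⁺ {R} {shift S x} {y} {b // x} y∈ (subst (_∈ S) (group 2 (λ b x → b ≗ (b ⊘ x) ⊙ x) refl b x) b∈)))

        -- Large subgroups of `H` have small index in the whole group, so the piece of `B` in any
        -- coset of `H` meets all their cosets. The growth bound inside `H` thus applies unless `P`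
        -- leaves fewer than `τ′` points of the coset.
        dichotomy : ∀ x → # H < # ((H ⇀ x) ∩ P) + τ′ ⊎ # Y + # ((H ⇀ x) ∩ B) ≤ # ((H ⇀ x) ∩ P) + θ′
        dichotomy x with # ((H ⇀ x) ∩ P) + τ′ ≤? # H
        ... | no p = inj₁ (≰⇒> p)
        ... | yes p =
            let k , k∈ , kx∈ = hits H sub H-index x in
            inj₂ (lin 7 (λ y y′ b b′ s s′ t → (y′ ⊞ b′ ≼ s′ ⊞ t) ⟨ 1 ⟩⇒ (y′ ≑ y) ⟨ 1 ⟩⇒ (b′ ≑ b) ⟨ 1 ⟩⇒ (s′ ≐ s) ⟨ 1 ⟩⇒ 1 ⊢ y ⊞ b
                ≼ s ⊞ t) (# Y) (ℍ.# restrict Y) (# ((H ⇀ x) ∩ B)) (ℍ.# restrict (shift B x)) (# ((H ⇀ x) ∩ P))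
                (ℍ.# (restrict Y ℍ.⊕ restrict (shift B x))) (θ′)
              (Isoperimetry.Fragments.growth group-of (restrict (shift B x)) τ′ {k , k∈} kx∈ {θ′} {κ′} 1≤τ′
                (≤-<-trans (*-monoʳ-≤ 2 (*-monoˡ-≤ τ′ (≤-trans (≤-reflexive h-restrict) (#≤h H)))) τ′<θ′) κ′≤θ′ meets (restrict Y)
                (≤-trans τ′≤τ (≤-trans τ≤Y (≤-reflexive (sym sizeY))) ,
                 lin 5 (λ s s′ t H h → (s ⊞ t ≼ H) ⟨ 1 ⟩⇒ (s′ ≐ s) ⟨ 1 ⟩⇒ (h ≑ H) ⟨ 1 ⟩⇒ 1 ⊢ t ⊞ s′ ≼ h) (# ((H ⇀ x) ∩ P))
                    (ℍ.# (restrict Y ℍ.⊕ restrict (shift B x))) (τ′) (# H) (ℍ.h) p sizeS h-restrict))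
              sizeY sizeB sizeS)
          where
          sizeY : ℍ.# restrict Y ≡ # Y
          sizeY = #-restrict-⊑ Y Y⊑H
          sizeB : ℍ.# restrict (shift B x) ≡ # ((H ⇀ x) ∩ B)
          sizeB = trans (#-restrict (shift B x)) (#-shift B x)
          sizeS : ℍ.# (restrict Y ℍ.⊕ restrict (shift B x)) ≡ # ((H ⇀ x) ∩ P)
          sizeS = trans (#-⊕-restrict Y (shift B x) Y⊑H) (⊕-shift Y B x)
          meets : ∀ K → ℍ.Subgroup K → κ′ ≤ ℍ.# K → ℍ.Meets (restrict (shift B x)) K
          meets K sK κ≤ (p , p∈) =
            let k , k∈ , kpx = hits (extend K) (extend-subgroup sK) (≤-trans κ′-index
                    (*-monoʳ-≤ D (≤-trans κ≤ (≤-reflexive (sym (#-extend K)))))) (p ∙ x)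
                kH , kK = extend⁻ K k∈
            in (k , kH) , kK , subst (_∈ B) (sym (assoc k p x)) kpx

        Thin : Carrier → Set
        Thin x = # ((H ⇀ x) ∩ P) + τ′ ≤ # H

        gain : ∀ x → # ((H ⇀ x) ∩ P) ≡ # ((H ⇀ x) ∩ B) + # ((H ⇀ x) ∩ (P ∖ B))
        gain x = trans (∑-cong elems (λ z → at (H (z // x)) (P z) (B z) (B⊑P z))) (∑-+ elems _ _)
          where
          at : ∀ a b c → (T c → T b) → 𝟙 (a ∧ b) ≡ 𝟙 (a ∧ c) + 𝟙 (a ∧ (b ∧ not c))
          at false b c _ = refl
          at true true true _ = refl
          at true true false _ = refl
          at true false true f = ⊥-elim (f tt)
          at true false false _ = refl

        excess : # (P ∖ B) ≤ # Y + d
        excess = lin 6 (λ e i p b y d → (i ⊞ e ≐ p) ⟨ 1 ⟩⇒ (b ≼ i) ⟨ 1 ⟩⇒ (p ≼ y ⊞ b ⊞ d) ⟨ 1 ⟩⇒ 1 ⊢ e ≼ y ⊞ d) (# (P ∖ B))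
            (# (P ∩ B)) (# P) (# B) (# Y) d
          (#-∖ P B) (#-mono {B} {P ∩ B} λ x p → ∈∩⁺ {P} {B} {x} (B⊑P x p) p) critY

        -- Two thin cosets would each contribute at least `# Y - θ′` elements to `P ∖ B`, which has
        -- at most `# Y + d`.
        one-thin : ∀ x x′ → Thin x → Thin x′ → x′ ∈ H ⇀ x
        one-thin x x′ t t′ with x′ ∈? (H ⇀ x)
        ... | yes p = p
        ... | no p = ⊥-elim (<-irrefl refl (lin 12 (λ y s s′ b b′ e e′ u w q d τ → (y ⊞ b ≼ s ⊞ q) ⟨ 1 ⟩⇒ (y ⊞ b′ ≼ s′ ⊞ q) ⟨ 1 ⟩⇒
            (s ≐ b ⊞ e) ⟨ 1 ⟩⇒ (s′ ≐ b′ ⊞ e′) ⟨ 1 ⟩⇒ (e ⊞ e′ ≼ u) ⟨ 1 ⟩⇒ (u ≼ w) ⟨ 1 ⟩⇒ (w ≼ y ⊞ d) ⟨ 1 ⟩⇒ (con 1 ⊞ 2 ⊠ q ⊞ d ≼ τ)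
            ⟨ 1 ⟩⇒ (τ ≼ y) ⟨ 1 ⟩⇒ 1 ⊢ con 1 ⊞ y ≼ y) (# Y) (# (Hx ∩ P)) (# (Hx′ ∩ P)) (# (Hx ∩ B)) (# (Hx′ ∩ B))
            (# (Hx ∩ (P ∖ B))) (# (Hx′ ∩ (P ∖ B))) (# ((Hx ∩ (P ∖ B)) ∪ (Hx′ ∩ (P ∖ B)))) (# (P ∖ B)) (θ′) d τ
            (fat x t (dichotomy x)) (fat x′ t′ (dichotomy x′)) (gain x) (gain x′)
            (disjoint-# (Hx ∩ (P ∖ B)) (Hx′ ∩ (P ∖ B)) λ z a b → p (coset-trans (∈∩ˡ {Hx} {P ∖ B} {z} a) (coset-sym (∈∩ˡ {Hx′} {P ∖ B} {z} b))))
            (#-mono {(Hx ∩ (P ∖ B)) ∪ (Hx′ ∩ (P ∖ B))} {P ∖ B} λ z q → ∈∪-elim (Hx ∩ (P ∖ B)) (Hx′ ∩ (P ∖ B)) {z} q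
                (∈∩ʳ {Hx} {P ∖ B} {z}) (∈∩ʳ {Hx′} {P ∖ B} {z}))
            excess θ′<τ τ≤Y))
          where
          Hx Hx′ : Sub
          Hx = H ⇀ x
          Hx′ = H ⇀ x′
          fat : ∀ x → Thin x → # H < # ((H ⇀ x) ∩ P) + τ′ ⊎ # Y + # ((H ⇀ x) ∩ B) ≤ # ((H ⇀ x) ∩ P) + θ′ → # Y + # ((H ⇀ x) ∩ B) ≤
              # ((H ⇀ x) ∩ P) + θ′
          fat x t (inj₁ q) = ⊥-elim (<⇒≱ q t)
          fat x t (inj₂ q) = q

        opaque
          exceptional : ∃ λ x₀ → ∀ x → ¬ (x ∈ H ⇀ x₀) → # H < # ((H ⇀ x) ∩ P) + τ′
          exceptional with search (λ x → # ((H ⇀ x) ∩ P) + τ′ ≤ᵇ # H)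
          ... | inj₁ (x₀ , t) = x₀ , λ x p → ≰⇒> λ q → p (one-thin x₀ x (≤ᵇ⇒≤ _ _ t) q)
          ... | inj₂ none = ε , λ x _ → ≰⇒> λ q → none x (≤⇒≤ᵇ q)

        module AtCoset (x₀ : Carrier) (thick : ∀ x → ¬ (x ∈ H ⇀ x₀) → # H < # ((H ⇀ x) ∩ P) + τ′) where

          Ω : Sub
          Ω = ∁ (H ⇀ x₀)

          -- Summed over all translates of `H`: each misses at most `τ′` points of `P` within `Ω`,
          -- every point is counted `# H` times, and `# H` is at least `τ`.
          Ω-P : # (Ω ∖ P) ≤ ξ₀
          Ω-P = *-cancelˡ-≤ τ {{>-nonZero 1≤τ}} (begin
            τ * # (Ω ∖ P)     ≤⟨ *-monoˡ-≤ (# (Ω ∖ P)) (≤-trans τ≤Y (#-mono {Y} {H} Y⊑H)) ⟩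
            # H * # (Ω ∖ P)   ≡⟨ *-comm (# H) _ ⟩
            # (Ω ∖ P) * # H   ≡⟨ ∑-meet H (Ω ∖ P) ⟨
            ∑ᴳ (λ g → # ((Ω ∖ P) ∩ (H ⇀ g))) ≤⟨ ∑-mono elems at ⟩
            ∑ᴳ (λ _ → τ′)     ≡⟨ ∑-const τ′ ⟩
            τ′ * h            ≡⟨ *-comm τ′ h ⟩
            h * τ′            ≤⟨ ξ₀-big ⟩
            τ * ξ₀            ∎)
            where
            open ≤-Reasoning
            at : ∀ g → # ((Ω ∖ P) ∩ (H ⇀ g)) ≤ τ′
            at g with g ∈? (H ⇀ x₀)
            ... | yes p = ≤-trans (#-mono {(Ω ∖ P) ∩ (H ⇀ g)} {λ _ → false} λ z q →
                    ∁⁻ {H ⇀ x₀} {z} (∈∖ˡ {Ω} {P} {z} (∈∩ˡ {Ω ∖ P} {H ⇀ g} {z} q)) (coset-trans p (∈∩ʳ {Ω ∖ P} {H ⇀ g} {z} q)))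
                  (≤-trans (≤-reflexive (∑-const 0)) z≤n)
            ... | no p = lin 6 (λ a b i H H′ t → (a ≼ b) ⟨ 1 ⟩⇒ (i ⊞ b ≐ H′) ⟨ 1 ⟩⇒ (H′ ≐ H) ⟨ 1 ⟩⇒ (con 1 ⊞ H ≼ i ⊞ t) ⟨ 1 ⟩⇒ 1 ⊢
                a ≼ t) (# ((Ω ∖ P) ∩ (H ⇀ g))) (# ((H ⇀ g) ∖ P)) (# ((H ⇀ g) ∩ P)) (# H) (# (H ⇀ g)) (τ′)
                  (#-mono {(Ω ∖ P) ∩ (H ⇀ g)} {(H ⇀ g) ∖ P} λ z q → ∈∖⁺ {H ⇀ g} {P} {z} (∈∩ʳ {Ω ∖ P} {H ⇀ g} {z} q)
                      (∈∖ʳ {Ω} {P} {z} (∈∩ˡ {Ω ∖ P} {H ⇀ g} {z} q)))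
                  (#-∖ (H ⇀ g) P) (#-⇀ H g) (thick g p)

          ξ : ℕ
          ξ = ξ₀ + θ + d

          Ω-B : # (Ω ∖ B) ≤ ξ
          Ω-B = lin 7 (λ o p q y x t d → (o ≼ p ⊞ q) ⟨ 1 ⟩⇒ (p ≼ x) ⟨ 1 ⟩⇒ (q ≼ y ⊞ d) ⟨ 1 ⟩⇒ (con 1 ⊞ y ≼ t) ⟨ 1 ⟩⇒ 1 ⊢ o ≼ x ⊞ t
              ⊞ d) (# (Ω ∖ B)) (# (Ω ∖ P)) (# (P ∖ B)) (# Y) (ξ₀) (θ) d
            (∖-trans Ω P B) Ω-P excess Y<θ

          module _ (ξ-small : 2 * (E * (E * ξ)) < h) (1≤E : 1 ≤ E) where

            #Ω : # H + # Ω ≡ h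
            #Ω = trans (cong (_+ # Ω) (sym (#-⇀ H x₀))) (#-∁ (H ⇀ x₀))

            -- If `H` were small, `B` alone would nearly fill the group, against the room that
            -- `free` leaves outside `A ⊕ B`.
            H-bound : h ≤ 2 * (E * # H)
            H-bound = lin 6 (λ h Es Eh EH Ex EEx → (h ⊞ Es ≼ Eh) ⟨ 2 ⟩⇒ (Eh ≼ EH ⊞ Es ⊞ Ex) ⟨ 2 ⟩⇒ (Ex ≼ EEx) ⟨ 2 ⟩⇒
                (con 1 ⊞ 2 ⊠ EEx ≼ h) ⟨ 1 ⟩⇒ 1 ⊢ h ≼ 2 ⊠ EH) h (E * # (A ⊕ B)) (E * h) (E * # H) (E * ξ) (E * (E * ξ))
              free scaled (≤-trans (≤-reflexive (sym (*-identityˡ (E * ξ)))) (*-monoˡ-≤ (E * ξ) 1≤E)) ξ-small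
              where
              scaled : E * h ≤ E * # H + E * # (A ⊕ B) + E * ξ
              scaled = ≤-trans (*-monoʳ-≤ E
                (lin 9 (λ h H O i m b b′ s x → (H ⊞ O ≑ h) ⟨ 1 ⟩⇒ (i ⊞ m ≑ O) ⟨ 1 ⟩⇒ (i ≼ b) ⟨ 1 ⟩⇒ (b ≼ b′) ⟨ 1 ⟩⇒ (b′ ≐ s) ⟨ 1
                    ⟩⇒ (m ≼ x) ⟨ 1 ⟩⇒ 1 ⊢ h ≼ H ⊞ s ⊞ x) h (# H) (# Ω) (# (Ω ∩ B)) (# (Ω ∖ B)) (# B) (# (B ⊕ A)) (# (A ⊕ B)) (ξ)
                  #Ω (#-∖ Ω B) (#-mono {Ω ∩ B} {B} λ z → ∈∩ʳ {Ω} {B} {z}) (#≤⊕ B A a₀∈) (#-comm B A) Ω-B))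
                (≤-reflexive (trans (*-distribˡ-+ E (# H + # (A ⊕ B)) ξ) (cong (_+ E * ξ) (*-distribˡ-+ E (# H) (# (A ⊕ B))))))

            Eξ<H : E * ξ < # H
            Eξ<H = *-cancelˡ-< E (E * ξ) (# H) (*-cancelˡ-< 2 (E * (E * ξ)) (E * # H) (<-≤-trans ξ-small H-bound))

            -- Were some `a ∈ A` in another coset, the exceptional cosets of the translates of `B`
            -- by `a₀` and by `a` would differ, so `A ⊕ B` would miss at most `ξ` points of every
            -- coset. But it misses at least `h / E` points in all, which would force `# H ≤ E * ξ`.
            A⊑ : A ⊑ H ⇀ a₀
            A⊑ a a∈ with a ∈? (H ⇀ a₀)
            ... | yes p = p
            ... | no p = ⊥-elim (<⇒≱ Eξ<H (*-cancelʳ-≤ (# H) (E * ξ) h {{>-nonZero (≤-trans (s≤s z≤n) ξ-small)}} (begin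
                # H * h ≡⟨ *-comm (# H) h ⟩
                h * # H ≤⟨ *-monoˡ-≤ (# H) missing ⟩
                E * # (∁ (A ⊕ B)) * # H ≡⟨ *-assoc E _ (# H) ⟩
                E * (# (∁ (A ⊕ B)) * # H) ≡⟨ cong (E *_) (∑-meet H (∁ (A ⊕ B))) ⟨
                E * ∑ᴳ (λ g → # (∁ (A ⊕ B) ∩ (H ⇀ g))) ≤⟨ *-monoʳ-≤ E (∑-mono elems at) ⟩
                E * ∑ᴳ (λ _ → ξ) ≡⟨ cong (E *_) (∑-const ξ) ⟩
                E * (ξ * h) ≡⟨ *-assoc E ξ h ⟨
                E * ξ * h ∎)))
              where
              open ≤-Reasoning
              missing : h ≤ E * # (∁ (A ⊕ B))
              missing = lin 4 (λ h Es Ec Eh → (h ⊞ Es ≼ Eh) ⟨ 1 ⟩⇒ (Es ⊞ Ec ≑ Eh) ⟨ 1 ⟩⇒ 1 ⊢ h ≼ Ec) h (E * # (A ⊕ B))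
                  (E * # (∁ (A ⊕ B))) (E * h) free
                (trans (sym (*-distribˡ-+ E (# (A ⊕ B)) (# (∁ (A ⊕ B))))) (cong (E *_) (#-∁ (A ⊕ B))))
              via : ∀ g {c} → c ∈ A → ¬ (g // c ∈ H ⇀ x₀) → # (∁ (A ⊕ B) ∩ (H ⇀ g)) ≤ ξ
              via g {c} c∈ n = ≤-trans (#-mono {∁ (A ⊕ B) ∩ (H ⇀ g)} {(Ω ∖ B) ⇀ c} λ z q → ∈∖⁺ {Ω} {B} {z // c}
                  (∁⁺ {H ⇀ x₀} {z // c} λ w → n (coset-trans w (coset-sym
                      (subst (_∈ H) (group 3 (λ z g c → z ⊘ g ≗ (z ⊘ c) ⊘ (g ⊘ c)) refl z g c) (∈∩ʳ {∁ (A ⊕ B)} {H ⇀ g} {z} q)))))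
                  (λ b∈ → ∁⁻ {A ⊕ B} {z} (∈∩ˡ {∁ (A ⊕ B)} {H ⇀ g} {z} q)
                      (subst (_∈ A ⊕ B) (group 2 (λ z c → c ⊙ (z ⊘ c) ≗ z) refl z c) (⊕⁺ {A} {B} c∈ b∈))))
                (≤-trans (≤-reflexive (#-⇀ (Ω ∖ B) c)) Ω-B)
              at : ∀ g → # (∁ (A ⊕ B) ∩ (H ⇀ g)) ≤ ξ
              at g with (g // a₀) ∈? (H ⇀ x₀)
              ... | no n = via g a₀∈ n
              ... | yes q = via g a∈ λ r → p (subst (_∈ H) (group 3 (λ g a b → (g ⊘ b) ⊘ (g ⊘ a) ≗ a ⊘ b) refl g a a₀) (coset-trans (coset-sym r) q))

            b₀-exists : ∃ λ b₀ → b₀ ∈ B × b₀ ∈ H ⇀ x₀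
            b₀-exists = let k , k∈ , kx∈ = hits H sub H-index x₀ in k ∙ x₀ , kx∈ , ⇀⁺ {H} x₀ k∈

            module _ {b₀ : Carrier} (b₀∈ : b₀ ∈ B) (b₀∈H : b₀ ∈ H ⇀ x₀) where

              A₀ B₀ : Sub
              A₀ = shift A a₀
              B₀ = shift B b₀

              A₀⊑H : A₀ ⊑ H
              A₀⊑H x p = subst (_∈ H) (group 2 (λ x a → (x ⊙ a) ⊘ a ≗ x) refl x a₀) (A⊑ (x ∙ a₀) p)

              #A₀ : # A₀ ≡ # A
              #A₀ = reindex (_∙ a₀) (_// a₀) (λ x → group 2 (λ x a → (x ⊙ a) ⊘ a ≗ x) refl x a₀)
                  (λ x → group 2 (λ x a → (x ⊘ a) ⊙ a ≗ x) refl x a₀) (λ x → 𝟙 (A x))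

              same-coset : ∀ z → (H ⇀ b₀) z ≡ (H ⇀ x₀) z
              same-coset z = Bool-≡ᴳ (λ p → coset-trans b₀∈H p) (λ p → coset-trans (coset-sym b₀∈H) p)
                where
                Bool-≡ᴳ : ∀ {a b} → (T a → T b) → (T b → T a) → a ≡ b
                Bool-≡ᴳ {true} {true} _ _ = refl
                Bool-≡ᴳ {false} {false} _ _ = refl
                Bool-≡ᴳ {true} {false} p _ = ⊥-elim (p tt)
                Bool-≡ᴳ {false} {true} _ q = ⊥-elim (q tt)

              B₁ : Sub
              B₁ = B ∖ (H ⇀ b₀)

              B₁-large : h ≤ # H + # B₁ + ξ
              B₁-large = lin 7 (λ h H O i m b x → (H ⊞ O ≑ h) ⟨ 1 ⟩⇒ (i ⊞ m ≑ O) ⟨ 1 ⟩⇒ (i ≼ b) ⟨ 1 ⟩⇒ (m ≼ x) ⟨ 1 ⟩⇒ 1 ⊢ h ≼ H ⊞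
                  b ⊞ x) h (# H) (# Ω) (# (Ω ∩ B)) (# (Ω ∖ B)) (# B₁) (ξ)
                #Ω (#-∖ Ω B) (#-mono {Ω ∩ B} {B₁} λ z q → ∈∖⁺ {B} {H ⇀ b₀} {z} (∈∩ʳ {Ω} {B} {z} q)
                  (λ w → ∁⁻ {H ⇀ x₀} {z} (∈∩ˡ {Ω} {B} {z} q) (subst T (same-coset z) w))) Ω-B

              #B₀ : ℍ.# restrict B₀ ≡ # ((H ⇀ b₀) ∩ B)
              #B₀ = trans (#-restrict B₀) (#-shift B b₀)

              c : Carrier
              c = a₀ ∙ b₀

              sum-size : ℍ.# (restrict A₀ ℍ.⊕ restrict B₀) ≡ # ((H ⇀ c) ∩ (A ⊕ B))
              sum-size = trans (#-⊕-restrict A₀ B₀ A₀⊑H) (trans (⊕-shift A₀ B b₀)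
                (trans (sym (#-⇀ ((H ⇀ b₀) ∩ (A₀ ⊕ B)) a₀)) (≤-antisym (#-mono {((H ⇀ b₀) ∩ (A₀ ⊕ B)) ⇀ a₀} {(H ⇀ c) ∩ (A ⊕ B)} into)
                  (#-mono {(H ⇀ c) ∩ (A ⊕ B)} {((H ⇀ b₀) ∩ (A₀ ⊕ B)) ⇀ a₀} back))))
                where
                into : ((H ⇀ b₀) ∩ (A₀ ⊕ B)) ⇀ a₀ ⊑ (H ⇀ c) ∩ (A ⊕ B)
                into z q =
                  let x , b , x∈ , b∈ , eq = ⊕⁻ {A₀} {B} {z // a₀} (∈∩ʳ {H ⇀ b₀} {A₀ ⊕ B} {z // a₀} q) in
                  ∈∩⁺ {H ⇀ c} {A ⊕ B} {z} (subst (_∈ H) (group 3 (λ z a b → (z ⊘ a) ⊘ b ≗ z ⊘ (a ⊙ b)) refl z a₀ b₀)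
                      (∈∩ˡ {H ⇀ b₀} {A₀ ⊕ B} {z // a₀} q))
                    (subst (_∈ A ⊕ B) (trans (group 3 (λ x a b → (x ⊙ a) ⊙ b ≗ (x ⊙ b) ⊙ a) refl x a₀ b)
                        (trans (cong (_∙ a₀) (sym eq)) (group 2 (λ z a → (z ⊘ a) ⊙ a ≗ z) refl z a₀)))
                      (⊕⁺ {A} {B} {x ∙ a₀} {b} x∈ b∈))
                back : (H ⇀ c) ∩ (A ⊕ B) ⊑ ((H ⇀ b₀) ∩ (A₀ ⊕ B)) ⇀ a₀
                back z q =
                  let x , b , x∈ , b∈ , eq = ⊕⁻ {A} {B} {z} (∈∩ʳ {H ⇀ c} {A ⊕ B} {z} q) in
                  ∈∩⁺ {H ⇀ b₀} {A₀ ⊕ B} {z // a₀} (subst (_∈ H) (group 3 (λ z a b → z ⊘ (a ⊙ b) ≗ (z ⊘ a) ⊘ b) refl z a₀ b₀)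
                      (∈∩ˡ {H ⇀ c} {A ⊕ B} {z} q))
                    (subst (_∈ A₀ ⊕ B) (trans (group 3 (λ x a b → (x ⊘ a) ⊙ b ≗ (x ⊙ b) ⊘ a) refl x a₀ b) (cong (_// a₀) (sym eq)))
                      (⊕⁺ {A₀} {B} {x // a₀} {b} (subst (_∈ A) (group 2 (λ x a → x ≗ (x ⊘ a) ⊙ a) refl x a₀) x∈) b∈))

              B₁-⊑ : # B₁ ≤ # ((A ⊕ B) ∖ (H ⇀ c))
              B₁-⊑ = ≤-trans (≤-reflexive (sym (#-⇀ B₁ a₀))) (#-mono {B₁ ⇀ a₀} {(A ⊕ B) ∖ (H ⇀ c)} λ z q →
                ∈∖⁺ {A ⊕ B} {H ⇀ c} {z} (subst (_∈ A ⊕ B) (group 2 (λ z a → a ⊙ (z ⊘ a) ≗ z) refl z a₀)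
                    (⊕⁺ {A} {B} a₀∈ (∈∖ˡ {B} {H ⇀ b₀} {z // a₀} q)))
                  (λ w → ∈∖ʳ {B} {H ⇀ b₀} {z // a₀} q (subst (_∈ H) (group 3 (λ z a b → z ⊘ (a ⊙ b) ≗ (z ⊘ a) ⊘ b) refl z a₀ b₀) w)))

              swap-∩ : ∀ (S R : Sub) → # (S ∩ R) ≡ # (R ∩ S)
              swap-∩ S R = ≤-antisym (#-mono {S ∩ R} {R ∩ S} λ z q → ∈∩⁺ {R} {S} {z} (∈∩ʳ {S} {R} {z} q) (∈∩ˡ {S} {R} {z} q))
                                     (#-mono {R ∩ S} {S ∩ R} λ z q → ∈∩⁺ {S} {R} {z} (∈∩ʳ {R} {S} {z} q) (∈∩ˡ {R} {S} {z} q))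

              -- Outside the coset of `c` the sumset contains a translate of `B₁`, so discarding
              -- `B₁` from `B` and that translate from the sumset does not increase the excess. The
              -- bound is stated with `# Y + d` to agree with `local-lip`.
              local-crit : ℍ.# (restrict A₀ ℍ.⊕ restrict B₀) ≤ ℍ.# restrict A₀ + ℍ.# restrict B₀ + (# Y + d)
              local-crit = lin 15 (λ s i i′ m t a a′ a″ b b′ b″ b1 B y d → (s ≐ i) ⟨ 1 ⟩⇒ (i ≐ i′) ⟨ 1 ⟩⇒ (i′ ⊞ m ≐ t) ⟨ 1 ⟩⇒
                  (b1 ≼ m) ⟨ 1 ⟩⇒ (t ≼ a″ ⊞ B ⊞ d) ⟨ 1 ⟩⇒ (a ≑ a′) ⟨ 1 ⟩⇒ (a′ ≑ a″) ⟨ 1 ⟩⇒ (b ≑ b′) ⟨ 1 ⟩⇒ (b′ ≑ b″) ⟨ 1 ⟩⇒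
                  (b″ ⊞ b1 ≑ B) ⟨ 1 ⟩⇒ 1 ⊢ s ≼ a ⊞ b ⊞ (y ⊞ d)) (ℍ.# (restrict A₀ ℍ.⊕ restrict B₀)) (# ((H ⇀ c) ∩ (A ⊕ B)))
                  (# ((A ⊕ B) ∩ (H ⇀ c))) (# ((A ⊕ B) ∖ (H ⇀ c))) (# (A ⊕ B)) (ℍ.# restrict A₀) (# A₀) (# A) (ℍ.# restrict B₀)
                  (# ((H ⇀ b₀) ∩ B)) (# (B ∩ (H ⇀ b₀))) (# B₁) (# B) (# Y) d
                sum-size (swap-∩ (H ⇀ c) (A ⊕ B)) (#-∖ (A ⊕ B) (H ⇀ c)) B₁-⊑ crit (#-restrict-⊑ A₀ A₀⊑H) #A₀ #B₀ (swap-∩ (H ⇀ b₀) B) (#-∖ B (H ⇀ b₀))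

              -- The error `ξ` uses up less than half of the `h / E` points left free, so the
              -- constant doubles to `2 * E`.
              local-free : ℍ.h + 2 * E * ℍ.# (restrict A₀ ℍ.⊕ restrict B₀) ≤ 2 * E * ℍ.h
              local-free = lin 11 (λ h h′ H ES Ehh EH Ei Eh Es Ex EEx → (h′ ≐ H) ⟨ 1 ⟩⇒ (H ≼ h) ⟨ 1 ⟩⇒ (ES ≐ 2 ⊠ Ei) ⟨ 1 ⟩⇒
                  (Ehh ≑ 2 ⊠ EH) ⟨ 1 ⟩⇒ (h ⊞ Es ≼ Eh) ⟨ 2 ⟩⇒ (Eh ⊞ Ei ≼ EH ⊞ Es ⊞ Ex) ⟨ 2 ⟩⇒ (Ex ≼ EEx) ⟨ 2 ⟩⇒
                  (con 1 ⊞ 2 ⊠ EEx ≼ h) ⟨ 1 ⟩⇒ 1 ⊢ h′ ⊞ ES ≼ Ehh) h (ℍ.h) (# H) (2 * E * S) (2 * E * ℍ.h) (E * # H)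
                  (E * # ((H ⇀ c) ∩ (A ⊕ B))) (E * h) (E * # (A ⊕ B)) (E * ξ) (E * (E * ξ))
                h-restrict (#≤h H) (trans (cong (2 * E *_) sum-size) (*-assoc 2 E _))
                    (trans (cong (2 * E *_) h-restrict) (*-assoc 2 E (# H))) free scaled
                (≤-trans (≤-reflexive (sym (*-identityˡ (E * ξ)))) (*-monoˡ-≤ (E * ξ) 1≤E)) ξ-small
                where
                S : ℕ
                S = ℍ.# (restrict A₀ ℍ.⊕ restrict B₀)
                scaled : E * h + E * # ((H ⇀ c) ∩ (A ⊕ B)) ≤ E * # H + E * # (A ⊕ B) + E * ξ
                scaled = ≤-trans (≤-reflexive (sym (*-distribˡ-+ E h _))) (≤-trans (*-monoʳ-≤ E
                  (lin 8 (λ h i i′ m t b1 H x → (i ≐ i′) ⟨ 1 ⟩⇒ (i′ ⊞ m ≐ t) ⟨ 1 ⟩⇒ (b1 ≼ m) ⟨ 1 ⟩⇒ (h ≼ H ⊞ b1 ⊞ x) ⟨ 1 ⟩⇒ 1 ⊢ h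
                      ⊞ i ≼ H ⊞ t ⊞ x) h (# ((H ⇀ c) ∩ (A ⊕ B))) (# ((A ⊕ B) ∩ (H ⇀ c))) (# ((A ⊕ B) ∖ (H ⇀ c))) (# (A ⊕ B))
                      (# B₁) (# H) (ξ)
                    (swap-∩ (H ⇀ c) (A ⊕ B)) (#-∖ (A ⊕ B) (H ⇀ c)) B₁-⊑ B₁-large))
                  (≤-reflexive (trans (*-distribˡ-+ E (# H + # (A ⊕ B)) ξ) (cong (_+ E * ξ) (*-distribˡ-+ E (# H) (# (A ⊕ B)))))))

              -- With `y` and `y // u` in `Y`, the set `B ∖ (B ⇀ u)` can be translated into `P`
              -- minus a translate of `B`, where only `# Y + d` points are available.
              local-lip : ∀ u → (∃ λ y → y ∈ Y × y // u ∈ Y) → (u∈ : u ∈ H) →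
                ℍ.# (restrict B₀ ℍ.∖ (restrict B₀ ℍ.⇀ (u , u∈))) ≤ # Y + d
              local-lip u (y , y∈ , yu∈) u∈ = ≤-trans (≤-reflexive (#-restrict (B₀ ∖ (B₀ ⇀ u)))) (≤-trans
                (#-mono {H ∩ (B₀ ∖ (B₀ ⇀ u))} {B₀ ∖ (B₀ ⇀ u)} λ z → ∈∩ʳ {H} {B₀ ∖ (B₀ ⇀ u)} {z})
                (≤-trans (≤-reflexive moved) (≤-trans (#-mono {((B ∖ (B ⇀ u))) ⇀ (y // u)} {P ∖ (B ⇀ y)} into) bound)))
                where
                moved : # (B₀ ∖ (B₀ ⇀ u)) ≡ # ((B ∖ (B ⇀ u)) ⇀ (y // u))
                moved = trans (trans (#-cong {B₀ ∖ (B₀ ⇀ u)} {shift (B ∖ (B ⇀ u)) b₀} λ z →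
                    cong (λ w → B (z ∙ b₀) ∧ not (B w)) (group 3 (λ z b u → (z ⊘ u) ⊙ b ≗ (z ⊙ b) ⊘ u) refl z b₀ u))
                  (reindex (_∙ b₀) (_// b₀) (λ x → group 2 (λ x a → (x ⊙ a) ⊘ a ≗ x) refl x b₀)
                      (λ x → group 2 (λ x a → (x ⊘ a) ⊙ a ≗ x) refl x b₀) (λ x → 𝟙 ((B ∖ (B ⇀ u)) x))))
                  (sym (#-⇀ (B ∖ (B ⇀ u)) (y // u)))
                into : (B ∖ (B ⇀ u)) ⇀ (y // u) ⊑ P ∖ (B ⇀ y)
                into z q = ∈∖⁺ {P} {B ⇀ y} {z}
                  (subst (_∈ P) (group 3 (λ z y u → (y ⊘ u) ⊙ (z ⊘ (y ⊘ u)) ≗ z) refl z y u) (⊕⁺ {Y} {B} yu∈ (∈∖ˡ {B} {B ⇀ u} {z // (y // u)} q)))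
                  (λ w → ∈∖ʳ {B} {B ⇀ u} {z // (y // u)} q (subst (_∈ B) (group 3 (λ z y u → z ⊘ y ≗ (z ⊘ (y ⊘ u)) ⊘ u) refl z y u) w))
                bound : # (P ∖ (B ⇀ y)) ≤ # Y + d
                bound = lin 7 (λ e i p b b′ y d → (i ⊞ e ≐ p) ⟨ 1 ⟩⇒ (b ≼ i) ⟨ 1 ⟩⇒ (b ≑ b′) ⟨ 1 ⟩⇒ (p ≼ y ⊞ b′ ⊞ d) ⟨ 1 ⟩⇒ 1 ⊢ e
                    ≼ y ⊞ d) (# (P ∖ (B ⇀ y))) (# (P ∩ (B ⇀ y))) (# P) (# (B ⇀ y)) (# B) (# Y) d
                  (#-∖ P (B ⇀ y)) (#-mono {B ⇀ y} {P ∩ (B ⇀ y)} λ z q → ∈∩⁺ {P} {B ⇀ y} {z}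
                     (subst (_∈ P) (group 2 (λ z y → y ⊙ (z ⊘ y) ≗ z) refl z y) (⊕⁺ {Y} {B} y∈ q)) q) (#-⇀ B y) critY

  -- The inverse theorem

  -- The common source of the alternatives (iii) and (iv), with `E` in the role of both `1/ε` and
  -- `1/η`; `rest` decides between them.
  record Outcome (𝔾 : FinAb) (A B : FinAb.Carrier 𝔾 → Bool) (E D k : ℕ) : Set where
    open Counting 𝔾
    field
      H     : Sub
      sub   : Subgroup H
      index : h ≤ D * # H
      a₀ b₀ : Carrier
      a₀∈   : a₀ ∈ A
      b₀∈   : b₀ ∈ B
      A⊑    : A ⊑ H ⇀ a₀
      B₁-large : E * h < E * # H + E * # (B ∖ (H ⇀ b₀)) + # H
      rest  : E * # ((H ⇀ b₀) ∩ B) < # H ⊎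
              BohrPair (SubgroupAsGroup.group-of 𝔾 H sub) (λ p → A (proj₁ p ∙ a₀)) (λ p → B (proj₁ p ∙ b₀)) (2 * E) k

  module Inverse (E k : ℕ) (E-big : 1000 ≤ E) (k≤E : k ≤ E) where

    private
      2E-big : 1000 ≤ 2 * E
      2E-big = ≤-trans E-big (m≤m+n E _)
      k≤2E : k ≤ 2 * E
      k≤2E = ≤-trans k≤E (m≤m+n E _)
      1≤E : 1 ≤ E
      1≤E = ≤-trans (s≤s z≤n) E-big

    open Threshold (2 * E) k 2E-big k≤2E

    private
      opaque
        -- The first summand makes `ξ ≤ 3 * θ` small against `h / (E * E)`; the second makes `H`
        -- large enough for the structure theorem with error `# Y + d`.
        H₂ : ℕ
        H₂ = 8 * (E * E) + 4 * (E * N₀)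

        H₂≥ : 8 * (E * E) ≤ H₂
        H₂≥ = m≤m+n _ _

        H₂≥′ : 4 * (E * N₀) ≤ H₂
        H₂≥′ = m≤n+m _ (8 * (E * E))

      -- Chosen so that `Z * μ = H₂ * θ = H₁ * θ′`: `θ` is the error of the growth bound in the
      -- whole group, `θ′` that in `H`, and `τ = 4 * θ′` separates the two levels.
      H₁ Z : ℕ
      H₁ = 32 * (H₂ * H₂)
      Z = H₂ * (8 * H₂ * (4 * (8 * H₁)))

      1≤H₂ : 1 ≤ H₂
      1≤H₂ = ≤-trans (*-mono-≤ (s≤s (z≤n {7})) (*-mono-≤ 1≤E 1≤E)) H₂≥
      1≤H₁ : 1 ≤ H₁
      1≤H₁ = *-mono-≤ (s≤s (z≤n {31})) (*-mono-≤ 1≤H₂ 1≤H₂)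
      1≤Z : 1 ≤ Z
      1≤Z = *-mono-≤ 1≤H₂ (*-mono-≤ (*-mono-≤ (s≤s (z≤n {7})) 1≤H₂) (*-mono-≤ (s≤s (z≤n {3})) (*-mono-≤ (s≤s (z≤n {7})) 1≤H₁)))

    Δ D : ℕ
    Δ = 2 * H₁
    D = 4 * H₁ + Z

    1≤Δ : 1 ≤ Δ
    1≤Δ = *-mono-≤ (s≤s (z≤n {1})) 1≤H₁

    module _ (𝔾 : FinAb) where
      open Counting 𝔾

      module Large (A B : Sub) (hits : ∀ K → Subgroup K → h ≤ D * # K → Meets B K) (A-big : h ≤ E * # A)
        (crit₀ : Δ * # (A ⊕ B) ≤ Δ * (# A + # B) + h) (free : h + E * # (A ⊕ B) ≤ E * h)
        {μ : ℕ} (1≤μ : 1 ≤ μ) (lo : Z * μ ≤ h) (hi : h ≤ 2 * (Z * μ)) where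

        private
          θ′ τ θ d κ′ : ℕ
          θ′ = 8 * H₁ * μ
          τ = 4 * θ′
          θ = 8 * H₂ * τ
          κ′ = 4 * H₁ * μ
          d = # (A ⊕ B) ∸ (# A + # B)

          1≤θ′ : 1 ≤ θ′
          1≤θ′ = *-mono-≤ (*-mono-≤ (s≤s (z≤n {7})) 1≤H₁) 1≤μ
          1≤τ : 1 ≤ τ
          1≤τ = *-mono-≤ (s≤s (z≤n {3})) 1≤θ′
          1≤θ : 1 ≤ θ
          1≤θ = *-mono-≤ (*-mono-≤ (s≤s (z≤n {7})) 1≤H₂) 1≤τ

          scaled : ∀ {a b} → 1 ≤ a → b ≤ a * b
          scaled {a} {b} p = ≤-trans (≤-reflexive (sym (*-identityˡ b))) (*-monoˡ-≤ b p)

          τ≤θ : τ ≤ θ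
          τ≤θ = scaled (*-mono-≤ (s≤s (z≤n {7})) 1≤H₂)
          θ′≤τ : θ′ ≤ τ
          θ′≤τ = scaled {4} (s≤s z≤n)
          H₁μ≤θ′ : H₁ * μ ≤ θ′
          H₁μ≤θ′ = *-monoˡ-≤ μ (scaled {8} {H₁} (s≤s z≤n))

          Zμ : Z * μ ≡ H₂ * θ
          Zμ = r H₂ H₁ μ
            where
            r : ∀ a b m → a * (8 * a * (4 * (8 * b))) * m ≡ a * (8 * a * (4 * (8 * b * m)))
            r = solve-∀
          Zμ′ : Z * μ ≡ H₁ * θ′
          Zμ′ = trans Zμ (r H₂ θ′)
            where
            r : ∀ a t → a * (8 * a * (4 * t)) ≡ 32 * (a * a) * t
            r = solve-∀

          h≤₂ : h ≤ 2 * (H₂ * θ)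
          h≤₂ = ≤-trans hi (≤-reflexive (cong (2 *_) Zμ))
          h≤₁ : h ≤ 2 * (H₁ * θ′)
          h≤₁ = ≤-trans hi (≤-reflexive (cong (2 *_) Zμ′))
          h≥₂ : H₂ * θ ≤ h
          h≥₂ = ≤-trans (≤-reflexive (sym Zμ)) lo

          κ′-index : h ≤ D * κ′
          κ′-index = ≤-trans h≤₁ (≤-trans (≤-reflexive (r H₁ μ)) (*-monoˡ-≤ κ′ (m≤m+n (4 * H₁) Z)))
            where
            r : ∀ a m → 2 * (a * (8 * a * m)) ≡ 4 * a * (4 * a * m)
            r = solve-∀
          κ′≤θ′ : 2 * κ′ ≤ θ′
          κ′≤θ′ = ≤-reflexive (r H₁ μ)
            where
            r : ∀ a m → 2 * (4 * a * m) ≡ 8 * a * m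
            r = solve-∀
          κ′≤τ : κ′ ≤ τ
          κ′≤τ = ≤-trans (≤-trans (scaled {2} (s≤s z≤n)) κ′≤θ′) θ′≤τ
          κ≤θ : 2 * (4 * H₂ * τ) ≤ θ
          κ≤θ = ≤-reflexive (r H₂ τ)
            where
            r : ∀ a m → 2 * (4 * a * m) ≡ 8 * a * m
            r = solve-∀
          κ-index : ∀ {c} → κ′ ≤ c → h ≤ D * c
          κ-index p = ≤-trans κ′-index (*-monoʳ-≤ D p)

          crit : # (A ⊕ B) ≤ # A + # B + d
          crit = m≤n+m∸n (# (A ⊕ B)) (# A + # B)

          d≤θ′ : d ≤ θ′
          d≤θ′ = *-cancelˡ-≤ Δ {{>-nonZero 1≤Δ}} (≤-trans (≤-reflexive (*-distribˡ-∸ Δ (# (A ⊕ B)) (# A + # B)))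
            (≤-trans (m≤n+o⇒m∸n≤o (Δ * # (A ⊕ B)) (Δ * (# A + # B)) crit₀) (≤-trans h≤₁ (≤-reflexive (sym (*-assoc 2 H₁ θ′))))))

          ξ₀-big : h * μ ≤ τ * (H₁ * μ)
          ξ₀-big = ≤-trans (*-monoˡ-≤ μ h≤₁) (≤-trans (≤-reflexive (regroup H₁ θ′ μ)) (*-monoˡ-≤ (H₁ * μ) (*-monoˡ-≤ θ′ (s≤s (s≤s (z≤n {2}))))))
            where
            regroup : ∀ a t m → 2 * (a * t) * m ≡ 2 * t * (a * m)
            regroup = solve-∀

          Eτ≤h : E * τ ≤ h
          Eτ≤h = ≤-trans (*-mono-≤ (≤-trans (scaled {8 * E} {E} (*-mono-≤ (s≤s (z≤n {7})) 1≤E)) (≤-trans (≤-reflexive (*-assoc 8 E E)) H₂≥)) τ≤θ) h≥₂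

          cancelE : ∀ {a b} → E * a ≤ E * b → a ≤ b
          cancelE = *-cancelˡ-≤ E {{>-nonZero 1≤E}}

          τ≤A : τ ≤ # A
          τ≤A = cancelE (≤-trans Eτ≤h A-big)
          roomA : τ + # (A ⊕ B) ≤ h
          roomA = cancelE (≤-trans (≤-reflexive (*-distribˡ-+ E τ (# (A ⊕ B)))) (≤-trans (+-monoˡ-≤ (E * # (A ⊕ B)) Eτ≤h) free))

          hits-nonempty : ∃ λ w → w ∈ B
          hits-nonempty = let k , _ , p = hits full (record { ε∈ = tt ; ∙∈ = λ _ _ → tt ; ⁻¹∈ = λ _ → tt }) (κ-index (≤-trans κ′≤τ (≤-trans τ≤A (#≤h A)))) ε in k ∙ ε , p

        opaque
          small-atom : ∃ λ Y → (τ ≤ # Y × τ + # (Y ⊕ B) ≤ h) × # Y < θ × # (Y ⊕ B) + # A ≤ # (A ⊕ B) + # Y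
          small-atom = Isoperimetry.Fragments.atom 𝔾 B τ (proj₂ hits-nonempty) {θ} {4 * H₂ * τ} 1≤τ
            (scale-tower {h} {H₂} {θ} {τ} refl (*-mono-≤ (*-mono-≤ 1≤H₂ 1≤θ) 1≤τ) h≤₂) κ≤θ
            (λ K s κ≤ → hits K s (κ-index (≤-trans (≤-trans κ′≤τ (scaled (*-mono-≤ (s≤s (z≤n {3})) 1≤H₂))) κ≤))) A (τ≤A , roomA)

        module Based (Y : Sub) (ε∈Y : ε ∈ Y) (τ≤Y : τ ≤ # Y) (Y<θ : # Y < θ) (critY : # (Y ⊕ B) ≤ # Y + # B + d) where

          U : Sub
          U u = some (Y ∩ (Y ⇀ u))

          U⁻ : ∀ {u} → u ∈ U → ∃ λ y → y ∈ Y × y // u ∈ Y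
          U⁻ {u} p = let y , q = some⁻ (Y ∩ (Y ⇀ u)) p in y , ∈∩ˡ {Y} {Y ⇀ u} {y} q , ∈∩ʳ {Y} {Y ⇀ u} {y} q

          U⁺ : ∀ {u} y → y ∈ Y → y // u ∈ Y → u ∈ U
          U⁺ {u} y p q = some⁺ {Y ∩ (Y ⇀ u)} {y} (∈∩⁺ {Y} {Y ⇀ u} {y} p q)

          U-sym : ∀ u → u ∈ U → u ⁻¹ ∈ U
          U-sym u p = let y , y∈ , yu∈ = U⁻ p in
            U⁺ {u ⁻¹} (y // u) yu∈ (subst (_∈ Y) (group 2 (λ y u → y ≗ (y ⊘ u) ⊘ inv u) refl y u) y∈)

          open Generated 𝔾 U

          module OnSpan (H : Sub) (ε∈H : ε ∈ H) (closed : Closed H) (min : Minimal H) where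

            sub : Subgroup H
            sub = span-subgroup U-sym ε∈H closed min

            U⊑H : U ⊑ H
            U⊑H u u∈ = subst (_∈ H) (identityˡ u) (closed ε u ε∈H u∈)

            Y⊑H : Y ⊑ H
            Y⊑H y y∈ = U⊑H y (U⁺ {y} y y∈ (subst (_∈ Y) (sym (inverseʳ y)) ε∈Y))

            index : h ≤ D * # H
            index = κ-index (≤-trans κ′≤τ (≤-trans τ≤Y (#-mono {Y} {H} Y⊑H)))

            module _ {a₀ : Carrier} (a₀∈ : a₀ ∈ A) where
              open Reduction.Critical₁ 𝔾 A B {E} {D} {d} hits crit free a₀∈
              open InSubgroup H sub index Y ε∈Y Y⊑H critY {τ} {θ} {μ} {θ′} {κ′} {H₁ * μ} 1≤τ τ≤Y Y<θ 1≤μ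
                (scale-tower {h} {H₁} {θ′} {μ} refl (*-mono-≤ (*-mono-≤ 1≤H₁ 1≤θ′) 1≤μ) h≤₁) κ′≤θ′ κ′-index
                (≤-trans (≤-trans (scaled 1≤H₁) H₁μ≤θ′) θ′≤τ)
                (lin 2 (λ t d → (d ≼ t) ⟨ 1 ⟩⇒ (con 1 ≼ t) ⟨ 1 ⟩⇒ 1 ⊢ con 1 ⊞ 2 ⊠ t ⊞ d ≼ 4 ⊠ t) (θ′) d d≤θ′ 1≤θ′)
                ξ₀-big

              conclude : ∀ x₀ → (∀ x → ¬ (x ∈ H ⇀ x₀) → # H < # ((H ⇀ x) ∩ P) + μ) → Outcome 𝔾 A B E D k
              conclude x₀ thick =
                let b₀ , b₀∈ , b₀∈H = b₀-exists ξ-small 1≤E in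
                record
                { H = H ; sub = sub ; index = index ; a₀ = a₀ ; b₀ = b₀ ; a₀∈ = a₀∈ ; b₀∈ = b₀∈ ; A⊑ = A⊑ ξ-small 1≤E
                ; B₁-large = lin 5 (λ Eh EH EB Ex H → (Eh ≼ EH ⊞ EB ⊞ Ex) ⟨ 1 ⟩⇒ (con 1 ⊞ Ex ≼ H) ⟨ 1 ⟩⇒ 1 ⊢ con 1 ⊞ Eh ≼ EH ⊞ EB
                    ⊞ H) (E * h) (E * # H) (E * # (B ∖ (H ⇀ b₀))) (E * ξ) (# H)
                    (≤-trans (*-monoʳ-≤ E (B₁-large ξ-small 1≤E b₀∈ b₀∈H))
                        (≤-reflexive (trans (*-distribˡ-+ E (# H + # (B ∖ (H ⇀ b₀))) ξ)
                        (cong (_+ E * ξ) (*-distribˡ-+ E (# H) (# (B ∖ (H ⇀ b₀))))))))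
                    (Eξ<H ξ-small 1≤E)
                ; rest = alternative b₀ b₀∈ b₀∈H (E * # ((H ⇀ b₀) ∩ B) <? # H) }
                where
                open AtCoset x₀ thick
                open SubgroupAsGroup 𝔾 H sub using (group-of; restrict; restrict-generates; h-restrict; #-restrict-⊑; module ℍ)
                ξ≤ : ξ ≤ 3 * θ
                ξ≤ = lin 5 (λ x t t′ u d → (x ≼ t′) ⟨ 1 ⟩⇒ (t′ ≼ u) ⟨ 2 ⟩⇒ (u ≼ t) ⟨ 2 ⟩⇒ (d ≼ t′) ⟨ 1 ⟩⇒ 1 ⊢ x ⊞ t ⊞ d ≼ 3 ⊠ t)
                    (H₁ * μ) (θ) (θ′) (τ) d H₁μ≤θ′ θ′≤τ τ≤θ d≤θ′
                ξ-small : 2 * (E * (E * ξ)) < h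
                ξ-small = <-≤-trans (≤-<-trans (≤-trans (*-monoʳ-≤ 2 (*-monoʳ-≤ E (*-monoʳ-≤ E ξ≤))) (≤-reflexive (regroup E θ)))
                  (*-monoˡ-< θ {{>-nonZero 1≤θ}} (<-≤-trans (*-monoˡ-< (E * E) {{>-nonZero (*-mono-≤ 1≤E 1≤E)}} (m≤m+n 7 1)) H₂≥))) h≥₂
                  where
                  regroup : ∀ e t → 2 * (e * (e * (3 * t))) ≡ 6 * (e * e) * t
                  regroup = solve-∀
                -- `# Y + d` is both the Lipschitz constant and the excess inside `H`. It is below
                -- `2 * θ`, while `H` keeps at least `h / (2 * E)` elements.
                threshold : N₀ * suc (# Y + d) ≤ ℍ.h
                threshold = *-cancelˡ-≤ (2 * E) {{>-nonZero (*-mono-≤ (s≤s (z≤n {1})) 1≤E)}} (begin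
                  2 * E * (N₀ * suc (# Y + d)) ≤⟨ *-monoʳ-≤ (2 * E) (*-monoʳ-≤ N₀
                      (lin 5 (λ y t t′ u d → (con 1 ⊞ y ≼ t) ⟨ 1 ⟩⇒ (d ≼ t′) ⟨ 1 ⟩⇒ (t′ ≼ u) ⟨ 1 ⟩⇒ (u ≼ t) ⟨ 1 ⟩⇒ 1 ⊢ con 1 ⊞
                      (y ⊞ d) ≼ 2 ⊠ t) (# Y) (θ) (θ′) (τ) d Y<θ d≤θ′ θ′≤τ τ≤θ)) ⟩
                  2 * E * (N₀ * (2 * θ)) ≡⟨ regroup E N₀ θ ⟩
                  4 * (E * N₀) * θ ≤⟨ *-monoˡ-≤ θ H₂≥′ ⟩
                  H₂ * θ ≤⟨ h≥₂ ⟩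
                  h ≤⟨ H-bound ξ-small 1≤E ⟩
                  2 * (E * # H) ≡⟨ trans (sym (*-assoc 2 E (# H))) (cong (2 * E *_) (sym h-restrict)) ⟩
                  2 * E * ℍ.h ∎)
                  where
                  open ≤-Reasoning
                  regroup : ∀ e n t → 2 * e * (n * (2 * t)) ≡ 4 * (e * n) * t
                  regroup = solve-∀
                alternative : ∀ b₀ (b₀∈ : b₀ ∈ B) (b₀∈H : b₀ ∈ H ⇀ x₀) → Dec (E * # ((H ⇀ b₀) ∩ B) < # H) →
                  E * # ((H ⇀ b₀) ∩ B) < # H ⊎ BohrPair group-of (λ p → A (proj₁ p ∙ a₀)) (λ p → B (proj₁ p ∙ b₀)) (2 * E) k
                alternative b₀ b₀∈ b₀∈H (yes p) = inj₁ p
                alternative b₀ b₀∈ b₀∈H (no p) = inj₂ (structure group-of (restrict U) (restrict-generates U⊑H min)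
                  {restrict (λ x → A (x ∙ a₀))} {restrict (λ x → B (x ∙ b₀))} {# Y + d} threshold
                  (lin 5 (λ h′ H h Ea Ea′ → (h′ ≐ H) ⟨ 2 ⟩⇒ (H ≼ h) ⟨ 2 ⟩⇒ (h ≼ Ea) ⟨ 2 ⟩⇒ (Ea′ ≑ 2 ⊠ Ea) ⟨ 1 ⟩⇒ 2 ⊢ h′ ≼ Ea′)
                      (ℍ.h) (# H) h (E * # A) (2 * E * ℍ.# restrict (λ x → A (x ∙ a₀)))
                    h-restrict (#≤h H) A-big (trans (cong (2 * E *_) (trans
                        (#-restrict-⊑ (λ x → A (x ∙ a₀)) (A₀⊑H ξ-small 1≤E b₀∈ b₀∈H)) (#A₀ ξ-small 1≤E b₀∈ b₀∈H)))
                        (*-assoc 2 E (# A))))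
                  (lin 4 (λ h′ H Eb Eb′ → (h′ ≐ H) ⟨ 2 ⟩⇒ (H ≼ Eb) ⟨ 2 ⟩⇒ (Eb′ ≑ 2 ⊠ Eb) ⟨ 1 ⟩⇒ 2 ⊢ h′ ≼ Eb′) (ℍ.h) (# H)
                      (E * # ((H ⇀ b₀) ∩ B)) (2 * E * ℍ.# restrict (λ x → B (x ∙ b₀)))
                    h-restrict (≮⇒≥ p) (trans (cong (2 * E *_) (#B₀ ξ-small 1≤E b₀∈ b₀∈H)) (*-assoc 2 E (# ((H ⇀ b₀) ∩ B)))))
                  (lipschitz′ λ { (u , u∈) p → local-lip ξ-small 1≤E b₀∈ b₀∈H u (U⁻ p) u∈ })
                  (local-crit ξ-small 1≤E b₀∈ b₀∈H) (local-free ξ-small 1≤E b₀∈ b₀∈H))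
                  where
                  lipschitz′ : ∀ {W ν} → (∀ u → u ℍ.∈ restrict U → ℍ.# (W ℍ.∖ (W ℍ.⇀ u)) ≤ ν) → Lipschitz.Lip group-of
                      (restrict U) (restrict-generates U⊑H min) W ν
                  lipschitz′ b = record { bound = b }

              outcome : Outcome 𝔾 A B E D k
              outcome = let x₀ , thick = exceptional in conclude x₀ thick

          based : ∀ {a₀} → a₀ ∈ A → Outcome 𝔾 A B E D k
          based a₀∈ = let H , ε∈H , closed , min = span in OnSpan.outcome H ε∈H closed min a₀∈

        large-outcome : Outcome 𝔾 A B E D k
        large-outcome =
          let Y , (τ≤Y , _) , Y<θ , le = small-atom
              y , y∈ = #-∈ Y (≤-trans 1≤τ τ≤Y)
              a₀ , a₀∈ = #-∈ A (≤-trans 1≤τ τ≤A)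
              #Y = #-⇀ Y (y ⁻¹)
          in Based.based (Y ⇀ (y ⁻¹)) (subst (_∈ Y) (group 1 (λ y → y ≗ one ⊘ inv y) refl y) y∈)
               (≤-trans τ≤Y (≤-reflexive (sym #Y))) (≤-<-trans (≤-reflexive #Y) Y<θ)
               (lin 8 (λ s s′ a t y y′ b d → (s ≐ s′) ⟨ 1 ⟩⇒ (s′ ⊞ a ≼ t ⊞ y) ⟨ 1 ⟩⇒ (t ≼ a ⊞ b ⊞ d) ⟨ 1 ⟩⇒ (y′ ≑ y) ⟨ 1 ⟩⇒ 1 ⊢ s
                  ≼ y′ ⊞ b ⊞ d) (# ((Y ⇀ (y ⁻¹)) ⊕ B)) (# (Y ⊕ B)) (# A) (# (A ⊕ B)) (# Y) (# (Y ⇀ (y ⁻¹))) (# B) d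
                 (#-⇀-⊕ Y B (y ⁻¹)) le crit #Y) a₀∈

      -- For `h < Z` the trivial subgroup has index at most `D`, so `B` is the whole group and
      -- `A ⊕ B` is too, against `free`. This is why `Z` is a summand of `D`.
      inverse : ∀ (A B : Sub) → (∀ K → Subgroup K → h ≤ D * # K → Meets B K) → h ≤ E * # A →
        Δ * # (A ⊕ B) ≤ Δ * (# A + # B) + h → h + E * # (A ⊕ B) ≤ E * h → Outcome 𝔾 A B E D k
      inverse A B hits A-big crit₀ free with Z ≤? h
      ... | yes p = let μ , 1≤μ , lo , hi = floor-double Z 1≤Z 1 (≤-trans (≤-reflexive (*-identityʳ Z)) p) ≤-refl in
                    Large.large-outcome A B hits A-big crit₀ free 1≤μ lo hi
      ... | no p = ⊥-elim (<⇒≱ (∈-# {full} {ε} tt) (+-cancelʳ-≤ (E * h) h 0 (≤-trans (+-monoʳ-≤ h (*-monoʳ-≤ E everything)) free)))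
        where
        trivial : Sub
        trivial x = ⌊ x ≟ ε ⌋
        trivial-subgroup : Subgroup trivial
        trivial-subgroup = record { ε∈ = ≟-refl refl ; ∙∈ = λ p q → ≟-refl (trans (cong₂ _∙_ (≟-true p) (≟-true q)) (identityˡ ε))
          ; ⁻¹∈ = λ p → ≟-refl (trans (cong _⁻¹ (≟-true p)) (group 0 (inv one ≗ one) refl)) }
        B-full : ∀ x → x ∈ B
        B-full x = let k , k∈ , kx = hits trivial trivial-subgroup (≤-trans (<⇒≤ (≰⇒> p)) (≤-trans (m≤n+m Z (4 * H₁)) (≤-trans (≤-reflexive (sym (*-identityʳ D))) (*-monoʳ-≤ D (∈-# {trivial} {ε} (≟-refl refl)))))) x in
          subst (_∈ B) (trans (cong (_∙ x) (≟-true k∈)) (identityˡ x)) kx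
        everything : h ≤ # (A ⊕ B)
        everything = let a , a∈ = #-∈ A (positive (# A) (≤-trans (∈-# {full} {ε} tt) A-big)) in
          #-mono {full} {A ⊕ B} λ x _ → subst (_∈ A ⊕ B) (group 2 (λ a x → a ⊙ (x ⊘ a) ≗ x) refl a x) (⊕⁺ {A} {B} a∈ (B-full (x // a)))
          where
          positive : ∀ k → 1 ≤ E * k → 1 ≤ k
          positive zero q = ⊥-elim (<⇒≱ q (≤-reflexive (*-zeroʳ E)))
          positive (suc k) _ = s≤s z≤n

  InverseTheorem : ℕ → ℕ → ℕ → ℕ → Set₁
  InverseTheorem E k Δ D = ∀ (𝔾 : FinAb) → let open Counting 𝔾 in
    ∀ (A B : Sub) → (∀ K → Subgroup K → h ≤ D * # K → Meets B K) → h ≤ E * # A →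
    Δ * # (A ⊕ B) ≤ Δ * (# A + # B) + h → h + E * # (A ⊕ B) ≤ E * h → Outcome 𝔾 A B E D k

  inverse-theorem : ∀ E k → 1000 ≤ E → k ≤ E → ∃ λ Δ → ∃ λ D → 1 ≤ Δ × InverseTheorem E k Δ D
  inverse-theorem E k E-big k≤E = Δ , D , 1≤Δ , inverse
    where open Inverse E k E-big k≤E

  -- The cyclic groups ℤ/Q

  open RationalBounds

  T→≡ : ∀ {b} → T b → b ≡ true
  T→≡ {true} _ = refl

  ≡→T : ∀ {b} → b ≡ true → T b
  ≡→T refl = tt

  ∈⁺ : ∀ {n} {S : Subset n} {x} → T (lookup S x) → x ∈ˢ S
  ∈⁺ {S = S} {x} p = lookup⇒[]= x S (T→≡ p)

  ∈⁻ : ∀ {n} {S : Subset n} {x} → x ∈ˢ S → T (lookup S x)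
  ∈⁻ p = ≡→T ([]=⇒lookup p)

  tab⁺ : ∀ {n} {f : Fin n → Bool} {x} → T (f x) → x ∈ˢ tabulate f
  tab⁺ {f = f} {x} p = ∈⁺ (subst T (sym (lookup∘tabulate f x)) p)

  tab⁻ : ∀ {n} {f : Fin n → Bool} {x} → x ∈ˢ tabulate f → T (f x)
  tab⁻ {f = f} {x} p = subst T (lookup∘tabulate f x) (∈⁻ p)

  ∑-card : ∀ {n} {A : Set} (S : Subset n) (f : Fin n → A) (g : A → ℕ) → (∀ i → g (f i) ≡ 𝟙 (lookup S i)) →
    ∑ (List.tabulate f) g ≡ ∣ S ∣
  ∑-card [] f g p = refl
  ∑-card (true ∷ S) f g p = cong₂ _+_ (p zero) (∑-card S (λ i → f (suc i)) g (λ i → p (suc i)))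
  ∑-card (false ∷ S) f g p = cong₂ _+_ (p zero) (∑-card S (λ i → f (suc i)) g (λ i → p (suc i)))

  toℕ-mod : ∀ m Q .{{_ : NonZero Q}} → toℕ (m mod Q) ≡ m % Q
  toℕ-mod m Q = toℕ-fromℕ< (m%n<n m Q)

  half-< : ∀ {m n} → 2 * m ≤ n → 1 ≤ n → m < n
  half-< {m} {n} p q = ≰⇒> λ r → <-irrefl refl (lin 2 (λ m n → (2 ⊠ m ≼ n) ⟨ 1 ⟩⇒ (con 1 ≼ n) ⟨ 1 ⟩⇒ (n ≼ m) ⟨ 2 ⟩⇒ 1 ⊢ con 1 ⊞ n ≼ n) m n p q r)

  module Cyclic (Q : ℕ) {{Q≢0 : NonZero Q}} where

    toℕ-≅ : ∀ {x y : Fin Q} → toℕ x ≅ toℕ y [ Q ] → x ≡ y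
    toℕ-≅ {x} {y} p = toℕ-injective (≅-unique (toℕ<n x) (toℕ<n y) p)

    mod-≅ : ∀ m → toℕ (m mod Q) ≅ m [ Q ]
    mod-≅ m = ≅-sym (subst (λ y → m ≅ y [ Q ]) (sym (toℕ-mod m Q)) (%-≅ m Q))

    ≡⇒≅ : ∀ {a b} → a ≡ b → a ≅ b [ Q ]
    ≡⇒≅ refl = ≅-refl

    isAbelianGroupᶻ : IsAbelianGroup _≡_ (_+ₘ_ {Q}) 0ₘ (-ₘ_)
    isAbelianGroupᶻ = record
      { isGroup = record
        { isMonoid = record
          { isSemigroup = record
            { isMagma = record { isEquivalence = isEquivalence ; ∙-cong = cong₂ _+ₘ_ }
            ; assoc = λ x y z → toℕ-≅ (≅-trans (mod-≅ _) (≅-trans (≅-+ {c = toℕ z} (mod-≅ (toℕ x + toℕ y)) ≅-refl)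
                (≅-trans (≡⇒≅ (+-assoc (toℕ x) (toℕ y) (toℕ z))) (≅-sym (≅-trans (mod-≅ _) (≅-+ {toℕ x} ≅-refl (mod-≅ (toℕ y + toℕ z)))))))) }
          ; identity = (λ x → left x) , (λ x → trans (commute x 0ₘ) (left x)) }
        ; inverse = (λ x → inverse x) , (λ x → trans (commute x (-ₘ x)) (inverse x))
        ; ⁻¹-cong = cong (-ₘ_) }
      ; comm = commute }
      where
      commute : ∀ x y → x +ₘ y ≡ y +ₘ x
      commute x y = cong (_mod Q) (+-comm (toℕ x) (toℕ y))
      left : ∀ x → 0ₘ +ₘ x ≡ x
      left x = toℕ-≅ (≅-trans (mod-≅ _) (≅-+ {c = toℕ x} (mod-≅ 0) ≅-refl))
      inverse : ∀ x → (-ₘ x) +ₘ x ≡ 0ₘ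
      inverse x = toℕ-≅ (≅-trans (mod-≅ _) (≅-trans (≅-+ {c = toℕ x} (mod-≅ (Q ∸ toℕ x)) ≅-refl)
        (≅-trans (0 , 1 , trans (+-identityʳ _) (trans (m∸n+n≡m (<⇒≤ (toℕ<n x))) (sym (+-identityʳ Q)))) (≅-sym (mod-≅ 0)))))

    ℤ/ : FinAb
    ℤ/ = record
      { Carrier = Fin Q ; _∙_ = _+ₘ_ ; ε = 0ₘ ; _⁻¹ = -ₘ_ ; isAbelianGroup = isAbelianGroupᶻ
      ; _≟_ = Finₚ._≟_ ; elems = List.tabulate (λ i → i)
      ; once = λ a → trans (∑-card ⁅ a ⁆ (λ i → i) (λ x → 𝟙 ⌊ x Finₚ.≟ a ⌋) (single a)) (∣⁅x⁆∣≡1 a) }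
      where
      single : ∀ a i → 𝟙 ⌊ i Finₚ.≟ a ⌋ ≡ 𝟙 (lookup ⁅ a ⁆ i)
      single a i with i Finₚ.≟ a
      ... | yes refl = sym (𝟙-true (∈⁻ (x∈⁅x⁆ i)))
      ... | no n = sym (𝟙-false (λ p → n (x∈⁅y⁆⇒x≡y a (∈⁺ p))))

    open Counting ℤ/

    #-card : ∀ (S : Subset Q) → # (lookup S) ≡ ∣ S ∣
    #-card S = ∑-card S (λ i → i) (λ x → 𝟙 (lookup S x)) (λ _ → refl)

    #-tab : ∀ (f : Sub) → ∣ tabulate f ∣ ≡ # f
    #-tab f = trans (sym (#-card (tabulate f))) (#-cong {lookup (tabulate f)} {f} (lookup∘tabulate f))

    h≡Q : h ≡ Q
    h≡Q = trans (sym (#-tab full)) (trans (cong ∣_∣ (all-true Q)) (Data.Fin.Subset.Properties.∣⊤∣≡n Q))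
      where
      all-true : ∀ n → tabulate {n = n} (λ _ → true) ≡ Data.Fin.Subset.⊤
      all-true zero = refl
      all-true (suc n) = cong (true ∷_) (all-true n)

    sumset : ∀ (A B : Subset Q) → ∣ A Defs.⊕ B ∣ ≡ # (lookup A ⊕ lookup B)
    sumset A B = trans (sym (#-card (A Defs.⊕ B))) (≤-antisym (#-mono {lookup (A Defs.⊕ B)} {lookup A ⊕ lookup B} into)
        (#-mono {lookup A ⊕ lookup B} {lookup (A Defs.⊕ B)} back))
      where
      into : lookup (A Defs.⊕ B) ⊑ lookup A ⊕ lookup B
      into z p = let a , b , a∈ , b∈ , eq = toWitness (tab⁻ {x = z} (∈⁺ p)) in
        subst (_∈ lookup A ⊕ lookup B) eq (⊕⁺ {lookup A} {lookup B} {a} {b} (∈⁻ a∈) (∈⁻ b∈))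
      back : lookup A ⊕ lookup B ⊑ lookup (A Defs.⊕ B)
      back z p = let a , b , a∈ , b∈ , eq = ⊕⁻ {lookup A} {lookup B} {z} p in
        ∈⁻ (tab⁺ {x = z} (fromWitness (a , b , ∈⁺ {x = a} a∈ , ∈⁺ {x = b} b∈ , sym eq)))

    tab-subgroup : ∀ {K : Sub} → Subgroup K → IsSubgroup (tabulate K)
    tab-subgroup s = tab⁺ (ε∈ s) , (λ x y p q → tab⁺ (∙∈ s (tab⁻ p) (tab⁻ q))) , (λ x p → tab⁺ (⁻¹∈ s (tab⁻ p)))
      where open Subgroup

    tab-index : ∀ {K : Sub} {D} → h ≤ D * # K → IndexAtMost (tabulate K) D
    tab-index {K} {D} p = ≤-trans (≤-reflexive (sym h≡Q)) (≤-trans p (≤-reflexive (cong (D *_) (sym (#-tab K)))))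

    -- The part shared by the alternatives (iii) and (iv); `P` is the clause (c) in which they
    -- differ.
    Split : Subset Q → Subset Q → ℕ → ℚ → (Subset Q → Subset Q → Subset Q → Set) → Set
    Split A B D ε P = ∃ λ H → IsSubgroup H × IndexAtMost H D ×
      ∃ λ a₀ → a₀ ∈ˢ A × ∃ λ b₀ → b₀ ∈ˢ B ×
      ∃ λ A₀ → ∃ λ B₀ → ∃ λ B₁ → IsTranslate A A₀ a₀ × IsTranslate₂ B B₀ B₁ b₀ × A₀ ⊆ˢ H × B₀ ⊆ˢ H × B₁ ⊆ˢ ∁ˢ H ×
      ((ℕ→ℚ Q ℚ.- (ℕ→ℚ ∣ H ∣)) ℚ.- (ε ℚ.* (ℕ→ℚ ∣ H ∣)) ℚ.< ℕ→ℚ ∣ B₁ ∣) × P H A₀ B₀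

    NearIntervals : ℚ → ℕ → Subset Q → Subset Q → Subset Q → Set
    NearIntervals ε k H A₀ B₀ = ∃ λ n → k < suc n × Σ (Fin Q → Fin (suc n)) λ φ → IsSurjHomOn H φ ×
      ∃ λ I → ∃ λ J → IsInterval I × IsInterval J × A₀ ⊆ˢ preimage H φ I × B₀ ⊆ˢ preimage H φ J ×
      ℕ→ℚ ∣ preimageMinus H φ I A₀ ∣ ℚ.< ε ℚ.* ℕ→ℚ Q × ℕ→ℚ ∣ preimageMinus H φ J B₀ ∣ ℚ.< ε ℚ.* ℕ→ℚ Q

    Sparse : ℚ → Subset Q → Subset Q → Subset Q → Set
    Sparse η H A₀ B₀ = ℕ→ℚ ∣ B₀ ∣ ℚ.< η ℚ.* ℕ→ℚ ∣ H ∣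

    to-outcome : ∀ {E k Δ D} → InverseTheorem E k Δ D → (A B : Subset Q) →
      ((H : Subset Q) → IsSubgroup H → IndexAtMost H D → (x : Fin Q) → ∃ λ h → h ∈ˢ H × (h +ₘ x) ∈ˢ B) →
      Q ≤ E * ∣ A ∣ → Δ * ∣ A Defs.⊕ B ∣ ≤ Δ * (∣ A ∣ + ∣ B ∣) + Q → Q + E * ∣ A Defs.⊕ B ∣ ≤ E * Q →
      Outcome ℤ/ (lookup A) (lookup B) E D k
    to-outcome {E} {k} {Δ} {D} inverse A B hits A-large critical free = inverse ℤ/ (lookup A) (lookup B)
      (λ K s i x → let h , h∈ , hx∈ = hits (tabulate K) (tab-subgroup {K} s) (tab-index {K} {D} i) x in h , tab⁻ {f = K} {h} h∈ , ∈⁻ {S = B} {h +ₘ x} hx∈)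
      (sized (λ q a b s → q ≤ E * a) A-large)
      (sized (λ q a b s → Δ * s ≤ Δ * (a + b) + q) critical)
      (sized (λ q a b s → q + E * s ≤ E * q) free)
      where
      sized : (P : ℕ → ℕ → ℕ → ℕ → Set) → P Q (∣ A ∣) (∣ B ∣) (∣ A Defs.⊕ B ∣) → P h (# (lookup A)) (# (lookup B)) (# (lookup A ⊕ lookup B))
      sized P = transport (sym h≡Q) (sym (#-card A)) (sym (#-card B)) (sumset A B)
        where
        transport : ∀ {q q′ a a′ b b′ s s′} → q ≡ q′ → a ≡ a′ → b ≡ b′ → s ≡ s′ → P q a b s → P q′ a′ b′ s′
        transport refl refl refl refl p = p

    module Translate (A B : Subset Q) {E D k : ℕ} (O : Outcome ℤ/ (lookup A) (lookup B) E D k) where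
      open Outcome O
      open Subgroup sub
      open SubgroupAsGroup ℤ/ H sub

      Hˢ A₀ B₀ B₁ : Subset Q
      Hˢ = tabulate H
      A₀ = tabulate (λ x → lookup A (x +ₘ a₀))
      B₀ = tabulate (λ x → H x ∧ lookup B (x +ₘ b₀))
      B₁ = tabulate (λ x → not (H x) ∧ lookup B (x +ₘ b₀))

      translate-A : IsTranslate A A₀ a₀
      translate-A y = mk⇔
        (λ p → y // a₀ , tab⁺ (subst (_∈ lookup A) (group 2 (λ y a → y ≗ (y ⊘ a) ⊙ a) refl y a₀) (∈⁻ p)) , group 2
            (λ y a → (y ⊘ a) ⊙ a ≗ y) refl y a₀)
        (λ { (c , c∈ , refl) → ∈⁺ {S = A} (tab⁻ c∈) })

      translate-B : IsTranslate₂ B B₀ B₁ b₀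
      translate-B y = mk⇔
        (λ p → y // b₀ , part (subst (_∈ lookup B) (group 2 (λ y a → y ≗ (y ⊘ a) ⊙ a) refl y b₀) (∈⁻ p)) , group 2
            (λ y a → (y ⊘ a) ⊙ a ≗ y) refl y b₀)
        (λ { (c , inj₁ c∈ , refl) → ∈⁺ {S = B} (∈∩ʳ {H} {λ x → lookup B (x +ₘ b₀)} {c} (tab⁻ c∈))
           ; (c , inj₂ c∈ , refl) → ∈⁺ {S = B} (∈∩ʳ {λ x → not (H x)} {λ x → lookup B (x +ₘ b₀)} {c} (tab⁻ c∈)) })
        where
        part : ∀ {c} → c +ₘ b₀ ∈ lookup B → c ∈ˢ B₀ ⊎ c ∈ˢ B₁
        part {c} p with c ∈? H
        ... | yes q = inj₁ (tab⁺ (∈∩⁺ {H} {λ x → lookup B (x +ₘ b₀)} {c} q p))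
        ... | no q = inj₂ (tab⁺ (∈∩⁺ {λ x → not (H x)} {λ x → lookup B (x +ₘ b₀)} {c} (∈∖⁺ {full} {H} {c} tt q) p))

      A₀-H : ∀ {x} → x +ₘ a₀ ∈ lookup A → x ∈ H
      A₀-H {x} p = subst (_∈ H) (group 2 (λ x a → (x ⊙ a) ⊘ a ≗ x) refl x a₀) (A⊑ (x +ₘ a₀) p)

      A₀⊆ : A₀ ⊆ˢ Hˢ
      A₀⊆ p = tab⁺ (A₀-H (tab⁻ p))

      B₀⊆ : B₀ ⊆ˢ Hˢ
      B₀⊆ {x} p = tab⁺ (∈∩ˡ {H} {λ x → lookup B (x +ₘ b₀)} {x} (tab⁻ p))

      B₁⊆ : B₁ ⊆ˢ ∁ˢ Hˢ
      B₁⊆ {x} p = x∉p⇒x∈∁p λ q → ∈∖ʳ {full} {H} {x} (∈∩ˡ {λ x → not (H x)} {λ x → lookup B (x +ₘ b₀)} {x} (tab⁻ p)) (tab⁻ q)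

      #Hˢ : ∣ Hˢ ∣ ≡ # H
      #Hˢ = #-tab H

      moved-count : ∀ (f : Sub) b → # (λ x → f (x +ₘ b)) ≡ # f
      moved-count f b = reindex (_∙ b) (_// b) (λ x → group 2 (λ x a → (x ⊙ a) ⊘ a ≗ x) refl x b)
          (λ x → group 2 (λ x a → (x ⊘ a) ⊙ a ≗ x) refl x b) (λ x → 𝟙 (f x))

      #B₁ : ∣ B₁ ∣ ≡ # (lookup B ∖ (H ⇀ b₀))
      #B₁ = trans (#-tab (λ x → not (H x) ∧ lookup B (x +ₘ b₀))) (trans
        (#-cong {λ x → not (H x) ∧ lookup B (x +ₘ b₀)} {λ x → (lookup B ∖ (H ⇀ b₀)) (x +ₘ b₀)} (λ x →
          trans (∧-comm′ (not (H x)) (lookup B (x +ₘ b₀))) (cong (λ y → lookup B (x +ₘ b₀) ∧ not (H y))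
              (group 2 (λ x b → x ≗ (x ⊙ b) ⊘ b) refl x b₀))))
        (moved-count (lookup B ∖ (H ⇀ b₀)) b₀))
        where
        ∧-comm′ : ∀ a b → a ∧ b ≡ b ∧ a
        ∧-comm′ true true = refl
        ∧-comm′ true false = refl
        ∧-comm′ false true = refl
        ∧-comm′ false false = refl

      #B₀ : ∣ B₀ ∣ ≡ # ((H ⇀ b₀) ∩ lookup B)
      #B₀ = trans (#-tab (λ x → H x ∧ lookup B (x +ₘ b₀))) (trans
        (#-cong {λ x → H x ∧ lookup B (x +ₘ b₀)} {λ x → ((H ⇀ b₀) ∩ lookup B) (x +ₘ b₀)} (λ x →
          cong (λ y → H y ∧ lookup B (x +ₘ b₀)) (group 2 (λ x b → x ≗ (x ⊙ b) ⊘ b) refl x b₀)))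
        (moved-count ((H ⇀ b₀) ∩ lookup B) b₀))

      B₁-big : E * Q < E * ∣ Hˢ ∣ + E * ∣ B₁ ∣ + ∣ Hˢ ∣
      B₁-big = subst₃ (sym #Hˢ) (sym #B₁) h≡Q B₁-large
        where
        subst₃ : ∀ {a a′ b b′ c c′} → a ≡ a′ → b ≡ b′ → c ≡ c′ → E * c < E * a + E * b + a → E * c′ < E * a′ + E * b′ + a′
        subst₃ refl refl refl p = p

      split : ∀ {ε P} → 1ℚ ℚ.≤ ℕ→ℚ E ℚ.* ε → P Hˢ A₀ B₀ → Split A B D ε P
      split {ε} 1≤Eε p = Hˢ , tab-subgroup {H} sub , tab-index {H} {D} index , a₀ , ∈⁺ {S = A} a₀∈ , b₀ , ∈⁺ {S = B} b₀∈ , A₀ , B₀ , B₁ ,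
        translate-A , translate-B , A₀⊆ , B₀⊆ , B₁⊆ , nearly {ε} {E} 1≤Eε {Q} {∣ Hˢ ∣} {∣ B₁ ∣} B₁-big , p

      sparse : ∀ {η} → 1ℚ ℚ.≤ ℕ→ℚ E ℚ.* η → E * # ((H ⇀ b₀) ∩ lookup B) < # H → Sparse η Hˢ A₀ B₀
      sparse {η} 1≤Eη p = below {η} {E} 1≤Eη {∣ Hˢ ∣} {∣ B₀ ∣}
        (subst (λ x → E * x < ∣ Hˢ ∣) (sym #B₀) (subst (E * # ((H ⇀ b₀) ∩ lookup B) <_) (sym #Hˢ) p))

      module Circle {m : ℕ} (κ : Elem → ℕ) (κ-hom : ∀ p q → κ p + κ q ≅ κ (p ∘ q) [ suc m ]) (κ-onto : ∀ i → ∃ λ p → κ p ≅ i [ suc m ]) where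
        open Fibres group-of {suc m} κ κ-hom κ-onto using (k₀; rot; below-count)
        open Arcs group-of {suc m} κ κ-hom κ-onto using (arc)

        N : ℕ
        N = suc m

        -- Extended by `zero` outside `H`; `IsSurjHomOn` and the preimages look only at elements of
        -- `H`.
        φ : Fin Q → Fin N
        φ x with T? (H x)
        ... | yes p = κ (x , p) mod N
        ... | no _ = zero

        φ-on : ∀ {x} (p : x ∈ H) → φ x ≡ κ (x , p) mod N
        φ-on {x} p with T? (H x)
        ... | yes p′ = cong (λ q → κ (x , q) mod N) (T-irrelevant p′ p)
        ... | no n = ⊥-elim (n p)

        φ-≅ : ∀ {x} (p : x ∈ H) → toℕ (φ x) ≅ κ (x , p) [ N ]
        φ-≅ {x} p = subst (λ y → y ≅ κ (x , p) [ N ]) (sym (trans (cong toℕ (φ-on p)) (toℕ-mod (κ (x , p)) N))) (≅-sym (%-≅ (κ (x , p)) N))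

        fin-≅ : ∀ {x y : Fin N} → toℕ x ≅ toℕ y [ N ] → x ≡ y
        fin-≅ {x} {y} p = toℕ-injective (≅-unique (toℕ<n x) (toℕ<n y) p)

        mod-≅ᴺ : ∀ k → toℕ (k mod N) ≅ k [ N ]
        mod-≅ᴺ k = subst (λ y → y ≅ k [ N ]) (sym (toℕ-mod k N)) (≅-sym (%-≅ k N))

        φ-hom : IsSurjHomOn Hˢ φ
        φ-hom = (λ x y p q → let p′ = tab⁻ p ; q′ = tab⁻ q in
                  fin-≅ (≅-trans (φ-≅ (∙∈ p′ q′)) (≅-trans (≅-sym (κ-hom (x , p′) (y , q′))) (≅-sym (≅-trans (mod-≅ᴺ _) (≅-+ (φ-≅ p′) (φ-≅ q′)))))))
              , (λ z → let (x , p) , eq = κ-onto (toℕ z) in x , tab⁺ p , fin-≅ (≅-trans (φ-≅ p) eq))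

        -- The image of an arc on the circle: the interval of length `ℓ` that starts at `-c`.
        interval : ℕ → ℕ → Subset N
        interval c ℓ = tabulate (λ i → (toℕ i + c) % N <ᵇ ℓ)

        is-interval : ∀ c ℓ → ℓ ≤ N → IsInterval (interval c ℓ)
        is-interval c ℓ ℓ≤ = s , ℓ , λ y → mk⇔
            (λ p → (toℕ y + c) % N , <ᵇ⇒< _ _ (tab⁻ {f = λ i → (toℕ i + c) % N <ᵇ ℓ} p) , fin-≅
                (≅-trans (mod-≅ᴺ _) (≅-trans (≅-+ {s} ≅-refl (≅-sym (%-≅ (toℕ y + c) N))) (shifted (toℕ y)))))
            (λ { (i , i< , refl) → tab⁺ {f = λ i → (toℕ i + c) % N <ᵇ ℓ} (<⇒<ᵇ (subst (_< ℓ) (sym (residue i i<)) i<)) })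
          where
          s : ℕ
          s = N ∸ c % N
          s+c : s + c ≅ 0 [ N ]
          s+c = ≅-trans (≅-+ {s} ≅-refl (%-≅ c N)) (0 , 1 , trans (+-identityʳ _) (trans (m∸n+n≡m (<⇒≤ (m%n<n c N))) (sym (+-identityʳ N))))
          shifted : ∀ y → s + (y + c) ≅ y [ N ]
          shifted y = ≅-trans (0 , 0 , cong (_+ 0) ((≤-antisym (lin 3 (λ s y c → 1 ⊢ s ⊞ (y ⊞ c) ≼ y ⊞ (s ⊞ c)) s y c )
              (lin 3 (λ s y c → 1 ⊢ y ⊞ (s ⊞ c) ≼ s ⊞ (y ⊞ c)) s y c ))))
              (≅-trans (≅-+ {y} ≅-refl s+c) (0 , 0 , cong (_+ 0) (+-identityʳ y)))
          residue : ∀ i → i < ℓ → (toℕ ((s + i) mod N) + c) % N ≡ i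
          residue i i< = trans (≅-% (≅-trans (≅-+ {c = c} (mod-≅ᴺ (s + i)) ≅-refl)
              (≅-trans (0 , 0 , cong (_+ 0) (+-assoc s i c)) (shifted i)))) (m<n⇒m%n≡m (<-≤-trans i< ℓ≤))

        rot-φ : ∀ c {x} (p : x ∈ H) → (toℕ (φ x) + c) % N ≡ rot c (x , p)
        rot-φ c p = ≅-% (≅-+ {c = c} (φ-≅ p) ≅-refl)

        in-interval : ∀ {c ℓ x} (p : x ∈ H) → (x , p) ℍ.∈ arc c ℓ → φ x ∈ˢ interval c ℓ
        in-interval {c} {ℓ} p q = tab⁺ {f = λ i → (toℕ i + c) % N <ᵇ ℓ} (subst (λ y → T (y <ᵇ ℓ)) (sym (rot-φ c p)) q)

        in-arc : ∀ {c ℓ x} (p : x ∈ H) → φ x ∈ˢ interval c ℓ → (x , p) ℍ.∈ arc c ℓ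
        in-arc {c} {ℓ} p q = subst (λ y → T (y <ᵇ ℓ)) (rot-φ c p) (tab⁻ {f = λ i → (toℕ i + c) % N <ᵇ ℓ} q)

        in-preimage : ∀ {c ℓ x} (p : x ∈ H) → (x , p) ℍ.∈ arc c ℓ → x ∈ˢ preimage Hˢ φ (interval c ℓ)
        in-preimage {c} {ℓ} {x} p q = tab⁺ (∈∩⁺ {λ x → ⌊ x ∈ˢ? Hˢ ⌋} {λ x → ⌊ φ x ∈ˢ? interval c ℓ ⌋} {x} (fromWitness (tab⁺ p))
            (fromWitness (in-interval {c} {ℓ} {x} p q)))

        -- Density with the constant `2 * E` leaves at most `Q / (2 * E)` missing points; the factor
        -- 2 to spare makes the inequality strict.
        missing : ∀ {c ℓ} (S : Subset Q) → ℓ ≤ N → 2 * E * (ℓ * k₀) ≤ 2 * E * ℍ.# restrict (lookup S) + ℍ.h →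
          restrict (lookup S) ℍ.⊑ arc c ℓ → E * ∣ preimageMinus Hˢ φ (interval c ℓ) S ∣ < Q
        missing {c} {ℓ} S ℓ≤ dense S⊑ =
          half-< (lin 11 (λ Em Em′ EM Ei Ea El Es hh H h Q → (Em ≼ Em′) ⟨ 2 ⟩⇒ (EM ≑ 2 ⊠ Em′) ⟨ 1 ⟩⇒ (Ei ⊞ EM ≐ Ea) ⟨ 1 ⟩⇒
              (Ea ≐ El) ⟨ 1 ⟩⇒ (Es ≼ Ei) ⟨ 1 ⟩⇒ (El ≼ Es ⊞ hh) ⟨ 1 ⟩⇒ (hh ≐ H) ⟨ 1 ⟩⇒ (H ≼ h) ⟨ 1 ⟩⇒ (h ≐ Q) ⟨ 1 ⟩⇒ 1 ⊢ 2 ⊠ Em ≼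
              Q) (E * ∣ preimageMinus Hˢ φ (interval c ℓ) S ∣) (E * M) (2 * E * M) (2 * E * I) (2 * E * ℍ.# arc c ℓ)
              (2 * E * (ℓ * k₀)) (2 * E * ℍ.# restrict (lookup S)) (ℍ.h) (# H) h Q
          (*-monoʳ-≤ E (≤-trans (≤-reflexive (sym (#-card (preimageMinus Hˢ φ (interval c ℓ) S))))
            (≤-trans (≤-reflexive (sym (#-restrict-⊑ (lookup (preimageMinus Hˢ φ (interval c ℓ) S)) inH)))
              (ℍ.#-mono {restrict (lookup (preimageMinus Hˢ φ (interval c ℓ) S))} {arc c ℓ ℍ.∖ restrict (lookup S)} into))))
          (*-assoc 2 E M) (trans (sym (*-distribˡ-+ (2 * E) I M)) (cong (2 * E *_) (ℍ.#-∖ (arc c ℓ) (restrict (lookup S)))))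
              (cong (2 * E *_) (below-count c ℓ ℓ≤))
          (*-monoʳ-≤ (2 * E) (ℍ.#-mono {restrict (lookup S)} {arc c ℓ ℍ.∩ restrict (lookup S)} λ p q → ℍ.∈∩⁺ {arc c ℓ}
              {restrict (lookup S)} {p} (S⊑ p q) q))
          dense h-restrict (#≤h H) h≡Q) (≤-trans (∈-# {full} {ε} tt) (≤-reflexive h≡Q))
          where
          M I : ℕ
          M = ℍ.# (arc c ℓ ℍ.∖ restrict (lookup S))
          I = ℍ.# (arc c ℓ ℍ.∩ restrict (lookup S))
          parts : ∀ x → x ∈ lookup (preimageMinus Hˢ φ (interval c ℓ) S) → x ∈ H × φ x ∈ˢ interval c ℓ × ¬ (x ∈ lookup S)
          parts x p =
            let q = tab⁻ {x = x} (∈⁺ p)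
                r = ∈∩ʳ {λ x → ⌊ x ∈ˢ? Hˢ ⌋} {λ x → ⌊ φ x ∈ˢ? interval c ℓ ⌋ ∧ not ⌊ x ∈ˢ? S ⌋} {x} q
            in tab⁻ (toWitness (∈∩ˡ {λ x → ⌊ x ∈ˢ? Hˢ ⌋} {λ x → ⌊ φ x ∈ˢ? interval c ℓ ⌋ ∧ not ⌊ x ∈ˢ? S ⌋} {x} q)) ,
               toWitness (∈∩ˡ {λ x → ⌊ φ x ∈ˢ? interval c ℓ ⌋} {λ x → not ⌊ x ∈ˢ? S ⌋} {x} r) ,
               λ w → ∈∖ʳ {full} {λ x → ⌊ x ∈ˢ? S ⌋} {x} (∈∩ʳ {λ x → ⌊ φ x ∈ˢ? interval c ℓ ⌋} {λ x → not ⌊ x ∈ˢ? S ⌋} {x} r) (fromWitness (∈⁺ w))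
          inH : lookup (preimageMinus Hˢ φ (interval c ℓ) S) ⊑ H
          inH x p = proj₁ (parts x p)
          into : restrict (lookup (preimageMinus Hˢ φ (interval c ℓ) S)) ℍ.⊑ arc c ℓ ℍ.∖ restrict (lookup S)
          into (x , x∈) p = let _ , a , b = parts x p in ℍ.∈∖⁺ {arc c ℓ} {restrict (lookup S)} {x , x∈} (in-arc {c} {ℓ} {x} x∈ a) b

      A₀-restrict : ∀ p → restrict (lookup A₀) p ≡ lookup A (proj₁ p +ₘ a₀)
      A₀-restrict p = lookup∘tabulate (λ x → lookup A (x +ₘ a₀)) (proj₁ p)

      B₀-restrict : ∀ p → restrict (lookup B₀) p ≡ lookup B (proj₁ p +ₘ b₀)
      B₀-restrict (x , p) = trans (lookup∘tabulate (λ x → H x ∧ lookup B (x +ₘ b₀)) x) (cong (_∧ lookup B (x +ₘ b₀)) (T→≡ p))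

      near-intervals : ∀ {ε} → 1ℚ ℚ.≤ ℕ→ℚ E ℚ.* ε →
        BohrPair group-of (λ p → lookup A (proj₁ p +ₘ a₀)) (λ p → lookup B (proj₁ p +ₘ b₀)) (2 * E) k → NearIntervals ε k Hˢ A₀ B₀
      near-intervals {ε} 1≤Eε record { N = suc m ; k<N = k<N ; κ = κ ; κ-hom = κ-hom ; κ-onto = κ-onto ; cA = cA ; ℓA = ℓA ; cB = cB ; ℓB = ℓB
                           ; ℓA≤ = ℓA≤ ; ℓB≤ = ℓB≤ ; A⊑ = A⊑′ ; B⊑ = B⊑′ ; A-dense = A-dense ; B-dense = B-dense } =
        m , k<N , φ , φ-hom , interval cA ℓA , interval cB ℓB , is-interval cA ℓA ℓA≤ , is-interval cB ℓB ℓB≤ ,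
        (λ {x} p → in-preimage {cA} {ℓA} {x} (A₀-H (tab⁻ p)) (A⊑′ (x , A₀-H (tab⁻ p)) (tab⁻ p))) ,
        (λ {x} p → let q = tab⁻ p in in-preimage {cB} {ℓB} {x} (∈∩ˡ {H} {λ x → lookup B (x +ₘ b₀)} {x} q)
            (B⊑′ (x , ∈∩ˡ {H} {λ x → lookup B (x +ₘ b₀)} {x} q) (∈∩ʳ {H} {λ x → lookup B (x +ₘ b₀)} {x} q))) ,
        below {ε} {E} 1≤Eε {Q} {∣ preimageMinus Hˢ φ (interval cA ℓA) A₀ ∣}
          (missing {cA} {ℓA} A₀ ℓA≤ (subst (λ n → 2 * E * (ℓA * Fibres.k₀ group-of {suc m} κ κ-hom κ-onto) ≤ 2 * E * n + ℍ.h)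
            (sym (ℍ.#-cong {restrict (lookup A₀)} {λ p → lookup A (proj₁ p +ₘ a₀)} A₀-restrict)) A-dense)
          (λ p q → A⊑′ p (subst T (A₀-restrict p) q))) ,
        below {ε} {E} 1≤Eε {Q} {∣ preimageMinus Hˢ φ (interval cB ℓB) B₀ ∣}
          (missing {cB} {ℓB} B₀ ℓB≤ (subst (λ n → 2 * E * (ℓB * Fibres.k₀ group-of {suc m} κ κ-hom κ-onto) ≤ 2 * E * n + ℍ.h)
            (sym (ℍ.#-cong {restrict (lookup B₀)} {λ p → lookup B (proj₁ p +ₘ b₀)} B₀-restrict)) B-dense)
          (λ p q → B⊑′ p (subst T (B₀-restrict p) q)))
        where open Circle {m} κ κ-hom κ-onto

      alternatives : ∀ {ε η} → 1ℚ ℚ.≤ ℕ→ℚ E ℚ.* ε → 1ℚ ℚ.≤ ℕ→ℚ E ℚ.* η →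
        Split A B D ε (NearIntervals ε k) ⊎ Split A B D η (Sparse η)
      alternatives {ε} {η} 1≤Eε 1≤Eη = by rest
        where
        by : E * # ((H ⇀ b₀) ∩ lookup B) < # H ⊎
          BohrPair group-of (λ p → lookup A (proj₁ p +ₘ a₀)) (λ p → lookup B (proj₁ p +ₘ b₀)) (2 * E) k →
          Split A B D ε (NearIntervals ε k) ⊎ Split A B D η (Sparse η)
        by (inj₁ few) = inj₂ (split {η} {Sparse η} 1≤Eη (sparse {η} 1≤Eη few))
        by (inj₂ pair) = inj₁ (split {ε} {NearIntervals ε k} 1≤Eε (near-intervals {ε} 1≤Eε pair))

    -- Comparison of rationals is decidable. If (i) and (ii) both fail, their negations are the
    -- criticality and the free room required by the inverse theorem.
    conclusion : ∀ {α β ε η E k Δ D} (1≤Δ : 1 ≤ Δ) → InverseTheorem E k Δ D →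
      1ℚ ℚ.≤ ℕ→ℚ E ℚ.* α → 1ℚ ℚ.≤ ℕ→ℚ E ℚ.* ε → 1ℚ ℚ.≤ ℕ→ℚ E ℚ.* η → (A B : Subset Q) →
      α ℚ.* ℕ→ℚ Q ℚ.≤ ℕ→ℚ ∣ A ∣ → β ℚ.* ℕ→ℚ Q ℚ.≤ ℕ→ℚ ∣ B ∣ →
      ((H : Subset Q) → IsSubgroup H → IndexAtMost H D → (x : Fin Q) → ∃ λ h → h ∈ˢ H × (h +ₘ x) ∈ˢ B) →
      ((α ℚ.+ β ℚ.+ reciprocal Δ 1≤Δ) ℚ.* ℕ→ℚ Q ℚ.≤ ℕ→ℚ ∣ A Defs.⊕ B ∣) ⊎
      ((ℕ→ℚ 1 ℚ.- ε) ℚ.* ℕ→ℚ Q ℚ.≤ ℕ→ℚ ∣ A Defs.⊕ B ∣) ⊎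
      Split A B D ε (NearIntervals ε k) ⊎ Split A B D η (Sparse η)
    conclusion {α} {β} {ε} {η} {E} {k} {Δ} {D} 1≤Δ inverse 1≤Eα 1≤Eε 1≤Eη A B A-large B-large hits =
      by ((α ℚ.+ β ℚ.+ reciprocal Δ 1≤Δ) ℚ.* ℕ→ℚ Q ℚₚ.≤? ℕ→ℚ ∣ A Defs.⊕ B ∣) ((ℕ→ℚ 1 ℚ.- ε) ℚ.* ℕ→ℚ Q ℚₚ.≤? ℕ→ℚ ∣ A Defs.⊕ B ∣)
      where
      by : Dec ((α ℚ.+ β ℚ.+ reciprocal Δ 1≤Δ) ℚ.* ℕ→ℚ Q ℚ.≤ ℕ→ℚ ∣ A Defs.⊕ B ∣) → Dec ((ℕ→ℚ 1 ℚ.- ε) ℚ.* ℕ→ℚ Q ℚ.≤ ℕ→ℚ ∣ A Defs.⊕ B ∣) → _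
      by (yes p) _ = inj₁ p
      by (no _) (yes p) = inj₂ (inj₁ p)
      by (no p) (no q) = inj₂ (inj₂ (Translate.alternatives A B
        (to-outcome {E} {k} {Δ} {D} inverse A B hits
          (at-least {α} {E} 1≤Eα {Q} {∣ A ∣} A-large)
          (critical {α} {β} {Δ} 1≤Δ {Q} {∣ A ∣} {∣ B ∣} {∣ A Defs.⊕ B ∣} A-large B-large (ℚₚ.<⇒≤ (ℚₚ.≰⇒> p)))
          (co-large {ε} {E} 1≤Eε {Q} {∣ A Defs.⊕ B ∣} (Data.Fin.Subset.Properties.∣p∣≤n (A Defs.⊕ B)) (ℚₚ.<⇒≤ (ℚₚ.≰⇒> q))))
        {ε} {η} 1≤Eε 1≤Eη))

open import Defs
open import Data.Nat using (ℕ; NonZero; suc)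
open import Data.Fin using (Fin)
open import Data.Fin.Subset using (Subset; _∈_; _⊆_; ∁; ∣_∣)
open import Data.Rational using (ℚ; Positive; _+_; _-_; _*_; _≤_; _<_)
open import Data.Product using (Σ; ∃; ∃-syntax; _×_)
open import Data.Sum using (_⊎_)
open import Data.Product using (_,_)
open import Data.Nat.Properties using (≤-trans; m≤m+n; m≤n+m)
open import Data.Rational using (↧ₙ_)
open RationalBounds using (reciprocal; reciprocal-pos; 1≤multiple)
open Development using (inverse-theorem; module Cyclic)

theorem4p6 : (α β ε η : ℚ) → Positive α → Positive β → Positive ε → Positive η → (k : ℕ) →
    Σ ℚ λ δ → Positive δ × Σ ℕ λ D →
    (Q : ℕ) {{_ : NonZero Q}} (A B : Subset Q) →
    α * ℕ→ℚ Q ≤ ℕ→ℚ ∣ A ∣ →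
    β * ℕ→ℚ Q ≤ ℕ→ℚ ∣ B ∣ →
    ((H : Subset Q) → IsSubgroup H → IndexAtMost H D →
    (x : Fin Q) → ∃[ h ] (h ∈ H × (h +ₘ x) ∈ B)) →
    ((α + β + δ) * ℕ→ℚ Q ≤ ℕ→ℚ ∣ A ⊕ B ∣)
    ⊎ ((ℕ→ℚ 1 - ε) * ℕ→ℚ Q ≤ ℕ→ℚ ∣ A ⊕ B ∣)
    ⊎ (∃[ H ] (IsSubgroup H × IndexAtMost H D ×
    ∃[ a₀ ] (a₀ ∈ A × ∃[ b₀ ] (b₀ ∈ B ×
    ∃[ A₀ ] ∃[ B₀ ] ∃[ B₁ ] (IsTranslate A A₀ a₀ × IsTranslate₂ B B₀ B₁ b₀ ×
    A₀ ⊆ H × B₀ ⊆ H ×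
    B₁ ⊆ ∁ H × (ℕ→ℚ Q - ℕ→ℚ ∣ H ∣ - ε * ℕ→ℚ ∣ H ∣ < ℕ→ℚ ∣ B₁ ∣) ×
    ∃[ n ] (k Data.Nat.< suc n × Σ (Fin Q → Fin (suc n)) λ φ → (IsSurjHomOn H φ ×
    ∃[ I ] ∃[ J ] (IsInterval I × IsInterval J ×
    A₀ ⊆ preimage H φ I × B₀ ⊆ preimage H φ J ×
    ℕ→ℚ ∣ preimageMinus H φ I A₀ ∣ < ε * ℕ→ℚ Q ×
    ℕ→ℚ ∣ preimageMinus H φ J B₀ ∣ < ε * ℕ→ℚ Q))))))))
    ⊎ (∃[ H ] (IsSubgroup H × IndexAtMost H D ×
    ∃[ a₀ ] (a₀ ∈ A × ∃[ b₀ ] (b₀ ∈ B ×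
    ∃[ A₀ ] ∃[ B₀ ] ∃[ B₁ ] (IsTranslate A A₀ a₀ × IsTranslate₂ B B₀ B₁ b₀ ×
    A₀ ⊆ H × B₀ ⊆ H ×
    B₁ ⊆ ∁ H × (ℕ→ℚ Q - ℕ→ℚ ∣ H ∣ - η * ℕ→ℚ ∣ H ∣ < ℕ→ℚ ∣ B₁ ∣) ×
    ℕ→ℚ ∣ B₀ ∣ < η * ℕ→ℚ ∣ H ∣)))))
theorem4p6 α β ε η α>0 β>0 ε>0 η>0 k =
  let Δ , D , 1≤Δ , inverse = inverse-theorem E k (m≤m+n 1000 _) (≤-trans (m≤m+n k _) (m≤n+m _ 1000))
  in reciprocal Δ 1≤Δ , reciprocal-pos Δ 1≤Δ , D , λ Q A B → Cyclic.conclusion Q {α} {β} {ε} {η} {E} {k} {Δ} {D} 1≤Δ inverse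
       (1≤multiple α E α>0 α≤E) (1≤multiple ε E ε>0 ε≤E) (1≤multiple η E η>0 η≤E) A B
  where
  E : ℕ
  -- A sum, so as to dominate 1000, `k` and the three denominators at once; a positive rational
  -- times its denominator is at least 1.
  E = 1000 Data.Nat.+ (k Data.Nat.+ (↧ₙ α Data.Nat.+ (↧ₙ ε Data.Nat.+ ↧ₙ η)))
  α≤E : ↧ₙ α Data.Nat.≤ E
  α≤E = ≤-trans (m≤m+n (↧ₙ α) _) (≤-trans (m≤n+m _ k) (m≤n+m _ 1000))
  ε≤E : ↧ₙ ε Data.Nat.≤ E
  ε≤E = ≤-trans (m≤m+n (↧ₙ ε) (↧ₙ η)) (≤-trans (m≤n+m _ (↧ₙ α)) (≤-trans (m≤n+m _ k) (m≤n+m _ 1000)))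
  η≤E : ↧ₙ η Data.Nat.≤ E
  η≤E = ≤-trans (m≤n+m (↧ₙ η) (↧ₙ ε)) (≤-trans (m≤n+m _ (↧ₙ α)) (≤-trans (m≤n+m _ k) (m≤n+m _ 1000)))
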